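{- For each integer $k\ge 2$ let $$f_k(z)=\frac{d}{dz}\log\Big(\sum_{j=0}^{k-1}z^j\Big)=\frac{1+2z+\cdots+(k-1)z^{k-2}}{1+z+\cdots+z^{k-1}},\qquad z\in\mathbb{D}.$$ Then the linear span $\mathrm{Span}\{f_k : k=2,3,\ldots\}$ is dense in $\mathcal{H}=A_1^2(\mathbb{D})$.
   Context: $\mathbb{D}=\{z\in\mathbb{C}:|z|<1\}$ is the open unit disk. $dA=\pi^{ -1}\,dx\,dy$ is the normalized area measure on $\mathbb{D}$, and $dA_1(z)=2(1-|z|^2)\,dA(z)$, a probability measure on $\mathbb{D}$. The weighted Bergman space $\mathcal{H}=A_1^2(\mathbb{D})$ is the Hilbert space of all analytic functions on $\mathbb{D}$ lying in $L^2(\mathbb{D},dA_1)$, with norm $\|f\|_2=\left(\int_{\mathbb{D}}|f|^2\,dA_1\right)^{1/2}$; for $f(z)=\sum_{n\ge 0}a_nz^n$ one has $\|f\|_2^2=\sum_{n\ge 0}\frac{2|a_n|^2}{(n+1)(n+2)}$. Density is with respect to $\|\cdot\|_2$. -}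

module Defs where

open import Data.Integer.Base as ℤ using (ℤ; +_)
import Data.Integer.Properties as ℤₚ
open import Data.List.Base using (List; map; foldr; filter; length; upTo; cartesianProduct)
open import Data.List.Membership.Propositional using (_∈_)
open import Data.List.Membership.Propositional.Properties
  using (∈-map⁺; ∈-upTo⁺; ∈-filter⁺; ∈-cartesianProduct⁺; ∈-length)
open import Data.Nat.Base as ℕ using (ℕ; zero; suc)
import Data.Nat.Properties as ℕₚ
open import Data.Product.Base using (Σ; ∃; _×_; _,_; proj₁; proj₂)
open import Data.Rational.Base as ℚ using (ℚ; 0ℚ; 1ℚ; ½)
import Data.Rational.Properties as ℚₚ
open import Data.Rational.Solver using (module +-*-Solver)
open import Relation.Binary.PropositionalEquality
  using (_≡_; refl; sym; trans; cong; cong₂; subst; subst₂)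
open import Relation.Nullary using (Dec; yes; no)
open import Relation.Unary using (Pred; _⊆_)

------------------------------------------------------------------------
-- Polynomial identities over the rationals

module Identity where

  open +-*-Solver

  p+q-q : ∀ p q → p ℚ.+ q ℚ.- q ≡ p
  p+q-q = solve 2 (λ p q → p :+ q :- q := p) refl

  neg-square : ∀ p → (ℚ.- p) ℚ.* (ℚ.- p) ≡ p ℚ.* p
  neg-square = solve 1 (λ p → (:- p) :* (:- p) := p :* p) refl

  move-first : ∀ q a b → q ℚ.* (a ℚ.* b) ≡ (q ℚ.* b) ℚ.* a
  move-first = solve 3 (λ q a b → q :* (a :* b) := (q :* b) :* a) refl

  half+half : ∀ ε → ½ ℚ.* ε ℚ.+ ½ ℚ.* ε ≡ ε
  half+half = solve 1 (λ ε → con ½ :* ε :+ con ½ :* ε := ε) refl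

  q+[p-q] : ∀ a b → b ℚ.+ (a ℚ.- b) ≡ a
  q+[p-q] = solve 2 (λ a b → b :+ (a :- b) := a) refl

  neg-sub : ∀ a b → b ℚ.- a ≡ ℚ.- (a ℚ.- b)
  neg-sub = solve 2 (λ a b → b :- a := :- (a :- b)) refl

  p-q+q : ∀ a b → a ℚ.- b ℚ.+ b ≡ a
  p-q+q = solve 2 (λ a b → a :- b :+ b := a) refl

  sub-interchange : ∀ a b c d → (a ℚ.- b) ℚ.+ (c ℚ.- d) ≡ (a ℚ.+ c) ℚ.- (b ℚ.+ d)
  sub-interchange = solve 4 (λ a b c d → (a :- b) :+ (c :- d) := (a :+ c) :- (b :+ d)) refl

  neg-of-sub : ∀ a b → ℚ.- (a ℚ.- b) ≡ (ℚ.- a) ℚ.- (ℚ.- b)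
  neg-of-sub = solve 2 (λ a b → :- (a :- b) := (:- a) :- (:- b)) refl

  factor-sum : ∀ a b e i → a ℚ.* (e ℚ.* i) ℚ.+ b ℚ.* (e ℚ.* i) ≡ e ℚ.* ((a ℚ.+ b) ℚ.* i)
  factor-sum = solve 4 (λ a b e i → a :* (e :* i) :+ b :* (e :* i) := e :* ((a :+ b) :* i)) refl

  product-difference : ∀ a b c d → a ℚ.* (c ℚ.- d) ℚ.+ d ℚ.* (a ℚ.- b) ≡ a ℚ.* c ℚ.- b ℚ.* d
  product-difference = solve 4 (λ a b c d → a :* (c :- d) :+ d :* (a :- b) := a :* c :- b :* d) refl

  reciprocal-difference : ∀ i j a b → (i ℚ.* j) ℚ.* (b ℚ.- a) ≡ i ℚ.* (b ℚ.* j) ℚ.- j ℚ.* (a ℚ.* i)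
  reciprocal-difference = solve 4 (λ i j a b →
    (i :* j) :* (b :- a) :=
    i :* (b :* j) :- j :* (a :* i)) refl

  square-cancel : ∀ k e d → (k ℚ.* k) ℚ.* (e ℚ.* (d ℚ.* d)) ≡ e ℚ.* ((d ℚ.* k) ℚ.* (d ℚ.* k))
  square-cancel = solve 3 (λ k e d → (k :* k) :* (e :* (d :* d)) := e :* ((d :* k) :* (d :* k))) refl

  r+[1-r] : ∀ r → r ℚ.+ (1ℚ ℚ.- r) ≡ 1ℚ
  r+[1-r] = solve 1 (λ r → r :+ (con 1ℚ :- r) := con 1ℚ) refl

  telescope-re₀ : ∀ a b → (1ℚ ℚ.- a) ℚ.* 0ℚ ℚ.+ b ℚ.* 0ℚ ≡ 1ℚ ℚ.- 1ℚ
  telescope-re₀ = solve 2 (λ a b → (con 1ℚ :- a) :* con 0ℚ :+ b :* con 0ℚ := con 1ℚ :- con 1ℚ) refl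

  telescope-im₀ : ∀ a b → (1ℚ ℚ.- a) ℚ.* 0ℚ ℚ.- b ℚ.* 0ℚ ≡ ℚ.- 0ℚ
  telescope-im₀ = solve 2 (λ a b → (con 1ℚ :- a) :* con 0ℚ :- b :* con 0ℚ := :- con 0ℚ) refl

  telescope-re₁ : ∀ a b s t p q →
    (1ℚ ℚ.- a) ℚ.* (s ℚ.+ p) ℚ.+ b ℚ.* (t ℚ.+ q) ≡
    ((1ℚ ℚ.- a) ℚ.* s ℚ.+ b ℚ.* t) ℚ.+ ((1ℚ ℚ.- a) ℚ.* p ℚ.+ b ℚ.* q)
  telescope-re₁ = solve 6 (λ a b s t p q →
    (con 1ℚ :- a) :* (s :+ p) :+ b :* (t :+ q) :=
    ((con 1ℚ :- a) :* s :+ b :* t) :+ ((con 1ℚ :- a) :* p :+ b :* q)) refl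

  telescope-re₂ : ∀ a b p q →
    (1ℚ ℚ.- p) ℚ.+ ((1ℚ ℚ.- a) ℚ.* p ℚ.+ b ℚ.* q) ≡
    1ℚ ℚ.- (a ℚ.* p ℚ.- b ℚ.* q)
  telescope-re₂ = solve 4 (λ a b p q →
    (con 1ℚ :- p) :+ ((con 1ℚ :- a) :* p :+ b :* q) :=
    con 1ℚ :- (a :* p :- b :* q)) refl

  telescope-im₁ : ∀ a b s t p q →
    (1ℚ ℚ.- a) ℚ.* (t ℚ.+ q) ℚ.- b ℚ.* (s ℚ.+ p) ≡
    ((1ℚ ℚ.- a) ℚ.* t ℚ.- b ℚ.* s) ℚ.+ ((1ℚ ℚ.- a) ℚ.* q ℚ.- b ℚ.* p)
  telescope-im₁ = solve 6 (λ a b s t p q →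
    (con 1ℚ :- a) :* (t :+ q) :- b :* (s :+ p) :=
    ((con 1ℚ :- a) :* t :- b :* s) :+ ((con 1ℚ :- a) :* q :- b :* p)) refl

  telescope-im₂ : ∀ a b p q → (ℚ.- q) ℚ.+ ((1ℚ ℚ.- a) ℚ.* q ℚ.- b ℚ.* p) ≡ ℚ.- (a ℚ.* q ℚ.+ b ℚ.* p)
  telescope-im₂ = solve 4 (λ a b p q →
    (:- q) :+ ((con 1ℚ :- a) :* q :- b :* p) :=
    :- (a :* q :+ b :* p)) refl

  norm-z¹ : ∀ a b →
    (a ℚ.* 1ℚ ℚ.- b ℚ.* 0ℚ) ℚ.* (a ℚ.* 1ℚ ℚ.- b ℚ.* 0ℚ) ℚ.+ (a ℚ.* 0ℚ ℚ.+ b ℚ.* 1ℚ) ℚ.* (a ℚ.* 0ℚ ℚ.+ b ℚ.* 1ℚ) ≡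
    a ℚ.* a ℚ.+ b ℚ.* b
  norm-z¹ = solve 2 (λ a b →
    (a :* con 1ℚ :- b :* con 0ℚ) :* (a :* con 1ℚ :- b :* con 0ℚ) :+ (a :* con 0ℚ :+ b :* con 1ℚ) :* (a :* con 0ℚ :+ b :* con 1ℚ) :=
    a :* a :+ b :* b) refl

  norm-product : ∀ a b p q →
    (a ℚ.* a ℚ.+ b ℚ.* b) ℚ.* (p ℚ.* p ℚ.+ q ℚ.* q) ≡
    (a ℚ.* p ℚ.- b ℚ.* q) ℚ.* (a ℚ.* p ℚ.- b ℚ.* q) ℚ.+ (a ℚ.* q ℚ.+ b ℚ.* p) ℚ.* (a ℚ.* q ℚ.+ b ℚ.* p)
  norm-product = solve 4 (λ a b p q →
    (a :* a :+ b :* b) :* (p :* p :+ q :* q) :=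
    (a :* p :- b :* q) :* (a :* p :- b :* q) :+ (a :* q :+ b :* p) :* (a :* q :+ b :* p)) refl

  half-lhs : ∀ p q d → ½ ℚ.* ((0ℚ ℚ.+ (p ℚ.* p ℚ.+ q ℚ.* q ℚ.+ d)) ℚ.- (p ℚ.* p ℚ.+ q ℚ.* q)) ≡ ½ ℚ.* d
  half-lhs = solve 3 (λ p q d →
    con ½ :* ((con 0ℚ :+ (p :* p :+ q :* q :+ d)) :- (p :* p :+ q :* q)) :=
    con ½ :* d) refl

  half-rhs : ∀ p q →
    ½ ℚ.* (((1ℚ ℚ.- p) ℚ.* (1ℚ ℚ.- p) ℚ.+ q ℚ.* q) ℚ.+ 1ℚ ℚ.- (p ℚ.* p ℚ.+ q ℚ.* q)) ≡
    1ℚ ℚ.- p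
  half-rhs = solve 2 (λ p q →
    con ½ :* (((con 1ℚ :- p) :* (con 1ℚ :- p) :+ q :* q) :+ con 1ℚ :- (p :* p :+ q :* q)) :=
    con 1ℚ :- p) refl

  norm-telescope : ∀ a b s r →
    ((1ℚ ℚ.- a) ℚ.* s ℚ.+ b ℚ.* r) ℚ.* ((1ℚ ℚ.- a) ℚ.* s ℚ.+ b ℚ.* r) ℚ.+ ((1ℚ ℚ.- a) ℚ.* r ℚ.- b ℚ.* s) ℚ.* ((1ℚ ℚ.- a) ℚ.* r ℚ.- b ℚ.* s) ≡
    ((1ℚ ℚ.- a) ℚ.* (1ℚ ℚ.- a) ℚ.+ b ℚ.* b) ℚ.* (s ℚ.* s ℚ.+ r ℚ.* r)
  norm-telescope = solve 4 (λ a b s r →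
    ((con 1ℚ :- a) :* s :+ b :* r) :* ((con 1ℚ :- a) :* s :+ b :* r) :+ ((con 1ℚ :- a) :* r :- b :* s) :* ((con 1ℚ :- a) :* r :- b :* s) :=
    ((con 1ℚ :- a) :* (con 1ℚ :- a) :+ b :* b) :* (s :* s :+ r :* r)) refl

  parallelogram : ∀ a b t →
    ((1ℚ ℚ.- a) ℚ.* (1ℚ ℚ.- a) ℚ.+ b ℚ.* b) ℚ.+ ((1ℚ ℚ.+ a) ℚ.* (1ℚ ℚ.+ a) ℚ.+ b ℚ.* b) ℚ.+ (1ℚ ℚ.+ 1ℚ) ℚ.* (1ℚ ℚ.- (a ℚ.* a ℚ.+ b ℚ.* b)) ≡
    (+ 4 ℚ./ 1)
  parallelogram = solve 3 (λ a b t →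
    ((con 1ℚ :- a) :* (con 1ℚ :- a) :+ b :* b) :+ ((con 1ℚ :+ a) :* (con 1ℚ :+ a) :+ b :* b) :+ (con 1ℚ :+ con 1ℚ) :* (con 1ℚ :- (a :* a :+ b :* b)) :=
    con (+ 4 ℚ./ 1)) refl

  quarter-four : ∀ x → (+ 1 ℚ./ 4) ℚ.* ((+ 4 ℚ./ 1) ℚ.* x) ≡ x
  quarter-four = solve 1 (λ x → con (+ 1 ℚ./ 4) :* (con (+ 4 ℚ./ 1) :* x) := x) refl

------------------------------------------------------------------------
-- Inequalities between rationals

module RationalLemmas where

  open Identity

  q+-q : ∀ {p q r} → p ℚ.+ q ℚ.≤ r → p ℚ.≤ r ℚ.- q
  q+-q {p} {q} {r} h =
    subst (ℚ._≤ r ℚ.- q) (p+q-q p q)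
      (ℚₚ.+-monoˡ-≤ (ℚ.- q) h)

  0<+ : ∀ {p q} → 0ℚ ℚ.< p → 0ℚ ℚ.< q → 0ℚ ℚ.< p ℚ.+ q
  0<+ 0<p 0<q = ℚₚ.+-mono-< 0<p 0<q

  0<* : ∀ {p q} → 0ℚ ℚ.< p → 0ℚ ℚ.< q → 0ℚ ℚ.< p ℚ.* q
  0<* {p} {q} 0<p 0<q =
    ℚₚ.positive⁻¹ _ {{ℚₚ.pos*pos⇒pos p {{ℚ.positive 0<p}} q {{ℚ.positive 0<q}}}}

  0≤* : ∀ {p q} → 0ℚ ℚ.≤ p → 0ℚ ℚ.≤ q → 0ℚ ℚ.≤ p ℚ.* q
  0≤* {p} {q} 0≤p 0≤q =
    ℚₚ.nonNegative⁻¹ _ {{ℚₚ.nonNeg*nonNeg⇒nonNeg p {{ℚ.nonNegative 0≤p}} q {{ℚ.nonNegative 0≤q}}}}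

  *-mono-≤ : ∀ {p q r s} → 0ℚ ℚ.≤ r → 0ℚ ℚ.≤ q → p ℚ.≤ q → r ℚ.≤ s → p ℚ.* r ℚ.≤ q ℚ.* s
  *-mono-≤ {p} {q} {r} 0≤r 0≤q p≤q r≤s = ℚₚ.≤-trans
    (ℚₚ.*-monoʳ-≤-nonNeg r {{ℚ.nonNegative 0≤r}} p≤q)
    (ℚₚ.*-monoˡ-≤-nonNeg q {{ℚ.nonNegative 0≤q}} r≤s)

  0≤p² : ∀ p → 0ℚ ℚ.≤ p ℚ.* p
  0≤p² p = subst (0ℚ ℚ.≤_) (lemma (ℚₚ.∣p∣≡p∨∣p∣≡-p p)) (0≤* (ℚₚ.0≤∣p∣ p) (ℚₚ.0≤∣p∣ p))
    where
    open import Data.Sum.Base using (_⊎_; inj₁; inj₂)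
    lemma : ℚ.∣ p ∣ ≡ p ⊎ ℚ.∣ p ∣ ≡ ℚ.- p → ℚ.∣ p ∣ ℚ.* ℚ.∣ p ∣ ≡ p ℚ.* p
    lemma (inj₁ e) rewrite e = refl
    lemma (inj₂ e) rewrite e = neg-square p

  inv : (p : ℚ) → 0ℚ ℚ.< p → ℚ
  inv p 0<p = (ℚ.1/ p) {{ℚ.>-nonZero 0<p}}

  inv-inverse : ∀ p (0<p : 0ℚ ℚ.< p) → p ℚ.* inv p 0<p ≡ 1ℚ
  inv-inverse p 0<p = ℚₚ.*-inverseʳ p {{ℚ.>-nonZero 0<p}}

  0<inv : ∀ p (0<p : 0ℚ ℚ.< p) → 0ℚ ℚ.< inv p 0<p
  0<inv p 0<p = ℚₚ.positive⁻¹ _ {{ℚₚ.1/pos⇒pos p {{ℚ.positive 0<p}}}}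

  inv-anti : ∀ p q 0<p 0<q → p ℚ.≤ q → inv q 0<q ℚ.≤ inv p 0<p
  inv-anti p q 0<p 0<q p≤q = subst₂ ℚ._≤_ e₁ e₂
    (ℚₚ.*-monoʳ-≤-nonNeg _ {{ℚ.nonNegative (ℚₚ.<⇒≤ (0<* (0<inv p 0<p) (0<inv q 0<q)))}} p≤q)
    where
    ip iq : ℚ
    ip = inv p 0<p
    iq = inv q 0<q
    e₁ : p ℚ.* (ip ℚ.* iq) ≡ iq
    e₁ = trans (sym (ℚₚ.*-assoc p ip iq)) (trans (cong (ℚ._* iq) (inv-inverse p 0<p)) (ℚₚ.*-identityˡ iq))
    e₂ : q ℚ.* (ip ℚ.* iq) ≡ ip
    e₂ = trans (move-first q ip iq)
           (trans (cong (ℚ._* ip) (inv-inverse q 0<q)) (ℚₚ.*-identityˡ ip))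

open Identity
open RationalLemmas

------------------------------------------------------------------------
-- Real numbers, as Cauchy sequences of rationals

record ℝ : Set where
  constructor mkℝ
  field
    seq    : ℕ → ℚ
    cauchy : ∀ ε → 0ℚ ℚ.< ε →
             ∃ λ N → ∀ m n → N ℕ.≤ m → N ℕ.≤ n → ℚ.∣ seq m ℚ.- seq n ∣ ℚ.≤ ε
open ℝ public

infix 4 _≈_ _<_

_≈_ : ℝ → ℝ → Set
x ≈ y = ∀ ε → 0ℚ ℚ.< ε → ∃ λ N → ∀ n → N ℕ.≤ n → ℚ.∣ seq x n ℚ.- seq y n ∣ ℚ.≤ ε

_<_ : ℝ → ℝ → Set
x < y = Σ ℚ λ δ → 0ℚ ℚ.< δ × ∃ λ N → ∀ n → N ℕ.≤ n → seq x n ℚ.+ δ ℚ.≤ seq y n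

ι : ℚ → ℝ
ι q = mkℝ (λ _ → q) λ ε 0<ε → 0 , λ _ _ _ _ →
  subst (ℚ._≤ ε) (sym (cong ℚ.∣_∣ (ℚₚ.+-inverseʳ q))) (ℚₚ.<⇒≤ 0<ε)

0ℝ 1ℝ : ℝ
0ℝ = ι 0ℚ
1ℝ = ι 1ℚ

infixl 6 _+_ _-_
infixl 7 _*_
infix  8 -_

module RealLemmas where

  0<half : ∀ {ε} → 0ℚ ℚ.< ε → 0ℚ ℚ.< ½ ℚ.* ε
  0<half = 0<* (ℚₚ.positive⁻¹ ½)

  EventuallyBounded : ℝ → Set
  EventuallyBounded x = Σ ℚ λ B → 0ℚ ℚ.< B × ∃ λ N → ∀ n → N ℕ.≤ n → ℚ.∣ seq x n ∣ ℚ.≤ B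

  eventually-bounded : ∀ x → EventuallyBounded x
  eventually-bounded x with cauchy x 1ℚ (ℚₚ.positive⁻¹ 1ℚ)
  ... | N , c = ℚ.∣ b ∣ ℚ.+ 1ℚ , ℚₚ.+-mono-≤-< (ℚₚ.0≤∣p∣ b) (ℚₚ.positive⁻¹ 1ℚ) , N , λ n N≤n →
    subst (λ p → ℚ.∣ p ∣ ℚ.≤ ℚ.∣ b ∣ ℚ.+ 1ℚ)
      (q+[p-q] (seq x n) b)
      (ℚₚ.≤-trans (ℚₚ.∣p+q∣≤∣p∣+∣q∣ b (seq x n ℚ.- b))
        (ℚₚ.+-monoʳ-≤ ℚ.∣ b ∣ (c n N N≤n ℕₚ.≤-refl)))
    where
    b : ℚ
    b = seq x N

  reverse-triangle : ∀ p q → ℚ.∣ ℚ.∣ p ∣ ℚ.- ℚ.∣ q ∣ ∣ ℚ.≤ ℚ.∣ p ℚ.- q ∣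
  reverse-triangle p q = abs≤ (upper p q)
    (subst (ℚ._≤ ℚ.∣ p ℚ.- q ∣) (neg-sub ℚ.∣ p ∣ ℚ.∣ q ∣)
      (subst (ℚ.∣ q ∣ ℚ.- ℚ.∣ p ∣ ℚ.≤_)
        (trans (cong ℚ.∣_∣ (neg-sub p q)) (ℚₚ.∣-p∣≡∣p∣ (p ℚ.- q)))
        (upper q p)))
    where
    open import Data.Sum.Base using (_⊎_; inj₁; inj₂)
    upper : ∀ a b → ℚ.∣ a ∣ ℚ.- ℚ.∣ b ∣ ℚ.≤ ℚ.∣ a ℚ.- b ∣
    upper a b = subst (ℚ.∣ a ∣ ℚ.- ℚ.∣ b ∣ ℚ.≤_)
      (p+q-q ℚ.∣ a ℚ.- b ∣ ℚ.∣ b ∣)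
      (ℚₚ.+-monoˡ-≤ (ℚ.- ℚ.∣ b ∣)
        (subst (λ c → ℚ.∣ c ∣ ℚ.≤ ℚ.∣ a ℚ.- b ∣ ℚ.+ ℚ.∣ b ∣)
          (p-q+q a b)
          (ℚₚ.∣p+q∣≤∣p∣+∣q∣ (a ℚ.- b) b)))
    abs≤ : ∀ {a b} → a ℚ.≤ b → ℚ.- a ℚ.≤ b → ℚ.∣ a ∣ ℚ.≤ b
    abs≤ {a} h h′ with ℚₚ.∣p∣≡p∨∣p∣≡-p a
    ... | inj₁ e = subst (ℚ._≤ _) (sym e) h
    ... | inj₂ e = subst (ℚ._≤ _) (sym e) h′

open RealLemmas

_+_ : ℝ → ℝ → ℝ
x + y = mkℝ (λ n → seq x n ℚ.+ seq y n) c
  where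
  c : ∀ ε → 0ℚ ℚ.< ε → _
  c ε 0<ε with cauchy x (½ ℚ.* ε) (0<half 0<ε) | cauchy y (½ ℚ.* ε) (0<half 0<ε)
  ... | M , cx | N , cy = M ℕ.⊔ N , λ m n hm hn →
    subst₂ ℚ._≤_
      (cong ℚ.∣_∣ (sub-interchange
        (seq x m) (seq x n) (seq y m) (seq y n)))
      (half+half ε)
      (ℚₚ.≤-trans (ℚₚ.∣p+q∣≤∣p∣+∣q∣ (seq x m ℚ.- seq x n) (seq y m ℚ.- seq y n))
        (ℚₚ.+-mono-≤
          (cx m n (ℕₚ.m⊔n≤o⇒m≤o M N hm) (ℕₚ.m⊔n≤o⇒m≤o M N hn))
          (cy m n (ℕₚ.m⊔n≤o⇒n≤o M N hm) (ℕₚ.m⊔n≤o⇒n≤o M N hn))))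

-_ : ℝ → ℝ
- x = mkℝ (λ n → ℚ.- seq x n) c
  where
  c : ∀ ε → 0ℚ ℚ.< ε → _
  c ε 0<ε with cauchy x ε 0<ε
  ... | N , cx = N , λ m n hm hn → subst (ℚ._≤ ε)
    (trans (sym (ℚₚ.∣-p∣≡∣p∣ (seq x m ℚ.- seq x n)))
      (cong ℚ.∣_∣ (neg-of-sub (seq x m) (seq x n))))
    (cx m n hm hn)

_-_ : ℝ → ℝ → ℝ
x - y = x + (- y)

∣_∣ : ℝ → ℝ
∣ x ∣ = mkℝ (λ n → ℚ.∣ seq x n ∣) c
  where
  c : ∀ ε → 0ℚ ℚ.< ε → _
  c ε 0<ε with cauchy x ε 0<ε
  ... | N , cx = N , λ m n hm hn →
    ℚₚ.≤-trans (reverse-triangle (seq x m) (seq x n)) (cx m n hm hn)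

_*_ : ℝ → ℝ → ℝ
x * y = mkℝ (λ n → seq x n ℚ.* seq y n) c
  where
  Modulus : ℚ → Set
  Modulus ε = ∃ λ N → ∀ m n → N ℕ.≤ m → N ℕ.≤ n →
              ℚ.∣ seq x m ℚ.* seq y m ℚ.- seq x n ℚ.* seq y n ∣ ℚ.≤ ε
  c : ∀ ε → 0ℚ ℚ.< ε → Modulus ε
  c ε 0<ε = bounds (eventually-bounded x) (eventually-bounded y)
   where
   bounds : EventuallyBounded x → EventuallyBounded y → Modulus ε
   bounds (A , 0<A , L , bx) (B , 0<B , M , by) = K , bound
    where
    0<A+B : 0ℚ ℚ.< A ℚ.+ B
    0<A+B = 0<+ 0<A 0<B
    i δ : ℚ
    i = inv (A ℚ.+ B) 0<A+B
    δ = ε ℚ.* i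
    0<δ : 0ℚ ℚ.< δ
    0<δ = 0<* 0<ε (0<inv (A ℚ.+ B) 0<A+B)
    P Q K : ℕ
    P = proj₁ (cauchy x δ 0<δ)
    Q = proj₁ (cauchy y δ 0<δ)
    K = (L ℕ.⊔ M) ℕ.⊔ (P ℕ.⊔ Q)
    total : A ℚ.* δ ℚ.+ B ℚ.* δ ≡ ε
    total = trans
      (factor-sum A B ε i)
      (trans (cong (ε ℚ.*_) (inv-inverse (A ℚ.+ B) 0<A+B)) (ℚₚ.*-identityʳ ε))
    bound : ∀ m n → K ℕ.≤ m → K ℕ.≤ n →
            ℚ.∣ seq x m ℚ.* seq y m ℚ.- seq x n ℚ.* seq y n ∣ ℚ.≤ ε
    bound m n hm hn = subst₂ ℚ._≤_
      (cong ℚ.∣_∣ (product-difference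
        (seq x m) (seq x n) (seq y m) (seq y n)))
      total
      (ℚₚ.≤-trans
        (ℚₚ.∣p+q∣≤∣p∣+∣q∣ (seq x m ℚ.* (seq y m ℚ.- seq y n)) (seq y n ℚ.* (seq x m ℚ.- seq x n)))
        (ℚₚ.+-mono-≤
          (product (bx m (ℕₚ.m⊔n≤o⇒m≤o L M (lm hm)))
            (proj₂ (cauchy y δ 0<δ) m n (ℕₚ.m⊔n≤o⇒n≤o P Q (pq hm)) (ℕₚ.m⊔n≤o⇒n≤o P Q (pq hn))))
          (product (by n (ℕₚ.m⊔n≤o⇒n≤o L M (lm hn)))
            (proj₂ (cauchy x δ 0<δ) m n (ℕₚ.m⊔n≤o⇒m≤o P Q (pq hm)) (ℕₚ.m⊔n≤o⇒m≤o P Q (pq hn))))))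
      where
      lm : ∀ {j} → K ℕ.≤ j → L ℕ.⊔ M ℕ.≤ j
      lm = ℕₚ.m⊔n≤o⇒m≤o (L ℕ.⊔ M) (P ℕ.⊔ Q)
      pq : ∀ {j} → K ℕ.≤ j → P ℕ.⊔ Q ℕ.≤ j
      pq = ℕₚ.m⊔n≤o⇒n≤o (L ℕ.⊔ M) (P ℕ.⊔ Q)
      product : ∀ {p q a b} → ℚ.∣ p ∣ ℚ.≤ a → ℚ.∣ q ∣ ℚ.≤ b → ℚ.∣ p ℚ.* q ∣ ℚ.≤ a ℚ.* b
      product {p} {q} hp hq = subst (ℚ._≤ _) (sym (ℚₚ.∣p*q∣≡∣p∣*∣q∣ p q))
        (*-mono-≤ (ℚₚ.0≤∣p∣ q) (ℚₚ.≤-trans (ℚₚ.0≤∣p∣ p) hp) hp hq)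

-- The sequence is inverted after replacing x n by x n ⊔ δ, where δ is the
-- lower bound supplied by 0ℝ < x; this changes only finitely many terms.
reciprocal : ∀ x → 0ℝ < x → ℝ
reciprocal x (δ , 0<δ , L , lower) = mkℝ (λ n → inv (y n) (0<y n)) c
  where
  y : ℕ → ℚ
  y n = seq x n ℚ.⊔ δ
  δ≤y : ∀ n → δ ℚ.≤ y n
  δ≤y n = ℚₚ.p≤q⊔p (seq x n) δ
  0<y : ∀ n → 0ℚ ℚ.< y n
  0<y n = ℚₚ.<-≤-trans 0<δ (δ≤y n)
  y≡x : ∀ n → L ℕ.≤ n → y n ≡ seq x n
  y≡x n L≤n = ℚₚ.p≥q⇒p⊔q≡p (subst (ℚ._≤ seq x n) (ℚₚ.+-identityˡ δ) (lower n L≤n))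
  c : ∀ ε → 0ℚ ℚ.< ε → _
  c ε 0<ε = L ℕ.⊔ proj₁ cx , λ m n hm hn → bound m n
      (ℕₚ.m⊔n≤o⇒m≤o L _ hm) (ℕₚ.m⊔n≤o⇒m≤o L _ hn) (ℕₚ.m⊔n≤o⇒n≤o L _ hm) (ℕₚ.m⊔n≤o⇒n≤o L _ hn)
    where
    cx : _
    cx = cauchy x (ε ℚ.* (δ ℚ.* δ)) (0<* 0<ε (0<* 0<δ 0<δ))
    bound : ∀ m n → L ℕ.≤ m → L ℕ.≤ n → proj₁ cx ℕ.≤ m → proj₁ cx ℕ.≤ n →
            ℚ.∣ inv (y m) (0<y m) ℚ.- inv (y n) (0<y n) ∣ ℚ.≤ ε
    bound m n Lm Ln hm hn = subst₂ ℚ._≤_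
        (trans (cong (ℚ._* (ℚ.∣ yn-ym ∣)) (sym (ℚₚ.0≤p⇒∣p∣≡p 0≤ij)))
          (trans (sym (ℚₚ.∣p*q∣≡∣p∣*∣q∣ (i ℚ.* j) yn-ym)) (cong ℚ.∣_∣ difference)))
        total
        (*-mono-≤ (ℚₚ.0≤∣p∣ yn-ym) 0≤kk
          (*-mono-≤ (ℚₚ.<⇒≤ (0<inv _ (0<y n))) (ℚₚ.<⇒≤ (0<inv _ 0<δ))
            (inv-anti δ (y m) 0<δ (0<y m) (δ≤y m)) (inv-anti δ (y n) 0<δ (0<y n) (δ≤y n)))
          close)
      where
      i j k yn-ym : ℚ
      i = inv (y m) (0<y m)
      j = inv (y n) (0<y n)
      k = inv δ 0<δ
      yn-ym = y n ℚ.- y m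
      0≤ij : 0ℚ ℚ.≤ i ℚ.* j
      0≤ij = ℚₚ.<⇒≤ (0<* (0<inv _ (0<y m)) (0<inv _ (0<y n)))
      0≤kk : 0ℚ ℚ.≤ k ℚ.* k
      0≤kk = 0≤p² k
      difference : (i ℚ.* j) ℚ.* yn-ym ≡ i ℚ.- j
      difference = trans
        (reciprocal-difference i j (y m) (y n))
        (cong₂ ℚ._-_
          (trans (cong (i ℚ.*_) (inv-inverse (y n) (0<y n))) (ℚₚ.*-identityʳ i))
          (trans (cong (j ℚ.*_) (inv-inverse (y m) (0<y m))) (ℚₚ.*-identityʳ j)))
      close : ℚ.∣ yn-ym ∣ ℚ.≤ ε ℚ.* (δ ℚ.* δ)
      close = subst (λ p → ℚ.∣ p ∣ ℚ.≤ ε ℚ.* (δ ℚ.* δ))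
        (cong₂ ℚ._-_ (sym (y≡x n Ln)) (sym (y≡x m Lm))) (proj₂ cx n m hn hm)
      total : (k ℚ.* k) ℚ.* (ε ℚ.* (δ ℚ.* δ)) ≡ ε
      total = trans
        (square-cancel k ε δ)
        (trans (cong (λ u → ε ℚ.* (u ℚ.* u)) (inv-inverse δ 0<δ)) (ℚₚ.*-identityʳ ε))

infix 4 _⟶_

_⟶_ : (ℕ → ℝ) → ℝ → Set
x ⟶ l = ∀ ε → 0ℚ ℚ.< ε → ∃ λ N → ∀ n → N ℕ.≤ n → ∣ x n - l ∣ < ι ε

------------------------------------------------------------------------
-- Complex numbers

record ℂ : Set where
  constructor _+i_
  field
    re im : ℝ
open ℂ public

infix  4 _≈ᶜ_ _⟶ᶜ_
infixl 6 _+ᶜ_ _-ᶜ_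
infixl 7 _*ᶜ_
infixr 8 _^_

_≈ᶜ_ : ℂ → ℂ → Set
z ≈ᶜ w = re z ≈ re w × im z ≈ im w

0ᶜ 1ᶜ : ℂ
0ᶜ = 0ℝ +i 0ℝ
1ᶜ = 1ℝ +i 0ℝ

fromℕ : ℕ → ℂ
fromℕ n = ι (+ n ℚ./ 1) +i 0ℝ

_+ᶜ_ _-ᶜ_ _*ᶜ_ : ℂ → ℂ → ℂ
z +ᶜ w = (re z + re w) +i (im z + im w)
z -ᶜ w = (re z - re w) +i (im z - im w)
z *ᶜ w = (re z * re w - im z * im w) +i (re z * im w + im z * re w)

_^_ : ℂ → ℕ → ℂ
z ^ zero  = 1ᶜ
z ^ suc n = z *ᶜ z ^ n

∣_∣² : ℂ → ℝ
∣ z ∣² = re z * re z + im z * im z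

-- z / w = z w̄ / |w|²
divide : ℂ → (w : ℂ) → 0ℝ < ∣ w ∣² → ℂ
divide z w 0<w = z *ᶜ ((re w * r) +i (- im w * r))
  where
  r : ℝ
  r = reciprocal ∣ w ∣² 0<w

∑< : ℕ → (ℕ → ℂ) → ℂ
∑< zero    a = 0ᶜ
∑< (suc n) a = ∑< n a +ᶜ a n

_⟶ᶜ_ : (ℕ → ℂ) → ℂ → Set
z ⟶ᶜ l = (λ n → re (z n)) ⟶ re l × (λ n → im (z n)) ⟶ im l

------------------------------------------------------------------------
-- The unit disc and its normalised area measure

𝔻 : Set
𝔻 = Σ ℂ λ z → ∣ z ∣² < 1ℝ

∣_∣²ℚ : ℚ × ℚ → ℚ
∣ x , y ∣²ℚ = x ℚ.* x ℚ.+ y ℚ.* y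

-- The points (i + j √-1) / (n + 1) with |i|, |j| ≤ n + 1.
grid : ℕ → List (ℚ × ℚ)
grid n = cartesianProduct coordinates coordinates
  where
  coordinates : List ℚ
  coordinates = map (λ k → (+ k ℤ.- + suc n) ℚ./ suc n) (upTo (suc (suc n ℕ.+ suc n)))

inDisc? : ∀ r p → Dec (∣ p ∣²ℚ ℚ.≤ r)
inDisc? r p = ∣ p ∣²ℚ ℚₚ.≤? r

-- Number of grid points in the closed unit disc.  Each carries a cell of area
-- (n + 1)⁻², so π ≈ diskCount n / (n + 1)².
diskCount : ℕ → ℕ
diskCount n = length (filter (inDisc? 1ℚ) (grid n))

diskCount-nonZero : ∀ n → ℕ.NonZero (diskCount n)
diskCount-nonZero n =
  ℕ.>-nonZero (∈-length (∈-filter⁺ (inDisc? 1ℚ) (∈-cartesianProduct⁺ centre centre) (inside origin≡0)))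
  where
  f : ℕ → ℚ
  f k = (+ k ℤ.- + suc n) ℚ./ suc n
  centre : f (suc n) ∈ map f (upTo (suc (suc n ℕ.+ suc n)))
  centre = ∈-map⁺ f (∈-upTo⁺ (ℕ.s≤s (ℕₚ.m≤m+n (suc n) (suc n))))
  origin≡0 : f (suc n) ≡ 0ℚ
  origin≡0 = trans (cong (λ i → i ℚ./ suc n) (ℤₚ.+-inverseʳ (+ suc n))) (ℚₚ.0/n≡0 (suc n))
  inside : ∀ {q} → q ≡ 0ℚ → ∣ q , q ∣²ℚ ℚ.≤ 1ℚ
  inside refl = ℚₚ.<⇒≤ (ℚₚ.positive⁻¹ 1ℚ)

gridPoint : ∀ {r} → r ℚ.< 1ℚ → ∀ p → ∣ p ∣²ℚ ℚ.≤ r → 𝔻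
gridPoint {r} r<1 p@(x , y) p≤r =
  (ι x +i ι y) , 1ℚ ℚ.- r , 0<1-r , 0 , λ _ _ →
    subst (∣ p ∣²ℚ ℚ.+ (1ℚ ℚ.- r) ℚ.≤_) (r+[1-r] r)
      (ℚₚ.+-monoˡ-≤ (1ℚ ℚ.- r) p≤r)
  where
  0<1-r : 0ℚ ℚ.< 1ℚ ℚ.- r
  0<1-r = subst (ℚ._< 1ℚ ℚ.- r) (ℚₚ.+-inverseʳ r) (ℚₚ.+-monoˡ-< (ℚ.- r) r<1)

sampleOn : ∀ {r} → r ℚ.< 1ℚ → (𝔻 → ℝ) → ℚ × ℚ → ℝ
sampleOn {r} r<1 h p with inDisc? r p
... | yes p≤r = h (gridPoint r<1 p p≤r)
... | no  _   = 0ℝ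

-- Riemann sum over the disc |z|² ≤ r for dA = π⁻¹ dx dy: the cell area
-- (n + 1)⁻² is divided by the area diskCount n · (n + 1)⁻² of the unit disc.
riemannSum : ∀ {r} → r ℚ.< 1ℚ → (𝔻 → ℝ) → ℕ → ℝ
riemannSum r<1 h n =
  ι ((+ 1 ℚ./ diskCount n) {{diskCount-nonZero n}}) * foldr (λ p s → sampleOn r<1 h p + s) 0ℝ (grid n)

-- Integrals are relations, since the limits need not exist.
∫disc_,_dA≈_ : ∀ {r} → r ℚ.< 1ℚ → (𝔻 → ℝ) → ℝ → Set
∫disc r<1 , h dA≈ I = riemannSum r<1 h ⟶ I

exhaustion : ℕ → ℚ
exhaustion m = 1ℚ ℚ.- + 1 ℚ./ suc m

exhaustion<1 : ∀ m → exhaustion m ℚ.< 1ℚ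
exhaustion<1 m = subst (exhaustion m ℚ.<_) (ℚₚ.+-identityʳ 1ℚ)
  (ℚₚ.+-monoʳ-< 1ℚ {ℚ.- (+ 1 ℚ./ suc m)} {0ℚ} (ℚₚ.neg-antimono-< {0ℚ} {+ 1 ℚ./ suc m}
    (ℚₚ.positive⁻¹ (+ 1 ℚ./ suc m) {{ℚₚ.normalize-pos 1 (suc m)}})))

-- Improper integral over 𝔻, as the limit of the integrals over the closed
-- discs |z|² ≤ 1 - 1/(m+1).  For continuous h ≥ 0 this is the Lebesgue
-- integral, by monotone convergence.
∫𝔻_dA≈_ : (𝔻 → ℝ) → ℝ → Set
∫𝔻 h dA≈ s = Σ (ℕ → ℝ) λ I → (∀ m → ∫disc exhaustion<1 m , h dA≈ I m) × I ⟶ s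

∫𝔻_dA₁≈_ : (𝔻 → ℝ) → ℝ → Set
∫𝔻 h dA₁≈ s = ∫𝔻 (λ z → ι (+ 2 ℚ./ 1) * (1ℝ - ∣ proj₁ z ∣²) * h z) dA≈ s

------------------------------------------------------------------------
-- The weighted Bergman space A²₁(𝔻)

-- A function on 𝔻 is analytic iff it is the sum of a power series about 0
-- that converges on all of 𝔻.
Analytic : Pred (𝔻 → ℂ) _
Analytic f = Σ (ℕ → ℂ) λ a → ∀ z → (λ N → ∑< N (λ n → a n *ᶜ proj₁ z ^ n)) ⟶ᶜ f z

∥_∥₂²≈_ : (𝔻 → ℂ) → ℝ → Set
∥ f ∥₂²≈ s = ∫𝔻 (λ z → ∣ f z ∣²) dA₁≈ s

-- ‖f‖₂ < ε, with both sides squared.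
∥_∥₂<_ : (𝔻 → ℂ) → ℝ → Set
∥ f ∥₂< ε = 0ℝ < ε × Σ ℝ λ s → ∥ f ∥₂²≈ s × s < ε * ε

A²₁ : Pred (𝔻 → ℂ) _
A²₁ f = Analytic f × Σ ℝ λ s → ∥ f ∥₂²≈ s

Dense : Pred (𝔻 → ℂ) _ → Set
Dense S = S ⊆ A²₁ ×
  (∀ g → A²₁ g → ∀ ε → 0ℝ < ε → Σ (𝔻 → ℂ) λ h → S h × ∥ (λ z → g z -ᶜ h z) ∥₂< ε)

combination : {I : Set} → (I → 𝔻 → ℂ) → List (ℂ × I) → 𝔻 → ℂ
combination F cs z = foldr (λ (c , i) s → c *ᶜ F i z +ᶜ s) 0ᶜ cs

Span : {I : Set} → (I → 𝔻 → ℂ) → Pred (𝔻 → ℂ) _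
Span {I} F h = Σ (List (ℂ × I)) λ cs → ∀ z → h z ≈ᶜ combination F cs z

------------------------------------------------------------------------
-- The functions f k

geometric : ℕ → ℂ → ℂ
geometric k z = ∑< k (λ j → z ^ j)

-- ∑_{j<k} j z^{j-1}
geometric′ : ℕ → ℂ → ℂ
geometric′ k z = ∑< (k ℕ.∸ 1) (λ j → fromℕ (suc j) *ᶜ z ^ j)

module GeometricBound (z : ℂ) (n : ℕ) where

  a b : ℚ
  a = seq (re z) n
  b = seq (im z) n

  Sre Sim pre pim : ℕ → ℚ
  Sre k = seq (re (geometric k z)) n
  Sim k = seq (im (geometric k z)) n
  pre k = seq (re (z ^ k)) n
  pim k = seq (im (z ^ k)) n

  -- (1 - z) (1 + z + ⋯ + z^{k-1}) = 1 - z^k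
  telescope : ∀ k →
    (1ℚ ℚ.- a) ℚ.* Sre k ℚ.+ b ℚ.* Sim k ≡ 1ℚ ℚ.- pre k ×
    (1ℚ ℚ.- a) ℚ.* Sim k ℚ.- b ℚ.* Sre k ≡ ℚ.- pim k
  telescope zero =
    telescope-re₀ a b ,
    telescope-im₀ a b
  telescope (suc k) with telescope k
  ... | e₁ , e₂ =
    trans (telescope-re₁
             a b (Sre k) (Sim k) (pre k) (pim k))
      (trans (cong (ℚ._+ ((1ℚ ℚ.- a) ℚ.* pre k ℚ.+ b ℚ.* pim k)) e₁)
        (telescope-re₂ a b (pre k) (pim k))) ,
    trans (telescope-im₁
             a b (Sre k) (Sim k) (pre k) (pim k))
      (trans (cong (ℚ._+ ((1ℚ ℚ.- a) ℚ.* pim k ℚ.- b ℚ.* pre k)) e₂)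
        (telescope-im₂ a b (pre k) (pim k)))

  0≤a²+b² : ∀ x y → 0ℚ ℚ.≤ x ℚ.* x ℚ.+ y ℚ.* y
  0≤a²+b² x y = ℚₚ.+-mono-≤ (0≤p² x) (0≤p² y)

  t : ℚ
  t = a ℚ.* a ℚ.+ b ℚ.* b

  power-bound : t ℚ.≤ 1ℚ → ∀ k → pre (suc k) ℚ.* pre (suc k) ℚ.+ pim (suc k) ℚ.* pim (suc k) ℚ.≤ t
  power-bound t≤1 zero = ℚₚ.≤-reflexive
    (norm-z¹ a b)
  power-bound t≤1 (suc k) = subst₂ ℚ._≤_
    (norm-product
      a b (pre (suc k)) (pim (suc k)))
    (ℚₚ.*-identityˡ t)
    (*-mono-≤ (0≤a²+b² (pre (suc k)) (pim (suc k))) (ℚₚ.<⇒≤ (ℚₚ.positive⁻¹ 1ℚ)) t≤1 (power-bound t≤1 k))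

  S² : ℕ → ℚ
  S² k = Sre k ℚ.* Sre k ℚ.+ Sim k ℚ.* Sim k

  four : ℚ
  four = + 4 ℚ./ 1

  -- |1 - z^k| ≥ 1 - Re z^k ≥ δ/2 and |1 - z| ≤ 2
  geometric-bound : ∀ δ → 0ℚ ℚ.≤ δ → t ℚ.+ δ ℚ.≤ 1ℚ → ∀ k →
    (½ ℚ.* δ) ℚ.* (½ ℚ.* δ) ℚ.≤ four ℚ.* S² (suc k)
  geometric-bound δ 0≤δ t+δ≤1 k = ℚₚ.≤-trans lower (ℚₚ.≤-trans (ℚₚ.≤-reflexive norms) upper)
    where
    p q s r : ℚ
    p = pre (suc k)
    q = pim (suc k)
    s = Sre (suc k)
    r = Sim (suc k)
    t≤1 : t ℚ.≤ 1ℚ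
    t≤1 = ℚₚ.≤-trans (subst (ℚ._≤ t ℚ.+ δ) (ℚₚ.+-identityʳ t) (ℚₚ.+-monoʳ-≤ t 0≤δ)) t+δ≤1
    -- (1 - p)² + q² + δ ≥ δ and p² + q² + δ ≤ 1
    1-p : ½ ℚ.* δ ℚ.≤ 1ℚ ℚ.- p
    1-p = subst₂ ℚ._≤_
      (half-lhs p q δ)
      (half-rhs p q)
      (ℚₚ.*-monoˡ-≤-nonNeg ½
        (ℚₚ.+-monoˡ-≤ (ℚ.- (p ℚ.* p ℚ.+ q ℚ.* q))
          (ℚₚ.+-mono-≤ (0≤a²+b² (1ℚ ℚ.- p) q)
            (ℚₚ.≤-trans (ℚₚ.+-monoˡ-≤ δ (power-bound t≤1 k)) t+δ≤1))))
    0≤½δ : 0ℚ ℚ.≤ ½ ℚ.* δ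
    0≤½δ = 0≤* (ℚₚ.nonNegative⁻¹ ½) 0≤δ
    lower : (½ ℚ.* δ) ℚ.* (½ ℚ.* δ) ℚ.≤ (1ℚ ℚ.- p) ℚ.* (1ℚ ℚ.- p) ℚ.+ (ℚ.- q) ℚ.* (ℚ.- q)
    lower = subst (ℚ._≤ (1ℚ ℚ.- p) ℚ.* (1ℚ ℚ.- p) ℚ.+ (ℚ.- q) ℚ.* (ℚ.- q)) (ℚₚ.+-identityʳ _)
      (ℚₚ.+-mono-≤ (*-mono-≤ 0≤½δ (ℚₚ.≤-trans 0≤½δ 1-p) 1-p 1-p) (0≤p² (ℚ.- q)))
    1-a : ℚ
    1-a = (1ℚ ℚ.- a) ℚ.* (1ℚ ℚ.- a) ℚ.+ b ℚ.* b
    norms : (1ℚ ℚ.- p) ℚ.* (1ℚ ℚ.- p) ℚ.+ (ℚ.- q) ℚ.* (ℚ.- q) ≡ 1-a ℚ.* S² (suc k)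
    norms = trans
      (cong₂ (λ x y → x ℚ.* x ℚ.+ y ℚ.* y)
        (sym (proj₁ (telescope (suc k)))) (sym (proj₂ (telescope (suc k)))))
      (norm-telescope a b s r)
    1-a≤4 : 1-a ℚ.≤ four
    1-a≤4 = subst₂ ℚ._≤_
      (ℚₚ.+-identityʳ 1-a)
      (parallelogram a b t)
      (subst (1-a ℚ.+ 0ℚ ℚ.≤_)
        (sym (ℚₚ.+-assoc 1-a ((1ℚ ℚ.+ a) ℚ.* (1ℚ ℚ.+ a) ℚ.+ b ℚ.* b) ((1ℚ ℚ.+ 1ℚ) ℚ.* (1ℚ ℚ.- t))))
        (ℚₚ.+-monoʳ-≤ 1-a (ℚₚ.+-mono-≤ (0≤a²+b² (1ℚ ℚ.+ a) b)
          (0≤* (ℚₚ.nonNegative⁻¹ (1ℚ ℚ.+ 1ℚ)) 0≤1-t))))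
      where
      0≤1-t : 0ℚ ℚ.≤ 1ℚ ℚ.- t
      0≤1-t = q+-q {0ℚ} {t} {1ℚ} (subst (ℚ._≤ 1ℚ) (sym (ℚₚ.+-identityˡ t)) t≤1)
    upper : 1-a ℚ.* S² (suc k) ℚ.≤ four ℚ.* S² (suc k)
    upper = ℚₚ.*-monoʳ-≤-nonNeg (S² (suc k)) {{ℚ.nonNegative (0≤a²+b² s r)}} 1-a≤4

geometric-nonZero : ∀ k → 2 ℕ.≤ k → (z : 𝔻) → 0ℝ < ∣ geometric k (proj₁ z) ∣²
geometric-nonZero (suc k) _ (z , δ , 0<δ , N , z<1) =
  η , 0<* (ℚₚ.positive⁻¹ quarter) (0<* (0<half 0<δ) (0<half 0<δ)) , N , λ n N≤n →
    subst₂ ℚ._≤_ (sym (ℚₚ.+-identityˡ η))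
      (quarter-four _)
      (ℚₚ.*-monoˡ-≤-nonNeg quarter (GeometricBound.geometric-bound z n δ (ℚₚ.<⇒≤ 0<δ) (z<1 n N≤n) k))
  where
  quarter η : ℚ
  quarter = + 1 ℚ./ 4
  η = quarter ℚ.* ((½ ℚ.* δ) ℚ.* (½ ℚ.* δ))

-- The logarithmic derivative of geometric k.
f : (k : ℕ) → 2 ℕ.≤ k → 𝔻 → ℂ
f k 2≤k z = divide (geometric′ k (proj₁ z)) (geometric k (proj₁ z)) (geometric-nonZero k 2≤k z)

-- With R = 1/(1 - z) one has f k = R - F k, where F k = k z^(k-1) / (1 - z^k) has
-- the coefficient k at z^(n-1) if k divides n, and 0 otherwise.  The F (2^i) are
-- almost orthogonal, so averages of f (2^i) converge to R, and every F k is a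
-- limit of elements of the span.  Since F k / k is the indicator of the multiples
-- of k, the coefficientwise product F n / n · ∏_{2 ≤ p ≤ P} (1 - F (n p) / (n p)) is
-- a combination of the F k; it agrees with z^(n-1) up to degree n P and has
-- coefficients 0 and 1.  Hence the span approximates polynomials.
--
-- The norm enters through ‖f‖² = Σ 2 |a_n|² / ((n+1)(n+2)).  For Riemann sums over
-- the grid of mesh h this rests on: the sum of ∂P over a disc vanishes up to O(h)
-- if P vanishes on the boundary circle.  Applied to (r - |z|²) |z|^(2j) z^d and
-- (r - |z|²) |z|^(2j) z̄ it gives the orthogonality of the monomials and
-- recursions for the radial moments; the second one with j = 0, together with
-- the monotonicity of the area in r, shows that the area is proportional to r.

module Submission where

open import Algebra.Bundles using (CommutativeRing)
import Algebra.Solver.Ring as RingSolver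
import Algebra.Solver.Ring.AlmostCommutativeRing as ACR
open import Algebra.Structures using (IsCommutativeRing)
open import Data.Empty using (⊥-elim)
open import Data.Integer.Base as ℤ using (ℤ; +_)
import Data.Integer.Properties as ℤₚ
open import Data.List.Base using (List; []; _∷_; _++_; map; foldr; filter; length; upTo; cartesianProduct)
open import Data.List.Properties using (applyUpTo-∷ʳ; foldr-cong; foldr-fusion)
import Data.Maybe.Base as Maybe
open import Data.Nat.Base as ℕ using (ℕ; zero; suc)
open import Data.Nat.Divisibility using (_∣_; _∣?_; divides; ∣-trans; ∣⇒≤; ∣m+n∣m⇒∣n; n∣m*n; ∣-refl; m∣m*n; 0∣⇒≡0)
import Data.Nat.DivMod as DM
open import Data.Nat.LCM using (lcm; lcm-least; m∣lcm[m,n]; n∣lcm[m,n])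
import Data.Nat.Properties as ℕₚ
open import Data.Product.Base using (Σ; ∃; _×_; _,_; proj₁; proj₂)
open import Data.Rational.Base as ℚ using (ℚ; 0ℚ; 1ℚ; ½)
import Data.Rational.Properties as ℚₚ
open import Data.Fin.Base using (Fin; zero; suc; toℕ)
open import Data.Vec.Base using (Vec; tabulate)
open import Data.Vec.N-ary using (N-ary; _$ⁿ_; curryⁿ; Eq; Eqʰ; Eqʰ-to-Eq; curryⁿ-cong; curryⁿ-cong⁻¹)
open import Data.Rational.Solver using (module +-*-Solver)
import Data.Rational.Unnormalised.Base as ℚᵘ
import Data.Rational.Unnormalised.Properties as ℚᵘₚ
open import Data.Sum.Base using (_⊎_; inj₁; inj₂)
open import Defs using (grid; inDisc?; ∣_∣²ℚ; diskCount; diskCount-nonZero; exhaustion; exhaustion<1)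
import Relation.Binary.Reasoning.Setoid as SetoidReasoning
open import Relation.Binary.PropositionalEquality as ≡ using (_≡_)
open import Relation.Nullary using (Dec; yes; no; ¬_)
import Relation.Nullary.Decidable as Dec

-- The norm is given only through Riemann sums on square grids, so neither polar coordinates nor
-- dominated convergence is at hand: every integral has to come from summation by parts on the grid,
-- with errors of explicit order in the mesh. Discs |z|² ≤ r with r < 1 are treated before the limit
-- r → 1, because on them a power series converges uniformly at a geometric rate. The two limits may
-- be exchanged since all weights are nonnegative and bounded by their limits.
--
-- On the side of the coefficients, averaging is forced by the size of the F (2^i): the energy of F
-- k stays bounded as k grows but does not become small, so a single f k does not approximate R. A
-- sieve of length P leaves a multiple σ R behind, and nothing is known about the size of σ;
-- therefore the number of averaged terms is chosen after P.
--
-- The order of the reals is never decided. Sign cases are replaced by polynomial identities, and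
-- every limit is constructed from a modulus of convergence.

module Fractions where

  -- Integers and unit fractions inside the rationals.

  /1-homo-+ : ∀ i j → (i ℤ.+ j) ℚ./ 1 ≡ (i ℚ./ 1) ℚ.+ (j ℚ./ 1)
  /1-homo-+ i j = ℚₚ.toℚᵘ-injective (begin
    ℚ.toℚᵘ ((i ℤ.+ j) ℚ./ 1)                   ≈⟨ ℚₚ.toℚᵘ-fromℚᵘ (ℚᵘ.mkℚᵘ (i ℤ.+ j) 0) ⟩
    ℚᵘ.mkℚᵘ (i ℤ.+ j) 0                        ≈⟨ ℚᵘ.*≡* (≡.cong (ℤ._* + 1) (≡.cong₂ ℤ._+_ (≡.sym (ℤₚ.*-identityʳ i)) (≡.sym (ℤₚ.*-identityʳ j)))) ⟩
    ℚᵘ.mkℚᵘ i 0 ℚᵘ.+ ℚᵘ.mkℚᵘ j 0               ≈⟨ ℚᵘₚ.+-cong (ℚₚ.toℚᵘ-fromℚᵘ (ℚᵘ.mkℚᵘ i 0)) (ℚₚ.toℚᵘ-fromℚᵘ (ℚᵘ.mkℚᵘ j 0)) ⟨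
    ℚ.toℚᵘ (i ℚ./ 1) ℚᵘ.+ ℚ.toℚᵘ (j ℚ./ 1)     ≈⟨ ℚₚ.toℚᵘ-homo-+ (i ℚ./ 1) (j ℚ./ 1) ⟨
    ℚ.toℚᵘ ((i ℚ./ 1) ℚ.+ (j ℚ./ 1))           ∎)
    where open ℚᵘₚ.≃-Reasoning

  /1-homo-* : ∀ i j → (i ℤ.* j) ℚ./ 1 ≡ (i ℚ./ 1) ℚ.* (j ℚ./ 1)
  /1-homo-* i j = ℚₚ.toℚᵘ-injective (begin
    ℚ.toℚᵘ ((i ℤ.* j) ℚ./ 1)                   ≈⟨ ℚₚ.toℚᵘ-fromℚᵘ (ℚᵘ.mkℚᵘ (i ℤ.* j) 0) ⟩
    ℚᵘ.mkℚᵘ i 0 ℚᵘ.* ℚᵘ.mkℚᵘ j 0               ≈⟨ ℚᵘₚ.*-cong (ℚₚ.toℚᵘ-fromℚᵘ (ℚᵘ.mkℚᵘ i 0)) (ℚₚ.toℚᵘ-fromℚᵘ (ℚᵘ.mkℚᵘ j 0)) ⟨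
    ℚ.toℚᵘ (i ℚ./ 1) ℚᵘ.* ℚ.toℚᵘ (j ℚ./ 1)     ≈⟨ ℚₚ.toℚᵘ-homo-* (i ℚ./ 1) (j ℚ./ 1) ⟨
    ℚ.toℚᵘ ((i ℚ./ 1) ℚ.* (j ℚ./ 1))           ∎)
    where open ℚᵘₚ.≃-Reasoning

  -‿homo-/1 : ∀ i → (ℤ.- i) ℚ./ 1 ≡ ℚ.- (i ℚ./ 1)
  -‿homo-/1 i = ≡.sym (neg-unique (i ℚ./ 1) ((ℤ.- i) ℚ./ 1)
      (≡.trans (≡.sym (/1-homo-+ i (ℤ.- i))) (≡.cong (ℚ._/ 1) (ℤₚ.+-inverseʳ i))))
    where
    open ≡.≡-Reasoning
    neg-unique : ∀ p q → p ℚ.+ q ≡ 0ℚ → ℚ.- p ≡ q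
    neg-unique p q e = begin
      ℚ.- p                  ≡⟨ ℚₚ.+-identityʳ _ ⟨
      ℚ.- p ℚ.+ 0ℚ           ≡⟨ ≡.cong (ℚ.- p ℚ.+_) e ⟨
      ℚ.- p ℚ.+ (p ℚ.+ q)    ≡⟨ ℚₚ.+-assoc (ℚ.- p) p q ⟨
      ℚ.- p ℚ.+ p ℚ.+ q      ≡⟨ ≡.cong (ℚ._+ q) (ℚₚ.+-inverseˡ p) ⟩
      0ℚ ℚ.+ q               ≡⟨ ℚₚ.+-identityˡ q ⟩
      q                      ∎

  /suc : ∀ i n → i ℚ./ suc n ≡ (i ℚ./ 1) ℚ.* (+ 1 ℚ./ suc n)
  /suc i n = ℚₚ.toℚᵘ-injective (begin
    ℚ.toℚᵘ (i ℚ./ suc n)                        ≈⟨ ℚₚ.toℚᵘ-fromℚᵘ (ℚᵘ.mkℚᵘ i n) ⟩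
    ℚᵘ.mkℚᵘ i n                                 ≈⟨ ℚᵘ.*≡* (≡.cong₂ ℤ._*_ (≡.sym (ℤₚ.*-identityʳ i)) (ℤₚ.*-identityˡ (+ suc n))) ⟩
    ℚᵘ.mkℚᵘ i 0 ℚᵘ.* ℚᵘ.mkℚᵘ (+ 1) n            ≈⟨ ℚᵘₚ.*-cong (ℚₚ.toℚᵘ-fromℚᵘ (ℚᵘ.mkℚᵘ i 0)) (ℚₚ.toℚᵘ-fromℚᵘ (ℚᵘ.mkℚᵘ (+ 1) n)) ⟨
    ℚ.toℚᵘ (i ℚ./ 1) ℚᵘ.* ℚ.toℚᵘ (+ 1 ℚ./ suc n) ≈⟨ ℚₚ.toℚᵘ-homo-* (i ℚ./ 1) (+ 1 ℚ./ suc n) ⟨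
    ℚ.toℚᵘ ((i ℚ./ 1) ℚ.* (+ 1 ℚ./ suc n))      ∎)
    where open ℚᵘₚ.≃-Reasoning

  suc*1/suc : ∀ n → (+ suc n ℚ./ 1) ℚ.* (+ 1 ℚ./ suc n) ≡ 1ℚ
  suc*1/suc n = ≡.trans (≡.sym (/suc (+ suc n) n)) (ℚₚ.toℚᵘ-injective (begin
    ℚ.toℚᵘ (+ suc n ℚ./ suc n)  ≈⟨ ℚₚ.toℚᵘ-fromℚᵘ (ℚᵘ.mkℚᵘ (+ suc n) n) ⟩
    ℚᵘ.mkℚᵘ (+ suc n) n         ≈⟨ ℚᵘ.*≡* (ℤₚ.*-comm (+ suc n) (+ 1)) ⟩
    ℚᵘ.mkℚᵘ (+ 1) 0             ∎))
    where open ℚᵘₚ.≃-Reasoning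

  0≤+/ : ∀ n d → 0ℚ ℚ.≤ + n ℚ./ suc d
  0≤+/ n d = ℚₚ.nonNegative⁻¹ _ {{ℚₚ.normalize-nonNeg n (suc d)}}

  0<1/suc : ∀ d → 0ℚ ℚ.< + 1 ℚ./ suc d
  0<1/suc d = ℚₚ.positive⁻¹ _ {{ℚₚ.normalize-pos 1 (suc d)}}

-- The axioms of the real numbers on which the analysis rests.

record CompleteAlgebra (Carrier : Set) : Set₁ where
  infix  4 _≈_ _≤_
  infixl 6 _+_
  infixl 7 _*_
  infix  8 -_
  field
    _≈_ _≤_ : Carrier → Carrier → Set
    _+_ _*_ : Carrier → Carrier → Carrier
    -_      : Carrier → Carrier
    ι       : ℚ → Carrier
    isCommutativeRing : IsCommutativeRing _≈_ _+_ _*_ -_ (ι 0ℚ) (ι 1ℚ)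
    ι-+     : ∀ p q → ι (p ℚ.+ q) ≈ ι p + ι q
    ι-*     : ∀ p q → ι (p ℚ.* q) ≈ ι p * ι q
    ι-neg   : ∀ p → ι (ℚ.- p) ≈ - ι p
    ι-mono  : ∀ {p q} → p ℚ.≤ q → ι p ≤ ι q
    ι-cancel : ∀ {p q} → ι p ≤ ι q → p ℚ.≤ q
    ≤-reflexive : ∀ {x y} → x ≈ y → x ≤ y
    ≤-trans     : ∀ {x y z} → x ≤ y → y ≤ z → x ≤ z
    ≤-antisym   : ∀ {x y} → x ≤ y → y ≤ x → x ≈ y
    +-monoˡ     : ∀ {x y} z → x ≤ y → x + z ≤ y + z
    *-nonNeg    : ∀ {x y} → ι 0ℚ ≤ x → ι 0ℚ ≤ y → ι 0ℚ ≤ x * y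
    -- An axiom of its own beside `*-nonNeg`, because the sign of a Cauchy real cannot be decided.
    square-nonNeg : ∀ x → ι 0ℚ ≤ x * x
    ≤-closed    : ∀ {x y} → (∀ k → x ≤ y + ι (+ 1 ℚ./ suc k)) → x ≤ y
    archimedean : ∀ x → ∃ λ n → x ≤ ι (+ n ℚ./ 1)
    -- One-sided inequalities suffice in the Cauchy condition, since m and n may be exchanged. The
    -- moduli are data from which the limit is constructed.
    complete    : ∀ (x : ℕ → Carrier) →
      (∀ k → ∃ λ N → ∀ m n → N ℕ.≤ m → N ℕ.≤ n → x m ≤ x n + ι (+ 1 ℚ./ suc k)) →
      ∃ λ l → ∀ k → ∃ λ N → ∀ n → N ℕ.≤ n → x n ≤ l + ι (+ 1 ℚ./ suc k) × l ≤ x n + ι (+ 1 ℚ./ suc k)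

open Fractions

-- Syntax for reflected polynomial identities.

module Expressions where

  infix 4 _:=_
  infix 9 :-_
  infixl 8 _:*_
  infixl 7 _:+_ _:-_

  data Expr : Set where
    index : ℕ → Expr
    con : ℤ → Expr
    _:+_ _:*_ _:-_ : Expr → Expr → Expr
    :-_ : Expr → Expr

  _:=_ : Expr → Expr → Expr × Expr
  _:=_ = _,_

  indices : ∀ n → Vec Expr n
  indices n = tabulate λ i → index (toℕ i)

-- Analysis over an arbitrary complete algebra.

module Analysis (Carrier : Set) (𝕂 : CompleteAlgebra Carrier) where

  private module 𝕂 = CompleteAlgebra 𝕂

  commutativeRing : CommutativeRing _ _
  commutativeRing = record { isCommutativeRing = 𝕂.isCommutativeRing }

  open CommutativeRing commutativeRing public
    using (0#; 1#; refl; sym; trans; reflexive; setoid; +-cong; *-cong; -‿cong; +-congˡ; +-congʳ; *-congˡ; *-congʳ;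
           +-identityˡ; +-identityʳ; *-identityˡ; *-identityʳ; zeroˡ; zeroʳ; *-comm; +-comm; *-assoc; +-assoc; -‿inverseʳ)
  open CompleteAlgebra 𝕂 public
    using (ι; _≈_; _≤_; _+_; _*_; -_; ι-+; ι-*; ι-neg; ι-mono; ι-cancel; ≤-reflexive; ≤-trans; ≤-antisym; *-nonNeg; square-nonNeg)

  module ≈-Reasoning = SetoidReasoning setoid

  infixl 6 _-_
  _-_ : Carrier → Carrier → Carrier
  x - y = x + (- y)

  private
    almost : ACR.AlmostCommutativeRing _ _
    almost = ACR.fromCommutativeRing commutativeRing

    ℤ⟶𝕂 : ACR._-Raw-AlmostCommutative⟶_ (CommutativeRing.rawRing ℤₚ.+-*-commutativeRing) almost
    ℤ⟶𝕂 = record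
      { ⟦_⟧    = λ i → ι (i ℚ./ 1)
      ; +-homo = λ i j → trans (reflexive (≡.cong ι (/1-homo-+ i j))) (ι-+ _ _)
      ; *-homo = λ i j → trans (reflexive (≡.cong ι (/1-homo-* i j))) (ι-* _ _)
      ; -‿homo = λ i → trans (reflexive (≡.cong ι (-‿homo-/1 i))) (𝕂.ι-neg _)
      ; 0-homo = refl
      ; 1-homo = refl
      }

  module Reflect = RingSolver (CommutativeRing.rawRing ℤₚ.+-*-commutativeRing) almost ℤ⟶𝕂
    (λ i j → Maybe.map (λ e → reflexive (≡.cong (λ k → ι (k ℚ./ 1)) e)) (Dec.dec⇒maybe (i ℤₚ.≟ j)))

  open Expressions public

  polynomial : ∀ n → Expr → Reflect.Polynomial n
  polynomial n (index i) = variableAt n i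
    where
    variableAt : ∀ n → ℕ → Reflect.Polynomial n
    -- A default value: `indices n` produces only indices below `n`.
    variableAt zero    _       = Reflect.con (+ 0)
    variableAt (suc n) zero    = Reflect.var zero
    variableAt (suc n) (suc i) = weaken (variableAt n i)
      where
      weaken : ∀ {n} → Reflect.Polynomial n → Reflect.Polynomial (suc n)
      weaken (Reflect.var i) = Reflect.var (suc i)
      -- `variableAt` returns only variables and 0, so this clause meets 0 alone.
      weaken _               = Reflect.con (+ 0)
  polynomial n (con c)   = Reflect.con c
  polynomial n (a :+ b)  = polynomial n a Reflect.:+ polynomial n b
  polynomial n (a :* b)  = polynomial n a Reflect.:* polynomial n b
  polynomial n (a :- b)  = polynomial n a Reflect.:- polynomial n b
  polynomial n (:- a)    = Reflect.:- polynomial n a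

  -- The library's solver with expressions that are not indexed by the number of variables, which keeps type checking cheap.
  leftSide rightSide : ∀ n → N-ary n Expr (Expr × Expr) → Reflect.Polynomial n
  leftSide n f  = polynomial n (proj₁ (f $ⁿ indices n))
  rightSide n f = polynomial n (proj₂ (f $ⁿ indices n))

  solve : ∀ n (f : N-ary n Expr (Expr × Expr)) →
    Eqʰ n _≈_ (curryⁿ Reflect.⟦ leftSide n f ⟧↓) (curryⁿ Reflect.⟦ rightSide n f ⟧↓) →
    Eq n _≈_ (curryⁿ Reflect.⟦ leftSide n f ⟧) (curryⁿ Reflect.⟦ rightSide n f ⟧)
  solve n f hyp = curryⁿ-cong _≈_ Reflect.⟦ leftSide n f ⟧ Reflect.⟦ rightSide n f ⟧ λ v →
    Reflect.prove v (leftSide n f) (rightSide n f)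
      (curryⁿ-cong⁻¹ _≈_ Reflect.⟦ leftSide n f ⟧↓ Reflect.⟦ rightSide n f ⟧↓ (Eqʰ-to-Eq n _≈_ hyp) v)

  minus-def : ∀ x y → x - y ≡ x + (- y)
  minus-def x y = ≡.refl

  infix 4 _≥0
  _≥0 : Carrier → Set
  x ≥0 = 0# ≤ x

  2# : Carrier
  2# = ι (+ 2 ℚ./ 1)

  -- Abstract, so that unification does not unfold the normalisation of fractions.
  abstract
    nat inv : ℕ → Carrier
    nat n = ι (+ n ℚ./ 1)
    inv n = ι (+ 1 ℚ./ suc n)

    nat-ι : ∀ n → nat n ≡ ι (+ n ℚ./ 1)
    nat-ι n = ≡.refl

    inv-ι : ∀ n → inv n ≡ ι (+ 1 ℚ./ suc n)
    inv-ι n = ≡.refl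

    nat-0 : nat 0 ≈ 0#
    nat-0 = refl

    nat-1 : nat 1 ≈ 1#
    nat-1 = refl

    nat-2 : nat 2 ≈ 2#
    nat-2 = refl

    inv-0 : inv 0 ≈ 1#
    inv-0 = refl

    nat≥0 : ∀ n → 0# ≤ nat n
    nat≥0 n = ι-mono (0≤+/ n 0)

    inv≥0 : ∀ n → 0# ≤ inv n
    inv≥0 n = ι-mono (0≤+/ 1 n)

    nat-+ : ∀ m n → nat (m ℕ.+ n) ≈ nat m + nat n
    nat-+ m n = trans (reflexive (≡.cong ι (/1-homo-+ (+ m) (+ n)))) (ι-+ _ _)

    nat-* : ∀ m n → nat (m ℕ.* n) ≈ nat m * nat n
    nat-* m n = trans (reflexive (≡.cong ι (≡.trans (≡.cong (ℚ._/ 1) (ℤₚ.pos-* m n)) (/1-homo-* (+ m) (+ n))))) (ι-* _ _)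

    nat*inv : ∀ n → nat (suc n) * inv n ≈ 1#
    nat*inv n = trans (sym (ι-* _ _)) (reflexive (≡.cong ι (suc*1/suc n)))

    archimedean : ∀ x → ∃ λ n → x ≤ nat n
    archimedean = 𝕂.archimedean

    ≤-closed : ∀ {x y} → (∀ k → x ≤ y + inv k) → x ≤ y
    ≤-closed = 𝕂.≤-closed

    complete : ∀ (x : ℕ → Carrier) →
      (∀ k → ∃ λ N → ∀ m n → N ℕ.≤ m → N ℕ.≤ n → x m ≤ x n + inv k) →
      ∃ λ l → ∀ k → ∃ λ N → ∀ n → N ℕ.≤ n → x n ≤ l + inv k × l ≤ x n + inv k
    complete = 𝕂.complete


  -- Consequences of the order axioms.

  ≤-refl : ∀ {x} → x ≤ x
  ≤-refl = ≤-reflexive refl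

  ≤-resp : ∀ {x y z w} → x ≈ y → z ≈ w → x ≤ z → y ≤ w
  ≤-resp e f h = ≤-trans (≤-reflexive (sym e)) (≤-trans h (≤-reflexive f))

  ≤⇒≥0 : ∀ {x y} → x ≤ y → y - x ≥0
  ≤⇒≥0 {x} h = ≤-resp (-‿inverseʳ x) refl (𝕂.+-monoˡ (- x) h)

  ≥0⇒≤ : ∀ {x y} e → e ≥0 → e ≈ y - x → x ≤ y
  ≥0⇒≤ {x} {y} e h q = ≤-resp (+-identityˡ x)
    (trans (+-congʳ q) (solve 2 (λ x y → (y :- x) :+ x := y) refl x y)) (𝕂.+-monoˡ x h)

  ≥0-resp : ∀ {x y} → x ≈ y → x ≥0 → y ≥0
  ≥0-resp e = ≤-resp refl e

  +-mono : ∀ {x y z w} → x ≤ y → z ≤ w → x + z ≤ y + w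
  +-mono {x} {y} {z} {w} p q = ≤-trans (𝕂.+-monoˡ z p)
    (≤-resp (+-comm z y) (+-comm w y) (𝕂.+-monoˡ y q))

  +-nonNeg : ∀ {x y} → x ≥0 → y ≥0 → x + y ≥0
  +-nonNeg p q = ≤-resp (+-identityˡ 0#) refl (+-mono p q)

  neg-anti : ∀ {x y} → x ≤ y → - y ≤ - x
  neg-anti {x} {y} h = ≥0⇒≤ _ (≤⇒≥0 h) (solve 2 (λ x y → y :- x := (:- x) :- (:- y)) refl x y)

  *-monoˡ : ∀ {x y} z → z ≥0 → x ≤ y → z * x ≤ z * y
  *-monoˡ {x} {y} z p h = ≥0⇒≤ _ (*-nonNeg p (≤⇒≥0 h)) (solve 3 (λ x y z → z :* (y :- x) := z :* y :- z :* x) refl x y z)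

  *-monoʳ : ∀ {x y} z → z ≥0 → x ≤ y → x * z ≤ y * z
  *-monoʳ {x} {y} z p h = ≤-resp (*-comm z x) (*-comm z y) (*-monoˡ z p h)

  *-mono : ∀ {x y z w} → z ≥0 → y ≥0 → x ≤ y → z ≤ w → x * z ≤ y * w
  *-mono {x} {y} {z} {w} p q h k = ≤-trans (*-monoʳ z p h) (*-monoˡ y q k)

  x≤x+ : ∀ {x y} → y ≥0 → x ≤ x + y
  x≤x+ {x} {y} h = ≥0⇒≤ y h (solve 2 (λ x y → y := (x :+ y) :- x) refl x y)

  ι≥0 : ∀ {p} → 0ℚ ℚ.≤ p → ι p ≥0
  ι≥0 = ι-mono

  1≥0 : 1# ≥0
  1≥0 = ι≥0 (0≤+/ 1 0)

  nat-suc : ∀ n → nat (suc n) ≈ nat n + 1#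
  nat-suc n = trans (nat-+ 1 n) (trans (+-congʳ nat-1) (+-comm 1# (nat n)))

  nat-mono : ∀ {m n} → m ℕ.≤ n → nat m ≤ nat n
  nat-mono {m} h = ≤-resp refl (sym (trans (reflexive (≡.cong nat (≡.sym (ℕₚ.m+[n∸m]≡n h)))) (nat-+ m _))) (x≤x+ (nat≥0 _))

  [1+nat]*inv : ∀ n → (nat n + 1#) * inv n ≈ 1#
  [1+nat]*inv n = trans (*-congʳ (sym (nat-suc n))) (nat*inv n)

  inv-anti : ∀ {m n} → m ℕ.≤ n → inv n ≤ inv m
  inv-anti {m} {n} h = ≥0⇒≤ _ (*-nonNeg (*-nonNeg (inv≥0 m) (inv≥0 n)) (≤⇒≥0 (nat-mono (ℕ.s≤s h)))) (begin
    inv m * inv n * (nat (suc n) - nat (suc m))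
      ≈⟨ solve 4 (λ i j a b → i :* j :* (b :- a) := i :* (b :* j) :- j :* (a :* i)) refl (inv m) (inv n) (nat (suc m)) (nat (suc n)) ⟩
    inv m * (nat (suc n) * inv n) - inv n * (nat (suc m) * inv m)
      ≈⟨ +-cong (*-congˡ (nat*inv n)) (-‿cong (*-congˡ (nat*inv m))) ⟩
    inv m * 1# - inv n * 1#
      ≈⟨ solve 2 (λ i j → i :* con (+ 1) :- j :* con (+ 1) := i :- j) refl (inv m) (inv n) ⟩
    inv m - inv n ∎)
    where open ≈-Reasoning

  inv≤1 : ∀ n → inv n ≤ 1#
  inv≤1 n = ≤-resp refl inv-0 (inv-anti {0} {n} ℕ.z≤n)

  cancel-nat : ∀ n {x} → nat (suc n) * x ≥0 → x ≥0
  cancel-nat n {x} h = ≥0-resp (begin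
      inv n * (nat (suc n) * x)  ≈⟨ solve 3 (λ i a x → i :* (a :* x) := a :* i :* x) refl (inv n) (nat (suc n)) x ⟩
      nat (suc n) * inv n * x    ≈⟨ *-congʳ (nat*inv n) ⟩
      1# * x                     ≈⟨ *-identityˡ x ⟩
      x ∎) (*-nonNeg (inv≥0 n) h)
    where open ≈-Reasoning

  halve : ∀ {x} → 2# * x ≥0 → x ≥0
  halve h = cancel-nat 1 (≥0-resp (*-congʳ (sym nat-2)) h)

  cancel-nat-≤ : ∀ n {x y} → nat (suc n) * x ≤ nat (suc n) * y → x ≤ y
  cancel-nat-≤ n {x} {y} h = ≥0⇒≤ _ (cancel-nat n (≥0-resp
    (solve 3 (λ a x y → a :* y :- a :* x := a :* (y :- x)) refl (nat (suc n)) x y) (≤⇒≥0 h))) refl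

  -- Constants are absorbed by a finer tolerance.
  finer : ∀ C k → ∃ λ j → ∀ i → j ℕ.≤ i → C * inv i ≤ inv k
  finer C k with archimedean C
  ... | M , C≤M = M ℕ.* suc k , λ i h → cancel-nat-≤ k (≤-trans (*-monoˡ _ (nat≥0 (suc k)) (*-monoʳ _ (inv≥0 i) C≤M))
    (≤-resp (trans (*-congʳ (nat-* M (suc k)))
               (solve 3 (λ a b c → a :* b :* c := b :* (a :* c)) refl (nat M) (nat (suc k)) (inv i)))
            (trans (nat*inv i) (sym (nat*inv k)))
       (*-monoʳ (inv i) (inv≥0 i) (nat-mono (ℕₚ.≤-trans h (ℕₚ.n≤1+n i))))))

  ≤-limit : ∀ {x y} C → (∀ k → x ≤ y + C * inv k) → x ≤ y
  ≤-limit C h = ≤-closed λ k → let j , f = finer C k in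
    ≤-trans (h j) (+-mono ≤-refl (f j ℕₚ.≤-refl))

  -- Absolute bounds

  -- The bound |x| ≤ B, split into two inequalities because the axioms contain neither an absolute
  -- value nor a maximum.
  record Abs (x B : Carrier) : Set where
    constructor abs
    field
      upper : x ≤ B
      lower : - x ≤ B
  open Abs public

  Abs-resp : ∀ {x y A B} → x ≈ y → A ≈ B → Abs x A → Abs y B
  Abs-resp e f (abs u l) = abs (≤-resp e f u) (≤-resp (-‿cong e) f l)

  Abs-respˡ : ∀ {x y A} → x ≈ y → Abs x A → Abs y A
  Abs-respˡ e = Abs-resp e refl

  Abs-weaken : ∀ {x A B} → A ≤ B → Abs x A → Abs x B
  Abs-weaken h (abs u l) = abs (≤-trans u h) (≤-trans l h)

  Abs-+ : ∀ {x y A B} → Abs x A → Abs y B → Abs (x + y) (A + B)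
  Abs-+ {x} {y} (abs u l) (abs v m) = abs (+-mono u v)
    (≤-resp (solve 2 (λ x y → (:- x) :+ (:- y) := :- (x :+ y)) refl x y) refl (+-mono l m))

  Abs-neg : ∀ {x A} → Abs x A → Abs (- x) A
  Abs-neg {x} (abs u l) = abs l (≤-resp (solve 1 (λ x → x := :- (:- x)) refl x) refl u)

  Abs-- : ∀ {x y A B} → Abs x A → Abs y B → Abs (x - y) (A + B)
  Abs-- p q = Abs-+ p (Abs-neg q)

  Abs-0 : ∀ {x A} → x ≈ 0# → A ≥0 → Abs x A
  Abs-0 {x} e h = abs (≤-resp (sym e) refl h) (≤-resp (trans (solve 0 (con (+ 0) := :- con (+ 0)) refl) (-‿cong (sym e))) refl h)

  Abs-≥0 : ∀ {x A} → Abs x A → A ≥0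
  Abs-≥0 {x} {A} (abs u l) = halve (≤-resp (-‿inverseʳ x) (solve 1 (λ a → a :+ a := con (+ 2) :* a) refl A) (+-mono u l))

  Abs-nonNeg : ∀ {x A} → x ≥0 → x ≤ A → Abs x A
  Abs-nonNeg {x} h k = abs k (≤-trans (≥0⇒≤ (x + x) (+-nonNeg h h) (solve 1 (λ x → x :+ x := x :- (:- x)) refl x)) k)

  -- Sign cases are replaced by an identity: 2 (AB - xy) = (A - x)(B + y) + (A + x)(B - y) is a sum
  -- of products of nonnegative factors. The lower bound uses it with the sign of y changed.
  Abs-* : ∀ {x y A B} → Abs x A → Abs y B → Abs (x * y) (A * B)
  Abs-* {x} {y} {A} {B} (abs u l) (abs v m) = abs
    (≥0⇒≤ _ (halve (≥0-resp
      (solve 4 (λ x y a b → (a :- x) :* (b :- (:- y)) :+ (a :- (:- x)) :* (b :- y) := con (+ 2) :* (a :* b :- x :* y)) refl x y A B)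
      (+-nonNeg (*-nonNeg (≤⇒≥0 u) (≤⇒≥0 m)) (*-nonNeg (≤⇒≥0 l) (≤⇒≥0 v))))) refl)
    (≥0⇒≤ _ (halve (≥0-resp
      (solve 4 (λ x y a b → (a :- x) :* (b :- y) :+ (a :- (:- x)) :* (b :- (:- y)) := con (+ 2) :* (a :* b :- (:- (x :* y)))) refl x y A B)
      (+-nonNeg (*-nonNeg (≤⇒≥0 u) (≤⇒≥0 v)) (*-nonNeg (≤⇒≥0 l) (≤⇒≥0 m))))) refl)

  Abs-scale : ∀ {x A} c → c ≥0 → Abs x A → Abs (c * x) (c * A)
  Abs-scale c h = Abs-* (Abs-nonNeg h ≤-refl)

  abs-bound : ∀ x → ∃ λ n → Abs x (nat n)
  abs-bound x with archimedean x | archimedean (- x)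
  ... | m , p | n , q = m ℕ.+ n , abs (≤-trans p (nat-mono (ℕₚ.m≤m+n m n))) (≤-trans q (nat-mono (ℕₚ.m≤n+m n m)))

  -- 2 b (b - x) = (b² - x²) + (b - x)²
  Abs-square : ∀ x b b⁻¹ → b⁻¹ ≥0 → b * b⁻¹ ≈ 1# → x * x ≤ b * b → Abs x b
  Abs-square x b b⁻¹ p e h = abs (go x h) (go (- x) (≤-resp (solve 1 (λ x → x :* x := (:- x) :* (:- x)) refl x) refl h))
    where
    go : ∀ x → x * x ≤ b * b → x ≤ b
    go x h = ≥0⇒≤ _ (halve (≥0-resp
      (trans (solve 3 (λ b c x → c :* ((b :* b :- x :* x) :+ (b :- x) :* (b :- x)) := con (+ 2) :* ((b :* c) :* (b :- x))) refl b b⁻¹ x)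
        (*-congˡ (trans (*-congʳ e) (*-identityˡ _))))
      (*-nonNeg p (+-nonNeg (≤⇒≥0 h) (square-nonNeg (b - x)))))) refl

  -- Finite sums

  ∑ : ℕ → (ℕ → Carrier) → Carrier
  ∑ zero    g = 0#
  ∑ (suc n) g = ∑ n g + g n

  ∑-cong : ∀ n {g h} → (∀ i → i ℕ.< n → g i ≈ h i) → ∑ n g ≈ ∑ n h
  ∑-cong zero    e = refl
  ∑-cong (suc n) e = +-cong (∑-cong n λ i h → e i (ℕₚ.m<n⇒m<1+n h)) (e n ℕₚ.≤-refl)

  ∑-cong′ : ∀ n {g h} → (∀ i → g i ≈ h i) → ∑ n g ≈ ∑ n h
  ∑-cong′ n e = ∑-cong n λ i _ → e i

  ∑-+ : ∀ n g h → ∑ n (λ i → g i + h i) ≈ ∑ n g + ∑ n h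
  ∑-+ zero    g h = solve 0 (con (+ 0) := con (+ 0) :+ con (+ 0)) refl
  ∑-+ (suc n) g h = trans (+-congʳ (∑-+ n g h))
    (solve 4 (λ a b c d → a :+ b :+ (c :+ d) := a :+ c :+ (b :+ d)) refl (∑ n g) (∑ n h) (g n) (h n))

  ∑-* : ∀ n c g → ∑ n (λ i → c * g i) ≈ c * ∑ n g
  ∑-* zero    c g = solve 1 (λ c → con (+ 0) := c :* con (+ 0)) refl c
  ∑-* (suc n) c g = trans (+-congʳ (∑-* n c g)) (solve 3 (λ c s g → c :* s :+ c :* g := c :* (s :+ g)) refl c (∑ n g) (g n))

  ∑-neg : ∀ n g → ∑ n (λ i → - g i) ≈ - ∑ n g
  ∑-neg zero    g = solve 0 (con (+ 0) := :- con (+ 0)) refl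
  ∑-neg (suc n) g = trans (+-congʳ (∑-neg n g)) (solve 2 (λ s g → (:- s) :+ (:- g) := :- (s :+ g)) refl (∑ n g) (g n))

  ∑-0 : ∀ n {g} → (∀ i → i ℕ.< n → g i ≈ 0#) → ∑ n g ≈ 0#
  ∑-0 zero    e = refl
  ∑-0 (suc n) e = trans (+-cong (∑-0 n λ i h → e i (ℕₚ.m<n⇒m<1+n h)) (e n ℕₚ.≤-refl)) (+-identityˡ 0#)

  ∑-mono : ∀ n {g h} → (∀ i → i ℕ.< n → g i ≤ h i) → ∑ n g ≤ ∑ n h
  ∑-mono zero    e = ≤-refl
  ∑-mono (suc n) e = +-mono (∑-mono n λ i h → e i (ℕₚ.m<n⇒m<1+n h)) (e n ℕₚ.≤-refl)

  ∑-≥0 : ∀ n {g} → (∀ i → i ℕ.< n → g i ≥0) → ∑ n g ≥0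
  ∑-≥0 zero    e = ≤-refl
  ∑-≥0 (suc n) e = +-nonNeg (∑-≥0 n λ i h → e i (ℕₚ.m<n⇒m<1+n h)) (e n ℕₚ.≤-refl)

  ∑-const : ∀ n c → ∑ n (λ _ → c) ≈ nat n * c
  ∑-const zero    c = trans (sym (zeroˡ c)) (*-congʳ (sym nat-0))
  ∑-const (suc n) c = trans (+-congʳ (∑-const n c))
    (trans (solve 2 (λ n c → n :* c :+ c := (n :+ con (+ 1)) :* c) refl (nat n) c) (*-congʳ (sym (nat-suc n))))

  ∑-split : ∀ m n g → ∑ (m ℕ.+ n) g ≈ ∑ m g + ∑ n (λ i → g (m ℕ.+ i))
  ∑-split m zero    g = trans (reflexive (≡.cong (λ k → ∑ k g) (ℕₚ.+-identityʳ m))) (sym (+-identityʳ _))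
  ∑-split m (suc n) g = trans (reflexive (≡.cong (λ k → ∑ k g) (ℕₚ.+-suc m n)))
    (trans (+-congʳ (∑-split m n g)) (+-assoc _ _ _))

  ∑-≤ : ∀ {m n g} → m ℕ.≤ n → (∀ i → g i ≥0) → ∑ m g ≤ ∑ n g
  ∑-≤ {m} {n} {g} h p = ≤-resp refl
    (trans (sym (∑-split m (n ℕ.∸ m) g)) (reflexive (≡.cong (λ k → ∑ k g) (ℕₚ.m+[n∸m]≡n h))))
    (x≤x+ (∑-≥0 (n ℕ.∸ m) λ i _ → p _))

  ∑-telescope : ∀ n (g : ℕ → Carrier) → ∑ n (λ i → g (suc i) - g i) ≈ g n - g 0
  ∑-telescope zero    g = sym (-‿inverseʳ _)
  ∑-telescope (suc n) g = trans (+-congʳ (∑-telescope n g))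
    (solve 3 (λ a b c → a :- b :+ (c :- a) := c :- b) refl (g n) (g 0) (g (suc n)))

  ∑-swap : ∀ m n (g : ℕ → ℕ → Carrier) → ∑ m (λ i → ∑ n (g i)) ≈ ∑ n (λ j → ∑ m (λ i → g i j))
  ∑-swap zero    n g = sym (∑-0 n λ _ _ → refl)
  ∑-swap (suc m) n g = trans (+-congʳ (∑-swap m n g)) (sym (∑-+ n _ _))

  ∑-Abs : ∀ n {g h} → (∀ i → i ℕ.< n → Abs (g i) (h i)) → Abs (∑ n g) (∑ n h)
  ∑-Abs zero    e = Abs-0 refl ≤-refl
  ∑-Abs (suc n) e = Abs-+ (∑-Abs n λ i h → e i (ℕₚ.m<n⇒m<1+n h)) (e n ℕₚ.≤-refl)

  infixr 8 _^ᴷ_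
  _^ᴷ_ : Carrier → ℕ → Carrier
  x ^ᴷ zero  = 1#
  x ^ᴷ suc n = x * x ^ᴷ n

  ^-≥0 : ∀ {x} n → x ≥0 → x ^ᴷ n ≥0
  ^-≥0 zero    h = 1≥0
  ^-≥0 (suc n) h = *-nonNeg h (^-≥0 n h)

  ^-≤1 : ∀ {x} n → x ≥0 → x ≤ 1# → x ^ᴷ n ≤ 1#
  ^-≤1 zero    h k = ≤-refl
  ^-≤1 (suc n) h k = ≤-resp refl (*-identityˡ 1#) (*-mono (^-≥0 n h) 1≥0 k (^-≤1 n h k))

  ^-mono : ∀ {x y} n → x ≥0 → x ≤ y → x ^ᴷ n ≤ y ^ᴷ n
  ^-mono zero    h k = ≤-refl
  ^-mono (suc n) h k = *-mono (^-≥0 n h) (≤-trans h k) k (^-mono n h k)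

  ^-cong : ∀ {x y} n → x ≈ y → x ^ᴷ n ≈ y ^ᴷ n
  ^-cong zero    e = refl
  ^-cong (suc n) e = *-cong e (^-cong n e)

  *-^ : ∀ x y n → (x * y) ^ᴷ n ≈ x ^ᴷ n * y ^ᴷ n
  *-^ x y zero    = sym (*-identityˡ 1#)
  *-^ x y (suc n) = trans (*-congˡ (*-^ x y n))
    (solve 4 (λ x y a b → x :* y :* (a :* b) := x :* a :* (y :* b)) refl x y (x ^ᴷ n) (y ^ᴷ n))

  -- Limits

  record Lim (x : ℕ → Carrier) (l : Carrier) : Set where
    constructor lim
    field within : ∀ k → ∃ λ N → ∀ n → N ℕ.≤ n → Abs (x n - l) (inv k)
  open Lim public

  Lim-by : ∀ {x l} C → (∀ k → ∃ λ N → ∀ n → N ℕ.≤ n → Abs (x n - l) (C * inv k)) → Lim x l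
  Lim-by C h = lim λ k → let j , f = finer C k; N , b = h j in
    N , λ n N≤n → Abs-weaken (f j ℕₚ.≤-refl) (b n N≤n)

  Lim-const : ∀ c → Lim (λ _ → c) c
  Lim-const c = lim λ k → 0 , λ n _ → Abs-0 (-‿inverseʳ c) (inv≥0 k)

  Lim-cong : ∀ {x y l m} → (∀ n → x n ≈ y n) → l ≈ m → Lim x l → Lim y m
  Lim-cong e f (lim h) = lim λ k → let N , b = h k in N , λ n p → Abs-respˡ (+-cong (e n) (-‿cong f)) (b n p)

  Lim-+ : ∀ {x y l m} → Lim x l → Lim y m → Lim (λ n → x n + y n) (l + m)
  Lim-+ {x} {y} {l} {m} (lim h) (lim h′) = Lim-by 2# λ k → let M , b = h k; N , c = h′ k in
    M ℕ.⊔ N , λ n p → Abs-resp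
      (solve 4 (λ x y l m → (x :- l) :+ (y :- m) := (x :+ y) :- (l :+ m)) refl (x n) (y n) l m)
      (solve 1 (λ e → e :+ e := con (+ 2) :* e) refl (inv k))
      (Abs-+ (b n (ℕₚ.m⊔n≤o⇒m≤o M N p)) (c n (ℕₚ.m⊔n≤o⇒n≤o M N p)))

  Lim-* : ∀ {x l} c → Lim x l → Lim (λ n → c * x n) (c * l)
  Lim-* {x} {l} c (lim h) = let C , bc = abs-bound c in Lim-by (nat C) λ k → let N , b = h k in
    N , λ n p → Abs-respˡ (solve 3 (λ c x l → c :* (x :- l) := c :* x :- c :* l) refl c (x n) l) (Abs-* bc (b n p))

  Lim-neg : ∀ {x l} → Lim x l → Lim (λ n → - x n) (- l)
  Lim-neg {x} {l} (lim h) = lim λ k → let N , b = h k in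
    N , λ n p → Abs-respˡ (solve 2 (λ x l → :- (x :- l) := (:- x) :- (:- l)) refl (x n) l) (Abs-neg (b n p))

  Lim-- : ∀ {x y l m} → Lim x l → Lim y m → Lim (λ n → x n - y n) (l - m)
  Lim-- p q = Lim-+ p (Lim-neg q)

  Lim-∑ : ∀ N {x : ℕ → ℕ → Carrier} {l} → (∀ i → Lim (λ n → x n i) (l i)) → Lim (λ n → ∑ N (x n)) (∑ N l)
  Lim-∑ zero    h = Lim-const 0#
  Lim-∑ (suc N) h = Lim-+ (Lim-∑ N h) (h N)

  -- An exchange of limits: y may depend on k, but it is close to x uniformly in n, so the limit of
  -- y near l locates the limit of x. Partial sums of power series will play the role of y.
  Lim-approx : ∀ {x l} C → (∀ k → ∃ λ y → ∃ λ m → Lim y m × Abs (m - l) (C * inv k) × (∀ n → Abs (x n - y n) (C * inv k))) → Lim x l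
  Lim-approx {x} {l} C h = Lim-by (C + C + 1#) λ k → let y , m , lim p , q , r = h k; N , b = p k in
    N , λ n N≤n → Abs-resp
      (solve 4 (λ x y m l → (x :- y) :+ ((y :- m) :+ (m :- l)) := x :- l) refl (x n) (y n) m l)
      (solve 2 (λ C i → C :* i :+ (i :+ C :* i) := (C :+ C :+ con (+ 1)) :* i) refl C (inv k))
      (Abs-+ (r n) (Abs-+ (b n N≤n) q))

  Lim-≤-eventually : ∀ {x y l m} → Lim x l → Lim y m → ∀ M → (∀ n → M ℕ.≤ n → x n ≤ y n) → l ≤ m
  Lim-≤-eventually {x} {y} {l} {m} (lim p) (lim q) M h = ≤-limit 2# λ k → let A , a = p k; B , b = q k; n = M ℕ.⊔ (A ℕ.⊔ B) in
    ≥0⇒≤ _ (+-nonNeg (+-nonNeg (≤⇒≥0 (lower (a n (ℕₚ.≤-trans (ℕₚ.m≤m⊔n A B) (ℕₚ.m≤n⊔m M _)))))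
                               (≤⇒≥0 (upper (b n (ℕₚ.≤-trans (ℕₚ.m≤n⊔m A B) (ℕₚ.m≤n⊔m M _))))))
                     (≤⇒≥0 (h n (ℕₚ.m≤m⊔n M _))))
      (solve 5 (λ x y l m i → (i :- (:- (x :- l))) :+ (i :- (y :- m)) :+ (y :- x) := m :+ con (+ 2) :* i :- l) refl (x n) (y n) l m (inv k))

  Lim-≤ : ∀ {x y l m} → Lim x l → Lim y m → (∀ n → x n ≤ y n) → l ≤ m
  Lim-≤ p q h = Lim-≤-eventually p q 0 λ n _ → h n

  Lim-unique : ∀ {x l m} → Lim x l → Lim x m → l ≈ m
  Lim-unique p q = ≤-antisym (Lim-≤ p q λ _ → ≤-refl) (Lim-≤ q p λ _ → ≤-refl)

  Lim-Abs : ∀ {x l B} → Lim x l → ∀ M → (∀ n → M ℕ.≤ n → Abs (x n) B) → Abs l B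
  Lim-Abs p M h = abs (Lim-≤-eventually p (Lim-const _) M λ n k → upper (h n k))
                      (Lim-≤-eventually (Lim-neg p) (Lim-const _) M λ n k → lower (h n k))

  Lim-shift : ∀ {x l} → Lim (λ n → x (suc n)) l → Lim x l
  Lim-shift (lim h) = lim λ k → let N , b = h k in suc N , λ where (suc n) (ℕ.s≤s p) → b n p

  Lim-shift⁻ : ∀ {x l} → Lim x l → Lim (λ n → x (suc n)) l
  Lim-shift⁻ (lim h) = lim λ k → let N , b = h k in N , λ n p → b (suc n) (ℕₚ.m≤n⇒m≤1+n p)

  Lim-exists : ∀ {x} C → (∀ k → ∃ λ N → ∀ n → N ℕ.≤ n → Abs (x n - x N) (C * inv k)) → ∃ (Lim x)
  Lim-exists {x} C h = let l , p = complete x cauchy in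
    l , lim λ k → let N , b = p k in N , λ n q → let u , v = b n q in abs
      (≥0⇒≤ _ (≤⇒≥0 u) (solve 3 (λ x l i → l :+ i :- x := i :- (x :- l)) refl (x n) l (inv k)))
      (≥0⇒≤ _ (≤⇒≥0 v) (solve 3 (λ x l i → x :+ i :- l := i :- (:- (x :- l))) refl (x n) l (inv k)))
    where
    cauchy : ∀ k → ∃ λ N → ∀ m n → N ℕ.≤ m → N ℕ.≤ n → x m ≤ x n + inv k
    cauchy k = let j , f = finer (2# * C) k; N , b = h j in
      N , λ m n p q → ≥0⇒≤ _ (+-nonNeg (+-nonNeg (≤⇒≥0 (upper (b m p))) (≤⇒≥0 (lower (b n q)))) (≤⇒≥0 (f j ℕₚ.≤-refl)))
        (solve 6 (λ m n N c j k → (c :* j :- (m :- N)) :+ (c :* j :- (:- (n :- N))) :+ (k :- con (+ 2) :* c :* j) := n :+ k :- m)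
           refl (x m) (x n) (x N) C (inv j) (inv k))

  -- Quantities of order 1/(n+1)

  -- The bound holds from n = 0 on with a single constant, so quantities of this order add and scale
  -- without thresholds.
  record O (x : ℕ → Carrier) : Set where
    constructor order
    field
      constant : Carrier
      bounded  : ∀ n → Abs (x n) (constant * inv n)

  O⇒Lim : ∀ {x} → O x → Lim x 0#
  O⇒Lim {x} (order C h) = lim λ k → let j , f = finer C k in
    j , λ n p → Abs-respˡ (solve 1 (λ x → x := x :- con (+ 0)) refl (x n)) (Abs-weaken (f n p) (h n))

  O-+ : ∀ {x y} → O x → O y → O (λ n → x n + y n)
  O-+ (order C h) (order D k) = order (C + D) λ n →
    Abs-resp refl (solve 3 (λ a b c → a :* c :+ b :* c := (a :+ b) :* c) refl C D (inv n)) (Abs-+ (h n) (k n))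

  O-* : ∀ {x} c → O x → O (λ n → c * x n)
  O-* c (order C h) = let B , b = abs-bound c in order (nat B * C) λ n → Abs-resp refl (sym (*-assoc _ _ _)) (Abs-* b (h n))

  O-cong : ∀ {x y} → (∀ n → x n ≈ y n) → O x → O y
  O-cong e (order C h) = order C λ n → Abs-respˡ (e n) (h n)

  O-neg : ∀ {x} → O x → O (λ n → - x n)
  O-neg (order C h) = order C λ n → Abs-neg (h n)

  O-0 : O (λ _ → 0#)
  O-0 = order 0# λ n → Abs-0 refl (≤-reflexive (sym (zeroˡ _)))

  O-cancel : ∀ {x} c → O (λ n → nat (suc c) * x n) → O x
  O-cancel {x} c p = O-cong (λ n → trans (solve 3 (λ i a x → i :* (a :* x) := a :* i :* x) refl (inv c) (nat (suc c)) (x n))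
      (trans (*-congʳ (nat*inv c)) (*-identityˡ _))) (O-* (inv c) p)

  -- Polynomials in x, y and the mesh h

  infixl 6 _⊕_
  infixl 7 _⊗_

  -- The mesh `H` is a variable of its own, so that the remainder of the difference quotient with
  -- step h is again such an expression and `eval-bound` applies to it.
  data Poly : Set where
    const   : Carrier → Poly
    X Y H   : Poly
    _⊕_ _⊗_ : Poly → Poly → Poly

  eval : Poly → Carrier → Carrier → Carrier → Carrier
  eval (const c) x y h = c
  eval X         x y h = x
  eval Y         x y h = y
  eval H         x y h = h
  eval (P ⊕ Q)   x y h = eval P x y h + eval Q x y h
  eval (P ⊗ Q)   x y h = eval P x y h * eval Q x y h

  ∂x ∂y shift remainder swap : Poly → Poly

  ∂x (const c) = const 0#
  ∂x X         = const 1#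
  ∂x Y         = const 0#
  ∂x H         = const 0#
  ∂x (P ⊕ Q)   = ∂x P ⊕ ∂x Q
  ∂x (P ⊗ Q)   = ∂x P ⊗ Q ⊕ P ⊗ ∂x Q

  ∂y (const c) = const 0#
  ∂y X         = const 0#
  ∂y Y         = const 1#
  ∂y H         = const 0#
  ∂y (P ⊕ Q)   = ∂y P ⊕ ∂y Q
  ∂y (P ⊗ Q)   = ∂y P ⊗ Q ⊕ P ⊗ ∂y Q

  shift (const c) = const c
  shift X         = X ⊕ H
  shift Y         = Y
  shift H         = H
  shift (P ⊕ Q)   = shift P ⊕ shift Q
  shift (P ⊗ Q)   = shift P ⊗ shift Q

  remainder (P ⊕ Q) = remainder P ⊕ remainder Q
  -- Expand P + h (P' + h R) times the shifted Q: the terms with a factor h² are R times the shifted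
  -- Q, P times the remainder of Q, and P' times the difference quotient of Q.
  remainder (P ⊗ Q) = remainder P ⊗ shift Q ⊕ P ⊗ remainder Q ⊕ ∂x P ⊗ (∂x Q ⊕ H ⊗ remainder Q)
  remainder _       = const 0#

  swap X       = Y
  swap Y       = X
  swap (P ⊕ Q) = swap P ⊕ swap Q
  swap (P ⊗ Q) = swap P ⊗ swap Q
  swap P       = P

  eval-shift : ∀ P x y h → eval (shift P) x y h ≡ eval P (x + h) y h
  eval-shift (const c) x y h = ≡.refl
  eval-shift X         x y h = ≡.refl
  eval-shift Y         x y h = ≡.refl
  eval-shift H         x y h = ≡.refl
  eval-shift (P ⊕ Q)   x y h = ≡.cong₂ _+_ (eval-shift P x y h) (eval-shift Q x y h)
  eval-shift (P ⊗ Q)   x y h = ≡.cong₂ _*_ (eval-shift P x y h) (eval-shift Q x y h)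

  eval-swap : ∀ P x y h → eval (swap P) x y h ≡ eval P y x h
  eval-swap (const c) x y h = ≡.refl
  eval-swap X         x y h = ≡.refl
  eval-swap Y         x y h = ≡.refl
  eval-swap H         x y h = ≡.refl
  eval-swap (P ⊕ Q)   x y h = ≡.cong₂ _+_ (eval-swap P x y h) (eval-swap Q x y h)
  eval-swap (P ⊗ Q)   x y h = ≡.cong₂ _*_ (eval-swap P x y h) (eval-swap Q x y h)

  eval-∂x-swap : ∀ P x y h → eval (∂x (swap P)) x y h ≡ eval (∂y P) y x h
  eval-∂x-swap (const c) x y h = ≡.refl
  eval-∂x-swap X         x y h = ≡.refl
  eval-∂x-swap Y         x y h = ≡.refl
  eval-∂x-swap H         x y h = ≡.refl
  eval-∂x-swap (P ⊕ Q)   x y h = ≡.cong₂ _+_ (eval-∂x-swap P x y h) (eval-∂x-swap Q x y h)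
  eval-∂x-swap (P ⊗ Q)   x y h = ≡.cong₂ _+_
    (≡.cong₂ _*_ (eval-∂x-swap P x y h) (eval-swap Q x y h))
    (≡.cong₂ _*_ (eval-swap P x y h) (eval-∂x-swap Q x y h))

  eval-cong : ∀ P {x x′ y y′ h} → x ≈ x′ → y ≈ y′ → eval P x y h ≈ eval P x′ y′ h
  eval-cong (const c) e f = refl
  eval-cong X         e f = e
  eval-cong Y         e f = f
  eval-cong H         e f = refl
  eval-cong (P ⊕ Q)   e f = +-cong (eval-cong P e f) (eval-cong Q e f)
  eval-cong (P ⊗ Q)   e f = *-cong (eval-cong P e f) (eval-cong Q e f)

  taylor-shift : ∀ P x y h → eval (shift P) x y h ≈ eval P x y h + h * (eval (∂x P) x y h + h * eval (remainder P) x y h)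
  taylor-shift (const c) x y h = solve 2 (λ c h → c := c :+ h :* (con (+ 0) :+ h :* con (+ 0))) refl c h
  taylor-shift X x y h = solve 2 (λ x h → x :+ h := x :+ h :* (con (+ 1) :+ h :* con (+ 0))) refl x h
  taylor-shift Y x y h = solve 2 (λ c h → c := c :+ h :* (con (+ 0) :+ h :* con (+ 0))) refl y h
  taylor-shift H x y h = solve 1 (λ h → h := h :+ h :* (con (+ 0) :+ h :* con (+ 0))) refl h
  taylor-shift (P ⊕ Q) x y h = trans (+-cong (taylor-shift P x y h) (taylor-shift Q x y h))
    (solve 7 (λ p q dp dq rp rq h → p :+ h :* (dp :+ h :* rp) :+ (q :+ h :* (dq :+ h :* rq)) :=
       p :+ q :+ h :* (dp :+ dq :+ h :* (rp :+ rq))) refl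
       (eval P x y h) (eval Q x y h) (eval (∂x P) x y h) (eval (∂x Q) x y h) (eval (remainder P) x y h) (eval (remainder Q) x y h) h)
  taylor-shift (P ⊗ Q) x y h = begin
    p′ * q′                                            ≈⟨ *-congʳ (taylor-shift P x y h) ⟩
    (p + h * (dp + h * rp)) * q′                       ≈⟨ solve 5 (λ p q dp rp h → (p :+ h :* (dp :+ h :* rp)) :* q := p :* q :+ h :* (dp :* q) :+ h :* (h :* (rp :* q))) refl p q′ dp rp h ⟩
    p * q′ + h * (dp * q′) + h * (h * (rp * q′))       ≈⟨ +-congʳ (+-cong (*-congˡ (taylor-shift Q x y h)) (*-congˡ (*-congˡ (taylor-shift Q x y h)))) ⟩
    p * (q + h * (dq + h * rq)) + h * (dp * (q + h * (dq + h * rq))) + h * (h * (rp * q′))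
      ≈⟨ solve 8 (λ p q q′ dp dq rp rq h →
           p :* (q :+ h :* (dq :+ h :* rq)) :+ h :* (dp :* (q :+ h :* (dq :+ h :* rq))) :+ h :* (h :* (rp :* q′)) :=
           p :* q :+ h :* (dp :* q :+ p :* dq :+ h :* (rp :* q′ :+ p :* rq :+ dp :* (dq :+ h :* rq)))) refl p q q′ dp dq rp rq h ⟩
    p * q + h * (dp * q + p * dq + h * (rp * q′ + p * rq + dp * (dq + h * rq))) ∎
    where
    open ≈-Reasoning
    p q p′ q′ dp dq rp rq : Carrier
    p = eval P x y h
    q = eval Q x y h
    p′ = eval (shift P) x y h
    q′ = eval (shift Q) x y h
    dp = eval (∂x P) x y h
    dq = eval (∂x Q) x y h
    rp = eval (remainder P) x y h
    rq = eval (remainder Q) x y h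

  taylor : ∀ P x y h → eval P (x + h) y h - eval P x y h ≈ h * eval (∂x P) x y h + h * (h * eval (remainder P) x y h)
  taylor P x y h = trans (+-congʳ (trans (reflexive (≡.sym (eval-shift P x y h))) (taylor-shift P x y h)))
    (solve 4 (λ p d r h → p :+ h :* (d :+ h :* r) :- p := h :* d :+ h :* (h :* r)) refl
      (eval P x y h) (eval (∂x P) x y h) (eval (remainder P) x y h) h)

  -- The box of half-width 2 contains every sample point: coordinates reach 1 + h one step past the
  -- grid, and h ≤ 1.
  eval-bound : ∀ P → ∃ λ C → ∀ x y h → Abs x 2# → Abs y 2# → Abs h 2# → Abs (eval P x y h) C
  eval-bound (const c) = let n , b = abs-bound c in nat n , λ _ _ _ _ _ _ → b
  eval-bound X = 2# , λ _ _ _ a b c → a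
  eval-bound Y = 2# , λ _ _ _ a b c → b
  eval-bound H = 2# , λ _ _ _ a b c → c
  eval-bound (P ⊕ Q) = let C , p = eval-bound P; D , q = eval-bound Q in
    C + D , λ x y h a b c → Abs-+ (p x y h a b c) (q x y h a b c)
  eval-bound (P ⊗ Q) = let C , p = eval-bound P; D , q = eval-bound Q in
    C * D , λ x y h a b c → Abs-* (p x y h a b c) (q x y h a b c)

  -- Sums over lists

  sum : {A : Set} → List A → (A → Carrier) → Carrier
  sum xs φ = foldr (λ p s → φ p + s) 0# xs

  sum-cong : ∀ {A : Set} (xs : List A) {φ ψ} → (∀ p → φ p ≈ ψ p) → sum xs φ ≈ sum xs ψ
  sum-cong []       e = refl
  sum-cong (x ∷ xs) e = +-cong (e x) (sum-cong xs e)

  sum-++ : ∀ {A : Set} (xs ys : List A) φ → sum (xs ++ ys) φ ≈ sum xs φ + sum ys φ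
  sum-++ []       ys φ = sym (+-identityˡ _)
  sum-++ (x ∷ xs) ys φ = trans (+-congˡ (sum-++ xs ys φ)) (sym (+-assoc _ _ _))

  sum-map : ∀ {A B : Set} (f : A → B) xs φ → sum (map f xs) φ ≡ sum xs (λ p → φ (f p))
  sum-map f []       φ = ≡.refl
  sum-map f (x ∷ xs) φ = ≡.cong (λ s → φ (f x) + s) (sum-map f xs φ)

  sum-cartesianProduct : ∀ {A B : Set} (xs : List A) (ys : List B) φ →
    sum (cartesianProduct xs ys) φ ≈ sum xs (λ x → sum ys (λ y → φ (x , y)))
  sum-cartesianProduct []       ys φ = refl
  sum-cartesianProduct (x ∷ xs) ys φ = trans (sum-++ (map (x ,_) ys) (cartesianProduct xs ys) φ)
    (+-cong (reflexive (sum-map (x ,_) ys φ)) (sum-cartesianProduct xs ys φ))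

  sum-upTo : ∀ n φ → sum (upTo n) φ ≈ ∑ n φ
  sum-upTo zero    φ = refl
  sum-upTo (suc n) φ = trans (reflexive (≡.cong (λ xs → sum xs φ) (≡.sym (applyUpTo-∷ʳ (λ k → k) n))))
    (trans (sum-++ (upTo n) (n ∷ []) φ) (+-cong (sum-upTo n φ) (+-identityʳ (φ n))))

  sum-+ : ∀ {A : Set} (xs : List A) φ ψ → sum xs (λ p → φ p + ψ p) ≈ sum xs φ + sum xs ψ
  sum-+ []       φ ψ = sym (+-identityˡ 0#)
  sum-+ (x ∷ xs) φ ψ = trans (+-congˡ (sum-+ xs φ ψ))
    (solve 4 (λ a b c d → a :+ b :+ (c :+ d) := a :+ c :+ (b :+ d)) refl (φ x) (ψ x) (sum xs φ) (sum xs ψ))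

  sum-* : ∀ {A : Set} (xs : List A) c φ → sum xs (λ p → c * φ p) ≈ c * sum xs φ
  sum-* []       c φ = sym (zeroʳ c)
  sum-* (x ∷ xs) c φ = trans (+-congˡ (sum-* xs c φ))
    (solve 3 (λ c a s → c :* a :+ c :* s := c :* (a :+ s)) refl c (φ x) (sum xs φ))

  sum-Abs : ∀ {A : Set} (xs : List A) {φ ψ} → (∀ p → Abs (φ p) (ψ p)) → Abs (sum xs φ) (sum xs ψ)
  sum-Abs []       h = Abs-0 refl ≤-refl
  sum-Abs (x ∷ xs) h = Abs-+ (h x) (sum-Abs xs h)

  sum-mono : ∀ {A : Set} (xs : List A) {φ ψ} → (∀ p → φ p ≤ ψ p) → sum xs φ ≤ sum xs ψ
  sum-mono []       h = ≤-refl
  sum-mono (x ∷ xs) h = +-mono (h x) (sum-mono xs h)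

  -- The grid

  side : ℕ → ℕ
  side n = suc (suc n ℕ.+ suc n)

  coordinate : ℕ → ℕ → ℚ
  coordinate n k = (+ k ℤ.- + suc n) ℚ./ suc n

  sum-grid : ∀ n φ → sum (grid n) φ ≈ ∑ (side n) (λ i → ∑ (side n) (λ j → φ (coordinate n i , coordinate n j)))
  sum-grid n φ = trans (sum-cartesianProduct (map (coordinate n) (upTo (side n))) (map (coordinate n) (upTo (side n))) φ)
    (trans (line _) (∑-cong′ (side n) λ i → line _))
    where
    line : ∀ φ → sum (map (coordinate n) (upTo (side n))) φ ≈ ∑ (side n) (λ i → φ (coordinate n i))
    line φ = trans (reflexive (sum-map (coordinate n) (upTo (side n)) φ)) (sum-upTo (side n) _)

  u : ℕ → ℕ → Carrier
  u n k = ι (coordinate n k)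

  u-nat : ∀ n k → u n k ≈ (nat k - nat (suc n)) * inv n
  u-nat n k = begin
    ι ((+ k ℤ.- + suc n) ℚ./ suc n)                             ≈⟨ reflexive (≡.cong ι (/suc (+ k ℤ.- + suc n) n)) ⟩
    ι (((+ k ℤ.- + suc n) ℚ./ 1) ℚ.* (+ 1 ℚ./ suc n))           ≈⟨ ι-* _ _ ⟩
    ι ((+ k ℤ.- + suc n) ℚ./ 1) * ι (+ 1 ℚ./ suc n)             ≈⟨ *-cong (trans (reflexive (≡.cong ι (/1-homo-+ (+ k) (ℤ.- + suc n)))) (ι-+ _ _)) (reflexive (≡.sym (inv-ι n))) ⟩
    (ι (+ k ℚ./ 1) + ι ((ℤ.- + suc n) ℚ./ 1)) * inv n           ≈⟨ *-congʳ (+-cong (reflexive (≡.sym (nat-ι k)))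
        (trans (reflexive (≡.cong ι (-‿homo-/1 (+ suc n)))) (trans (ι-neg _) (-‿cong (reflexive (≡.sym (nat-ι (suc n)))))))) ⟩
    (nat k - nat (suc n)) * inv n ∎
    where open ≈-Reasoning

  u-+ : ∀ n k i → u n (k ℕ.+ i) ≈ u n k + nat i * inv n
  u-+ n k i = trans (u-nat n (k ℕ.+ i)) (trans (*-congʳ (+-congʳ (nat-+ k i)))
    (trans (solve 4 (λ k i s v → (k :+ i :- s) :* v := (k :- s) :* v :+ i :* v) refl (nat k) (nat i) (nat (suc n)) (inv n))
      (+-congʳ (sym (u-nat n k)))))

  u-suc : ∀ n k → u n (suc k) ≈ u n k + inv n
  u-suc n k = trans (reflexive (≡.cong (u n) (ℕₚ.+-comm 1 k))) (trans (u-+ n k 1) (+-congˡ (trans (*-congʳ nat-1) (*-identityˡ _))))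

  u-mid : ∀ n → u n (suc n) ≈ 0#
  u-mid n = trans (u-nat n (suc n)) (solve 2 (λ s v → (s :- s) :* v := con (+ 0)) refl (nat (suc n)) (inv n))

  u-0 : ∀ n → u n 0 ≈ - 1#
  u-0 n = trans (u-nat n 0) (trans (*-congʳ (+-congʳ nat-0))
    (trans (solve 2 (λ s v → (con (+ 0) :- s) :* v := :- (s :* v)) refl (nat (suc n)) (inv n)) (-‿cong (nat*inv n))))

  -- The last grid coordinate is 1, and this point lies one step beyond it. Summation by parts along
  -- a row ends here, where no boundary term arises.
  u-end : ∀ n → u n (side n) ≈ 1# + inv n
  u-end n = trans (u-suc n (suc n ℕ.+ suc n)) (+-congʳ (trans (u-+ n (suc n) (suc n))
    (trans (+-cong (u-mid n) (nat*inv n)) (+-identityˡ 1#))))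

  u-lower : ∀ n k → - 1# ≤ u n k
  u-lower n k = ≤-resp (u-0 n) (sym (u-+ n 0 k)) (x≤x+ (*-nonNeg (nat≥0 k) (inv≥0 n)))

  u-mono : ∀ n {k l} → k ℕ.≤ l → u n k ≤ u n l
  u-mono n {k} {l} h = ≤-resp refl (trans (sym (u-+ n k (l ℕ.∸ k))) (reflexive (≡.cong (u n) (ℕₚ.m+[n∸m]≡n h))))
    (x≤x+ (*-nonNeg (nat≥0 _) (inv≥0 n)))

  1+inv≤2 : ∀ n → 1# + inv n ≤ 2#
  1+inv≤2 n = ≤-resp refl (solve 0 (con (+ 1) :+ con (+ 1) := con (+ 2)) refl) (+-mono ≤-refl (inv≤1 n))

  u-bound : ∀ n k → k ℕ.≤ side n → Abs (u n k) 2#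
  u-bound n k h = abs (≤-trans (≤-resp refl (u-end n) (u-mono n h)) (1+inv≤2 n))
    (≤-trans (neg-anti (u-lower n k)) (≥0⇒≤ 1# 1≥0 (solve 0 (con (+ 1) := con (+ 2) :- (:- (:- con (+ 1)))) refl)))

  inv-bound : ∀ n → Abs (inv n) 2#
  inv-bound n = Abs-nonNeg (inv≥0 n) (≤-trans (inv≤1 n) (≥0⇒≤ 1# 1≥0 (solve 0 (con (+ 1) := con (+ 2) :- con (+ 1)) refl)))

  3# : Carrier
  3# = ι (+ 3 ℚ./ 1)

  side*inv≤3 : ∀ n → nat (side n) * inv n ≤ 3#
  side*inv≤3 n = ≤-resp (sym e) refl (≥0⇒≤ _ (≤⇒≥0 (inv≤1 n)) (solve 1 (λ i → con (+ 1) :- i := con (+ 3) :- (con (+ 2) :+ i)) refl (inv n)))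
    where
    e : nat (side n) * inv n ≈ 2# + inv n
    e = trans (*-congʳ (trans (nat-suc _) (+-congʳ (nat-+ (suc n) (suc n)))))
      (trans (solve 2 (λ s i → (s :+ s :+ con (+ 1)) :* i := s :* i :+ s :* i :+ i) refl (nat (suc n)) (inv n))
        (trans (+-congʳ (+-cong (nat*inv n) (nat*inv n))) (solve 1 (λ i → con (+ 1) :+ con (+ 1) :+ i := con (+ 2) :+ i) refl (inv n))))

  -- Indicators of discs

  norm : ℚ × ℚ → Carrier
  norm (x , y) = ι x * ι x + ι y * ι y

  ι-norm : ∀ p → ι ∣ p ∣²ℚ ≈ norm p
  ι-norm (x , y) = trans (ι-+ _ _) (+-cong (ι-* x x) (ι-* y y))

  indicator : ∀ {A : Set} → Dec A → Carrier
  indicator (yes _) = 1#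
  indicator (no  _) = 0#

  abstract
    χ : ℚ → ℚ × ℚ → Carrier
    χ r p = indicator (inDisc? r p)

    χ-indicator : ∀ r p → χ r p ≡ indicator (inDisc? r p)
    χ-indicator r p = ≡.refl

  -- `χ` is abstract, so a case distinction has to deliver its value together with the membership
  -- proof.
  data Side (r : ℚ) (p : ℚ × ℚ) : Set where
    inside  : χ r p ≈ 1# → ∣ p ∣²ℚ ℚ.≤ r → Side r p
    outside : χ r p ≈ 0# → ¬ (∣ p ∣²ℚ ℚ.≤ r) → Side r p

  side? : ∀ r p → Side r p
  side? r p = classify (inDisc? r p) ≡.refl
    where
    classify : ∀ d → inDisc? r p ≡ d → Side r p
    classify (yes h) e = inside  (reflexive (≡.trans (χ-indicator r p) (≡.cong indicator e))) h
    classify (no  h) e = outside (reflexive (≡.trans (χ-indicator r p) (≡.cong indicator e))) h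

  χ≥0 : ∀ r p → χ r p ≥0
  χ≥0 r p with side? r p
  ... | inside  e _ = ≥0-resp (sym e) 1≥0
  ... | outside e _ = ≥0-resp (sym e) ≤-refl

  χ≤1 : ∀ r p → χ r p ≤ 1#
  χ≤1 r p with side? r p
  ... | inside  e _ = ≤-reflexive e
  ... | outside e _ = ≤-resp (sym e) refl 1≥0

  χ-≤1 : ∀ r p → Abs (χ r p) 1#
  χ-≤1 r p = Abs-nonNeg (χ≥0 r p) (χ≤1 r p)

  ∣∣²-reflects : ∀ p q → norm p ≤ norm q → ∣ p ∣²ℚ ℚ.≤ ∣ q ∣²ℚ
  ∣∣²-reflects p q h = ι-cancel (≤-resp (sym (ι-norm p)) (sym (ι-norm q)) h)

  χ-anti : ∀ r p q → norm p ≤ norm q → χ r q ≤ χ r p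
  χ-anti r p q h with side? r p | side? r q
  ... | inside e _  | _           = ≤-trans (χ≤1 r q) (≤-reflexive (sym e))
  ... | outside e _ | outside f _ = ≤-reflexive (trans f (sym e))
  ... | outside e k | inside f l  = ⊥-elim (k (ℚₚ.≤-trans (∣∣²-reflects p q h) l))

  inside-≤ : ∀ r p → ∣ p ∣²ℚ ℚ.≤ r → norm p ≤ ι r
  inside-≤ r p h = ≤-resp (ι-norm p) refl (ι-mono h)

  outside-≥ : ∀ r p → ¬ (∣ p ∣²ℚ ℚ.≤ r) → ι r ≤ norm p
  outside-≥ r p h = ≤-resp refl (ι-norm p) (ι-mono (ℚₚ.<⇒≤ (ℚₚ.≰⇒> h)))

  -- When the disc boundary separates two points, both are within c of it.
  boundary : ∀ r p q c → Abs (norm p - norm q) c → norm q ≤ norm p →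
    Abs ((χ r p - χ r q) * (ι r - norm q)) ((χ r q - χ r p) * c) ×
    Abs ((χ r q - χ r p) * (ι r - norm p)) ((χ r q - χ r p) * c)
  boundary r p q c b h with side? r p | side? r q
  ... | inside e _ | inside f _ = same e f , same f e
    where
    same : ∀ {a b d v} → a ≈ v → b ≈ v → Abs ((a - b) * d) ((χ r q - χ r p) * c)
    same {d = d} e′ f′ = Abs-0 (trans (*-congʳ (trans (+-cong e′ (-‿cong f′)) (-‿inverseʳ _))) (zeroˡ d))
      (≤-reflexive (sym (trans (*-congʳ (trans (+-cong f (-‿cong e)) (-‿inverseʳ _))) (zeroˡ c))))
  ... | outside e _ | outside f _ = same e f , same f e
    where
    same : ∀ {a b d v} → a ≈ v → b ≈ v → Abs ((a - b) * d) ((χ r q - χ r p) * c)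
    same {d = d} e′ f′ = Abs-0 (trans (*-congʳ (trans (+-cong e′ (-‿cong f′)) (-‿inverseʳ _))) (zeroˡ d))
      (≤-reflexive (sym (trans (*-congʳ (trans (+-cong f (-‿cong e)) (-‿inverseʳ _))) (zeroˡ c))))
  ... | inside e k | outside f l = ⊥-elim (l (ℚₚ.≤-trans (∣∣²-reflects q p h) k))
  ... | outside e k | inside f l =
    Abs-resp (trans (solve 1 (λ d → :- d := (con (+ 0) :- con (+ 1)) :* d) refl _) (*-congʳ (+-cong (sym e) (-‿cong (sym f))))) scale
      (Abs-neg (Abs-nonNeg (≤⇒≥0 (inside-≤ r q l)) (≤-trans (≥0⇒≤ _ (≤⇒≥0 (outside-≥ r p k))
        (solve 3 (λ p q r → p :- r := (p :- q) :- (r :- q)) refl (norm p) (norm q) (ι r))) (upper b)))) ,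
    Abs-resp (trans (solve 1 (λ d → d := (con (+ 1) :- con (+ 0)) :* d) refl _) (*-congʳ (+-cong (sym f) (-‿cong (sym e))))) scale
      (Abs-respˡ (solve 2 (λ p r → :- (p :- r) := r :- p) refl (norm p) (ι r))
        (Abs-neg (Abs-nonNeg (≤⇒≥0 (outside-≥ r p k)) (≤-trans (≥0⇒≤ _ (≤⇒≥0 (inside-≤ r q l))
          (solve 3 (λ p q r → r :- q := (p :- q) :- (p :- r)) refl (norm p) (norm q) (ι r))) (upper b)))))
    where
    scale : c ≈ (χ r q - χ r p) * c
    scale = trans (solve 1 (λ d → d := (con (+ 1) :- con (+ 0)) :* d) refl c) (*-congʳ (+-cong (sym f) (-‿cong (sym e))))

  -- Summation by parts along the rows of a disc.

  4# : Carrier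
  4# = ι (+ 4 ℚ./ 1)

  at : Poly → ℕ → ℚ × ℚ → Carrier
  at P n (x , y) = eval P (ι x) (ι y) (inv n)

  gridPoint : ℕ → ℕ → ℕ → ℚ × ℚ
  gridPoint n i j = coordinate n i , coordinate n j

  -- ∂x of a polynomial vanishing on the circle |z|² = r, summed along a row of
  -- the disc |z|² ≤ r: summation by parts leaves the terms at the boundary of
  -- the disc, where the polynomial is of order h.
  module Row (r : ℚ) (r≤1 : ι r ≤ 1#) (F P : Poly)
    (F≈ : ∀ x y h → eval F x y h ≈ (ι r - (x * x + y * y)) * eval P x y h) where

    D E : Carrier
    D = proj₁ (eval-bound P)
    E = proj₁ (eval-bound (remainder F))

    constant : Carrier
    -- A row meets the circle at most once on each side of its middle, and there the polynomial is
    -- at most 4 h D; 3 E bounds the Taylor remainders of at most 3/h points.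
    constant = 4# * D + 4# * D + 3# * E

    module _ (n j : ℕ) (j<M : j ℕ.< side n) where

      h y : Carrier
      h = inv n
      y = u n j
      M : ℕ
      M = side n
      p : ℕ → ℚ × ℚ
      p k = gridPoint n k j
      c G g ∂ ρ : ℕ → Carrier
      c k = χ r (p k)
      G k = eval F (u n k) y h
      g k = eval P (u n k) y h
      ∂ k = eval (∂x F) (u n k) y h
      ρ k = eval (remainder F) (u n k) y h

      y-bound : Abs y 2#
      y-bound = u-bound n j (ℕₚ.<⇒≤ j<M)

      g-bound : ∀ k → k ℕ.≤ M → Abs (g k) D
      g-bound k k≤M = proj₂ (eval-bound P) _ _ _ (u-bound n k k≤M) y-bound (inv-bound n)

      ρ-bound : ∀ k → k ℕ.≤ M → Abs (ρ k) E
      ρ-bound k k≤M = proj₂ (eval-bound (remainder F)) _ _ _ (u-bound n k k≤M) y-bound (inv-bound n)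

      D≥0 : D ≥0
      D≥0 = Abs-≥0 (g-bound 0 ℕ.z≤n)

      E≥0 : E ≥0
      E≥0 = Abs-≥0 (ρ-bound 0 ℕ.z≤n)

      -- If such a point lies in the disc, then |z|² = r exactly, because r ≤ 1 ≤ x²; on this circle
      -- `F` vanishes.
      end : ∀ k → 1# ≤ u n k * u n k → c k * G k ≈ 0#
      end k k≥1 with side? r (p k)
      ... | outside e _ = trans (*-congʳ e) (zeroˡ _)
      ... | inside e i = trans (*-congˡ (trans (F≈ _ _ _) (trans (*-congʳ (trans (+-congʳ (sym norm≈r)) (-‿inverseʳ _))) (zeroˡ _)))) (zeroʳ _)
        where
        norm≈r : norm (p k) ≈ ι r
        norm≈r = ≤-antisym (inside-≤ r (p k) i) (≤-trans r≤1 (≤-trans k≥1 (x≤x+ (square-nonNeg y))))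

      first : c 0 * G 0 ≈ 0#
      first = end 0 (≤-reflexive (sym (trans (*-cong (u-0 n) (u-0 n)) (solve 0 (:- con (+ 1) :* :- con (+ 1) := con (+ 1)) refl))))

      last : c M * G M ≈ 0#
      last = end M (≤-resp refl (sym (*-cong (u-end n) (u-end n)))
        (≥0⇒≤ _ (+-nonNeg (+-nonNeg (inv≥0 n) (inv≥0 n)) (square-nonNeg h))
          (solve 1 (λ h → h :+ h :+ h :* h := (con (+ 1) :+ h) :* (con (+ 1) :+ h) :- con (+ 1)) refl h)))

      by-parts : ∑ M (λ k → c k * (G (suc k) - G k)) ≈ ∑ M (λ k → (c k - c (suc k)) * G (suc k))
      by-parts = begin
        ∑ M (λ k → c k * (G (suc k) - G k))
          ≈⟨ ∑-cong′ M (λ k → solve 4 (λ c c′ G G′ → c :* (G′ :- G) := (c′ :* G′ :- c :* G) :+ (c :- c′) :* G′) refl (c k) (c (suc k)) (G k) (G (suc k))) ⟩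
        ∑ M (λ k → (c (suc k) * G (suc k) - c k * G k) + (c k - c (suc k)) * G (suc k))
          ≈⟨ ∑-+ M _ _ ⟩
        ∑ M (λ k → c (suc k) * G (suc k) - c k * G k) + ∑ M (λ k → (c k - c (suc k)) * G (suc k))
          ≈⟨ +-congʳ (trans (∑-telescope M (λ k → c k * G k)) (trans (+-cong last (-‿cong first)) (-‿inverseʳ 0#))) ⟩
        0# + ∑ M (λ k → (c k - c (suc k)) * G (suc k))
          ≈⟨ +-identityˡ _ ⟩
        ∑ M (λ k → (c k - c (suc k)) * G (suc k)) ∎
        where open ≈-Reasoning

      expand : ∑ M (λ k → c k * (G (suc k) - G k)) ≈ h * ∑ M (λ k → c k * ∂ k) + h * (h * ∑ M (λ k → c k * ρ k))
      expand = begin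
        ∑ M (λ k → c k * (G (suc k) - G k))
          ≈⟨ ∑-cong′ M (λ k → *-congˡ (trans (+-congʳ (eval-cong F (u-suc n k) refl)) (taylor F (u n k) y h))) ⟩
        ∑ M (λ k → c k * (h * ∂ k + h * (h * ρ k)))
          ≈⟨ ∑-cong′ M (λ k → solve 4 (λ c d e h → c :* (h :* d :+ h :* (h :* e)) := h :* (c :* d) :+ h :* (h :* (c :* e))) refl (c k) (∂ k) (ρ k) h) ⟩
        ∑ M (λ k → h * (c k * ∂ k) + h * (h * (c k * ρ k)))
          ≈⟨ ∑-+ M _ _ ⟩
        ∑ M (λ k → h * (c k * ∂ k)) + ∑ M (λ k → h * (h * (c k * ρ k)))
          ≈⟨ +-cong (∑-* M h _) (trans (∑-* M h _) (*-congˡ (∑-* M h _))) ⟩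
        h * ∑ M (λ k → c k * ∂ k) + h * (h * ∑ M (λ k → c k * ρ k)) ∎
        where open ≈-Reasoning

      norm-step : ∀ k → norm (p (suc k)) - norm (p k) ≈ h * (u n k + u n (suc k))
      norm-step k = begin
        norm (p (suc k)) - norm (p k)
          ≈⟨ solve 3 (λ x x′ y → x′ :* x′ :+ y :* y :- (x :* x :+ y :* y) := (x′ :- x) :* (x :+ x′)) refl (u n k) (u n (suc k)) y ⟩
        (u n (suc k) - u n k) * (u n k + u n (suc k))
          ≈⟨ *-congʳ (trans (+-congʳ (u-suc n k)) (solve 2 (λ x h → x :+ h :- x := h) refl (u n k) h)) ⟩
        h * (u n k + u n (suc k)) ∎
        where open ≈-Reasoning

      step-bound : ∀ k → k ℕ.< M → Abs (norm (p (suc k)) - norm (p k)) (4# * h)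
      step-bound k k<M = Abs-resp (sym (norm-step k)) (solve 1 (λ h → h :* (con (+ 2) :+ con (+ 2)) := con (+ 4) :* h) refl h)
        (Abs-scale h (inv≥0 n) (Abs-+ (u-bound n k (ℕₚ.<⇒≤ k<M)) (u-bound n (suc k) k<M)))

      left : ∀ k → k ℕ.< suc n → norm (p (suc k)) ≤ norm (p k)
      left k k<R = ≥0⇒≤ _ (*-nonNeg (inv≥0 n) (+-nonNeg (neg k (ℕₚ.<⇒≤ k<R)) (neg (suc k) k<R)))
        (trans (solve 3 (λ h x y → h :* ((con (+ 0) :- x) :+ (con (+ 0) :- y)) := :- (h :* (x :+ y))) refl h (u n k) (u n (suc k)))
          (trans (-‿cong (sym (norm-step k))) (solve 2 (λ a b → :- (a :- b) := b :- a) refl _ _)))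
        where
        neg : ∀ k → k ℕ.≤ suc n → 0# - u n k ≥0
        neg k l = ≤⇒≥0 (≤-resp refl (u-mid n) (u-mono n l))

      right : ∀ k → suc n ℕ.≤ k → norm (p k) ≤ norm (p (suc k))
      right k R≤k = ≥0⇒≤ _ (*-nonNeg (inv≥0 n) (+-nonNeg (pos k R≤k) (pos (suc k) (ℕₚ.m≤n⇒m≤1+n R≤k)))) (sym (norm-step k))
        where
        pos : ∀ k → suc n ℕ.≤ k → u n k ≥0
        pos k l = ≤-resp (u-mid n) refl (u-mono n l)

      jump : ∀ k δ → k ℕ.< M → Abs ((c k - c (suc k)) * (ι r - norm (p (suc k)))) (δ * (4# * h)) →
        Abs ((c k - c (suc k)) * G (suc k)) ((4# * h * D) * δ)
      jump k δ k<M b = Abs-resp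
        (trans (*-assoc _ _ _) (*-congˡ (sym (F≈ _ _ _))))
        (solve 3 (λ a b c → a :* b :* c := b :* c :* a) refl δ (4# * h) D)
        (Abs-* b (g-bound (suc k) k<M))

      -- Up to the middle column |z|² decreases, and beyond it |z|² increases, so the indicator is
      -- monotone on each half of the row. Its jumps telescope to at most 1 on either side, however
      -- fine the grid.
      jumps : Abs (∑ M (λ k → (c k - c (suc k)) * G (suc k))) (4# * h * D + 4# * h * D)
      jumps = Abs-respˡ (trans (sym (∑-split (suc n) (suc (suc n)) T)) (reflexive (≡.cong (λ m → ∑ m T) (ℕₚ.+-suc (suc n) (suc n)))))
        (Abs-+ (Abs-weaken left-total (∑-Abs (suc n) left-jump)) (Abs-weaken right-total (∑-Abs (suc (suc n)) right-jump)))
        where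
        open ≈-Reasoning
        T : ℕ → Carrier
        T k = (c k - c (suc k)) * G (suc k)
        B : Carrier
        B = 4# * h * D
        B≥0 : B ≥0
        B≥0 = *-nonNeg (*-nonNeg (ι≥0 (0≤+/ 4 0)) (inv≥0 n)) D≥0
        below : ∀ i → i ℕ.< suc (suc n) → suc n ℕ.+ i ℕ.< M
        below i l = ℕₚ.≤-trans (ℕₚ.+-monoʳ-< (suc n) l) (ℕₚ.≤-reflexive (ℕₚ.+-suc (suc n) (suc n)))
        left-jump : ∀ k → k ℕ.< suc n → Abs ((c k - c (suc k)) * G (suc k)) (B * (c (suc k) - c k))
        left-jump k l = jump k _ k<M (proj₁ (boundary r (p k) (p (suc k)) (4# * h)
          (Abs-respˡ (solve 2 (λ a b → :- (a :- b) := b :- a) refl _ _) (Abs-neg (step-bound k k<M))) (left k l)))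
          where
          k<M : k ℕ.< M
          k<M = ℕₚ.≤-trans l (ℕₚ.m≤n⇒m≤1+n (ℕₚ.m≤m+n (suc n) (suc n)))
        right-jump : ∀ i → i ℕ.< suc (suc n) → Abs ((c (suc n ℕ.+ i) - c (suc (suc n ℕ.+ i))) * G (suc (suc n ℕ.+ i))) (B * (c (suc n ℕ.+ i) - c (suc (suc n ℕ.+ i))))
        right-jump i l = jump k _ (below i l) (proj₂ (boundary r (p (suc k)) (p k) (4# * h) (step-bound k (below i l)) (right k (ℕₚ.m≤m+n (suc n) i))))
          where
          k : ℕ
          k = suc n ℕ.+ i
        left-total : ∑ (suc n) (λ k → B * (c (suc k) - c k)) ≤ B
        left-total = ≤-trans (≤-reflexive (trans (∑-* (suc n) B _) (*-congˡ (∑-telescope (suc n) c))))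
          (≥0⇒≤ _ (*-nonNeg B≥0 (+-nonNeg (≤⇒≥0 (χ≤1 r (p (suc n)))) (χ≥0 r (p 0))))
            (solve 3 (λ b a d → b :* (con (+ 1) :- a :+ d) := b :- b :* (a :- d)) refl B (c (suc n)) (c 0)))
        right-total : ∑ (suc (suc n)) (λ i → B * (c (suc n ℕ.+ i) - c (suc (suc n ℕ.+ i)))) ≤ B
        right-total = ≤-trans (≤-reflexive (begin
            ∑ (suc (suc n)) (λ i → B * (c (suc n ℕ.+ i) - c (suc (suc n ℕ.+ i))))
              ≈⟨ ∑-* (suc (suc n)) B _ ⟩
            B * ∑ (suc (suc n)) (λ i → c (suc n ℕ.+ i) - c (suc (suc n ℕ.+ i)))
              ≈⟨ *-congˡ (∑-cong′ (suc (suc n)) λ i → trans (+-congˡ (-‿cong (reflexive (≡.cong c (≡.sym (ℕₚ.+-suc (suc n) i))))))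
                   (solve 2 (λ a b → a :- b := :- b :- :- a) refl _ _)) ⟩
            B * ∑ (suc (suc n)) (λ i → - c (suc n ℕ.+ suc i) - - c (suc n ℕ.+ i))
              ≈⟨ *-congˡ (∑-telescope (suc (suc n)) (λ i → - c (suc n ℕ.+ i))) ⟩
            B * (- c (suc n ℕ.+ suc (suc n)) - - c (suc n ℕ.+ 0)) ∎))
          (≥0⇒≤ _ (*-nonNeg B≥0 (+-nonNeg (≤⇒≥0 (χ≤1 r (p (suc n ℕ.+ 0)))) (χ≥0 r (p (suc n ℕ.+ suc (suc n))))))
            (solve 3 (λ b a d → b :* (con (+ 1) :- a :+ d) := b :- b :* (:- d :- :- a)) refl B (c (suc n ℕ.+ 0)) (c (suc n ℕ.+ suc (suc n)))))

      remainder-total : Abs (h * (h * ∑ M (λ k → c k * ρ k))) (3# * E * h)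
      remainder-total = Abs-weaken (≤-resp
          (solve 3 (λ h m e → h :* (m :* h :* e) := h :* (h :* (m :* e))) refl h (nat M) E)
          (solve 2 (λ h e → h :* (con (+ 3) :* e) := con (+ 3) :* e :* h) refl h E)
          (*-monoˡ h (inv≥0 n) (*-monoʳ E E≥0 (side*inv≤3 n))))
        (Abs-scale h (inv≥0 n) (Abs-scale h (inv≥0 n) (Abs-resp refl (∑-const M E) (∑-Abs M λ k k<M →
          Abs-resp refl (*-identityˡ E) (Abs-* (χ-≤1 r (p k)) (ρ-bound k (ℕₚ.<⇒≤ k<M)))))))

      row : Abs (h * ∑ M (λ k → c k * ∂ k)) (constant * h)
      row = Abs-resp
        (trans (+-congʳ (trans (sym by-parts) expand)) (solve 2 (λ a b → a :+ b :- b := a) refl _ _))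
        (solve 3 (λ d e h → con (+ 4) :* h :* d :+ con (+ 4) :* h :* d :+ con (+ 3) :* e :* h := (con (+ 4) :* d :+ con (+ 4) :* d :+ con (+ 3) :* e) :* h) refl D E h)
        (Abs-- jumps remainder-total)

    -- There are at most 3/h rows, each of order h, so one further factor h keeps the double sum of
    -- order h.
    double : ∀ n → Abs (inv n * (inv n * sum (grid n) (λ p → χ r p * at (∂x F) n p))) (3# * constant * inv n)
    double n = Abs-resp (sym e) refl (Abs-weaken (≤-resp
        (solve 3 (λ m h K → m :* h :* (K :* h) := h :* (m :* (K :* h))) refl (nat (side n)) (inv n) constant)
        (sym (*-assoc 3# constant (inv n)))
        (*-monoʳ (constant * inv n) (Abs-≥0 (row n 0 (ℕ.s≤s ℕ.z≤n))) (side*inv≤3 n)))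
      (Abs-scale (inv n) (inv≥0 n) (Abs-resp refl (∑-const (side n) (constant * inv n)) (∑-Abs (side n) (row n)))))
      where
      e : inv n * (inv n * sum (grid n) (λ p → χ r p * at (∂x F) n p)) ≈
          inv n * ∑ (side n) (λ j → inv n * ∑ (side n) (λ i → χ r (gridPoint n i j) * eval (∂x F) (u n i) (u n j) (inv n)))
      e = *-congˡ (trans (*-congˡ (trans (sum-grid n _) (∑-swap (side n) (side n) _))) (sym (∑-* (side n) (inv n) _)))

  -- Averages over discs

  length-filter : ∀ {A : Set} {Q : A → Set} (Q? : ∀ x → Dec (Q x)) xs → nat (length (filter Q? xs)) ≈ sum xs (λ x → indicator (Q? x))
  length-filter Q? []       = nat-0
  length-filter Q? (x ∷ xs) with Q? x
  ... | yes _ = trans (nat-suc _) (trans (+-comm _ _) (+-congˡ (length-filter Q? xs)))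
  ... | no  _ = trans (length-filter Q? xs) (sym (+-identityˡ _))

  κ : ℕ → Carrier
  κ n = ι ((+ 1 ℚ./ diskCount n) {{diskCount-nonZero n}})

  reciprocal-nat : ∀ d {{_ : ℕ.NonZero d}} → ι (+ 1 ℚ./ d) * nat d ≈ 1#
  reciprocal-nat (suc d) = trans (*-comm _ _) (trans (*-congˡ (reflexive (≡.sym (inv-ι d)))) (nat*inv d))

  κ≥0 : ∀ n → κ n ≥0
  κ≥0 n = nonNeg (diskCount n) {{diskCount-nonZero n}}
    where
    nonNeg : ∀ d {{_ : ℕ.NonZero d}} → ι (+ 1 ℚ./ d) ≥0
    nonNeg (suc d) = ι≥0 (0≤+/ 1 d)

  κ*count : ∀ n → κ n * nat (diskCount n) ≈ 1#
  κ*count n = reciprocal-nat (diskCount n) {{diskCount-nonZero n}}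

  count≈ : ∀ n → nat (diskCount n) ≈ sum (grid n) (χ 1ℚ)
  count≈ n = trans (length-filter (inDisc? 1ℚ) (grid n)) (sum-cong (grid n) λ p → reflexive (≡.sym (χ-indicator 1ℚ p)))

  ∑-window : ∀ m q {M} {g : ℕ → Carrier} → m ℕ.+ q ℕ.≤ M → (∀ i → g i ≥0) → ∑ q (λ i → g (m ℕ.+ i)) ≤ ∑ M g
  ∑-window m q {M} {g} h p = ≤-trans
    (≥0⇒≤ _ (∑-≥0 m {g} λ i _ → p i) (trans (solve 2 (λ a b → a := a :+ b :- b) refl _ _) (+-congʳ (sym (∑-split m q g)))))
    (∑-≤ h p)

  -- The square [0,1/2]² lies in the unit disc.
  count-lower : ∀ n → nat (suc n) * nat (suc n) ≤ 4# * nat (diskCount n)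
  count-lower n = ≤-trans
    (*-mono (nat≥0 R) (+-nonNeg (nat≥0 q) (nat≥0 q)) R≤2q R≤2q)
    (≤-resp (solve 1 (λ q → con (+ 4) :* (q :* q) := (q :+ q) :* (q :+ q)) refl (nat q)) refl
      (*-monoˡ 4# (ι≥0 (0≤+/ 4 0)) (≤-resp (trans (∑-const q (nat q * 1#)) (*-congˡ (*-identityʳ _))) (sym (trans (count≈ n) (sum-grid n (χ 1ℚ))))
        (≤-trans (∑-mono q inner) (∑-window R q window λ i → ∑-≥0 (side n) λ j _ → χ≥0 1ℚ _)))))
    where
    R q : ℕ
    R = suc n
    -- The indices 0, ..., ⌊R/2⌋ to the right of the centre have coordinates at most 1/2, and there
    -- are at least R/2 of them.
    q = suc ℕ.⌊ R /2⌋
    R≤2q : nat R ≤ nat q + nat q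
    R≤2q = ≤-resp refl (nat-+ q q) (nat-mono (ℕₚ.≤-trans (ℕₚ.≤-reflexive (≡.sym (ℕₚ.⌊n/2⌋+⌈n/2⌉≡n R)))
      (ℕₚ.+-mono-≤ (ℕₚ.n≤1+n _) (ℕₚ.⌊n/2⌋-mono (ℕ.s≤s (ℕₚ.n≤1+n R))))))
    window : R ℕ.+ q ℕ.≤ side n
    window = ℕₚ.≤-trans (ℕₚ.+-monoʳ-≤ R (ℕ.s≤s (ℕₚ.⌊n/2⌋≤n R))) (ℕₚ.≤-reflexive (ℕₚ.+-suc R R))
    twice : ∀ i → i ℕ.< q → u n (R ℕ.+ i) + u n (R ℕ.+ i) ≤ 1#
    twice i (ℕ.s≤s h) = ≤-resp
      (trans (*-congʳ (nat-+ i i)) (trans (solve 2 (λ a b → (a :+ a) :* b := (con (+ 0) :+ a :* b) :+ (con (+ 0) :+ a :* b)) refl (nat i) (inv n))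
        (sym (+-cong u≈ u≈))))
      (nat*inv n) (*-monoʳ (inv n) (inv≥0 n) (nat-mono (ℕₚ.≤-trans (ℕₚ.+-mono-≤ h (ℕₚ.≤-trans h (ℕₚ.⌊n/2⌋≤⌈n/2⌉ R))) (ℕₚ.≤-reflexive (ℕₚ.⌊n/2⌋+⌈n/2⌉≡n R)))))
      where
      u≈ : u n (R ℕ.+ i) ≈ 0# + nat i * inv n
      u≈ = trans (u-+ n R i) (+-congʳ (u-mid n))
    u≥0 : ∀ i → u n (R ℕ.+ i) ≥0
    u≥0 i = ≤-resp (u-mid n) refl (u-mono n (ℕₚ.m≤m+n R i))
    in-disc : ∀ i j → i ℕ.< q → j ℕ.< q → 1# ≤ χ 1ℚ (gridPoint n (R ℕ.+ i) (R ℕ.+ j))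
    in-disc i j hi hj with side? 1ℚ (gridPoint n (R ℕ.+ i) (R ℕ.+ j))
    ... | inside e _  = ≤-reflexive (sym e)
    ... | outside _ k = ⊥-elim (k (ι-cancel (≤-resp (sym (ι-norm _)) refl (≥0⇒≤ _ (cancel-nat 3 (≥0-resp
        (trans (solve 2 (λ x y → con (+ 2) :+ (con (+ 1) :- (x :+ x) :* (x :+ x)) :+ (con (+ 1) :- (y :+ y) :* (y :+ y)) := con (+ 4) :* (con (+ 1) :- (x :* x :+ y :* y))) refl
           (u n (R ℕ.+ i)) (u n (R ℕ.+ j))) (*-congʳ (reflexive (≡.sym (nat-ι 4)))))
        (+-nonNeg (+-nonNeg (ι≥0 (0≤+/ 2 0)) (≤⇒≥0 (square i hi))) (≤⇒≥0 (square j hj))))) refl))))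
      where
      square : ∀ i → i ℕ.< q → (u n (R ℕ.+ i) + u n (R ℕ.+ i)) * (u n (R ℕ.+ i) + u n (R ℕ.+ i)) ≤ 1#
      square i h = ≤-resp refl (*-identityˡ 1#) (*-mono (+-nonNeg (u≥0 i) (u≥0 i)) 1≥0 (twice i h) (twice i h))
    inner : ∀ i → i ℕ.< q → nat q * 1# ≤ ∑ (side n) (λ j → χ 1ℚ (gridPoint n (R ℕ.+ i) j))
    inner i hi = ≤-trans (≤-resp (∑-const q 1#) refl (∑-mono q λ j hj → in-disc i j hi hj)) (∑-window R q window λ j → χ≥0 1ℚ _)

  -- The normalisation divides by a point count instead of multiplying by cell areas. Comparing the
  -- two turns estimates of h² times a grid sum into estimates of `avg`.
  κR²-bound : ∀ n → Abs (κ n * (nat (suc n) * nat (suc n))) 4#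
  κR²-bound n = Abs-nonNeg (*-nonNeg (κ≥0 n) (*-nonNeg (nat≥0 _) (nat≥0 _)))
    (≤-trans (*-monoˡ (κ n) (κ≥0 n) (count-lower n))
      (≤-reflexive (trans (solve 2 (λ k d → k :* (con (+ 4) :* d) := con (+ 4) :* (k :* d)) refl _ _) (trans (*-congˡ (κ*count n)) (*-identityʳ 4#)))))

  abstract
    avg : ℚ → (ℚ × ℚ → Carrier) → ℕ → Carrier
    avg r φ n = κ n * sum (grid n) (λ p → χ r p * φ p)

    avg-cong : ∀ r {φ ψ} n → (∀ p → φ p ≈ ψ p) → avg r φ n ≈ avg r ψ n
    avg-cong r n e = *-congˡ (sum-cong (grid n) λ p → *-congˡ (e p))

    avg-+ : ∀ r φ ψ n → avg r (λ p → φ p + ψ p) n ≈ avg r φ n + avg r ψ n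
    avg-+ r φ ψ n = trans (*-congˡ (trans (sum-cong (grid n) λ p → solve 3 (λ c a b → c :* (a :+ b) := c :* a :+ c :* b) refl (χ r p) (φ p) (ψ p)) (sum-+ (grid n) _ _)))
      (solve 3 (λ k a b → k :* (a :+ b) := k :* a :+ k :* b) refl _ _ _)

    avg-* : ∀ r c φ n → avg r (λ p → c * φ p) n ≈ c * avg r φ n
    avg-* r c φ n = trans (*-congˡ (trans (sum-cong (grid n) λ p → solve 3 (λ k c a → k :* (c :* a) := c :* (k :* a)) refl (χ r p) c (φ p)) (sum-* (grid n) c _)))
      (solve 3 (λ k c s → k :* (c :* s) := c :* (k :* s)) refl _ _ _)

    avg-neg : ∀ r φ n → avg r (λ p → - φ p) n ≈ - avg r φ n
    avg-neg r φ n = trans (avg-cong r n λ p → solve 1 (λ a → :- a := (:- con (+ 1)) :* a) refl (φ p))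
      (trans (avg-* r (- 1#) φ n) (solve 1 (λ a → (:- con (+ 1)) :* a := :- a) refl _))

    avg-- : ∀ r φ ψ n → avg r (λ p → φ p - ψ p) n ≈ avg r φ n - avg r ψ n
    avg-- r φ ψ n = trans (avg-+ r φ (λ p → - ψ p) n) (+-congˡ (avg-neg r ψ n))

    avg-∑ : ∀ r N (φ : ℕ → ℚ × ℚ → Carrier) n → avg r (λ p → ∑ N (λ i → φ i p)) n ≈ ∑ N (λ i → avg r (φ i) n)
    avg-∑ r zero    φ n = trans (avg-cong r n λ p → sym (zeroˡ 0#)) (trans (avg-* r 0# (λ _ → 0#) n) (zeroˡ _))
    avg-∑ r (suc N) φ n = trans (avg-+ r (λ p → ∑ N (λ i → φ i p)) (φ N) n) (+-congʳ (avg-∑ r N φ n))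

    χ-swap : ∀ r x y → χ r (x , y) ≈ χ r (y , x)
    χ-swap r x y = ≤-antisym (χ-anti r (y , x) (x , y) (≤-reflexive (+-comm _ _))) (χ-anti r (x , y) (y , x) (≤-reflexive (+-comm _ _)))

    avg-swap : ∀ r φ n → avg r (λ (x , y) → φ (y , x)) n ≈ avg r φ n
    avg-swap r φ n = *-congˡ (trans (sum-grid n _) (trans (∑-swap (side n) (side n) _)
      (trans (∑-cong′ (side n) λ i → ∑-cong′ (side n) λ j → *-congʳ (χ-swap r (coordinate n j) (coordinate n i))) (sym (sum-grid n _)))))

  radial : ℚ → Poly
  radial r = const (ι r) ⊕ const (- 1#) ⊗ (X ⊗ X ⊕ Y ⊗ Y)

  abstract
    O-∂x : ∀ r → ι r ≤ 1# → ∀ F P → (∀ x y h → eval F x y h ≈ (ι r - (x * x + y * y)) * eval P x y h) → O (λ n → avg r (at (∂x F) n) n)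
    O-∂x r r≤1 F P e = order (4# * (3# * Row.constant r r≤1 F P e)) λ n → Abs-resp
      (trans (solve 4 (λ k R h s → k :* (R :* R) :* (h :* (h :* s)) := k :* ((R :* h) :* (R :* h) :* s)) refl (κ n) (nat (suc n)) (inv n) _)
        (*-congˡ (trans (*-congʳ (trans (*-cong (nat*inv n) (nat*inv n)) (*-identityˡ 1#))) (*-identityˡ _))))
      (sym (*-assoc _ _ _))
      (Abs-* (κR²-bound n) (Row.double r r≤1 F P e n))

  O-∂x-radial : ∀ r → ι r ≤ 1# → ∀ P → O (λ n → avg r (at (∂x (radial r ⊗ P)) n) n)
  O-∂x-radial r r≤1 P = O-∂x r r≤1 (radial r ⊗ P) P λ x y h →
    solve 4 (λ r x y p → (r :+ (:- con (+ 1)) :* (x :* x :+ y :* y)) :* p := (r :- (x :* x :+ y :* y)) :* p) refl (ι r) x y (eval P x y h)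

  -- Only x-derivatives are summed by parts. Exchanging x and y preserves the grid and the disc and
  -- turns one derivative into the other.
  O-∂y-radial : ∀ r → ι r ≤ 1# → ∀ P → O (λ n → avg r (at (∂y (radial r ⊗ P)) n) n)
  O-∂y-radial r r≤1 P = O-cong
    (λ n → trans (avg-cong r n λ (x , y) → reflexive (eval-∂x-swap (radial r ⊗ P) (ι x) (ι y) (inv n))) (avg-swap r (at (∂y (radial r ⊗ P)) n) n))
    (O-∂x r r≤1 (swap (radial r ⊗ P)) (swap P) λ x y h →
      solve 4 (λ r x y p → (r :+ (:- con (+ 1)) :* (y :* y :+ x :* x)) :* p := (r :- (x :* x :+ y :* y)) :* p) refl (ι r) x y (eval (swap P) x y h))

  -- Real and imaginary parts of (x + iy)^d

  zr zi : ℕ → Carrier → Carrier → Carrier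
  zr zero    x y = 1#
  zr (suc d) x y = x * zr d x y - y * zi d x y
  zi zero    x y = 0#
  zi (suc d) x y = x * zi d x y + y * zr d x y

  Zr Zi Tp : ℕ → Poly
  Zr zero    = const 1#
  Zr (suc d) = X ⊗ Zr d ⊕ const (- 1#) ⊗ (Y ⊗ Zi d)
  Zi zero    = const 0#
  Zi (suc d) = X ⊗ Zi d ⊕ Y ⊗ Zr d
  Tp zero    = const 1#
  Tp (suc j) = (X ⊗ X ⊕ Y ⊗ Y) ⊗ Tp j

  -- The derivative of t^j with respect to t.
  dTp : ℕ → Carrier → Carrier
  dTp zero    t = 0#
  dTp (suc j) t = nat (suc j) * t ^ᴷ j

  eval-Zr : ∀ d x y h → eval (Zr d) x y h ≈ zr d x y
  eval-Zi : ∀ d x y h → eval (Zi d) x y h ≈ zi d x y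
  eval-Zr zero    x y h = refl
  eval-Zr (suc d) x y h = trans (+-cong (*-congˡ (eval-Zr d x y h)) (*-congˡ (*-congˡ (eval-Zi d x y h))))
    (solve 4 (λ x y a b → x :* a :+ (:- con (+ 1)) :* (y :* b) := x :* a :- y :* b) refl x y (zr d x y) (zi d x y))
  eval-Zi zero    x y h = refl
  eval-Zi (suc d) x y h = +-cong (*-congˡ (eval-Zi d x y h)) (*-congˡ (eval-Zr d x y h))

  eval-Tp : ∀ j x y h → eval (Tp j) x y h ≡ (x * x + y * y) ^ᴷ j
  eval-Tp zero    x y h = ≡.refl
  eval-Tp (suc j) x y h = ≡.cong (λ s → (x * x + y * y) * s) (eval-Tp j x y h)

  t*dTp : ∀ j t → t * dTp j t ≈ nat j * t ^ᴷ j
  t*dTp zero    t = trans (zeroʳ t) (sym (trans (*-congʳ nat-0) (zeroˡ 1#)))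
  t*dTp (suc j) t = solve 3 (λ t n s → t :* (n :* s) := n :* (t :* s)) refl t (nat (suc j)) (t ^ᴷ j)

  dTp-suc : ∀ j t → dTp (suc j) t ≈ t ^ᴷ j + t * dTp j t
  dTp-suc j t = trans (*-congʳ (nat-suc j)) (trans (solve 2 (λ n s → (n :+ con (+ 1)) :* s := s :+ n :* s) refl (nat j) (t ^ᴷ j))
    (+-congˡ (sym (t*dTp j t))))

  ∂x-Tp : ∀ j x y h → eval (∂x (Tp j)) x y h ≈ 2# * x * dTp j (x * x + y * y)
  ∂x-Tp zero    x y h = solve 1 (λ x → con (+ 0) := con (+ 2) :* x :* con (+ 0)) refl x
  ∂x-Tp (suc j) x y h = trans (+-cong (*-congˡ (reflexive (eval-Tp j x y h))) (*-congˡ (∂x-Tp j x y h)))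
    (trans (solve 4 (λ x y s d → (con (+ 1) :* x :+ x :* con (+ 1) :+ (con (+ 0) :* y :+ y :* con (+ 0))) :* s :+ (x :* x :+ y :* y) :* (con (+ 2) :* x :* d) :=
       con (+ 2) :* x :* (s :+ (x :* x :+ y :* y) :* d)) refl x y _ _) (*-congˡ (sym (dTp-suc j _))))

  ∂y-Tp : ∀ j x y h → eval (∂y (Tp j)) x y h ≈ 2# * y * dTp j (x * x + y * y)
  ∂y-Tp zero    x y h = solve 1 (λ x → con (+ 0) := con (+ 2) :* x :* con (+ 0)) refl y
  ∂y-Tp (suc j) x y h = trans (+-cong (*-congˡ (reflexive (eval-Tp j x y h))) (*-congˡ (∂y-Tp j x y h)))
    (trans (solve 4 (λ x y s d → (con (+ 0) :* x :+ x :* con (+ 0) :+ (con (+ 1) :* y :+ y :* con (+ 1))) :* s :+ (x :* x :+ y :* y) :* (con (+ 2) :* y :* d) :=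
       con (+ 2) :* y :* (s :+ (x :* x :+ y :* y) :* d)) refl x y _ _) (*-congˡ (sym (dTp-suc j _))))

  cauchy-riemann : ∀ d x y h →
    eval (∂y (Zi d)) x y h ≈ eval (∂x (Zr d)) x y h × eval (∂y (Zr d)) x y h ≈ - eval (∂x (Zi d)) x y h
  cauchy-riemann zero    x y h = refl , solve 0 (con (+ 0) := :- con (+ 0)) refl
  cauchy-riemann (suc d) x y h = let p , q = cauchy-riemann d x y h in
    trans (+-cong (+-congˡ (*-congˡ p)) (+-congˡ (*-congˡ q)))
      (solve 6 (λ x y a b a′ b′ → con (+ 0) :* b :+ x :* a′ :+ (con (+ 1) :* a :+ y :* (:- b′)) :=
        con (+ 1) :* a :+ x :* a′ :+ (con (+ 0) :* (y :* b) :+ (:- con (+ 1)) :* (con (+ 0) :* b :+ y :* b′))) refl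
        x y (eval (Zr d) x y h) (eval (Zi d) x y h) (eval (∂x (Zr d)) x y h) (eval (∂x (Zi d)) x y h)) ,
    trans (+-cong (+-congˡ (*-congˡ q)) (+-congˡ (*-congˡ (+-congˡ (*-congˡ p)))))
      (solve 6 (λ x y a b a′ b′ → con (+ 0) :* a :+ x :* (:- b′) :+ (con (+ 0) :* (y :* b) :+ (:- con (+ 1)) :* (con (+ 1) :* b :+ y :* a′)) :=
        :- (con (+ 1) :* b :+ x :* b′ :+ (con (+ 0) :* a :+ y :* a′))) refl
        x y (eval (Zr d) x y h) (eval (Zi d) x y h) (eval (∂x (Zr d)) x y h) (eval (∂x (Zi d)) x y h))

  re^ im^ : ℕ → ℚ × ℚ → Carrier
  re^ d (x , y) = zr d (ι x) (ι y)
  im^ d (x , y) = zi d (ι x) (ι y)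

  -- Moments of a disc up to the order of the mesh.

  module Moments (r : ℚ) (r≤1 : ι r ≤ 1#) where

    -- the derivative of (r - t) t^j with respect to t
    slope : ℕ → Carrier → Carrier
    slope j t = (ι r - t) * dTp j t - t ^ᴷ j

    O-split : ∀ {φ ψ : ℕ → ℚ × ℚ → Carrier} {ω} → O (λ n → avg r (φ n) n) → O (λ n → avg r (ψ n) n) →
      (∀ n p → φ n p + ψ n p ≈ 2# * ω p) → O (avg r ω)
    O-split {φ} {ψ} {ω} p q e = O-cancel 1 (O-cong (λ n → trans (sym (avg-+ r (φ n) (ψ n) n))
      (trans (avg-cong r n (e n)) (trans (avg-* r 2# ω n) (*-congʳ (sym nat-2))))) (O-+ p q))

    -- ∂x + i ∂y applied to (r - t) t^j z^d
    slope-re : ∀ j d → O (avg r (λ p → slope j (norm p) * re^ (suc d) p))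
    slope-re j d = O-split (O-∂x-radial r r≤1 (Tp j ⊗ Zr d))
      (O-cong (λ n → sym (avg-neg r _ n)) (O-neg (O-∂y-radial r r≤1 (Tp j ⊗ Zi d)))) λ n p@(x , y) → let X = ι x; Y = ι y; h = inv n; t = norm p in
      trans (+-cong (+-cong (*-congˡ (*-cong (reflexive (eval-Tp j X Y h)) (eval-Zr d X Y h)))
                            (*-congˡ (+-cong (*-cong (∂x-Tp j X Y h) (eval-Zr d X Y h)) (*-congʳ (reflexive (eval-Tp j X Y h))))))
            (-‿cong (+-cong (*-congˡ (*-cong (reflexive (eval-Tp j X Y h)) (eval-Zi d X Y h)))
                            (*-congˡ (+-cong (*-cong (∂y-Tp j X Y h) (eval-Zi d X Y h)) (*-cong (reflexive (eval-Tp j X Y h)) (proj₁ (cauchy-riemann d X Y h))))))))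
        -- By the Cauchy-Riemann equations the operator kills z^d and differentiates only (r - t)
        -- t^j, which gives twice the t-derivative times z; hence the exponent d + 1.
        (solve 8 (λ r x y s d a b a′ →
           (con (+ 0) :+ (con (+ 0) :* (x :* x :+ y :* y) :+ (:- con (+ 1)) :* ((con (+ 1) :* x :+ x :* con (+ 1)) :+ (con (+ 0) :* y :+ y :* con (+ 0))))) :* (s :* a)
             :+ (r :+ (:- con (+ 1)) :* (x :* x :+ y :* y)) :* (con (+ 2) :* x :* d :* a :+ s :* a′)
           :- ((con (+ 0) :+ (con (+ 0) :* (x :* x :+ y :* y) :+ (:- con (+ 1)) :* ((con (+ 0) :* x :+ x :* con (+ 0)) :+ (con (+ 1) :* y :+ y :* con (+ 1))))) :* (s :* b)
             :+ (r :+ (:- con (+ 1)) :* (x :* x :+ y :* y)) :* (con (+ 2) :* y :* d :* b :+ s :* a′))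
           := con (+ 2) :* (((r :- (x :* x :+ y :* y)) :* d :- s) :* (x :* a :- y :* b)))
           refl (ι r) X Y (t ^ᴷ j) (dTp j t) (zr d X Y) (zi d X Y) (eval (∂x (Zr d)) X Y h))

    slope-im : ∀ j d → O (avg r (λ p → slope j (norm p) * im^ (suc d) p))
    slope-im j d = O-split (O-∂x-radial r r≤1 (Tp j ⊗ Zi d)) (O-∂y-radial r r≤1 (Tp j ⊗ Zr d)) λ n p@(x , y) → let X = ι x; Y = ι y; h = inv n; t = norm p in
      trans (+-cong (+-cong (*-congˡ (*-cong (reflexive (eval-Tp j X Y h)) (eval-Zi d X Y h)))
                            (*-congˡ (+-cong (*-cong (∂x-Tp j X Y h) (eval-Zi d X Y h)) (*-congʳ (reflexive (eval-Tp j X Y h))))))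
                    (+-cong (*-congˡ (*-cong (reflexive (eval-Tp j X Y h)) (eval-Zr d X Y h)))
                            (*-congˡ (+-cong (*-cong (∂y-Tp j X Y h) (eval-Zr d X Y h)) (*-cong (reflexive (eval-Tp j X Y h)) (proj₂ (cauchy-riemann d X Y h)))))))
        (solve 8 (λ r x y s d a b b′ →
           (con (+ 0) :+ (con (+ 0) :* (x :* x :+ y :* y) :+ (:- con (+ 1)) :* ((con (+ 1) :* x :+ x :* con (+ 1)) :+ (con (+ 0) :* y :+ y :* con (+ 0))))) :* (s :* b)
             :+ (r :+ (:- con (+ 1)) :* (x :* x :+ y :* y)) :* (con (+ 2) :* x :* d :* b :+ s :* b′)
           :+ ((con (+ 0) :+ (con (+ 0) :* (x :* x :+ y :* y) :+ (:- con (+ 1)) :* ((con (+ 0) :* x :+ x :* con (+ 0)) :+ (con (+ 1) :* y :+ y :* con (+ 1))))) :* (s :* a)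
             :+ (r :+ (:- con (+ 1)) :* (x :* x :+ y :* y)) :* (con (+ 2) :* y :* d :* a :+ s :* (:- b′)))
           := con (+ 2) :* (((r :- (x :* x :+ y :* y)) :* d :- s) :* (x :* b :+ y :* a)))
           refl (ι r) X Y (t ^ᴷ j) (dTp j t) (zr d X Y) (zi d X Y) (eval (∂x (Zi d)) X Y h))

    -- ∂x + i ∂y applied to (r - t) t^j z̄
    slope-radial : ∀ j → O (avg r (λ p → nat (suc j) * (ι r * norm p ^ᴷ j) - nat (suc (suc j)) * norm p ^ᴷ suc j))
    slope-radial j = O-split (O-∂x-radial r r≤1 (X ⊗ Tp j)) (O-∂y-radial r r≤1 (Y ⊗ Tp j)) λ n p@(x , y) → let X = ι x; Y = ι y; h = inv n; t = norm p; S = t ^ᴷ j in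
      begin
        eval (∂x (radial r ⊗ (Poly.X ⊗ Tp j))) X Y h + eval (∂y (radial r ⊗ (Poly.Y ⊗ Tp j))) X Y h
          ≈⟨ +-cong (+-cong (*-congˡ (*-congˡ (reflexive (eval-Tp j X Y h)))) (*-congˡ (+-cong (*-congˡ (reflexive (eval-Tp j X Y h))) (*-congˡ (∂x-Tp j X Y h)))))
                    (+-cong (*-congˡ (*-congˡ (reflexive (eval-Tp j X Y h)))) (*-congˡ (+-cong (*-congˡ (reflexive (eval-Tp j X Y h))) (*-congˡ (∂y-Tp j X Y h))))) ⟩
        _ ≈⟨ solve 5 (λ r x y s d →
           (con (+ 0) :+ (con (+ 0) :* (x :* x :+ y :* y) :+ (:- con (+ 1)) :* ((con (+ 1) :* x :+ x :* con (+ 1)) :+ (con (+ 0) :* y :+ y :* con (+ 0))))) :* (x :* s)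
             :+ (r :+ (:- con (+ 1)) :* (x :* x :+ y :* y)) :* (con (+ 1) :* s :+ x :* (con (+ 2) :* x :* d))
           :+ ((con (+ 0) :+ (con (+ 0) :* (x :* x :+ y :* y) :+ (:- con (+ 1)) :* ((con (+ 0) :* x :+ x :* con (+ 0)) :+ (con (+ 1) :* y :+ y :* con (+ 1))))) :* (y :* s)
             :+ (r :+ (:- con (+ 1)) :* (x :* x :+ y :* y)) :* (con (+ 1) :* s :+ y :* (con (+ 2) :* y :* d)))
           := con (+ 2) :* ((r :- (x :* x :+ y :* y)) :* (s :+ (x :* x :+ y :* y) :* d) :- (x :* x :+ y :* y) :* s)) refl (ι r) X Y S (dTp j t) ⟩
        2# * ((ι r - t) * (S + t * dTp j t) - t * S)
          ≈⟨ *-congˡ (+-congʳ (*-congˡ (+-congˡ (t*dTp j t)))) ⟩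
        2# * ((ι r - t) * (S + nat j * S) - t * S)
          ≈⟨ *-congˡ (solve 4 (λ r t s n → (r :- t) :* (s :+ n :* s) :- t :* s := (n :+ con (+ 1)) :* (r :* s) :- (n :+ con (+ 1) :+ con (+ 1)) :* (t :* s)) refl (ι r) t S (nat j)) ⟩
        2# * ((nat j + 1#) * (ι r * S) - (nat j + 1# + 1#) * (t * S))
          ≈⟨ *-congˡ (+-cong (*-congʳ (sym (nat-suc j))) (-‿cong (*-congʳ (trans (+-congʳ (sym (nat-suc j))) (sym (nat-suc (suc j))))))) ⟩
        2# * (nat (suc j) * (ι r * S) - nat (suc (suc j)) * (t * S)) ∎
      where open ≈-Reasoning

    module _ (ω : ℚ × ℚ → Carrier) (O-slope : ∀ j → O (avg r (λ p → slope j (norm p) * ω p))) where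

      -- `slope j` equals r j t^(j-1) - (j+1) t^j, so its vanishing average expresses each moment by
      -- the previous one. The recursion starts at `slope 0`, the constant -1.
      O-power : ∀ j → O (avg r (λ p → norm p ^ᴷ j * ω p))
      O-power zero = O-cong (λ n → trans (sym (avg-neg r _ n)) (avg-cong r n λ p →
        solve 3 (λ r t w → :- (((r :- t) :* con (+ 0) :- con (+ 1)) :* w) := con (+ 1) :* w) refl (ι r) (norm p) (ω p))) (O-neg (O-slope 0))
      O-power (suc j) = O-cancel (suc j) (O-cong (λ n → begin
          nat (suc j) * ι r * avg r (λ p → norm p ^ᴷ j * ω p) n - avg r (λ p → slope (suc j) (norm p) * ω p) n
            ≈⟨ +-congʳ (sym (avg-* r _ _ n)) ⟩
          avg r (λ p → nat (suc j) * ι r * (norm p ^ᴷ j * ω p)) n - avg r (λ p → slope (suc j) (norm p) * ω p) n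
            ≈⟨ sym (avg-- r _ _ n) ⟩
          avg r (λ p → nat (suc j) * ι r * (norm p ^ᴷ j * ω p) - slope (suc j) (norm p) * ω p) n
            ≈⟨ avg-cong r n (λ p → trans (solve 5 (λ m r s w t → m :* r :* (s :* w) :- ((r :- t) :* (m :* s) :- t :* s) :* w := (m :+ con (+ 1)) :* (t :* s :* w)) refl
                 (nat (suc j)) (ι r) (norm p ^ᴷ j) (ω p) (norm p)) (*-congʳ (sym (nat-suc (suc j))))) ⟩
          avg r (λ p → nat (suc (suc j)) * (norm p ^ᴷ suc j * ω p)) n
            ≈⟨ avg-* r _ _ n ⟩
          nat (suc (suc j)) * avg r (λ p → norm p ^ᴷ suc j * ω p) n ∎)
        (O-+ (O-* (nat (suc j) * ι r) (O-power j)) (O-neg (O-slope (suc j)))))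
        where open ≈-Reasoning

    moment-re : ∀ j d → O (avg r (λ p → norm p ^ᴷ j * re^ (suc d) p))
    moment-re j d = O-power (re^ (suc d)) (λ j → slope-re j d) j

    moment-im : ∀ j d → O (avg r (λ p → norm p ^ᴷ j * im^ (suc d) p))
    moment-im j d = O-power (im^ (suc d)) (λ j → slope-im j d) j

    area : ℕ → Carrier
    area = avg r (λ _ → 1#)

    -- Consecutive moments satisfy (j+2) m' = (j+1) r m up to O(h), and the first one is the area.
    -- This determines them as multiples of the area before the dependence of the area on r is
    -- known.
    moment-radial : ∀ j → O (λ n → avg r (λ p → norm p ^ᴷ j) n - ι r ^ᴷ j * inv j * area n)
    moment-radial zero = O-cong (λ n → sym (trans (+-congˡ (-‿cong (trans (*-congʳ (trans (*-identityˡ _) inv-0)) (*-identityˡ _)))) (-‿inverseʳ _))) O-0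
    moment-radial (suc j) = O-cancel (suc j) (O-cong (λ n → let A = avg r (λ p → norm p ^ᴷ j) n; B = avg r (λ p → norm p ^ᴷ suc j) n in begin
        nat (suc j) * ι r * (A - ι r ^ᴷ j * inv j * area n) - avg r (λ p → nat (suc j) * (ι r * norm p ^ᴷ j) - nat (suc (suc j)) * norm p ^ᴷ suc j) n
          ≈⟨ +-congˡ (-‿cong (trans (avg-- r _ _ n) (+-cong (trans (avg-* r _ _ n) (*-congˡ (avg-* r _ _ n))) (-‿cong (avg-* r _ _ n))))) ⟩
        nat (suc j) * ι r * (A - ι r ^ᴷ j * inv j * area n) - (nat (suc j) * (ι r * A) - nat (suc (suc j)) * B)
          ≈⟨ solve 8 (λ m r a s i w m′ b → m :* r :* (a :- s :* i :* w) :- (m :* (r :* a) :- m′ :* b) := m′ :* b :- r :* s :* w :* (m :* i)) refl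
               (nat (suc j)) (ι r) A (ι r ^ᴷ j) (inv j) (area n) (nat (suc (suc j))) B ⟩
        nat (suc (suc j)) * B - ι r * ι r ^ᴷ j * area n * (nat (suc j) * inv j)
          ≈⟨ +-congˡ (-‿cong (*-congˡ (trans (nat*inv j) (sym (nat*inv (suc j)))))) ⟩
        nat (suc (suc j)) * B - ι r * ι r ^ᴷ j * area n * (nat (suc (suc j)) * inv (suc j))
          ≈⟨ solve 6 (λ m b r s w i → m :* b :- r :* s :* w :* (m :* i) := m :* (b :- r :* s :* i :* w)) refl (nat (suc (suc j))) B (ι r) (ι r ^ᴷ j) (area n) (inv (suc j)) ⟩
        nat (suc (suc j)) * (B - ι r * ι r ^ᴷ j * inv (suc j) * area n) ∎)
      (O-+ (O-* (nat (suc j) * ι r) (moment-radial j)) (O-neg (slope-radial j))))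
      where open ≈-Reasoning

  -- Area of concentric discs

  -- The two products are the positive parts of s - |z|² and r - |z|². Raising the level from r to s
  -- adds s - r inside the smaller disc, at most s - r between the circles, and nothing outside.
  sandwich : ∀ r s p → ι r ≤ ι s →
    χ r p * (ι s - ι r) ≤ χ s p * (ι s - norm p) - χ r p * (ι r - norm p) ×
    χ s p * (ι s - norm p) - χ r p * (ι r - norm p) ≤ χ s p * (ι s - ι r)
  sandwich r s p r≤s with side? r p | side? s p
  ... | inside e _  | inside f _ =
    ≤-resp (*-congʳ (sym e)) (+-cong (*-congʳ (sym f)) (-‿cong (*-congʳ (sym e)))) (≤-reflexive (solve 3 (λ r s t → con (+ 1) :* (s :- r) := con (+ 1) :* (s :- t) :- con (+ 1) :* (r :- t)) refl (ι r) (ι s) (norm p))) ,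
    ≤-resp (+-cong (*-congʳ (sym f)) (-‿cong (*-congʳ (sym e)))) (*-congʳ (sym f)) (≤-reflexive (solve 3 (λ r s t → con (+ 1) :* (s :- t) :- con (+ 1) :* (r :- t) := con (+ 1) :* (s :- r)) refl (ι r) (ι s) (norm p)))
  ... | inside _ h  | outside _ k = ⊥-elim (k (ι-cancel (≤-trans (ι-mono h) r≤s)))
  ... | outside e h | inside f k =
    ≤-resp (*-congʳ (sym e)) (+-cong (*-congʳ (sym f)) (-‿cong (*-congʳ (sym e)))) (≥0⇒≤ _ (≤⇒≥0 (inside-≤ s p k)) (solve 3 (λ r s t → s :- t := con (+ 1) :* (s :- t) :- con (+ 0) :* (r :- t) :- con (+ 0) :* (s :- r)) refl (ι r) (ι s) (norm p))) ,
    ≤-resp (+-cong (*-congʳ (sym f)) (-‿cong (*-congʳ (sym e)))) (*-congʳ (sym f)) (≥0⇒≤ _ (≤⇒≥0 (outside-≥ r p h)) (solve 3 (λ r s t → t :- r := con (+ 1) :* (s :- r) :- (con (+ 1) :* (s :- t) :- con (+ 0) :* (r :- t))) refl (ι r) (ι s) (norm p)))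
  ... | outside e _ | outside f _ =
    ≤-resp (*-congʳ (sym e)) (+-cong (*-congʳ (sym f)) (-‿cong (*-congʳ (sym e)))) (≤-reflexive (solve 3 (λ r s t → con (+ 0) :* (s :- r) := con (+ 0) :* (s :- t) :- con (+ 0) :* (r :- t)) refl (ι r) (ι s) (norm p))) ,
    ≤-resp (+-cong (*-congʳ (sym f)) (-‿cong (*-congʳ (sym e)))) (*-congʳ (sym f)) (≤-reflexive (solve 3 (λ r s t → con (+ 0) :* (s :- t) :- con (+ 0) :* (r :- t) := con (+ 0) :* (s :- r)) refl (ι r) (ι s) (norm p)))

  area : ℚ → ℕ → Carrier
  area r = avg r (λ _ → 1#)

  -- The volume under the paraboloid r - |z|² over its disc. Its derivative in r is the area;
  -- `cone-difference` says so without derivatives.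
  cone : ℚ → ℕ → Carrier
  cone r = avg r (λ p → ι r - norm p)

  abstract
    area≥0 : ∀ r n → area r n ≥0
    area≥0 r n = *-nonNeg (κ≥0 n) (≤-resp (trans (sum-* (grid n) 0# (λ _ → 0#)) (zeroˡ _)) refl
      (sum-mono (grid n) λ p → ≤-resp (sym (zeroˡ 0#)) (sym (*-identityʳ _)) (χ≥0 r p)))

    area-1 : ∀ n → area 1ℚ n ≈ 1#
    area-1 n = trans (*-congˡ (trans (sum-cong (grid n) λ p → *-identityʳ _) (sym (count≈ n)))) (κ*count n)

    cone-difference : ∀ r s n → ι r ≤ ι s →
      area r n * (ι s - ι r) ≤ cone s n - cone r n × cone s n - cone r n ≤ area s n * (ι s - ι r)
    cone-difference r s n r≤s =
      ≤-resp (scale r) difference (*-monoˡ (κ n) (κ≥0 n) (sum-mono (grid n) λ p → proj₁ (sandwich r s p r≤s))) ,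
      ≤-resp difference (scale s) (*-monoˡ (κ n) (κ≥0 n) (sum-mono (grid n) λ p → proj₂ (sandwich r s p r≤s)))
      where
      scale : ∀ q → κ n * sum (grid n) (λ p → χ q p * (ι s - ι r)) ≈ area q n * (ι s - ι r)
      scale q = trans (avg-cong q n λ p → sym (*-identityʳ _)) (trans (avg-* q (ι s - ι r) (λ _ → 1#) n) (*-comm _ _))
      difference : κ n * sum (grid n) (λ p → χ s p * (ι s - norm p) - χ r p * (ι r - norm p)) ≈ cone s n - cone r n
      difference = trans (*-congˡ (trans (sum-+ (grid n) _ _) (+-congˡ
          (trans (sum-cong (grid n) λ p → solve 1 (λ a → :- a := (:- con (+ 1)) :* a) refl _) (sum-* (grid n) (- 1#) _)))))
        (solve 3 (λ k a b → k :* (a :+ (:- con (+ 1)) :* b) := k :* a :- k :* b) refl (κ n) _ _)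

  -- `slope-radial` at j = 0 says that r - 2|z|² has average O(h) over the disc, and this function
  -- equals 2 (r - |z|²) - r.
  cone-area : ∀ r → ι r ≤ 1# → O (λ n → 2# * cone r n - ι r * area r n)
  cone-area r r≤1 = O-cong (λ n → begin
      avg r (λ p → nat 1 * (ι r * 1#) - nat 2 * (norm p * 1#)) n
        ≈⟨ avg-cong r n (λ p → trans (+-cong (*-congʳ nat-1) (-‿cong (*-congʳ nat-2)))
             (solve 2 (λ r t → con (+ 1) :* (r :* con (+ 1)) :- con (+ 2) :* (t :* con (+ 1)) := con (+ 2) :* (r :- t) :- r :* con (+ 1)) refl (ι r) (norm p))) ⟩
      avg r (λ p → 2# * (ι r - norm p) - ι r * 1#) n
        ≈⟨ trans (avg-- r _ _ n) (+-cong (avg-* r _ _ n) (-‿cong (avg-* r _ _ n))) ⟩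
      2# * cone r n - ι r * area r n ∎)
    (Moments.slope-radial r r≤1 0)
    where open ≈-Reasoning

  infix 4 _≲_
  record _≲_ (x y : ℕ → Carrier) : Set where
    constructor upto
    field
      constant : Carrier
      below    : ∀ n → x n ≤ y n + constant * inv n

  ≲-trans : ∀ {x y z} → x ≲ y → y ≲ z → x ≲ z
  ≲-trans {z = z} (upto C h) (upto D k) = upto (D + C) λ n → ≤-trans (h n)
    (≤-resp refl (solve 4 (λ z d c i → z :+ d :* i :+ c :* i := z :+ (d :+ c) :* i) refl (z n) D C (inv n)) (+-mono (k n) ≤-refl))

  ≲-scale : ∀ {x y} c → c ≥0 → x ≲ y → (λ n → c * x n) ≲ (λ n → c * y n)
  ≲-scale {x} {y} c c≥0 (upto C h) = upto (c * C) λ n → ≤-resp refl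
    (solve 4 (λ c y C i → c :* (y :+ C :* i) := c :* y :+ c :* C :* i) refl c (y n) C (inv n)) (*-monoˡ c c≥0 (h n))

  ≲-resp : ∀ {x y x′ y′} → (∀ n → x n ≈ x′ n) → (∀ n → y n ≈ y′ n) → x ≲ y → x′ ≲ y′
  ≲-resp e f (upto C h) = upto C λ n → ≤-resp (e n) (+-congʳ (f n)) (h n)

  ≲-refl : ∀ {x} → x ≲ x
  ≲-refl = upto 0# λ n → ≤-resp refl refl (x≤x+ (≤-reflexive (sym (zeroˡ _))))

  -- The relations 2 cone = r area and cone' = area force the area to be linear in r. They are used
  -- in difference form at the levels k/N: N times the increment of 2 cone equals (k+1) A (k+1) - k
  -- A k up to O(h), and it lies between 2 A k and 2 A (k+1).
  module Concentric (N-1 : ℕ) where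

    v : Carrier
    v = inv N-1

    abstract
      fraction : ℕ → ℚ
      fraction k = + k ℚ./ suc N-1

      ι-fraction : ∀ k → ι (fraction k) ≈ nat k * v
      ι-fraction k = trans (reflexive (≡.cong ι (/suc (+ k) N-1))) (trans (ι-* _ _)
        (*-cong (reflexive (≡.sym (nat-ι k))) (reflexive (≡.sym (inv-ι N-1)))))

    A : ℕ → ℕ → Carrier
    A k = area (fraction k)

    ≤1 : ∀ {k} → k ℕ.≤ suc N-1 → ι (fraction k) ≤ 1#
    ≤1 {k} h = ≤-resp (sym (ι-fraction k)) (nat*inv N-1) (*-monoʳ v (inv≥0 N-1) (nat-mono h))

    gap : ∀ k → ι (fraction (suc k)) - ι (fraction k) ≈ v
    gap k = trans (+-cong (trans (ι-fraction (suc k)) (*-congʳ (nat-suc k))) (-‿cong (ι-fraction k)))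
      (solve 2 (λ k v → (k :+ con (+ 1)) :* v :- k :* v := v) refl (nat k) v)

    mono : ∀ k → ι (fraction k) ≤ ι (fraction (suc k))
    mono k = ≥0⇒≤ v (inv≥0 N-1) (sym (gap k))

    2cone : ∀ k → k ℕ.< suc N-1 → ∃ λ C → ∀ n →
      Abs (nat (suc N-1) * (2# * cone (fraction (suc k)) n - 2# * cone (fraction k) n) - (nat (suc k) * A (suc k) n - nat k * A k n)) (C * inv n)
    2cone k h = O.constant o , λ n → Abs-respˡ (begin
        N * (2# * cone (fraction (suc k)) n - ι (fraction (suc k)) * A (suc k) n + - (2# * cone (fraction k) n - ι (fraction k) * A k n))
          ≈⟨ *-congˡ (+-cong (+-congˡ (-‿cong (*-congʳ (ι-fraction (suc k))))) (-‿cong (+-congˡ (-‿cong (*-congʳ (ι-fraction k)))))) ⟩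
        N * (2# * cone (fraction (suc k)) n - nat (suc k) * v * A (suc k) n + - (2# * cone (fraction k) n - nat k * v * A k n))
          ≈⟨ solve 8 (λ N v b k′ a′ c k a → N :* (b :- k′ :* v :* a′ :+ :- (c :- k :* v :* a)) := N :* (b :- c) :- (N :* v) :* (k′ :* a′ :- k :* a)) refl
               N v (2# * cone (fraction (suc k)) n) (nat (suc k)) (A (suc k) n) (2# * cone (fraction k) n) (nat k) (A k n) ⟩
        N * (2# * cone (fraction (suc k)) n - 2# * cone (fraction k) n) - (N * v) * (nat (suc k) * A (suc k) n - nat k * A k n)
          ≈⟨ +-congˡ (-‿cong (trans (*-congʳ (nat*inv N-1)) (*-identityˡ _))) ⟩
        N * (2# * cone (fraction (suc k)) n - 2# * cone (fraction k) n) - (nat (suc k) * A (suc k) n - nat k * A k n) ∎) (O.bounded o n)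
      where
      open ≈-Reasoning
      o : O (λ n → nat (suc N-1) * (2# * cone (fraction (suc k)) n - ι (fraction (suc k)) * A (suc k) n + - (2# * cone (fraction k) n - ι (fraction k) * A k n)))
      o = O-* (nat (suc N-1)) (O-+ (cone-area (fraction (suc k)) (≤1 h)) (O-neg (cone-area (fraction k) (≤1 (ℕₚ.<⇒≤ h)))))
      N : Carrier
      N = nat (suc N-1)

    N*gap : ∀ k a → nat (suc N-1) * (2# * (a * (ι (fraction (suc k)) - ι (fraction k)))) ≈ 2# * a
    N*gap k a = trans (*-congˡ (*-congˡ (*-congˡ (gap k)))) (trans
      (solve 3 (λ N a v → N :* (con (+ 2) :* (a :* v)) := con (+ 2) :* a :* (N :* v)) refl _ a v) (trans (*-congˡ (nat*inv N-1)) (*-identityʳ _)))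

    2≥0 : 2# ≥0
    2≥0 = ι≥0 (0≤+/ 2 0)

    nat-suc-suc : ∀ k → nat (suc (suc k)) ≈ nat k + 2#
    nat-suc-suc k = trans (trans (nat-suc _) (+-congʳ (nat-suc k))) (solve 1 (λ k → k :+ con (+ 1) :+ con (+ 1) := k :+ con (+ 2)) refl (nat k))

    increment : ℕ → ℕ → Carrier
    increment k n = nat (suc N-1) * (2# * cone (fraction (suc k)) n - 2# * cone (fraction k) n)

    increment≥ : ∀ k n → 2# * A k n ≤ increment k n
    increment≥ k n = ≤-resp (N*gap k (A k n)) (*-congˡ (solve 2 (λ a b → con (+ 2) :* (a :- b) := con (+ 2) :* a :- con (+ 2) :* b) refl _ _))
      (*-monoˡ _ (nat≥0 (suc N-1)) (*-monoˡ 2# 2≥0 (proj₁ (cone-difference (fraction k) (fraction (suc k)) n (mono k)))))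

    increment≤ : ∀ k n → increment k n ≤ 2# * A (suc k) n
    increment≤ k n = ≤-resp (*-congˡ (solve 2 (λ a b → con (+ 2) :* (a :- b) := con (+ 2) :* a :- con (+ 2) :* b) refl _ _)) (N*gap k (A (suc k) n))
      (*-monoˡ _ (nat≥0 (suc N-1)) (*-monoˡ 2# 2≥0 (proj₂ (cone-difference (fraction k) (fraction (suc k)) n (mono k)))))

    -- From the lower bound `increment≥`. Divided by (k+1)(k+2) it makes A k / (k+1) grow with k.
    step-up : ∀ k → k ℕ.< suc N-1 → (λ n → nat (suc (suc k)) * A k n) ≲ (λ n → nat (suc k) * A (suc k) n)
    step-up k h = let C , b = 2cone k h in upto C λ n →
      ≥0⇒≤ _ (+-nonNeg (≤⇒≥0 (upper (b n))) (≤⇒≥0 (increment≥ k n)))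
        (trans (solve 5 (λ e X B k a → e :- (X :- (B :- k :* a)) :+ (X :- con (+ 2) :* a) := B :+ e :- (k :+ con (+ 2)) :* a) refl
           (C * inv n) (increment k n) (nat (suc k) * A (suc k) n) (nat k) (A k n)) (+-congˡ (-‿cong (*-congʳ (sym (nat-suc-suc k))))))

    -- From the upper bound `increment≤` at level i + 1. Divided by i (i+1), for i > 0, it makes A k
    -- / (k-1) fall with k; the shifted indices avoid subtraction.
    step-down : ∀ i → suc i ℕ.< suc N-1 → (λ n → nat i * A (suc (suc i)) n) ≲ (λ n → nat (suc i) * A (suc i) n)
    step-down i h = let C , b = 2cone (suc i) h in upto C λ n →
      ≥0⇒≤ _ (+-nonNeg (≤⇒≥0 (lower (b n))) (≤⇒≥0 (increment≤ (suc i) n)))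
        (trans (+-congʳ (+-congˡ (-‿cong (-‿cong (+-congˡ (-‿cong (+-congʳ (*-congʳ (nat-suc-suc i)))))))))
          (solve 5 (λ e X B k a → e :- :- (X :- ((k :+ con (+ 2)) :* a :- B)) :+ (con (+ 2) :* a :- X) := B :+ e :- k :* a) refl
           (C * inv n) (increment (suc i) n) (nat (suc i) * A (suc i) n) (nat i) (A (suc (suc i)) n)))

    nat-inv-cancel : ∀ k x → inv k * inv (suc k) * (nat (suc k) * x) ≈ inv (suc k) * x
    nat-inv-cancel k x = trans (solve 4 (λ i j k x → i :* j :* (k :* x) := (k :* i) :* (j :* x)) refl _ _ _ x) (trans (*-congʳ (nat*inv k)) (*-identityˡ _))

    nat-inv-cancel′ : ∀ k x → inv k * inv (suc k) * (nat (suc (suc k)) * x) ≈ inv k * x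
    nat-inv-cancel′ k x = trans (solve 4 (λ i j k x → i :* j :* (k :* x) := (k :* j) :* (i :* x)) refl _ _ _ x) (trans (*-congʳ (nat*inv (suc k))) (*-identityˡ _))

    increasing : ∀ k d → k ℕ.+ d ℕ.≤ suc N-1 → (λ n → inv k * A k n) ≲ (λ n → inv (k ℕ.+ d) * A (k ℕ.+ d) n)
    increasing k zero    h = ≲-resp (λ _ → refl) (λ n → reflexive (≡.cong (λ m → inv m * A m n) (≡.sym (ℕₚ.+-identityʳ k)))) ≲-refl
    increasing k (suc d) h = ≲-trans (increasing k d (ℕₚ.<⇒≤ l))
      (≲-resp (λ n → nat-inv-cancel′ (k ℕ.+ d) _) (λ n → trans (nat-inv-cancel (k ℕ.+ d) _) (reflexive (≡.cong (λ m → inv m * A m n) (≡.sym (ℕₚ.+-suc k d)))))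
        (≲-scale _ (*-nonNeg (inv≥0 (k ℕ.+ d)) (inv≥0 (suc (k ℕ.+ d)))) (step-up (k ℕ.+ d) l)))
      where
      l : k ℕ.+ d ℕ.< suc N-1
      l = ℕₚ.≤-trans (ℕₚ.≤-reflexive (≡.sym (ℕₚ.+-suc k d))) h

    decreasing : ∀ i d → 2 ℕ.+ (i ℕ.+ d) ℕ.≤ suc N-1 → (λ n → inv (i ℕ.+ d) * A (2 ℕ.+ (i ℕ.+ d)) n) ≲ (λ n → inv i * A (2 ℕ.+ i) n)
    decreasing i zero    h = ≲-resp (λ n → reflexive (≡.cong (λ m → inv m * A (2 ℕ.+ m) n) (≡.sym (ℕₚ.+-identityʳ i)))) (λ _ → refl) ≲-refl
    decreasing i (suc d) h = ≲-trans
      (≲-resp (λ n → trans (nat-inv-cancel (i ℕ.+ d) _) (reflexive (≡.cong (λ m → inv m * A (2 ℕ.+ m) n) (≡.sym (ℕₚ.+-suc i d))))) (λ n → nat-inv-cancel′ (i ℕ.+ d) _)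
        (≲-scale _ (*-nonNeg (inv≥0 (i ℕ.+ d)) (inv≥0 (suc (i ℕ.+ d)))) (step-down (suc (i ℕ.+ d)) l)))
      (decreasing i d (ℕₚ.<⇒≤ l))
      where
      l : 2 ℕ.+ (i ℕ.+ d) ℕ.< suc N-1
      l = ℕₚ.≤-trans (ℕₚ.≤-reflexive (≡.cong (2 ℕ.+_) (≡.sym (ℕₚ.+-suc i d)))) h

    A-N : ∀ n → A (suc N-1) n ≈ 1#
    A-N n = trans (reflexive (≡.cong (λ q → area q n) (ℚₚ.≤-antisym (ι-cancel (≤-reflexive one)) (ι-cancel (≤-reflexive (sym one)))))) (area-1 n)
      where
      one : ι (fraction (suc N-1)) ≈ ι 1ℚ
      one = trans (ι-fraction (suc N-1)) (nat*inv N-1)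

  ι-exhaustion : ∀ m → ι (exhaustion m) ≈ 1# - inv m
  ι-exhaustion m = trans (ι-+ _ _) (+-congˡ (trans (ι-neg _) (-‿cong (reflexive (≡.sym (inv-ι m))))))

  nat*inv-suc : ∀ m → nat m * inv m ≈ 1# - inv m
  nat*inv-suc m = trans (solve 2 (λ m i → m :* i := (m :+ con (+ 1)) :* i :- i) refl (nat m) (inv m)) (+-congʳ ([1+nat]*inv m))

  -- The level m/(m+1) is k/N with k = m (j+2) and N = (m+1)(j+2). Comparing A k with A N = 1
  -- through the two monotone quotients gives (k-1)/(N-1) ≤ A k ≤ (k+1)/(N+1) up to O(h), and both
  -- ends differ from k/N by at most 1/(j+1).
  area-limit : ∀ m → Lim (area (exhaustion m)) (1# - inv m)
  area-limit m = Lim-by 2# λ j → bounds j m ≡.refl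
    where
    r : Carrier
    r = 1# - inv m
    M k : ℕ → ℕ
    -- At least 2, so that k can be written as 2 + i when m > 0, as `decreasing` requires.
    M j = 2 ℕ.+ j
    k j = m ℕ.* M j
    same : ∀ j n → area (exhaustion m) n ≈ Concentric.A (suc j ℕ.+ m ℕ.* M j) (k j) n
    same j n = reflexive (≡.cong (λ q → area q n) (ℚₚ.≤-antisym (ι-cancel (≤-reflexive e)) (ι-cancel (≤-reflexive (sym e)))))
      where
      open Concentric (suc j ℕ.+ m ℕ.* M j)
      e : ι (exhaustion m) ≈ ι (fraction (k j))
      e = begin
        ι (exhaustion m)                   ≈⟨ trans (ι-exhaustion m) (sym (nat*inv-suc m)) ⟩
        nat m * inv m                      ≈⟨ trans (sym (*-identityʳ _)) (*-congˡ (sym (nat*inv _))) ⟩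
        nat m * inv m * (nat (suc m ℕ.* M j) * v)      ≈⟨ *-congˡ (*-congʳ (nat-* (suc m) (M j))) ⟩
        nat m * inv m * (nat (suc m) * nat (M j) * v)  ≈⟨ solve 5 (λ m i m′ M v → m :* i :* (m′ :* M :* v) := m :* M :* v :* (m′ :* i)) refl (nat m) (inv m) (nat (suc m)) (nat (M j)) v ⟩
        nat m * nat (M j) * v * (nat (suc m) * inv m)  ≈⟨ trans (*-congˡ (nat*inv m)) (*-identityʳ _) ⟩
        nat m * nat (M j) * v              ≈⟨ *-congʳ (sym (nat-* m (M j))) ⟩
        nat (k j) * v                      ≈⟨ sym (ι-fraction (k j)) ⟩
        ι (fraction (k j))                 ∎
        where open ≈-Reasoning
    -- (r + inv j) (N + 1) ≥ k + 1 for N = (m + 1) M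
    r*N : ∀ j → r * nat (suc m ℕ.* M j) ≈ nat (k j)
    r*N j = begin
      r * nat (suc m ℕ.* M j)                 ≈⟨ *-cong (sym (nat*inv-suc m)) (nat-* (suc m) (M j)) ⟩
      nat m * inv m * (nat (suc m) * nat (M j)) ≈⟨ solve 4 (λ m i m′ M → m :* i :* (m′ :* M) := m :* M :* (m′ :* i)) refl (nat m) (inv m) (nat (suc m)) (nat (M j)) ⟩
      nat m * nat (M j) * (nat (suc m) * inv m) ≈⟨ trans (*-congˡ (nat*inv m)) (*-identityʳ _) ⟩
      nat m * nat (M j)                       ≈⟨ sym (nat-* m (M j)) ⟩
      nat (k j) ∎
      where open ≈-Reasoning
    r≥0 : r ≥0
    r≥0 = ≤⇒≥0 (inv≤1 m)
    1≤inv*N : ∀ j {N} → suc j ℕ.≤ N → 1# ≤ inv j * nat N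
    1≤inv*N j h = ≤-resp (trans (*-comm _ _) (nat*inv j)) refl (*-monoˡ (inv j) (inv≥0 j) (nat-mono h))
    above : ∀ j → ∃ λ C → ∀ n → area (exhaustion m) n ≤ r + inv j + C * inv n
    above j = nat (suc (k j)) * C , λ n → ≤-trans (≤-reflexive (same j n)) (≤-trans
        (≤-resp (trans (sym (*-assoc _ _ _)) (trans (*-congʳ (nat*inv (k j))) (*-identityˡ _)))
          (trans (*-congˡ (+-congʳ (trans (reflexive (≡.cong (λ N → inv N * Concentric.A N-1 N n) (ℕₚ.+-comm (k j) (M j)))) (trans (*-congˡ (Concentric.A-N N-1 n)) (*-identityʳ _)))))
            (solve 4 (λ k i C n → k :* (i :+ C :* n) := k :* i :+ k :* C :* n) refl (nat (suc (k j))) (inv N) C (inv n)))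
          (*-monoˡ (nat (suc (k j))) (nat≥0 _) (h n)))
        (+-mono fits ≤-refl))
      where
      N-1 N : ℕ
      N-1 = suc j ℕ.+ m ℕ.* M j
      N = suc N-1
      open _≲_ (Concentric.increasing N-1 (k j) (M j) (ℕₚ.≤-reflexive (ℕₚ.+-comm (k j) (M j)))) renaming (constant to C; below to h)
      fits : nat (suc (k j)) * inv N ≤ r + inv j
      fits = cancel-nat-≤ N (≥0⇒≤ _ (+-nonNeg (+-nonNeg r≥0 (≤⇒≥0 (1≤inv*N j (ℕₚ.m≤n⇒m≤1+n (ℕₚ.m≤m+n (suc j) (m ℕ.* M j)))))) (inv≥0 j)) (begin
        r + (inv j * nat N - 1#) + inv j
          ≈⟨ solve 4 (λ r i N k → r :+ (i :* N :- con (+ 1)) :+ i := (N :+ con (+ 1)) :* (r :+ i) :- (r :* N :+ con (+ 1))) refl r (inv j) (nat N) (nat (k j)) ⟩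
        (nat N + 1#) * (r + inv j) - (r * nat N + 1#)
          ≈⟨ +-cong (*-congʳ (sym (nat-suc N))) (-‿cong (trans (+-congʳ (r*N j)) (trans (sym (nat-suc (k j))) (trans (sym (*-identityʳ _)) (*-congˡ (sym (nat*inv N))))))) ⟩
        nat (suc N) * (r + inv j) - nat (suc (k j)) * (nat (suc N) * inv N)
          ≈⟨ +-congˡ (-‿cong (solve 3 (λ k N i → k :* (N :* i) := N :* (k :* i)) refl (nat (suc (k j))) (nat (suc N)) (inv N))) ⟩
        nat (suc N) * (r + inv j) - nat (suc N) * (nat (suc (k j)) * inv N) ∎))
        where open ≈-Reasoning
    below : ∀ j m₀ → m ≡ suc m₀ → ∃ λ C → ∀ n → r ≤ area (exhaustion m) n + inv j + C * inv n
    below j m₀ ≡.refl = nat (suc i) * C , λ n → ≤-trans fits (≤-resp refl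
          (solve 3 (λ a e f → a :+ f :+ e := a :+ e :+ f) refl _ _ _)
          (+-mono (≤-resp (*-congˡ (trans (*-congˡ (trans (reflexive (≡.cong (λ l → Concentric.A N-1 (2 ℕ.+ l) n) i+M≡l)) (Concentric.A-N N-1 n))) (trans (*-identityʳ _) (reflexive (≡.cong inv i+M≡l)))))
             (trans (solve 5 (λ k i a C n → k :* (i :* a :+ C :* n) := (k :* i) :* a :+ k :* C :* n) refl (nat (suc i)) (inv i) (Concentric.A N-1 (2 ℕ.+ i) n) C (inv n))
               (+-congʳ (trans (*-congʳ (nat*inv i)) (trans (*-identityˡ _) (sym (same j n))))))
             (*-monoˡ (nat (suc i)) (nat≥0 _) (h n)))
            ≤-refl))
      where
      N-1 i l : ℕ
      N-1 = suc j ℕ.+ m ℕ.* M j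
      i = j ℕ.+ m₀ ℕ.* M j
      l = j ℕ.+ m ℕ.* M j
      i+M≡l : i ℕ.+ M j ≡ l
      i+M≡l = ≡.trans (ℕₚ.+-assoc j (m₀ ℕ.* M j) (M j)) (≡.cong (j ℕ.+_) (ℕₚ.+-comm (m₀ ℕ.* M j) (M j)))
      open _≲_ (Concentric.decreasing N-1 i (M j) (ℕₚ.≤-reflexive (≡.cong (2 ℕ.+_) i+M≡l))) renaming (constant to C; below to h)
      fits : r ≤ nat (suc i) * inv l + inv j
      fits = cancel-nat-≤ l (≥0⇒≤ _ (+-nonNeg (≤⇒≥0 (1≤inv*N j {suc l} (ℕ.s≤s (ℕₚ.m≤m+n j _)))) r≥0) (begin
        (inv j * nat (suc l) - 1#) + r
          ≈⟨ solve 3 (λ r e L → (e :* L :- con (+ 1)) :+ r := (r :* (L :+ con (+ 1)) :- con (+ 1)) :+ L :* e :- L :* r) refl r (inv j) (nat (suc l)) ⟩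
        (r * (nat (suc l) + 1#) - 1#) + nat (suc l) * inv j - nat (suc l) * r
          ≈⟨ +-congʳ (+-congʳ (trans (+-congʳ (trans (*-congˡ (sym (nat-suc (suc l)))) (trans (r*N j) (nat-suc (suc i))))) (solve 1 (λ a → a :+ con (+ 1) :- con (+ 1) := a) refl _))) ⟩
        nat (suc i) + nat (suc l) * inv j - nat (suc l) * r
          ≈⟨ +-congʳ (+-congʳ (trans (sym (*-identityʳ _)) (*-congˡ (sym (nat*inv l))))) ⟩
        nat (suc i) * (nat (suc l) * inv l) + nat (suc l) * inv j - nat (suc l) * r
          ≈⟨ +-congʳ (solve 4 (λ k L i e → k :* (L :* i) :+ L :* e := L :* (k :* i :+ e)) refl (nat (suc i)) (nat (suc l)) (inv l) (inv j)) ⟩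
        nat (suc l) * (nat (suc i) * inv l + inv j) - nat (suc l) * r ∎))
        where open ≈-Reasoning
    bounds : ∀ j m₀ → m ≡ m₀ → ∃ λ N → ∀ n → N ℕ.≤ n → Abs (area (exhaustion m) n - r) (2# * inv j)
    -- Level 0 leaves no room for i = k - 2; here the lower bound is the nonnegativity of the area.
    bounds j zero e = let C , a = above j; N , f = finer C j in N , λ n p → abs
      (≥0⇒≤ _ (+-nonNeg (≤⇒≥0 (a n)) (≤⇒≥0 (f n p))) (solve 4 (λ a r i c → r :+ i :+ c :- a :+ (i :- c) := con (+ 2) :* i :- (a :- r)) refl (area (exhaustion m) n) r (inv j) (C * inv n)))
      (≥0⇒≤ _ (+-nonNeg (+-nonNeg (area≥0 (exhaustion m) n) (*-nonNeg (ι≥0 (0≤+/ 2 0)) (inv≥0 j))) (≤-reflexive (sym r≈0)))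
        (trans (solve 3 (λ a i r → a :+ con (+ 2) :* i :+ (:- r) := con (+ 2) :* i :- :- (a :- r)) refl (area (exhaustion m) n) (inv j) r) refl))
      where
      r≈0 : - r ≈ 0#
      r≈0 = trans (-‿cong (trans (sym (nat*inv-suc m)) (trans (*-congʳ (trans (reflexive (≡.cong nat e)) nat-0)) (zeroˡ _)))) (solve 0 (:- con (+ 0) := con (+ 0)) refl)
    bounds j (suc m₀) e = let C , a = above j; D , b = below j m₀ e; N , f = finer C j; N′ , f′ = finer D j in N ℕ.⊔ N′ , λ n p → abs
      (≥0⇒≤ _ (+-nonNeg (≤⇒≥0 (a n)) (≤⇒≥0 (f n (ℕₚ.m⊔n≤o⇒m≤o N N′ p)))) (solve 4 (λ a r i c → r :+ i :+ c :- a :+ (i :- c) := con (+ 2) :* i :- (a :- r)) refl (area (exhaustion m) n) r (inv j) (C * inv n)))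
      (≥0⇒≤ _ (+-nonNeg (≤⇒≥0 (b n)) (≤⇒≥0 (f′ n (ℕₚ.m⊔n≤o⇒n≤o N N′ p)))) (solve 4 (λ a r i c → a :+ i :+ c :- r :+ (i :- c) := con (+ 2) :* i :- :- (a :- r)) refl (area (exhaustion m) n) r (inv j) (D * inv n)))

  -- Orthogonality of the monomials on discs

  zr-+ : ∀ i d x y → zr (i ℕ.+ d) x y ≈ zr i x y * zr d x y - zi i x y * zi d x y
  zi-+ : ∀ i d x y → zi (i ℕ.+ d) x y ≈ zr i x y * zi d x y + zi i x y * zr d x y
  zr-+ zero    d x y = solve 2 (λ a b → a := con (+ 1) :* a :- con (+ 0) :* b) refl (zr d x y) (zi d x y)
  zr-+ (suc i) d x y = trans (+-cong (*-congˡ (zr-+ i d x y)) (-‿cong (*-congˡ (zi-+ i d x y))))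
    (solve 6 (λ x y a b c e → x :* (a :* c :- b :* e) :- y :* (a :* e :+ b :* c) := (x :* a :- y :* b) :* c :- (x :* b :+ y :* a) :* e) refl
      x y (zr i x y) (zi i x y) (zr d x y) (zi d x y))
  zi-+ zero    d x y = solve 2 (λ a b → b := con (+ 1) :* b :+ con (+ 0) :* a) refl (zr d x y) (zi d x y)
  zi-+ (suc i) d x y = trans (+-cong (*-congˡ (zi-+ i d x y)) (*-congˡ (zr-+ i d x y)))
    (solve 6 (λ x y a b c e → x :* (a :* e :+ b :* c) :+ y :* (a :* c :- b :* e) := (x :* a :- y :* b) :* e :+ (x :* b :+ y :* a) :* c) refl
      x y (zr i x y) (zi i x y) (zr d x y) (zi d x y))

  ∣z^∣² : ∀ n x y → zr n x y * zr n x y + zi n x y * zi n x y ≈ (x * x + y * y) ^ᴷ n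
  ∣z^∣² zero    x y = solve 0 (con (+ 1) :* con (+ 1) :+ con (+ 0) :* con (+ 0) := con (+ 1)) refl
  ∣z^∣² (suc n) x y = trans
    (solve 4 (λ x y a b → (x :* a :- y :* b) :* (x :* a :- y :* b) :+ (x :* b :+ y :* a) :* (x :* b :+ y :* a) := (x :* x :+ y :* y) :* (a :* a :+ b :* b)) refl
      x y (zr n x y) (zi n x y)) (*-congˡ (∣z^∣² n x y))

  -- the contribution of z^n to ∫ 2 (1 - |z|²) |f|² dA over the disc |z|² ≤ r
  diskWeight : Carrier → ℕ → Carrier
  diskWeight r n = 2# * (r ^ᴷ suc n * inv n - r ^ᴷ suc (suc n) * inv (suc n))

  density : ℚ × ℚ → Carrier
  density p = 2# * (1# - norm p)

  module PowerSeries (a b : ℕ → Carrier) where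

    -- real and imaginary part of (a_n + i b_n) z^n
    termRe termIm : ℕ → ℚ × ℚ → Carrier
    termRe n p = a n * re^ n p - b n * im^ n p
    termIm n p = a n * im^ n p + b n * re^ n p

    partialRe partialIm : ℕ → ℚ × ℚ → Carrier
    partialRe N p = ∑ N (λ n → termRe n p)
    partialIm N p = ∑ N (λ n → termIm n p)

    ∣a∣² : ℕ → Carrier
    ∣a∣² n = a n * a n + b n * b n

    term-square : ∀ n p → termRe n p * termRe n p + termIm n p * termIm n p ≈ ∣a∣² n * norm p ^ᴷ n
    term-square n p@(x , y) = trans
      (solve 4 (λ a b c d → (a :* c :- b :* d) :* (a :* c :- b :* d) :+ (a :* d :+ b :* c) :* (a :* d :+ b :* c) := (a :* a :+ b :* b) :* (c :* c :+ d :* d)) refl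
        (a n) (b n) (re^ n p) (im^ n p)) (*-congˡ (∣z^∣² n (ι x) (ι y)))

    inner : ℕ → ℕ → ℚ × ℚ → Carrier
    inner i n p = termRe i p * termRe n p + termIm i p * termIm n p

    -- With α = a + ib, w = c + is and their primed counterparts, this is the real part of α′ w w′
    -- times the conjugate of α w, where w and its conjugate combine to |w|².
    conj-product : ∀ a b a′ b′ c s c′ s′ →
      (a * c - b * s) * (a′ * (c * c′ - s * s′) - b′ * (c * s′ + s * c′)) + (a * s + b * c) * (a′ * (c * s′ + s * c′) + b′ * (c * c′ - s * s′)) ≈
      (a * a′ + b * b′) * ((c * c + s * s) * c′) + (b * a′ - a * b′) * ((c * c + s * s) * s′)
    conj-product a b a′ b′ c s c′ s′ = begin
      p * (a′ * R - b′ * S) + q * (a′ * S + b′ * R)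
        ≈⟨ solve 6 (λ p q a b R S → p :* (a :* R :- b :* S) :+ q :* (a :* S :+ b :* R) := a :* (p :* R :+ q :* S) :- b :* (p :* S :- q :* R)) refl p q a′ b′ R S ⟩
      a′ * (p * R + q * S) - b′ * (p * S - q * R)
        ≈⟨ +-cong (*-congˡ (solve 6 (λ a b c s u v → (a :* c :- b :* s) :* (c :* u :- s :* v) :+ (a :* s :+ b :* c) :* (c :* v :+ s :* u) := a :* ((c :* c :+ s :* s) :* u) :+ b :* ((c :* c :+ s :* s) :* v)) refl a b c s c′ s′))
                  (-‿cong (*-congˡ (solve 6 (λ a b c s u v → (a :* c :- b :* s) :* (c :* v :+ s :* u) :- (a :* s :+ b :* c) :* (c :* u :- s :* v) := a :* ((c :* c :+ s :* s) :* v) :- b :* ((c :* c :+ s :* s) :* u)) refl a b c s c′ s′))) ⟩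
      a′ * (a * U + b * V) - b′ * (a * V - b * U)
        ≈⟨ solve 6 (λ a b a′ b′ U V → a′ :* (a :* U :+ b :* V) :- b′ :* (a :* V :- b :* U) := (a :* a′ :+ b :* b′) :* U :+ (b :* a′ :- a :* b′) :* V) refl a b a′ b′ U V ⟩
      (a * a′ + b * b′) * U + (b * a′ - a * b′) * V ∎
      where
      open ≈-Reasoning
      p q R S U V : Carrier
      p = a * c - b * s
      q = a * s + b * c
      R = c * c′ - s * s′
      S = c * s′ + s * c′
      U = (c * c + s * s) * c′
      V = (c * c + s * s) * s′

    inner-+ : ∀ i d p → inner i (i ℕ.+ d) p ≈
      (a i * a (i ℕ.+ d) + b i * b (i ℕ.+ d)) * (norm p ^ᴷ i * re^ d p) + (b i * a (i ℕ.+ d) - a i * b (i ℕ.+ d)) * (norm p ^ᴷ i * im^ d p)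
    inner-+ i d p@(x , y) = begin
      inner i n p
        ≈⟨ +-cong (*-congˡ (+-cong (*-congˡ (zr-+ i d X′ Y′)) (-‿cong (*-congˡ (zi-+ i d X′ Y′))))) (*-congˡ (+-cong (*-congˡ (zi-+ i d X′ Y′)) (*-congˡ (zr-+ i d X′ Y′)))) ⟩
      _ ≈⟨ conj-product (a i) (b i) (a n) (b n) (zr i X′ Y′) (zi i X′ Y′) (zr d X′ Y′) (zi d X′ Y′) ⟩
      _ ≈⟨ +-cong (*-congˡ (*-congʳ (∣z^∣² i X′ Y′))) (*-congˡ (*-congʳ (∣z^∣² i X′ Y′))) ⟩
      (a i * a n + b i * b n) * (norm p ^ᴷ i * re^ d p) + (b i * a n - a i * b n) * (norm p ^ᴷ i * im^ d p) ∎
      where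
      open ≈-Reasoning
      n : ℕ
      n = i ℕ.+ d
      X′ Y′ : Carrier
      X′ = ι x
      Y′ = ι y

    ∣partial∣² : ℕ → ℚ × ℚ → Carrier
    ∣partial∣² N p = partialRe N p * partialRe N p + partialIm N p * partialIm N p

  module Orthogonality (m : ℕ) where

    r : ℚ
    r = exhaustion m

    R : Carrier
    R = ι r

    r≤1 : R ≤ 1#
    r≤1 = ι-mono (ℚₚ.<⇒≤ (exhaustion<1 m))

    open Moments r r≤1 using (moment-re; moment-im; moment-radial)

    -- The factor 2 (1 - |z|²) turns a moment into twice the difference of two consecutive moments,
    -- so the weighted measure follows from the unweighted one.
    Lim-density : ∀ (φ : ℕ → ℚ × ℚ → Carrier) (l : ℕ → Carrier) → (∀ j p → φ (suc j) p ≈ norm p * φ j p) →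
      (∀ j → Lim (avg r (φ j)) (l j)) → ∀ j → Lim (avg r (λ p → density p * φ j p)) (2# * (l j - l (suc j)))
    Lim-density φ l e h j = Lim-cong (λ n → begin
        2# * (avg r (φ j) n - avg r (φ (suc j)) n)           ≈⟨ *-congˡ (sym (avg-- r _ _ n)) ⟩
        2# * avg r (λ p → φ j p - φ (suc j) p) n             ≈⟨ sym (avg-* r _ _ n) ⟩
        avg r (λ p → 2# * (φ j p - φ (suc j) p)) n           ≈⟨ avg-cong r n (λ p → trans (*-congˡ (+-congˡ (-‿cong (e j p))))
          (solve 2 (λ t a → con (+ 2) :* (a :- t :* a) := con (+ 2) :* (con (+ 1) :- t) :* a) refl (norm p) (φ j p))) ⟩
        avg r (λ p → density p * φ j p) n ∎) refl (Lim-* 2# (Lim-- (h j) (h (suc j))))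
      where open ≈-Reasoning

    Lim-radial : ∀ j → Lim (avg r (λ p → norm p ^ᴷ j)) (R ^ᴷ suc j * inv j)
    Lim-radial j = Lim-cong
      (λ n → solve 2 (λ a b → a :- b :+ b := a) refl _ _)
      (trans (+-identityˡ _) (trans (*-congˡ (sym (ι-exhaustion m))) (solve 3 (λ s i r → s :* i :* r := r :* s :* i) refl (R ^ᴷ j) (inv j) R)))
      (Lim-+ (O⇒Lim (moment-radial j)) (Lim-* (R ^ᴷ j * inv j) (area-limit m)))

    Lim-diagonal : ∀ j → Lim (avg r (λ p → density p * norm p ^ᴷ j)) (diskWeight R j)
    Lim-diagonal = Lim-density (λ j p → norm p ^ᴷ j) _ (λ j p → refl) Lim-radial

    Lim-re : ∀ j d → Lim (avg r (λ p → density p * (norm p ^ᴷ j * re^ (suc d) p))) 0#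
    Lim-re j d = Lim-cong (λ _ → refl) (solve 0 (con (+ 2) :* (con (+ 0) :- con (+ 0)) := con (+ 0)) refl)
      (Lim-density (λ j p → norm p ^ᴷ j * re^ (suc d) p) _ (λ j p → *-assoc _ _ _) (λ j → O⇒Lim (moment-re j d)) j)

    Lim-im : ∀ j d → Lim (avg r (λ p → density p * (norm p ^ᴷ j * im^ (suc d) p))) 0#
    Lim-im j d = Lim-cong (λ _ → refl) (solve 0 (con (+ 2) :* (con (+ 0) :- con (+ 0)) := con (+ 0)) refl)
      (Lim-density (λ j p → norm p ^ᴷ j * im^ (suc d) p) _ (λ j p → *-assoc _ _ _) (λ j → O⇒Lim (moment-im j d)) j)

    module _ (a b : ℕ → Carrier) where

      open PowerSeries a b

      Lim-inner : ∀ i n → i ℕ.< n → Lim (avg r (λ p → density p * inner i n p)) 0#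
      Lim-inner i n i<n = go n (n ℕ.∸ suc i) (≡.trans (ℕₚ.+-suc i _) (ℕₚ.m+[n∸m]≡n i<n))
        where
        open ≈-Reasoning
        go : ∀ n d → i ℕ.+ suc d ≡ n → Lim (avg r (λ p → density p * inner i n p)) 0#
        go _ d ≡.refl = Lim-cong (λ k → begin
            c * avg r (λ p → density p * (norm p ^ᴷ i * re^ (suc d) p)) k + s * avg r (λ p → density p * (norm p ^ᴷ i * im^ (suc d) p)) k
              ≈⟨ +-cong (sym (avg-* r c _ k)) (sym (avg-* r s _ k)) ⟩
            avg r (λ p → c * (density p * (norm p ^ᴷ i * re^ (suc d) p))) k + avg r (λ p → s * (density p * (norm p ^ᴷ i * im^ (suc d) p))) k
              ≈⟨ sym (avg-+ r _ _ k) ⟩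
            avg r (λ p → c * (density p * (norm p ^ᴷ i * re^ (suc d) p)) + s * (density p * (norm p ^ᴷ i * im^ (suc d) p))) k
              ≈⟨ avg-cong r k (λ p → trans (solve 5 (λ c s w u v → c :* (w :* u) :+ s :* (w :* v) := w :* (c :* u :+ s :* v)) refl c s (density p) _ _) (*-congˡ (sym (inner-+ i (suc d) p)))) ⟩
            avg r (λ p → density p * inner i (i ℕ.+ suc d) p) k ∎)
          (solve 2 (λ c s → c :* con (+ 0) :+ s :* con (+ 0) := con (+ 0)) refl c s)
          (Lim-+ (Lim-* c (Lim-re i d)) (Lim-* s (Lim-im i d)))
          where
          c s : Carrier
          c = a i * a (i ℕ.+ suc d) + b i * b (i ℕ.+ suc d)
          s = b i * a (i ℕ.+ suc d) - a i * b (i ℕ.+ suc d)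

      -- By induction on N: adding a term to the partial sum adds its square and twice its inner
      -- products with the earlier terms, and these tend to 0 by `Lim-inner`.
      Lim-partial : ∀ N → Lim (avg r (λ p → density p * ∣partial∣² N p)) (∑ N (λ n → ∣a∣² n * diskWeight R n))
      Lim-partial zero = Lim-cong (λ k → trans (sym (zeroˡ _)) (trans (sym (avg-* r 0# (λ _ → 0#) k)) (avg-cong r k λ p →
        solve 1 (λ d → con (+ 0) :* con (+ 0) := d :* (con (+ 0) :* con (+ 0) :+ con (+ 0) :* con (+ 0))) refl (density p)))) refl (Lim-const 0#)
      Lim-partial (suc N) = Lim-cong (λ k → begin
          avg r (λ p → density p * ∣partial∣² N p) k + (2# * ∑ N (λ i → avg r (λ p → density p * inner i N p) k) + ∣a∣² N * avg r (λ p → density p * norm p ^ᴷ N) k)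
            ≈⟨ +-congˡ (+-cong (*-congˡ (sym (avg-∑ r N _ k))) (sym (avg-* r _ _ k))) ⟩
          avg r (λ p → density p * ∣partial∣² N p) k + (2# * avg r (λ p → ∑ N (λ i → density p * inner i N p)) k + avg r (λ p → ∣a∣² N * (density p * norm p ^ᴷ N)) k)
            ≈⟨ +-congˡ (trans (+-congʳ (sym (avg-* r _ _ k))) (sym (avg-+ r _ _ k))) ⟩
          avg r (λ p → density p * ∣partial∣² N p) k + avg r (λ p → 2# * ∑ N (λ i → density p * inner i N p) + ∣a∣² N * (density p * norm p ^ᴷ N)) k
            ≈⟨ sym (avg-+ r _ _ k) ⟩
          avg r (λ p → density p * ∣partial∣² N p + (2# * ∑ N (λ i → density p * inner i N p) + ∣a∣² N * (density p * norm p ^ᴷ N))) k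
            ≈⟨ avg-cong r k expand ⟩
          avg r (λ p → density p * ∣partial∣² (suc N) p) k ∎)
        (trans (+-congˡ (trans (+-congʳ (trans (*-congˡ (∑-0 N λ _ _ → refl)) (zeroʳ 2#))) (+-identityˡ _))) refl)
        (Lim-+ (Lim-partial N) (Lim-+ (Lim-* 2# (crossing N ℕₚ.≤-refl)) (Lim-* (∣a∣² N) (Lim-diagonal N))))
        where
        open ≈-Reasoning
        crossing : ∀ M → M ℕ.≤ N → Lim (λ k → ∑ M (λ i → avg r (λ p → density p * inner i N p) k)) (∑ M (λ _ → 0#))
        crossing zero    h = Lim-const 0#
        crossing (suc M) h = Lim-+ (crossing M (ℕₚ.<⇒≤ h)) (Lim-inner M N h)
        pull : ∀ p → ∑ N (λ i → inner i N p) ≈ partialRe N p * termRe N p + partialIm N p * termIm N p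
        pull p = trans (∑-+ N _ _) (+-cong (trans (∑-cong′ N λ i → *-comm _ _) (trans (∑-* N _ _) (*-comm _ _)))
                                           (trans (∑-cong′ N λ i → *-comm _ _) (trans (∑-* N _ _) (*-comm _ _))))
        expand : ∀ p → density p * ∣partial∣² N p + (2# * ∑ N (λ i → density p * inner i N p) + ∣a∣² N * (density p * norm p ^ᴷ N)) ≈ density p * ∣partial∣² (suc N) p
        expand p = trans (+-congˡ (+-cong (*-congˡ (trans (∑-* N _ _) (*-congˡ (pull p)))) (trans (solve 3 (λ a d t → a :* (d :* t) := d :* (a :* t)) refl _ _ _) (*-congˡ (sym (term-square N p))))))
          (solve 5 (λ w u v c s → w :* (u :* u :+ v :* v) :+ (con (+ 2) :* (w :* (u :* c :+ v :* s)) :+ w :* (c :* c :+ s :* s)) := w :* ((u :+ c) :* (u :+ c) :+ (v :+ s) :* (v :+ s))) refl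
            (density p) (partialRe N p) (partialIm N p) (termRe N p) (termIm N p))

  -- Geometric majorants

  Lim-bounded : ∀ {x l} → Lim x l → ∃ λ B → ∀ n → Abs (x n) (nat B)
  Lim-bounded {x} {l} (lim h) = go (h 0)
    where
    initial : ∀ N → ∃ λ B → ∀ n → n ℕ.< N → Abs (x n) (nat B)
    initial zero    = 0 , λ _ ()
    initial (suc N) = let B , b = initial N; C , c = abs-bound (x N) in B ℕ.+ C , λ n n<N → case n (ℕₚ.m≤n⇒m<n∨m≡n (ℕₚ.≤-pred n<N)) B C b c
      where
      case : ∀ n → n ℕ.< N ⊎ n ≡ N → ∀ B C → (∀ n → n ℕ.< N → Abs (x n) (nat B)) → Abs (x N) (nat C) → Abs (x n) (nat (B ℕ.+ C))
      case n (inj₁ p)      B C b c = Abs-weaken (nat-mono (ℕₚ.m≤m+n B C)) (b n p)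
      case n (inj₂ ≡.refl) B C b c = Abs-weaken (nat-mono (ℕₚ.m≤n+m C B)) c
    go : (∃ λ N → ∀ n → N ℕ.≤ n → Abs (x n - l) (inv 0)) → ∃ λ B → ∀ n → Abs (x n) (nat B)
    go (N , tail) = let B , b = initial N; C , c = abs-bound l in B ℕ.+ (1 ℕ.+ C) , λ n → case n (ℕₚ.<-≤-connex n N) B C b c
      where
      case : ∀ n → n ℕ.< N ⊎ N ℕ.≤ n → ∀ B C → (∀ n → n ℕ.< N → Abs (x n) (nat B)) → Abs l (nat C) → Abs (x n) (nat (B ℕ.+ (1 ℕ.+ C)))
      case n (inj₁ p) B C b c = Abs-weaken (nat-mono (ℕₚ.m≤m+n B (1 ℕ.+ C))) (b n p)
      case n (inj₂ p) B C b c = Abs-weaken (nat-mono (ℕₚ.m≤n+m (1 ℕ.+ C) B)) (Abs-resp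
        (solve 2 (λ x l → x :- l :+ l := x) refl (x n) l) (trans (+-congʳ (trans inv-0 (sym nat-1))) (sym (nat-+ 1 C))) (Abs-+ (tail n p) c))

  -- `Γ` stands for 1/(1 - ρ); it is a parameter because the axioms provide no reciprocals.
  module Geometric (ρ Γ : Carrier) (ρ≥0 : ρ ≥0) (Γ≥0 : Γ ≥0) (inverse : (1# - ρ) * Γ ≈ 1#) where

    geometric-sum : ∀ N d → ∑ d (λ i → ρ ^ᴷ (N ℕ.+ i)) ≈ (ρ ^ᴷ N - ρ ^ᴷ (N ℕ.+ d)) * Γ
    geometric-sum N zero = trans (sym (zeroˡ Γ)) (*-congʳ (trans (sym (-‿inverseʳ (ρ ^ᴷ N))) (+-congˡ (-‿cong (reflexive (≡.cong (ρ ^ᴷ_) (≡.sym (ℕₚ.+-identityʳ N))))))))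
    geometric-sum N (suc d) = begin
      ∑ d (λ i → ρ ^ᴷ (N ℕ.+ i)) + s                  ≈⟨ +-cong (geometric-sum N d) (trans (sym (*-identityʳ s)) (*-congˡ (sym inverse))) ⟩
      (ρ ^ᴷ N - s) * Γ + s * ((1# - ρ) * Γ)            ≈⟨ solve 4 (λ a s r g → (a :- s) :* g :+ s :* ((con (+ 1) :- r) :* g) := (a :- r :* s) :* g) refl (ρ ^ᴷ N) s ρ Γ ⟩
      (ρ ^ᴷ N - ρ * s) * Γ                             ≈⟨ *-congʳ (+-congˡ (-‿cong (reflexive (≡.cong (ρ ^ᴷ_) (≡.sym (ℕₚ.+-suc N d)))))) ⟩
      (ρ ^ᴷ N - ρ ^ᴷ (N ℕ.+ suc d)) * Γ                ∎
      where
      open ≈-Reasoning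
      s : Carrier
      s = ρ ^ᴷ (N ℕ.+ d)

    geometric-tail : ∀ N d → ∑ d (λ i → ρ ^ᴷ (N ℕ.+ i)) ≤ ρ ^ᴷ N * Γ
    geometric-tail N d = ≤-trans (≤-reflexive (geometric-sum N d)) (≥0⇒≤ _ (*-nonNeg (^-≥0 (N ℕ.+ d) ρ≥0) Γ≥0)
      (solve 3 (λ a b g → b :* g := a :* g :- (a :- b) :* g) refl _ _ _))

    module _ (ρ≤1 : ρ ≤ 1#) where

      ^-anti : ∀ m d → ρ ^ᴷ (m ℕ.+ d) ≤ ρ ^ᴷ m
      ^-anti m zero    = ≤-reflexive (reflexive (≡.cong (ρ ^ᴷ_) (ℕₚ.+-identityʳ m)))
      ^-anti m (suc d) = ≤-trans (≤-reflexive (reflexive (≡.cong (ρ ^ᴷ_) (ℕₚ.+-suc m d))))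
        (≤-trans (≤-resp refl (*-identityˡ _) (*-monoʳ _ (^-≥0 (m ℕ.+ d) ρ≥0) ρ≤1)) (^-anti m d))

      -- The powers up to N are all at least ρ^N, so N + 1 times ρ^N is bounded by the geometric
      -- sum. This slow rate suffices and spares logarithms.
      power-decay : ∀ N → ρ ^ᴷ N ≤ Γ * inv N
      power-decay N = cancel-nat-≤ N (≤-trans
        (≤-trans (≤-reflexive (sym (∑-const (suc N) _))) (∑-mono (suc N) λ i i<N → ≤-trans (≤-reflexive (reflexive (≡.cong (ρ ^ᴷ_) (≡.sym (ℕₚ.m+[n∸m]≡n (ℕₚ.≤-pred i<N)))))) (^-anti i _)))
        (≤-trans (geometric-tail 0 (suc N)) (≤-reflexive (trans (*-identityˡ Γ) (trans (sym (*-identityʳ Γ)) (trans (*-congˡ (sym (nat*inv N)))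
          (solve 3 (λ g n i → g :* (n :* i) := n :* (g :* i)) refl Γ _ _)))))))

      Lim-power : ∀ C → C ≥0 → ∀ k → ∃ λ N → ∀ n → N ℕ.≤ n → C * ρ ^ᴷ n ≤ inv k
      Lim-power C C≥0 k = let N , f = finer (C * Γ) k in N , λ n h →
        ≤-trans (*-monoˡ C C≥0 (power-decay n)) (≤-trans (≤-reflexive (sym (*-assoc C Γ _))) (f n h))

      module _ (C : Carrier) (C≥0 : C ≥0) (x : ℕ → Carrier) (h : ∀ n → Abs (x n) (C * ρ ^ᴷ n)) where

        sum-tail : ∀ N n → N ℕ.≤ n → Abs (∑ n x - ∑ N x) (C * Γ * ρ ^ᴷ N)
        sum-tail N n N≤n = go (n ℕ.∸ N) n (ℕₚ.m+[n∸m]≡n N≤n)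
          where
          go : ∀ d n → N ℕ.+ d ≡ n → Abs (∑ n x - ∑ N x) (C * Γ * ρ ^ᴷ N)
          go d _ ≡.refl = Abs-respˡ (trans (solve 2 (λ a b → b := a :+ b :- a) refl _ _) (+-congʳ (sym (∑-split N d x))))
            (Abs-weaken (≤-trans (≤-reflexive (∑-* d C _)) (≤-trans (*-monoˡ C C≥0 (geometric-tail N d))
              (≤-reflexive (solve 3 (λ c p g → c :* (p :* g) := c :* g :* p) refl C _ Γ)))) (∑-Abs d λ i _ → h (N ℕ.+ i)))

        series-limit : ∃ (Lim (λ N → ∑ N x))
        series-limit = Lim-exists 1# λ k → let N , f = Lim-power (C * Γ) (*-nonNeg C≥0 Γ≥0) k in
          N , λ n N≤n → Abs-weaken (≤-trans (f N ℕₚ.≤-refl) (≤-reflexive (sym (*-identityˡ _)))) (sum-tail N n N≤n)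

        series-tail : ∀ {l} → Lim (λ N → ∑ N x) l → ∀ N → Abs (l - ∑ N x) (C * Γ * ρ ^ᴷ N)
        series-tail p N = Lim-Abs (Lim-- p (Lim-const (∑ N x))) N (sum-tail N)

        partial-bound : ∀ N → Abs (∑ N x) (C * Γ)
        partial-bound N = Abs-resp (solve 1 (λ a → a :- con (+ 0) := a) refl _) (*-identityʳ _) (sum-tail 0 N ℕ.z≤n)

        series-bound : ∀ {l} → Lim (λ N → ∑ N x) l → Abs l (C * Γ)
        series-bound p = Abs-resp (solve 1 (λ a → a :- con (+ 0) := a) refl _) (*-identityʳ _) (series-tail p 0)

  abstract
    area≤1 : ∀ r → ι r ≤ 1# → ∀ n → area r n ≤ 1#
    area≤1 r r≤1 n = ≤-resp refl (area-1 n) (*-monoˡ (κ n) (κ≥0 n) (sum-mono (grid n) λ p →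
      ≤-resp (sym (*-identityʳ _)) (sym (*-identityʳ _)) (larger p)))
      where
      larger : ∀ p → χ r p ≤ χ 1ℚ p
      larger p with side? r p | side? 1ℚ p
      ... | outside e _ | _ = ≤-trans (≤-reflexive e) (χ≥0 1ℚ p)
      ... | inside e _ | inside f _ = ≤-reflexive (trans e (sym f))
      ... | inside e h | outside f k = ⊥-elim (k (ℚₚ.≤-trans h (ι-cancel r≤1)))

    avg-Abs : ∀ r → ι r ≤ 1# → ∀ φ ψ c n → c ≥0 → (∀ p → ∣ p ∣²ℚ ℚ.≤ r → Abs (φ p - ψ p) c) → Abs (avg r φ n - avg r ψ n) c
    avg-Abs r r≤1 φ ψ c n c≥0 h = Abs-resp (avg-- r φ ψ n) refl (Abs-weaken total
      (Abs-scale (κ n) (κ≥0 n) (sum-Abs (grid n) {λ p → χ r p * (φ p - ψ p)} {λ p → χ r p * c} pointwise)))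
      where
      total : κ n * sum (grid n) (λ p → χ r p * c) ≤ c
      total = ≤-trans (≤-reflexive (trans (avg-cong r n λ p → sym (*-identityʳ c)) (avg-* r c (λ _ → 1#) n)))
        (≤-resp refl (*-identityʳ c) (*-monoˡ c c≥0 (area≤1 r r≤1 n)))
      pointwise : ∀ p → Abs (χ r p * (φ p - ψ p)) (χ r p * c)
      pointwise p with side? r p
      ... | inside e i  = Abs-scale (χ r p) (χ≥0 r p) (h p i)
      ... | outside e _ = Abs-0 (trans (*-congʳ e) (zeroˡ _)) (≤-reflexive (sym (trans (*-congʳ e) (zeroˡ _))))

  -- Parseval's formula on discs

  module Parseval (a b : ℕ → Carrier) where

    open PowerSeries a b public

    record Sum (p : ℚ × ℚ) (v w : Carrier) : Set where
      constructor sums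
      field
        real      : Lim (λ N → partialRe N p) v
        imaginary : Lim (λ N → partialIm N p) w
    open Sum public

    -- Restricted to rational points, since the Riemann sums sample nothing else.
    Convergent : Set
    Convergent = ∀ m p → ∣ p ∣²ℚ ℚ.≤ exhaustion m → ∃ λ v → ∃ λ w → Sum p v w

    module Disc (convergent : Convergent) (m : ℕ) where

      open Orthogonality m public using (r; R; r≤1; Lim-partial)

      -- ρ = 1 - 1/(4(m+1)), so that ρ⁴ ≥ 1 - 1/(m+1) = r
      M : ℕ
      M = 3 ℕ.+ 4 ℕ.* m

      ρ ρ⁻¹ Γ : Carrier
      ρ = ι (exhaustion M)
      ρ⁻¹ = nat (suc M) * inv (2 ℕ.+ 4 ℕ.* m)
      Γ = nat (suc M)

      ρ≈ : ρ ≈ 1# - inv M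
      ρ≈ = ι-exhaustion M

      ρ≥0 : ρ ≥0
      ρ≥0 = ≥0-resp (sym ρ≈) (≤⇒≥0 (inv≤1 M))

      ρ≤1 : ρ ≤ 1#
      ρ≤1 = ι-mono (ℚₚ.<⇒≤ (exhaustion<1 M))

      Γ-inverse : (1# - ρ) * Γ ≈ 1#
      Γ-inverse = trans (*-congʳ (+-congˡ (-‿cong ρ≈))) (trans (solve 2 (λ i g → (con (+ 1) :- (con (+ 1) :- i)) :* g := g :* i) refl _ _) (nat*inv M))

      ρ*ρ⁻¹ : ρ * ρ⁻¹ ≈ 1#
      ρ*ρ⁻¹ = begin
        ρ * (nat (suc M) * inv (2 ℕ.+ 4 ℕ.* m))                    ≈⟨ *-congʳ (trans ρ≈ (sym (nat*inv-suc M))) ⟩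
        nat M * inv M * (nat (suc M) * inv (2 ℕ.+ 4 ℕ.* m))        ≈⟨ solve 4 (λ a i b j → a :* i :* (b :* j) := (b :* i) :* (a :* j)) refl _ _ _ _ ⟩
        (nat (suc M) * inv M) * (nat M * inv (2 ℕ.+ 4 ℕ.* m))      ≈⟨ *-cong (nat*inv M) (nat*inv _) ⟩
        1# * 1#                                                    ≈⟨ *-identityˡ 1# ⟩
        1# ∎
        where open ≈-Reasoning

      4*inv : 4# * inv M ≈ inv m
      4*inv = begin
        4# * inv M                                  ≈⟨ trans (sym (*-identityʳ _)) (*-congˡ (sym (nat*inv m))) ⟩
        4# * inv M * (nat (suc m) * inv m)          ≈⟨ solve 4 (λ c i a j → c :* i :* (a :* j) := (c :* a :* i) :* j) refl 4# (inv M) (nat (suc m)) (inv m) ⟩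
        4# * nat (suc m) * inv M * inv m            ≈⟨ *-congʳ (trans (*-congʳ (trans (*-congʳ (reflexive (≡.sym (nat-ι 4)))) (trans (sym (nat-* 4 (suc m))) (reflexive (≡.cong nat (ℕₚ.*-suc 4 m)))))) (nat*inv M)) ⟩
        1# * inv m                                  ≈⟨ *-identityˡ _ ⟩
        inv m ∎
        where open ≈-Reasoning

      R≤ρ⁴ : R ≤ (ρ * ρ) * (ρ * ρ)
      R≤ρ⁴ = ≥0⇒≤ _ (*-nonNeg (square-nonNeg (inv M)) (+-nonNeg (ι≥0 (0≤+/ 2 0)) (square-nonNeg (2# - inv M))))
        (trans (solve 1 (λ e → (e :* e) :* (con (+ 2) :+ (con (+ 2) :- e) :* (con (+ 2) :- e)) :=
                 ((con (+ 1) :- e) :* (con (+ 1) :- e)) :* ((con (+ 1) :- e) :* (con (+ 1) :- e)) :- (con (+ 1) :- con (+ 4) :* e)) refl (inv M))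
          (+-cong (*-cong (*-cong (sym ρ≈) (sym ρ≈)) (*-cong (sym ρ≈) (sym ρ≈))) (-‿cong (trans (+-congˡ (-‿cong 4*inv)) (sym (ι-exhaustion m))))))

      ρ-point : ℚ × ℚ
      ρ-point = exhaustion M , 0ℚ

      ρ-powers : ∀ n → re^ n ρ-point ≈ ρ ^ᴷ n × im^ n ρ-point ≈ 0#
      ρ-powers zero    = refl , refl
      ρ-powers (suc n) = let p , q = ρ-powers n in
        trans (+-cong (*-congˡ p) (-‿cong (zeroˡ _))) (solve 1 (λ a → a :- con (+ 0) := a) refl _) ,
        trans (+-cong (*-congˡ q) (zeroˡ _)) (solve 1 (λ a → a :* con (+ 0) :+ con (+ 0) := con (+ 0)) refl ρ)

      ρ-inside : ∣ ρ-point ∣²ℚ ℚ.≤ exhaustion M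
      ρ-inside = ι-cancel (≤-resp (sym (trans (ι-norm ρ-point) (solve 1 (λ a → a :* a :+ con (+ 0) :* con (+ 0) := a :* a) refl ρ))) (*-identityʳ ρ)
        (*-monoˡ ρ ρ≥0 ρ≤1))

      termRe-ρ : ∀ n → termRe n ρ-point ≈ a n * ρ ^ᴷ n
      termRe-ρ n = trans (+-cong (*-congˡ (proj₁ (ρ-powers n))) (-‿cong (*-congˡ (proj₂ (ρ-powers n))))) (solve 3 (λ a b r → a :* r :- b :* con (+ 0) := a :* r) refl _ _ _)

      termIm-ρ : ∀ n → termIm n ρ-point ≈ b n * ρ ^ᴷ n
      termIm-ρ n = trans (+-cong (*-congˡ (proj₂ (ρ-powers n))) (*-congˡ (proj₁ (ρ-powers n)))) (solve 3 (λ a b r → a :* con (+ 0) :+ b :* r := b :* r) refl _ _ _)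

      term-bounded : ∀ {x l} → Lim (λ N → ∑ N x) l → ∃ λ B → ∀ n → Abs (x n) (nat B)
      term-bounded {x} p = let B , b = Lim-bounded p in B ℕ.+ B , λ n →
        Abs-resp (solve 2 (λ s t → s :+ t :- s := t) refl _ _) (sym (nat-+ B B)) (Abs-- (b (suc n)) (b n))

      -- Convergence at the rational point ρ bounds the real and imaginary parts of a_n ρ^n. The two
      -- bounds are added, and `K` exceeds the sum by one so that `inv K-1` is its reciprocal.
      K-1 : ℕ
      K-1 = let _ , _ , s = convergent M ρ-point ρ-inside in
        proj₁ (term-bounded (real s)) ℕ.+ proj₁ (term-bounded (imaginary s))

      K : Carrier
      K = nat (suc K-1)

      ∣a∣²ρ²-bound : ∀ n → ∣a∣² n * (ρ ^ᴷ n * ρ ^ᴷ n) ≤ K * K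
      ∣a∣²ρ²-bound n = let _ , _ , s = convergent M ρ-point ρ-inside
                           A , α = term-bounded (real s)
                           B , β = term-bounded (imaginary s)
        in ≤-trans (≤-resp
          (trans (+-cong (*-cong (termRe-ρ n) (termRe-ρ n)) (*-cong (termIm-ρ n) (termIm-ρ n)))
            (solve 3 (λ a b r → (a :* r) :* (a :* r) :+ (b :* r) :* (b :* r) := (a :* a :+ b :* b) :* (r :* r)) refl (a n) (b n) (ρ ^ᴷ n)))
          refl (+-mono (upper (Abs-* (α n) (α n))) (upper (Abs-* (β n) (β n)))))
        (≥0⇒≤ _ (+-nonNeg (+-nonNeg (*-nonNeg (ι≥0 (0≤+/ 2 0)) (*-nonNeg (nat≥0 A) (nat≥0 B))) 1≥0) (*-nonNeg (ι≥0 (0≤+/ 2 0)) (+-nonNeg (nat≥0 A) (nat≥0 B))))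
          (trans (solve 2 (λ a b → con (+ 2) :* (a :* b) :+ con (+ 1) :+ con (+ 2) :* (a :+ b) := (a :+ b :+ con (+ 1)) :* (a :+ b :+ con (+ 1)) :- (a :* a :+ b :* b)) refl (nat A) (nat B))
            (+-congʳ (*-cong K≈ K≈))))
        where
        K≈ : ∀ {A B} → nat A + nat B + 1# ≈ nat (suc (A ℕ.+ B))
        K≈ {A} {B} = trans (+-congʳ (sym (nat-+ A B))) (sym (nat-suc _))

      ρ^4 : ∀ n → ((ρ * ρ) * (ρ * ρ)) ^ᴷ n ≈ (ρ ^ᴷ n * ρ ^ᴷ n) * (ρ ^ᴷ n * ρ ^ᴷ n)
      ρ^4 n = trans (*-^ (ρ * ρ) (ρ * ρ) n) (*-cong (*-^ ρ ρ n) (*-^ ρ ρ n))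

      ∣a∣²≥0 : ∀ n → ∣a∣² n ≥0
      ∣a∣²≥0 n = +-nonNeg (square-nonNeg (a n)) (square-nonNeg (b n))

      R≥0 : R ≥0
      R≥0 = ≥0-resp (sym (ι-exhaustion m)) (≤⇒≥0 (inv≤1 m))

      norm≥0 : ∀ p → norm p ≥0
      norm≥0 (x , y) = +-nonNeg (square-nonNeg (ι x)) (square-nonNeg (ι y))

      -- Bounded terms at ρ give |a_n|² ρ^(2n) ≤ K². For t ≤ r ≤ ρ⁴ a further factor ρ^(2n) remains,
      -- which makes the bound the square of K ρ^n. The fourth power is there so that no root of r
      -- has to be taken.
      power-bound : ∀ t n → t ≥0 → t ≤ R → ∣a∣² n * t ^ᴷ n ≤ (K * ρ ^ᴷ n) * (K * ρ ^ᴷ n)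
      power-bound t n t≥0 t≤R = ≤-trans
        (*-monoˡ _ (∣a∣²≥0 n) (≤-trans (^-mono n t≥0 (≤-trans t≤R R≤ρ⁴)) (≤-reflexive (ρ^4 n))))
        (≤-resp (*-assoc _ _ _) (solve 2 (λ k r → k :* k :* (r :* r) := (k :* r) :* (k :* r)) refl K (ρ ^ᴷ n))
          (*-monoʳ _ (square-nonNeg (ρ ^ᴷ n)) (∣a∣²ρ²-bound n)))

      majorant : ∀ x n → x * x ≤ (K * ρ ^ᴷ n) * (K * ρ ^ᴷ n) → Abs x (K * ρ ^ᴷ n)
      majorant x n = Abs-square x (K * ρ ^ᴷ n) (inv K-1 * ρ⁻¹ ^ᴷ n) (*-nonNeg (inv≥0 K-1) (^-≥0 n (*-nonNeg (nat≥0 _) (inv≥0 _))))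
        (trans (solve 4 (λ k r j s → k :* r :* (j :* s) := (k :* j) :* (r :* s)) refl K _ _ _)
          (trans (*-cong (nat*inv K-1) (trans (sym (*-^ ρ ρ⁻¹ n)) (trans (^-cong n ρ*ρ⁻¹) (1^ n)))) (*-identityˡ 1#)))
        where
        1^ : ∀ n → 1# ^ᴷ n ≈ 1#
        1^ zero    = refl
        1^ (suc n) = trans (*-identityˡ _) (1^ n)

      term-majorant : ∀ p n → ∣ p ∣²ℚ ℚ.≤ r → Abs (termRe n p) (K * ρ ^ᴷ n) × Abs (termIm n p) (K * ρ ^ᴷ n)
      term-majorant p n i =
        majorant _ n (≤-trans (≤-trans (x≤x+ (square-nonNeg (termIm n p))) (≤-reflexive (term-square n p))) (power-bound (norm p) n (norm≥0 p) (inside-≤ r p i))) ,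
        majorant _ n (≤-trans (≤-trans (≤-trans (x≤x+ (square-nonNeg (termRe n p))) (≤-reflexive (+-comm _ _))) (≤-reflexive (term-square n p))) (power-bound (norm p) n (norm≥0 p) (inside-≤ r p i)))

      open Geometric ρ Γ ρ≥0 (nat≥0 _) Γ-inverse

      K≥0 : K ≥0
      K≥0 = nat≥0 _

      L C : Carrier
      L = K * Γ
      -- From v² - s² = (v - s)(v + s) with |v - s| ≤ L ρ^N and |v + s| ≤ 2 L, once for the real and
      -- once for the imaginary part, with a density of at most 2.
      C = 2# * (2# * (L * (L + L)))

      L≥0 : L ≥0
      L≥0 = *-nonNeg K≥0 (nat≥0 _)

      2≥0 : 2# ≥0
      2≥0 = ι≥0 (0≤+/ 2 0)

      C≥0 : C ≥0
      C≥0 = *-nonNeg 2≥0 (*-nonNeg 2≥0 (*-nonNeg L≥0 (+-nonNeg L≥0 L≥0)))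

      density-bound : ∀ p → ∣ p ∣²ℚ ℚ.≤ r → Abs (density p) 2#
      density-bound p i = Abs-nonNeg (*-nonNeg 2≥0 (≤⇒≥0 (≤-trans (inside-≤ r p i) r≤1)))
        (≥0⇒≤ _ (*-nonNeg 2≥0 (norm≥0 p)) (solve 1 (λ t → con (+ 2) :* t := con (+ 2) :- con (+ 2) :* (con (+ 1) :- t)) refl (norm p)))

      uniform : ∀ p v w N → ∣ p ∣²ℚ ℚ.≤ r → Sum p v w → Abs (density p * (v * v + w * w) - density p * ∣partial∣² N p) (C * ρ ^ᴷ N)
      uniform p v w N i (sums x y) = Abs-resp
        (solve 5 (λ d v w s t → d :* ((v :- s) :* (v :+ s) :+ (w :- t) :* (w :+ t)) := d :* (v :* v :+ w :* w) :- d :* (s :* s :+ t :* t)) refl (density p) v w _ _)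
        (solve 2 (λ l q → con (+ 2) :* (l :* q :* (l :+ l) :+ l :* q :* (l :+ l)) := con (+ 2) :* (con (+ 2) :* (l :* (l :+ l))) :* q) refl L (ρ ^ᴷ N))
        (Abs-* (density-bound p i) (Abs-+
          (Abs-* (series-tail ρ≤1 K K≥0 _ re x N) (Abs-+ (series-bound ρ≤1 K K≥0 _ re x) (partial-bound ρ≤1 K K≥0 _ re N)))
          (Abs-* (series-tail ρ≤1 K K≥0 _ im y N) (Abs-+ (series-bound ρ≤1 K K≥0 _ im y) (partial-bound ρ≤1 K K≥0 _ im N)))))
        where
        re : ∀ n → Abs (termRe n p) (K * ρ ^ᴷ n)
        re n = proj₁ (term-majorant p n i)
        im : ∀ n → Abs (termIm n p) (K * ρ ^ᴷ n)
        im n = proj₂ (term-majorant p n i)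

      D : Carrier
      D = 4# * (K * K)

      D≥0 : D ≥0
      D≥0 = *-nonNeg (ι≥0 (0≤+/ 4 0)) (*-nonNeg K≥0 K≥0)

      weight-majorant : ∀ n → Abs (∣a∣² n * diskWeight R n) (D * ρ ^ᴷ n)
      weight-majorant n = Abs-respˡ
        (solve 5 (λ A q i j r → con (+ 2) :* (A :* q :* (r :* i :- r :* (r :* j))) := A :* (con (+ 2) :* (r :* q :* i :- r :* (r :* q) :* j))) refl (∣a∣² n) (R ^ᴷ n) (inv n) (inv (suc n)) R)
        (Abs-weaken (≤-trans (≤-reflexive (solve 2 (λ k q → con (+ 2) :* ((k :* q) :* (k :* q) :* con (+ 2)) := con (+ 4) :* (k :* k) :* (q :* q)) refl K (ρ ^ᴷ n)))
            (*-monoˡ D D≥0 (≤-resp refl (*-identityʳ _) (*-monoˡ _ (^-≥0 n ρ≥0) (^-≤1 n ρ≥0 ρ≤1)))))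
          (Abs-* (Abs-nonNeg 2≥0 ≤-refl) (Abs-* (Abs-nonNeg (*-nonNeg (∣a∣²≥0 n) (^-≥0 n R≥0)) (power-bound R n R≥0 ≤-refl))
            (Abs-weaken (≤-reflexive (solve 0 (con (+ 1) :* con (+ 1) :+ con (+ 1) :* (con (+ 1) :* con (+ 1)) := con (+ 2)) refl))
              (Abs-- (Abs-* R1 (i1 n)) (Abs-* R1 (Abs-* R1 (i1 (suc n)))))))))
        where
        R1 : Abs R 1#
        R1 = Abs-nonNeg R≥0 r≤1
        i1 : ∀ n → Abs (inv n) 1#
        i1 n = Abs-nonNeg (inv≥0 n) (inv≤1 n)

      integral : ∃ (Lim (λ N → ∑ N (λ n → ∣a∣² n * diskWeight R n)))
      integral = series-limit ρ≤1 D D≥0 _ weight-majorant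

      -- Partial sums approximate the integrand uniformly on the disc, hence its averages uniformly
      -- in the mesh. `Lim-partial` provides the limits of the approximations, and `Lim-approx`
      -- exchanges the two limits.
      parseval : ∀ φ → (∀ p → ∣ p ∣²ℚ ℚ.≤ r → ∃ λ v → ∃ λ w → Sum p v w × φ p ≈ density p * (v * v + w * w)) →
        Lim (avg r φ) (proj₁ integral)
      parseval φ h = Lim-approx 1# λ k → choose k (Lim-power ρ≤1 C C≥0 k) (Lim-power ρ≤1 (D * Γ) (*-nonNeg D≥0 (nat≥0 _)) k)
        where
        ψ : ℕ → ℚ × ℚ → Carrier
        ψ N p = density p * ∣partial∣² N p
        S : ℕ → Carrier
        S N = ∑ N (λ n → ∣a∣² n * diskWeight R n)
        choose : ∀ k → (∃ λ N → ∀ n → N ℕ.≤ n → C * ρ ^ᴷ n ≤ inv k) → (∃ λ N → ∀ n → N ℕ.≤ n → D * Γ * ρ ^ᴷ n ≤ inv k) →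
          ∃ λ y → ∃ λ m → Lim y m × Abs (m - proj₁ integral) (1# * inv k) × (∀ n → Abs (avg r φ n - y n) (1# * inv k))
        choose k (N₁ , f) (N₂ , g) = avg r (ψ N) , S N , Lim-partial a b N ,
            Abs-resp (solve 2 (λ a b → :- (a :- b) := b :- a) refl (proj₁ integral) (S N)) (sym (*-identityˡ (inv k)))
              (Abs-neg (Abs-weaken (g N (ℕₚ.m≤n⊔m N₁ N₂)) (series-tail ρ≤1 D D≥0 _ weight-majorant (proj₂ integral) N))) ,
            λ n → Abs-weaken (≤-reflexive (sym (*-identityˡ (inv k)))) (avg-Abs r r≤1 φ (ψ N) (inv k) n (inv≥0 k) λ p i → close p i (h p i))
          where
          N : ℕ
          N = N₁ ℕ.⊔ N₂
          close : ∀ p → ∣ p ∣²ℚ ℚ.≤ r → (∃ λ v → ∃ λ w → Sum p v w × φ p ≈ density p * (v * v + w * w)) → Abs (φ p - ψ N p) (inv k)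
          close p i (v , w , s , e) = Abs-weaken (f N (ℕₚ.m≤m⊔n N₁ N₂)) (Abs-respˡ (+-congʳ (sym e)) (uniform p v w N i s))

  -- Exhaustion of the unit disc

  weight : ℕ → Carrier
  weight n = 2# * (inv n * inv (suc n))

  weight≥0 : ∀ n → weight n ≥0
  weight≥0 n = *-nonNeg (ι≥0 (0≤+/ 2 0)) (*-nonNeg (inv≥0 n) (inv≥0 (suc n)))

  inv-difference : ∀ n → inv n - inv (suc n) ≈ inv n * inv (suc n)
  inv-difference n = begin
    inv n - inv (suc n)
      ≈⟨ +-cong (trans (sym (*-identityʳ _)) (*-congˡ (sym ([1+nat]*inv (suc n))))) (-‿cong (trans (sym (*-identityʳ _)) (*-congˡ (sym (nat*inv n))))) ⟩
    inv n * ((nat (suc n) + 1#) * inv (suc n)) - inv (suc n) * (nat (suc n) * inv n)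
      ≈⟨ solve 3 (λ i j n → i :* ((n :+ con (+ 1)) :* j) :- j :* (n :* i) := i :* j) refl (inv n) (inv (suc n)) (nat (suc n)) ⟩
    inv n * inv (suc n) ∎
    where open ≈-Reasoning

  weight-tail : ∀ N d → ∑ d (λ i → weight (N ℕ.+ i)) ≈ 2# * (inv N - inv (N ℕ.+ d))
  weight-tail N d = begin
    ∑ d (λ i → weight (N ℕ.+ i))
      ≈⟨ ∑-cong′ d (λ i → *-congˡ (trans (sym (inv-difference (N ℕ.+ i))) (trans
          (solve 2 (λ a b → a :- b := :- b :- :- a) refl _ _) (+-congʳ (-‿cong (reflexive (≡.cong inv (≡.sym (ℕₚ.+-suc N i))))))))) ⟩
    ∑ d (λ i → 2# * (- inv (N ℕ.+ suc i) - - inv (N ℕ.+ i)))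
      ≈⟨ trans (∑-* d 2# _) (*-congˡ (∑-telescope d (λ i → - inv (N ℕ.+ i)))) ⟩
    2# * (- inv (N ℕ.+ d) - - inv (N ℕ.+ 0))
      ≈⟨ *-congˡ (trans (+-congˡ (-‿cong (-‿cong (reflexive (≡.cong inv (ℕₚ.+-identityʳ N)))))) (solve 2 (λ a b → :- b :- :- a := a :- b) refl _ _)) ⟩
    2# * (inv N - inv (N ℕ.+ d)) ∎
    where open ≈-Reasoning

  weight-tail≤ : ∀ N d → ∑ d (λ i → weight (N ℕ.+ i)) ≤ 2# * inv N
  weight-tail≤ N d = ≤-trans (≤-reflexive (weight-tail N d)) (*-monoˡ 2# (ι≥0 (0≤+/ 2 0))
    (≥0⇒≤ _ (inv≥0 (N ℕ.+ d)) (solve 2 (λ a b → b := a :- (a :- b)) refl _ _)))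

  -- (n+2) r^(n+1) - (n+1) r^(n+2) = 1 - (1-r)² Σ_{k≤n} (k+1) r^k
  diskWeight-defect : ∀ r n → weight n - diskWeight r n ≈ weight n * ((1# - r) * (1# - r) * ∑ (suc n) (λ k → nat (suc k) * r ^ᴷ k))
  diskWeight-defect r n = begin
    weight n - diskWeight r n
      ≈⟨ +-congˡ (-‿cong (*-congˡ (+-cong (trans (sym (*-identityʳ _)) (*-congˡ (sym (nat*inv (suc n))))) (-‿cong (trans (sym (*-identityʳ _)) (*-congˡ (sym (nat*inv n)))))))) ⟩
    weight n - 2# * (r ^ᴷ suc n * inv n * (nat (suc (suc n)) * inv (suc n)) - r ^ᴷ suc (suc n) * inv (suc n) * (nat (suc n) * inv n))
      ≈⟨ solve 6 (λ i j p q a b → con (+ 2) :* (i :* j) :- con (+ 2) :* (p :* i :* (b :* j) :- q :* j :* (a :* i)) := con (+ 2) :* (i :* j) :* (con (+ 1) :- (b :* p :- a :* q))) refl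
           (inv n) (inv (suc n)) (r ^ᴷ suc n) (r ^ᴷ suc (suc n)) (nat (suc n)) (nat (suc (suc n))) ⟩
    weight n * (1# - (nat (suc (suc n)) * r ^ᴷ suc n - nat (suc n) * r ^ᴷ suc (suc n)))
      ≈⟨ *-congˡ (identity n) ⟩
    weight n * ((1# - r) * (1# - r) * ∑ (suc n) (λ k → nat (suc k) * r ^ᴷ k)) ∎
    where
    open ≈-Reasoning
    identity : ∀ n → 1# - (nat (suc (suc n)) * r ^ᴷ suc n - nat (suc n) * r ^ᴷ suc (suc n)) ≈ (1# - r) * (1# - r) * ∑ (suc n) (λ k → nat (suc k) * r ^ᴷ k)
    identity zero = trans (+-congˡ (-‿cong (+-cong (*-congʳ nat-2) (-‿cong (*-congʳ nat-1))))) (trans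
      (solve 1 (λ r → con (+ 1) :- (con (+ 2) :* (r :* con (+ 1)) :- con (+ 1) :* (r :* (r :* con (+ 1)))) := (con (+ 1) :- r) :* (con (+ 1) :- r) :* (con (+ 0) :+ con (+ 1) :* con (+ 1))) refl r)
      (*-congˡ (+-congˡ (*-congʳ (sym nat-1)))))
    identity (suc n) = begin
      1# - (nat (3 ℕ.+ n) * (r * (r * q)) - nat (2 ℕ.+ n) * (r * (r * (r * q))))
        ≈⟨ +-congˡ (-‿cong (+-cong (*-congʳ (trans (nat-suc _) (+-congʳ e))) (-‿cong (*-congʳ e)))) ⟩
      1# - ((a + 1# + 1#) * (r * (r * q)) - (a + 1#) * (r * (r * (r * q))))
        ≈⟨ solve 3 (λ a r q → con (+ 1) :- ((a :+ con (+ 1) :+ con (+ 1)) :* (r :* (r :* q)) :- (a :+ con (+ 1)) :* (r :* (r :* (r :* q)))) :=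
             (con (+ 1) :- ((a :+ con (+ 1)) :* (r :* q) :- a :* (r :* (r :* q)))) :+ (con (+ 1) :- r) :* (con (+ 1) :- r) :* ((a :+ con (+ 1)) :* (r :* q))) refl a r q ⟩
      (1# - ((a + 1#) * (r * q) - a * (r * (r * q)))) + (1# - r) * (1# - r) * ((a + 1#) * (r * q))
        ≈⟨ +-cong (trans (+-congˡ (-‿cong (+-congʳ (*-congʳ (sym e))))) (identity n)) (*-congˡ (*-congʳ (sym e))) ⟩
      (1# - r) * (1# - r) * ∑ (suc n) (λ k → nat (suc k) * r ^ᴷ k) + (1# - r) * (1# - r) * (nat (2 ℕ.+ n) * (r * q))
        ≈⟨ solve 3 (λ c s t → c :* s :+ c :* t := c :* (s :+ t)) refl _ _ _ ⟩
      (1# - r) * (1# - r) * ∑ (2 ℕ.+ n) (λ k → nat (suc k) * r ^ᴷ k) ∎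
      where
      q a : Carrier
      q = r ^ᴷ n
      a = nat (suc n)
      e : nat (2 ℕ.+ n) ≈ a + 1#
      e = nat-suc (suc n)

  diskWeight≤ : ∀ r n → r ≥0 → diskWeight r n ≤ weight n
  diskWeight≤ r n r≥0 = ≥0⇒≤ _ (*-nonNeg (weight≥0 n) (*-nonNeg (square-nonNeg _) (∑-≥0 (suc n) λ k _ → *-nonNeg (nat≥0 (suc k)) (^-≥0 k r≥0))))
    (sym (diskWeight-defect r n))

  diskWeight≥0 : ∀ r n → r ≥0 → r ≤ 1# → diskWeight r n ≥0
  diskWeight≥0 r n r≥0 r≤1 = *-nonNeg (ι≥0 (0≤+/ 2 0)) (≤⇒≥0 (*-mono (inv≥0 (suc n)) (^-≥0 (suc n) r≥0)
    (≤-resp refl (*-identityˡ _) (*-monoʳ _ (^-≥0 (suc n) r≥0) r≤1)) (inv-anti (ℕₚ.n≤1+n n))))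

  -- By `diskWeight-defect` the gap is (1 - r)² times a quantity bounded independently of r, and (1
  -- - r)² ≤ 1 - r = 1/(m+1).
  Lim-diskWeight : ∀ n → Lim (λ m → diskWeight (ι (exhaustion m)) n) (weight n)
  Lim-diskWeight n = Lim-cong (λ m → solve 2 (λ w d → w :+ :- (w :- d) := d) refl _ _) (solve 1 (λ w → w :+ con (+ 0) := w) refl _)
    (Lim-+ (Lim-const (weight n)) (O⇒Lim (O-neg (order (weight n * V) λ m → Abs-nonNeg
      (≥0-resp (sym (diskWeight-defect _ n)) (*-nonNeg (weight≥0 n) (*-nonNeg (square-nonNeg _) (∑-≥0 (suc n) λ k _ → *-nonNeg (nat≥0 (suc k)) (^-≥0 k (r≥0 m))))))
      (≤-trans (≤-reflexive (diskWeight-defect _ n)) (≤-resp refl (solve 3 (λ w v i → w :* (i :* v) := w :* v :* i) refl _ _ _)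
        (*-monoˡ _ (weight≥0 n) (*-mono (∑-≥0 (suc n) λ k _ → *-nonNeg (nat≥0 (suc k)) (^-≥0 k (r≥0 m))) (inv≥0 m) (gap m)
          (∑-mono (suc n) λ k _ → ≤-resp refl (*-identityʳ _) (*-monoˡ _ (nat≥0 (suc k)) (^-≤1 k (r≥0 m) (ι-mono (ℚₚ.<⇒≤ (exhaustion<1 m)))))))))))))) 
    where
    V : Carrier
    V = ∑ (suc n) (λ k → nat (suc k))
    r≥0 : ∀ m → ι (exhaustion m) ≥0
    r≥0 m = ≥0-resp (sym (ι-exhaustion m)) (≤⇒≥0 (inv≤1 m))
    gap : ∀ m → (1# - ι (exhaustion m)) * (1# - ι (exhaustion m)) ≤ inv m
    gap m = ≤-resp (sym (*-cong e e)) (*-identityʳ _) (*-monoˡ _ (inv≥0 m) (inv≤1 m))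
      where
      e : 1# - ι (exhaustion m) ≈ inv m
      e = trans (+-congˡ (-‿cong (ι-exhaustion m))) (solve 1 (λ i → con (+ 1) :- (con (+ 1) :- i) := i) refl (inv m))

  module Norm (a b : ℕ → Carrier) (convergent : Parseval.Convergent a b) where

    open Parseval a b using (∣a∣²; module Disc)
    open Disc convergent using (integral; R≥0; r≤1; ∣a∣²≥0)

    energy : ℕ → Carrier
    energy N = ∑ N (λ n → ∣a∣² n * weight n)

    diskEnergy : ℕ → ℕ → Carrier
    diskEnergy m N = ∑ N (λ n → ∣a∣² n * diskWeight (ι (exhaustion m)) n)

    abstract
      I : ℕ → Carrier
      I m = proj₁ (integral m)

      I-limit : ∀ m → Lim (λ N → ∑ N (λ n → ∣a∣² n * diskWeight (ι (exhaustion m)) n)) (I m)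
      I-limit m = proj₂ (integral m)

      parseval : ∀ m φ → (∀ p → ∣ p ∣²ℚ ℚ.≤ exhaustion m → ∃ λ v → ∃ λ w → Parseval.Sum a b p v w × φ p ≈ density p * (v * v + w * w)) →
        Lim (avg (exhaustion m) φ) (I m)
      parseval = Disc.parseval convergent

    diskEnergy≤energy : ∀ m N → diskEnergy m N ≤ energy N
    diskEnergy≤energy m N = ∑-mono N λ n _ → *-monoˡ _ (∣a∣²≥0 m n) (diskWeight≤ _ n (R≥0 m))

    diskEnergy≤I : ∀ m N → diskEnergy m N ≤ I m
    diskEnergy≤I m N = Lim-≤-eventually (Lim-const _) (I-limit m) N λ n N≤n →
      ∑-≤ N≤n λ n → *-nonNeg (∣a∣²≥0 m n) (diskWeight≥0 _ n (R≥0 m) (r≤1 m))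

    energy-mono : ∀ {M N} → M ℕ.≤ N → energy M ≤ energy N
    energy-mono h = ∑-≤ h λ n → *-nonNeg (∣a∣²≥0 0 n) (weight≥0 n)

    Lim-diskEnergy : ∀ N → Lim (λ m → diskEnergy m N) (energy N)
    Lim-diskEnergy N = Lim-∑ N λ n → Lim-* (∣a∣² n) (Lim-diskWeight n)

    -- The integrals over discs never exceed s, and each is at least the finite sum
    -- `diskEnergy m N`, which for fixed N tends to `energy N`, already close to s.
    energy⇒integral : ∀ {s} → Lim energy s → Lim I s
    energy⇒integral {s} p = Lim-by 2# λ k →
      let N , h = within p k; M , g = within (Lim-diskEnergy N) k in M , λ m M≤m → abs
        (≥0⇒≤ _ (+-nonNeg (≤⇒≥0 (I≤s m)) (*-nonNeg (ι≥0 (0≤+/ 2 0)) (inv≥0 k))) (solve 3 (λ s I i → s :- I :+ i := i :- (I :- s)) refl s (I m) (2# * inv k)))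
        (≥0⇒≤ _ (+-nonNeg (+-nonNeg (≤⇒≥0 (lower (h N ℕₚ.≤-refl))) (≤⇒≥0 (lower (g m M≤m)))) (≤⇒≥0 (diskEnergy≤I m N)))
          (solve 5 (λ e s i d I → i :- :- (e :- s) :+ (i :- :- (d :- e)) :+ (I :- d) := con (+ 2) :* i :- :- (I :- s)) refl (energy N) s (inv k) (diskEnergy m N) (I m)))
      where
      I≤s : ∀ m → I m ≤ s
      I≤s m = Lim-≤ (I-limit m) p (diskEnergy≤energy m)

    -- The roles of m and N in the double limit are exchanged. This direction extracts the
    -- square-summability of the coefficients from a norm that is given only as a limit of
    -- integrals.
    integral⇒energy : ∀ {s} → Lim I s → Lim energy s
    integral⇒energy {s} p = Lim-by 2# λ k →
      let M , h = within p k; N , g = within (I-limit M) k in N , λ n N≤n → abs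
        (≥0⇒≤ _ (+-nonNeg (≤⇒≥0 (energy≤s n)) (*-nonNeg (ι≥0 (0≤+/ 2 0)) (inv≥0 k))) (solve 3 (λ s e i → s :- e :+ i := i :- (e :- s)) refl s (energy n) (2# * inv k)))
        (≥0⇒≤ _ (+-nonNeg (+-nonNeg (≤⇒≥0 (lower (h M ℕₚ.≤-refl))) (≤⇒≥0 (lower (g n N≤n)))) (≤⇒≥0 (diskEnergy≤energy M n)))
          (solve 5 (λ I s i d e → i :- :- (I :- s) :+ (i :- :- (d :- I)) :+ (e :- d) := con (+ 2) :* i :- :- (e :- s)) refl (I M) s (inv k) (diskEnergy M n) (energy n)))
      where
      energy≤s : ∀ N → energy N ≤ s
      energy≤s N = Lim-≤ (Lim-diskEnergy N) p λ m → diskEnergy≤I m N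

  -- The coefficients of f k, and approximation of the unit vectors

  abstract
    -- The second argument is the exponent j of z, so divisibility is tested on j + 1.
    ind : ℕ → ℕ → Carrier
    ind k j = indicator (k ∣? suc j)

    ind-yes : ∀ {k j} → k ∣ suc j → ind k j ≈ 1#
    ind-yes {k} {j} h with k ∣? suc j
    ... | yes _ = refl
    ... | no ¬h = ⊥-elim (¬h h)

    ind-no : ∀ {k j} → ¬ (k ∣ suc j) → ind k j ≈ 0#
    ind-no {k} {j} ¬h with k ∣? suc j
    ... | yes h = ⊥-elim (¬h h)
    ... | no _  = refl

  data Multiple (k j : ℕ) : Set where
    multiple    : k ∣ suc j → ind k j ≈ 1# → Multiple k j
    nonmultiple : ¬ (k ∣ suc j) → ind k j ≈ 0# → Multiple k j

  multiple? : ∀ k j → Multiple k j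
  multiple? k j with k ∣? suc j
  ... | yes h = multiple h (ind-yes h)
  ... | no ¬h = nonmultiple ¬h (ind-no ¬h)

  ind≥0 : ∀ k j → ind k j ≥0
  ind≥0 k j with multiple? k j
  ... | multiple _ e    = ≥0-resp (sym e) 1≥0
  ... | nonmultiple _ e = ≥0-resp (sym e) ≤-refl

  ind≤1 : ∀ k j → ind k j ≤ 1#
  ind≤1 k j with multiple? k j
  ... | multiple _ e    = ≤-reflexive e
  ... | nonmultiple _ e = ≤-resp (sym e) refl 1≥0

  ind-square : ∀ k j → ind k j * ind k j ≈ ind k j
  ind-square k j with multiple? k j
  ... | multiple _ e    = trans (*-congˡ e) (*-identityʳ _)
  ... | nonmultiple _ e = trans (*-congˡ e) (trans (zeroʳ _) (sym e))

  -- Common multiples are the multiples of the lcm. Hence the indicators are closed under products,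
  -- and the sieve never leaves their span.
  ind-lcm : ∀ a b j → ind (lcm a b) j ≈ ind a j * ind b j
  ind-lcm a b j with multiple? a j | multiple? b j
  ... | multiple h e | multiple k f = trans (ind-yes (lcm-least h k)) (sym (trans (*-cong e f) (*-identityˡ 1#)))
  ... | nonmultiple h e | _ = trans (ind-no λ d → h (∣-trans (m∣lcm[m,n] a b) d)) (sym (trans (*-congʳ e) (zeroˡ _)))
  ... | multiple _ _ | nonmultiple k f = trans (ind-no λ d → k (∣-trans (n∣lcm[m,n] a b) d)) (sym (trans (*-congˡ f) (zeroʳ _)))

  inv-* : ∀ {j} a b → suc j ≡ suc a ℕ.* suc b → inv j ≈ inv a * inv b
  inv-* {j} a b e = begin
    inv j                                                             ≈⟨ trans (sym (*-identityʳ _)) (*-congˡ (sym (trans (*-cong (nat*inv a) (nat*inv b)) (*-identityˡ 1#)))) ⟩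
    inv j * ((nat (suc a) * inv a) * (nat (suc b) * inv b))           ≈⟨ solve 5 (λ i a x b y → i :* ((a :* x) :* (b :* y)) := (a :* b) :* i :* (x :* y)) refl _ _ _ _ _ ⟩
    nat (suc a) * nat (suc b) * inv j * (inv a * inv b)               ≈⟨ *-congʳ (trans (*-congʳ (trans (sym (nat-* (suc a) (suc b))) (reflexive (≡.cong nat (≡.sym e))))) (nat*inv j)) ⟩
    1# * (inv a * inv b)                                              ≈⟨ *-identityˡ _ ⟩
    inv a * inv b ∎
    where open ≈-Reasoning

  -- 1/(c+1)² is at most 2/((c+1)(c+2)), which telescopes.
  ∑-inv² : ∀ M → ∑ M (λ c → inv c * inv c) ≤ 2#
  ∑-inv² M = ≤-trans (∑-mono M λ c _ → ≤-trans (*-monoˡ (inv c) (inv≥0 c) (inv≤ c)) (≤-reflexive (solve 2 (λ i j → i :* (con (+ 2) :* j) := con (+ 2) :* (i :* j)) refl _ _)))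
    (≤-trans (weight-tail≤ 0 M) (≤-reflexive (trans (*-congˡ inv-0) (*-identityʳ _))))
    where
    inv≤ : ∀ c → inv c ≤ 2# * inv (suc c)
    inv≤ c = ≥0⇒≤ _ (*-nonNeg (*-nonNeg (inv≥0 c) (inv≥0 (suc c))) (nat≥0 c)) (begin
      inv c * inv (suc c) * nat c
        ≈⟨ solve 3 (λ i j n → i :* j :* n := con (+ 2) :* j :* ((n :+ con (+ 1)) :* i) :- i :* ((n :+ con (+ 1) :+ con (+ 1)) :* j)) refl (inv c) (inv (suc c)) (nat c) ⟩
      2# * inv (suc c) * ((nat c + 1#) * inv c) - inv c * ((nat c + 1# + 1#) * inv (suc c))
        ≈⟨ +-cong (trans (*-congˡ ([1+nat]*inv c)) (*-identityʳ _)) (-‿cong (trans (*-congˡ (trans (*-congʳ (+-congʳ (sym (nat-suc c)))) ([1+nat]*inv (suc c)))) (*-identityʳ _))) ⟩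
      2# * inv (suc c) - inv c ∎)
      where open ≈-Reasoning

  -- Each block of q + 1 consecutive indices contains one multiple, its last, where j + 1 =
  -- (M+1)(q+1) and the weight is at most 2/(j+1)². Consequently F (q+1), which carries the factor q
  -- + 1, has energy at most 4 for every q.
  ind-energy : ∀ q M → ∑ M (λ j → ind (suc q) j * weight j) ≤ 4# * (inv q * inv q)
  ind-energy q M = ≤-trans (∑-≤ (ℕₚ.m≤m*n M Q) λ j → *-nonNeg (ind≥0 Q j) (weight≥0 j)) (≤-trans (blocks M)
    (≤-trans (*-monoˡ _ c≥0 (∑-inv² M)) (≤-reflexive (solve 1 (λ i → con (+ 2) :* i :* con (+ 2) := con (+ 4) :* i) refl _))))
    where
    Q : ℕ
    Q = suc q
    c≥0 : 2# * (inv q * inv q) ≥0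
    c≥0 = *-nonNeg (ι≥0 (0≤+/ 2 0)) (square-nonNeg (inv q))
    g : ℕ → Carrier
    g j = ind Q j * weight j
    block : ∀ M → ∑ Q (λ s → g (M ℕ.* Q ℕ.+ s)) ≤ 2# * (inv q * inv q) * (inv M * inv M)
    block M = ≤-trans (≤-reflexive (trans (+-congʳ (∑-0 q λ s s<q → trans (*-congʳ (ind-no (off s s<q))) (zeroˡ _))) (+-identityˡ _)))
      (≤-trans (≤-resp refl (*-identityˡ _) (*-monoʳ _ (weight≥0 j) (ind≤1 Q j)))
        (≤-resp refl (trans (*-congˡ (*-cong e e)) (solve 2 (λ a b → con (+ 2) :* ((a :* b) :* (a :* b)) := con (+ 2) :* (b :* b) :* (a :* a)) refl (inv M) (inv q)))
          (*-monoˡ 2# (ι≥0 (0≤+/ 2 0)) (*-monoˡ _ (inv≥0 j) (inv-anti (ℕₚ.n≤1+n j))))))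
      where
      j : ℕ
      j = M ℕ.* Q ℕ.+ q
      e : inv j ≈ inv M * inv q
      e = inv-* M q (≡.trans (≡.sym (ℕₚ.+-suc (M ℕ.* Q) q)) (ℕₚ.+-comm (M ℕ.* Q) Q))
      off : ∀ s → s ℕ.< q → ¬ (Q ∣ suc (M ℕ.* Q ℕ.+ s))
      off s s<q d = ℕₚ.<⇒≱ (ℕ.s≤s s<q) (∣⇒≤ (∣m+n∣m⇒∣n (≡.subst (Q ∣_) (≡.sym (ℕₚ.+-suc (M ℕ.* Q) s)) d) (n∣m*n M)))
    blocks : ∀ M → ∑ (M ℕ.* Q) g ≤ 2# * (inv q * inv q) * ∑ M (λ c → inv c * inv c)
    blocks zero    = ≤-reflexive (sym (zeroʳ _))
    blocks (suc M) = ≤-resp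
      (trans (sym (∑-split (M ℕ.* Q) Q g)) (reflexive (≡.cong (λ n → ∑ n g) (ℕₚ.+-comm (M ℕ.* Q) Q))))
      (solve 3 (λ c s t → c :* s :+ c :* t := c :* (s :+ t)) refl _ _ _)
      (+-mono (blocks M) (block M))

  -- the coefficients of k z^(k-1) / (1 - z^k) and of f k
  F φ : ℕ → ℕ → Carrier
  F k j = nat k * ind k j
  φ k j = 1# - F k j

  2^ : ℕ → ℕ
  2^ i = 2 ℕ.^ suc i

  2^-1 : ℕ → ℕ
  2^-1 i = ℕ.pred (2^ i)

  suc-2^-1 : ∀ i → suc (2^-1 i) ≡ 2^ i
  suc-2^-1 i = ℕₚ.suc-pred (2^ i) {{ℕₚ.m^n≢0 2 (suc i)}}

  -- The F (2^i) are almost orthogonal, so that their averages tend to 0.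
  U mean : ℕ → ℕ → Carrier
  U K j = ∑ K (λ i → F (2^ i) j)
  mean K j = inv K * U (suc K) j

  U≥0 : ∀ K j → U K j ≥0
  U≥0 K j = ∑-≥0 K λ i _ → *-nonNeg (nat≥0 _) (ind≥0 _ j)

  nat-2^ : ∀ i → nat (2^ (suc i)) ≈ nat (2^ i) + nat (2^ i)
  nat-2^ i = trans (nat-* 2 (2^ i)) (trans (*-congʳ nat-2) (solve 1 (λ x → con (+ 2) :* x := x :+ x) refl _))

  U≤ : ∀ K j → U K j ≤ nat (2^ K)
  U≤ zero    j = nat≥0 _
  U≤ (suc K) j = ≤-resp refl (sym (nat-2^ K)) (+-mono (U≤ K j) (≤-resp refl (*-identityʳ _) (*-monoˡ _ (nat≥0 _) (ind≤1 _ j))))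

  -- Almost orthogonality holds pointwise: the earlier terms add up to at most 2^(K+1), the size of
  -- the new term where it does not vanish. So the mixed term is at most twice the new square, and
  -- together with that square this gives the factor 3.
  U²≤ : ∀ K j → U K j * U K j ≤ 3# * ∑ K (λ i → nat (2^ i) * nat (2^ i) * ind (2^ i) j)
  U²≤ zero    j = ≤-reflexive (solve 0 (con (+ 0) :* con (+ 0) := con (+ 3) :* con (+ 0)) refl)
  U²≤ (suc K) j = ≥0⇒≤ _ (+-nonNeg (≤⇒≥0 (U²≤ K j)) (*-nonNeg (*-nonNeg (ι≥0 (0≤+/ 2 0)) (*-nonNeg (nat≥0 _) (ind≥0 _ j))) (≤⇒≥0 (U≤ K j)))) (begin
    3# * s - v * v + 2# * (q * x) * (q - v)
      ≈⟨ solve 4 (λ s u q x → con (+ 3) :* s :- u :* u :+ con (+ 2) :* (q :* x) :* (q :- u) := con (+ 3) :* (s :+ q :* q :* x) :- (u :* u :+ con (+ 2) :* u :* (q :* x) :+ q :* q :* x)) refl s v q x ⟩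
    3# * (s + q * q * x) - (v * v + 2# * v * (q * x) + q * q * x)
      ≈⟨ +-congˡ (-‿cong (trans (+-congˡ (*-congˡ (sym (ind-square (2^ K) j)))) (solve 3 (λ u q x → u :* u :+ con (+ 2) :* u :* (q :* x) :+ q :* q :* (x :* x) := (u :+ q :* x) :* (u :+ q :* x)) refl v q x))) ⟩
    3# * (s + q * q * x) - (v + q * x) * (v + q * x) ∎)
    where
    open ≈-Reasoning
    s v q x : Carrier
    s = ∑ K (λ i → nat (2^ i) * nat (2^ i) * ind (2^ i) j)
    v = U K j
    q = nat (2^ K)
    x = ind (2^ K) j

  12# : Carrier
  12# = ι (+ 12 ℚ./ 1)

  -- Each of the K + 1 squares contributes at most 4 by `ind-energy`, with the factor 3 of `U²≤`.
  -- The squared averaging factor 1/(K+1)² leaves 12/(K+1).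
  mean-energy : ∀ K M → ∑ M (λ j → mean K j * mean K j * weight j) ≤ 12# * inv K
  mean-energy K M = ≤-trans (≤-reflexive (trans (∑-cong′ M λ j → solve 3 (λ i u w → (i :* u) :* (i :* u) :* w := i :* i :* (u :* u :* w)) refl (inv K) _ _) (∑-* M _ _)))
    (≤-trans (*-monoˡ _ (square-nonNeg (inv K)) (≤-trans (∑-mono M λ j _ → *-monoʳ _ (weight≥0 j) (U²≤ (suc K) j)) total))
      (≤-reflexive (trans (solve 2 (λ i n → i :* i :* (con (+ 12) :* n) := con (+ 12) :* i :* (n :* i)) refl (inv K) _) (trans (*-congˡ (nat*inv K)) (*-identityʳ _)))))
    where
    single : ∀ i → ∑ M (λ j → nat (2^ i) * nat (2^ i) * ind (2^ i) j * weight j) ≤ 4#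
    single i = ≤-trans (≤-reflexive (trans (∑-cong′ M λ j → *-assoc _ _ _) (trans (∑-* M _ _) (*-congˡ (reflexive (≡.cong (λ k → ∑ M (λ j → ind k j * weight j)) (≡.sym (suc-2^-1 i))))))))
      (≤-trans (*-monoˡ _ (*-nonNeg (nat≥0 _) (nat≥0 _)) (ind-energy (2^-1 i) M))
        (≤-reflexive (trans (solve 2 (λ n i → n :* n :* (con (+ 4) :* (i :* i)) := con (+ 4) :* ((n :* i) :* (n :* i))) refl _ _)
          (trans (*-congˡ (trans (*-cong one one) (*-identityˡ 1#))) (*-identityʳ _)))))
      where
      one : nat (2^ i) * inv (2^-1 i) ≈ 1#
      one = trans (*-congʳ (reflexive (≡.cong nat (≡.sym (suc-2^-1 i))))) (nat*inv _)
    total : ∑ M (λ j → 3# * ∑ (suc K) (λ i → nat (2^ i) * nat (2^ i) * ind (2^ i) j) * weight j) ≤ 12# * nat (suc K)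
    total = ≤-trans (≤-reflexive (begin
        ∑ M (λ j → 3# * ∑ (suc K) (λ i → nat (2^ i) * nat (2^ i) * ind (2^ i) j) * weight j)
          ≈⟨ ∑-cong′ M (λ j → trans (solve 2 (λ s w → con (+ 3) :* s :* w := con (+ 3) :* (w :* s)) refl _ _) (*-congˡ (trans (sym (∑-* (suc K) _ _)) (∑-cong′ (suc K) λ i → *-comm _ _)))) ⟩
        ∑ M (λ j → 3# * ∑ (suc K) (λ i → nat (2^ i) * nat (2^ i) * ind (2^ i) j * weight j))
          ≈⟨ trans (∑-* M 3# _) (*-congˡ (∑-swap M (suc K) _)) ⟩
        3# * ∑ (suc K) (λ i → ∑ M (λ j → nat (2^ i) * nat (2^ i) * ind (2^ i) j * weight j)) ∎))
      (≤-trans (*-monoˡ 3# (ι≥0 (0≤+/ 3 0)) (≤-resp refl (∑-const (suc K) 4#) (∑-mono (suc K) λ i _ → single i)))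
        (≤-reflexive (solve 1 (λ n → con (+ 3) :* (n :* con (+ 4)) := con (+ 12) :* n) refl _)))
      where open ≈-Reasoning

  -- A list entry (s , b) stands for s times the indicator of the multiples of b + 1.
  value : List (Carrier × ℕ) → ℕ → Carrier
  value E j = sum E (λ (s , b) → s * ind (suc b) j)

  exclude : ℕ → List (Carrier × ℕ) → List (Carrier × ℕ)
  exclude Q E = E ++ map (λ (s , b) → - s , ℕ.pred (lcm (suc b) (suc Q))) E

  value-exclude : ∀ Q E j → value (exclude Q E) j ≈ value E j * (1# - ind (suc Q) j)
  value-exclude Q E j = begin
    value (exclude Q E) j
      ≈⟨ sum-++ E _ _ ⟩
    value E j + sum (map (λ (s , b) → - s , ℕ.pred (lcm (suc b) (suc Q))) E) (λ (s , b) → s * ind (suc b) j)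
      ≈⟨ +-congˡ (trans (reflexive (sum-map _ E _)) (trans (sum-cong E λ (s , b) → trans (*-congˡ (trans (reflexive (≡.cong (λ l → ind l j) (ℕₚ.suc-pred (lcm (suc b) (suc Q)) {{lcm≢0 b}}))) (ind-lcm (suc b) (suc Q) j)))
           (solve 3 (λ s a b → (:- s) :* (a :* b) := (:- b) :* (s :* a)) refl s _ _)) (sum-* E _ _))) ⟩
    value E j + - ind (suc Q) j * value E j
      ≈⟨ solve 2 (λ v x → v :+ (:- x) :* v := v :* (con (+ 1) :- x)) refl _ _ ⟩
    value E j * (1# - ind (suc Q) j) ∎
    where
    open ≈-Reasoning
    lcm≢0 : ∀ b → ℕ.NonZero (lcm (suc b) (suc Q))
    lcm≢0 b = ℕ.≢-nonZero λ e → ℕₚ.1+n≢0 (0∣⇒≡0 (≡.subst (_∣ suc b ℕ.* suc Q) e (lcm-least {suc b} {suc Q} (m∣m*n {suc b} (suc Q)) (n∣m*n (suc b) {suc Q}))))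

  sieve : ℕ → ℕ → List (Carrier × ℕ)
  sieve n zero    = (1# , n) ∷ []
  -- The argument is (P+2)(n+1) - 1, since `exclude` takes the divisor minus one.
  sieve n (suc P) = exclude (suc n ℕ.+ (n ℕ.+ P ℕ.* suc n)) (sieve n P)

  excluded : ∀ n P → suc (suc n ℕ.+ (n ℕ.+ P ℕ.* suc n)) ≡ (2 ℕ.+ P) ℕ.* suc n
  excluded n P = ≡.cong suc (≡.sym (ℕₚ.+-suc n (n ℕ.+ P ℕ.* suc n)))

  δ : ℕ → ℕ → Carrier
  δ n j = indicator (n ℕₚ.≟ j)

  value-sieve-bounds : ∀ n P j → value (sieve n P) j ≥0 × value (sieve n P) j ≤ 1#
  value-sieve-bounds n zero    j = ≥0-resp (sym e) (ind≥0 _ j) , ≤-resp (sym e) refl (ind≤1 _ j)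
    where
    e : value (sieve n 0) j ≈ ind (suc n) j
    e = solve 1 (λ x → con (+ 1) :* x :+ con (+ 0) := x) refl _
  value-sieve-bounds n (suc P) j = let p , q = value-sieve-bounds n P j; e = value-exclude (suc n ℕ.+ (n ℕ.+ P ℕ.* suc n)) (sieve n P) j in
    ≥0-resp (sym e) (*-nonNeg p (≤⇒≥0 (ind≤1 _ j))) ,
    ≤-trans (≤-reflexive e) (≤-resp refl (*-identityˡ 1#) (*-mono (≤⇒≥0 (ind≤1 _ j)) 1≥0 q
      (≥0⇒≤ _ (ind≥0 _ j) (solve 1 (λ x → x := con (+ 1) :- (con (+ 1) :- x)) refl _))))

  value-sieve-self : ∀ n P → value (sieve n P) n ≈ 1#
  value-sieve-self n zero    = trans (solve 1 (λ x → con (+ 1) :* x :+ con (+ 0) := x) refl _) (ind-yes ∣-refl)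
  value-sieve-self n (suc P) = trans (value-exclude (suc n ℕ.+ (n ℕ.+ P ℕ.* suc n)) (sieve n P) n)
    (trans (*-cong (value-sieve-self n P) (+-congˡ (-‿cong (ind-no {suc (suc n ℕ.+ (n ℕ.+ P ℕ.* suc n))} λ d → ℕₚ.<⇒≱ (ℕ.s≤s (ℕₚ.m≤m+n (suc n) _)) (∣⇒≤ d)))))
      (solve 0 (con (+ 1) :* (con (+ 1) :- con (+ 0)) := con (+ 1)) refl))

  value-sieve-nonmultiple : ∀ n P j → ¬ (suc n ∣ suc j) → value (sieve n P) j ≈ 0#
  value-sieve-nonmultiple n zero    j h = trans (solve 1 (λ x → con (+ 1) :* x :+ con (+ 0) := x) refl _) (ind-no h)
  value-sieve-nonmultiple n (suc P) j h = trans (value-exclude (suc n ℕ.+ (n ℕ.+ P ℕ.* suc n)) (sieve n P) j)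
    (trans (*-congʳ (value-sieve-nonmultiple n P j h)) (zeroˡ _))

  value-sieve-multiple : ∀ n P j p → p ℕ.< P → suc j ≡ (2 ℕ.+ p) ℕ.* suc n → value (sieve n P) j ≈ 0#
  value-sieve-multiple n (suc P) j p (ℕ.s≤s p≤P) e = trans (value-exclude (suc n ℕ.+ (n ℕ.+ P ℕ.* suc n)) (sieve n P) j) (case (ℕₚ.m≤n⇒m<n∨m≡n p≤P))
    where
    case : p ℕ.< P ⊎ p ≡ P → _
    case (inj₁ p<P)    = trans (*-congʳ (value-sieve-multiple n P j p p<P e)) (zeroˡ _)
    case (inj₂ ≡.refl) = trans (*-congˡ (+-congˡ (-‿cong (ind-yes (divides 1 (≡.trans e (≡.trans (≡.sym (excluded n P)) (≡.sym (ℕₚ.*-identityˡ _)))))))))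
      (solve 1 (λ v → v :* (con (+ 1) :- con (+ 1)) := con (+ 0)) refl _)

  δ-self : ∀ n → δ n n ≈ 1#
  δ-self n with n ℕₚ.≟ n
  ... | yes _ = refl
  ... | no h  = ⊥-elim (h ≡.refl)

  δ-other : ∀ {n j} → ¬ (n ≡ j) → δ n j ≈ 0#
  δ-other {n} {j} h with n ℕₚ.≟ j
  ... | yes e = ⊥-elim (h e)
  ... | no _  = refl

  -- A multiple j + 1 = (p+2)(n+1) with j < P has p < P, so its factor has been excluded; the only
  -- other multiple is n + 1 itself.
  sieve-exact : ∀ n P j → j ℕ.< P → δ n j ≈ value (sieve n P) j
  sieve-exact n P j j<P with n ℕₚ.≟ j
  ... | yes ≡.refl = sym (value-sieve-self n P)
  ... | no n≢j with suc n ∣? suc j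
  ...   | no h = sym (value-sieve-nonmultiple n P j h)
  ...   | yes (divides (suc zero) e) = ⊥-elim (n≢j (≡.sym (ℕₚ.suc-injective (≡.trans e (ℕₚ.+-identityʳ (suc n))))))
  ...   | yes (divides (suc (suc p)) e) = sym (value-sieve-multiple n P j p
          (ℕₚ.<-≤-trans (ℕₚ.<-≤-trans (ℕₚ.n<1+n p) (ℕₚ.≤-pred (ℕₚ.≤-trans (ℕₚ.m≤m*n (2 ℕ.+ p) (suc n)) (ℕₚ.≤-reflexive (≡.sym e))))) (ℕₚ.<⇒≤ j<P)) e)

  sieve-error : ∀ n P j → Abs (δ n j - value (sieve n P) j) 1#
  sieve-error n P j with n ℕₚ.≟ j
  ... | yes ≡.refl = Abs-0 (trans (+-congˡ (-‿cong (value-sieve-self n P))) (-‿inverseʳ 1#)) 1≥0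
  ... | no _ = let p , q = value-sieve-bounds n P j in
    Abs-respˡ (solve 1 (λ v → :- v := con (+ 0) :- v) refl _) (Abs-neg (Abs-nonNeg p q))

  -- The error vanishes below P and is at most 1 elsewhere, so only a tail of the weights is left.
  sieve-energy : ∀ n P M → ∑ M (λ j → (δ n j - value (sieve n P) j) * (δ n j - value (sieve n P) j) * weight j) ≤ 2# * inv P
  sieve-energy n P M = ≤-trans (∑-≤ (ℕₚ.m≤n+m M P) λ j → *-nonNeg (square-nonNeg _) (weight≥0 j))
    (≤-trans (≤-reflexive (trans (∑-split P M _) (trans (+-congʳ (∑-0 P λ j j<P → trans (*-congʳ (trans (*-congʳ (trans (+-congʳ (sieve-exact n P j j<P)) (-‿inverseʳ _))) (zeroˡ _))) (zeroˡ _))) (+-identityˡ _))))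
      (≤-trans (∑-mono M λ i _ → ≤-resp refl (trans (*-congʳ (*-identityˡ 1#)) (*-identityˡ _)) (*-monoʳ _ (weight≥0 _) (upper (Abs-* (sieve-error n P (P ℕ.+ i)) (sieve-error n P (P ℕ.+ i))))))
        (weight-tail≤ P M)))

  -- A list entry (c , b) stands for c times the coefficients of f (b + 1).
  comb : List (Carrier × ℕ) → ℕ → Carrier
  comb cs j = sum cs (λ (c , b) → c * φ (suc b) j)

  module Approximant (n P K : ℕ) where

    E : List (Carrier × ℕ)
    E = sieve n P

    -- The indicator of the multiples of b + 1 is 1/(b+1) times R - f (b+1), so the sieve equals σ R
    -- minus a combination of the f. In place of R the entries contain the average of the f (2^i),
    -- which differs from R by `mean K`.
    σ : Carrier
    σ = sum E (λ (s , b) → s * inv b)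

    entries : List (Carrier × ℕ)
    entries = map (λ i → σ * inv K , 2^-1 i) (upTo (suc K)) ++ map (λ (s , b) → - (s * inv b) , b) E

    value-σ : ∀ j → value E j ≈ σ - sum E (λ (s , b) → s * inv b * φ (suc b) j)
    value-σ j = begin
      sum E (λ (s , b) → s * ind (suc b) j)
        ≈⟨ sum-cong E (λ (s , b) → trans (trans (sym (*-identityʳ _)) (*-congˡ (sym (nat*inv b))))
             (solve 4 (λ s x n i → s :* x :* (n :* i) := s :* i :+ (:- con (+ 1)) :* (s :* i :* (con (+ 1) :- n :* x))) refl s (ind (suc b) j) (nat (suc b)) (inv b))) ⟩
      sum E (λ (s , b) → s * inv b + (- 1#) * (s * inv b * φ (suc b) j))
        ≈⟨ trans (sum-+ E _ _) (+-congˡ (sum-* E (- 1#) _)) ⟩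
      σ + (- 1#) * sum E (λ (s , b) → s * inv b * φ (suc b) j)
        ≈⟨ solve 2 (λ a b → a :+ (:- con (+ 1)) :* b := a :- b) refl _ _ ⟩
      σ - sum E (λ (s , b) → s * inv b * φ (suc b) j) ∎
      where open ≈-Reasoning

    mean-φ : ∀ j → inv K * ∑ (suc K) (λ i → φ (suc (2^-1 i)) j) ≈ 1# - mean K j
    mean-φ j = begin
      inv K * ∑ (suc K) (λ i → φ (suc (2^-1 i)) j)
        ≈⟨ *-congˡ (trans (∑-+ (suc K) _ _) (+-cong (∑-const (suc K) 1#) (∑-neg (suc K) _))) ⟩
      inv K * (nat (suc K) * 1# - ∑ (suc K) (λ i → F (suc (2^-1 i)) j))
        ≈⟨ *-congˡ (+-congˡ (-‿cong (∑-cong′ (suc K) λ i → reflexive (≡.cong (λ k → F k j) (suc-2^-1 i))))) ⟩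
      inv K * (nat (suc K) * 1# - U (suc K) j)
        ≈⟨ solve 3 (λ i n u → i :* (n :* con (+ 1) :- u) := n :* i :- i :* u) refl (inv K) _ _ ⟩
      nat (suc K) * inv K - mean K j
        ≈⟨ +-congʳ (nat*inv K) ⟩
      1# - mean K j ∎
      where open ≈-Reasoning

    comb-entries : ∀ j → comb entries j ≈ value E j - σ * mean K j
    comb-entries j = begin
      comb entries j
        ≈⟨ sum-++ (map _ (upTo (suc K))) _ _ ⟩
      sum (map (λ i → σ * inv K , 2^-1 i) (upTo (suc K))) (λ (c , b) → c * φ (suc b) j) + sum (map (λ (s , b) → - (s * inv b) , b) E) (λ (c , b) → c * φ (suc b) j)
        ≈⟨ +-cong (trans (reflexive (sum-map _ (upTo (suc K)) _)) (trans (sum-upTo (suc K) _) (trans (∑-* (suc K) _ _) (trans (*-assoc _ _ _) (*-congˡ (mean-φ j))))))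
                  (trans (reflexive (sum-map _ E _)) (trans (sum-cong E λ (s , b) → solve 2 (λ s p → (:- s) :* p := (:- con (+ 1)) :* (s :* p)) refl _ _) (sum-* E (- 1#) _))) ⟩
      σ * (1# - mean K j) + (- 1#) * sum E (λ (s , b) → s * inv b * φ (suc b) j)
        ≈⟨ solve 3 (λ σ h t → σ :* (con (+ 1) :- h) :+ (:- con (+ 1)) :* t := (σ :- t) :- σ :* h) refl σ (mean K j) _ ⟩
      (σ - sum E (λ (s , b) → s * inv b * φ (suc b) j)) - σ * mean K j
        ≈⟨ +-congʳ (sym (value-σ j)) ⟩
      value E j - σ * mean K j ∎
      where open ≈-Reasoning

    -- The inequality |u - v|² ≤ 2|u|² + 2|v|² separates the errors of the sieve and of the average;
    -- whence 4 = 2 · 2 and 24 = 2 · 12.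
    energy : ∀ M → ∑ M (λ j → (δ n j - comb entries j) * (δ n j - comb entries j) * weight j) ≤ 4# * inv P + (ι (+ 24 ℚ./ 1) * (σ * σ)) * inv K
    energy M = ≤-trans (∑-mono M λ j _ → ≤-trans (*-monoʳ _ (weight≥0 j) (pointwise j))
        (≤-reflexive (solve 4 (λ a s h w → (con (+ 2) :* a :+ con (+ 2) :* s :* h) :* w := con (+ 2) :* (a :* w) :+ con (+ 2) :* s :* (h :* w)) refl _ (σ * σ) _ _)))
      (≤-trans (≤-reflexive (trans (∑-+ M _ _) (+-cong (∑-* M _ _) (∑-* M _ _))))
        (≤-trans (+-mono (*-monoˡ _ (ι≥0 (0≤+/ 2 0)) (sieve-energy n P M)) (*-monoˡ _ (*-nonNeg (ι≥0 (0≤+/ 2 0)) (square-nonNeg σ)) (mean-energy K M)))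
          (≤-reflexive (solve 3 (λ p s k → con (+ 2) :* (con (+ 2) :* p) :+ con (+ 2) :* s :* (con (+ 12) :* k) := con (+ 4) :* p :+ con (+ 24) :* s :* k) refl (inv P) (σ * σ) (inv K)))))
      where
      pointwise : ∀ j → (δ n j - comb entries j) * (δ n j - comb entries j) ≤ 2# * ((δ n j - value E j) * (δ n j - value E j)) + 2# * (σ * σ) * (mean K j * mean K j)
      pointwise j = ≥0⇒≤ _ (square-nonNeg (d - σ * mean K j)) (trans
        (solve 4 (λ a v s h → ((a :- v) :- s :* h) :* ((a :- v) :- s :* h) := con (+ 2) :* ((a :- v) :* (a :- v)) :+ con (+ 2) :* (s :* s) :* (h :* h) :- (a :- (v :- s :* h)) :* (a :- (v :- s :* h))) refl (δ n j) (value E j) σ (mean K j))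
        (+-congˡ (-‿cong (*-cong e e))))
        where
        d : Carrier
        d = δ n j - value E j
        e : δ n j - (value E j - σ * mean K j) ≈ δ n j - comb entries j
        e = +-congˡ (-‿cong (sym (comb-entries j)))

  -- `suc (k + k)` is the index of half the tolerance, 1/(2k+2); it serves wherever a tolerance is
  -- divided between two errors.
  inv-half : ∀ k → inv (suc (k ℕ.+ k)) + inv (suc (k ℕ.+ k)) ≈ inv k
  inv-half k = trans (+-cong e e) (trans (solve 2 (λ i x → i :* x :+ i :* x := con (+ 2) :* i :* x) refl (inv 1) (inv k))
    (trans (*-congʳ (trans (*-congʳ (sym nat-2)) (nat*inv 1))) (*-identityˡ (inv k))))
    where
    e : inv (suc (k ℕ.+ k)) ≈ inv 1 * inv k
    e = inv-* 1 k (≡.cong suc (≡.trans (≡.sym (ℕₚ.+-suc k k)) (≡.cong (k ℕ.+_) (≡.sym (≡.cong suc (ℕₚ.+-identityʳ k))))))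

  approximant : ∀ n k → ∃ λ cs → ∀ M → ∑ M (λ j → (δ n j - comb cs j) * (δ n j - comb cs j) * weight j) ≤ inv k
  approximant n k =
    let k′ = suc (k ℕ.+ k)
        P , p = finer 4# k′
        -- `σ` is determined by the sieve alone, so it is known once `P` is and `K` can be chosen
        -- against it.
        K , q = finer (ι (+ 24 ℚ./ 1) * (Approximant.σ n P 0 * Approximant.σ n P 0)) k′
    in Approximant.entries n P K , λ M → ≤-trans (Approximant.energy n P K M) (≤-trans (+-mono (p P ℕₚ.≤-refl) (q K ℕₚ.≤-refl)) (≤-reflexive (inv-half k)))

  -- f 1 = 0, so the entries with b = 0 may be dropped.
  drop : List (Carrier × ℕ) → List (Carrier × ℕ)
  drop []                = []
  drop ((c , zero) ∷ cs)  = drop cs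
  drop ((c , suc b) ∷ cs) = (c , b) ∷ drop cs

  comb-drop : ∀ cs j → comb cs j ≈ sum (drop cs) (λ (c , i) → c * φ (2 ℕ.+ i) j)
  comb-drop []                 j = refl
  comb-drop ((c , zero) ∷ cs)  j = trans (+-congʳ (trans (*-congˡ (trans (+-congˡ (-‿cong (trans (*-cong nat-1 (ind-yes (divides (suc j) (≡.sym (ℕₚ.*-identityʳ (suc j)))))) (*-identityˡ 1#)))) (-‿inverseʳ 1#))) (zeroʳ c)))
    (trans (+-identityˡ _) (comb-drop cs j))
  comb-drop ((c , suc b) ∷ cs) j = +-congˡ (comb-drop cs j)

  -- Density in the space of coefficients

  -- Bounded increasing partial sums need not have a limit constructively; here the convergence of
  -- the majorant supplies the modulus. The constant `D` is harmless because the weights themselves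
  -- are summable.
  summable : ∀ (x y : ℕ → Carrier) D {s} → (∀ j → x j ≥0) → D ≥0 → (∀ j → x j ≤ 2# * y j + D) →
    Lim (λ N → ∑ N (λ j → y j * weight j)) s → ∃ (Lim (λ N → ∑ N (λ j → x j * weight j)))
  summable x y D {s} x≥0 D≥0 h p = Lim-exists (4# + 2# * D) λ k →
    let M , b = within p k; N = M ℕ.⊔ k in
    N , λ n N≤n → let e = trans (+-congʳ (trans (reflexive (≡.cong (λ m → ∑ m V) (≡.sym (ℕₚ.m+[n∸m]≡n N≤n)))) (∑-split N (n ℕ.∸ N) V))) (solve 2 (λ a b → a :+ b :- a := b) refl (∑ N V) _)
                      e′ = trans (+-congʳ (trans (reflexive (≡.cong (λ m → ∑ m W) (≡.sym (ℕₚ.m+[n∸m]≡n N≤n)))) (∑-split N (n ℕ.∸ N) W))) (solve 2 (λ a b → a :+ b :- a := b) refl (∑ N W) _)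
      in Abs-respˡ (sym e) (Abs-nonNeg (∑-≥0 (n ℕ.∸ N) λ i _ → *-nonNeg (x≥0 _) (weight≥0 _)) (≤-trans
           (≤-trans (∑-mono (n ℕ.∸ N) λ i _ → ≤-trans (*-monoʳ _ (weight≥0 (N ℕ.+ i)) (h (N ℕ.+ i)))
              (≤-reflexive (solve 3 (λ y d w → (con (+ 2) :* y :+ d) :* w := con (+ 2) :* (y :* w) :+ d :* w) refl _ D _)))
              (≤-reflexive (trans (∑-+ (n ℕ.∸ N) _ _) (+-cong (∑-* (n ℕ.∸ N) 2# _) (∑-* (n ℕ.∸ N) D _)))))
           (≤-trans (+-mono (*-monoˡ 2# 2≥0 (≤-resp e′ refl (close n N (ℕₚ.≤-trans (ℕₚ.m≤m⊔n M k) N≤n) (ℕₚ.m≤m⊔n M k) b)))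
                            (*-monoˡ D D≥0 (≤-trans (weight-tail≤ N (n ℕ.∸ N)) (*-monoˡ 2# 2≥0 (inv-anti (ℕₚ.m≤n⊔m M k))))))
             (≤-reflexive (solve 2 (λ i d → con (+ 2) :* (i :+ i) :+ d :* (con (+ 2) :* i) := (con (+ 4) :+ con (+ 2) :* d) :* i) refl (inv k) D)))))
    where
    V W : ℕ → Carrier
    V j = x j * weight j
    W j = y j * weight j
    2≥0 : 2# ≥0
    2≥0 = ι≥0 (0≤+/ 2 0)
    close : ∀ n N {M k} → M ℕ.≤ n → M ℕ.≤ N → (∀ n → M ℕ.≤ n → Abs (∑ n W - s) (inv k)) → ∑ n W - ∑ N W ≤ inv k + inv k
    close n N p q b = ≤-resp (solve 3 (λ a b s → (a :- s) :+ :- (b :- s) := a :- b) refl _ _ _) refl (+-mono (upper (b n p)) (lower (b N q)))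

  spanRe spanIm : List ((Carrier × Carrier) × ℕ) → ℕ → Carrier
  spanRe cs j = sum cs (λ ((α , β) , i) → α * φ (2 ℕ.+ i) j)
  spanIm cs j = sum cs (λ ((α , β) , i) → β * φ (2 ℕ.+ i) j)

  φ-bound : ∀ k j → Abs (φ k j) (1# + nat k)
  φ-bound k j = Abs-- (Abs-nonNeg 1≥0 ≤-refl) (Abs-nonNeg (*-nonNeg (nat≥0 k) (ind≥0 k j)) (≤-resp refl (*-identityʳ _) (*-monoˡ _ (nat≥0 k) (ind≤1 k j))))

  span-bound : ∀ cs → ∃ λ B → ∀ j → Abs (spanRe cs j) B × Abs (spanIm cs j) B
  span-bound [] = 0# , λ j → Abs-0 refl ≤-refl , Abs-0 refl ≤-refl
  span-bound (((α , β) , i) ∷ cs) =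
    let B , b = span-bound cs; m , p = abs-bound α; n , q = abs-bound β; c = 1# + nat (2 ℕ.+ i)
        c≥0 = +-nonNeg 1≥0 (nat≥0 (2 ℕ.+ i)) in
    (nat m + nat n) * c + B , λ j →
      Abs-+ (Abs-* (Abs-weaken (x≤x+ (nat≥0 n)) p) (φ-bound (2 ℕ.+ i) j)) (proj₁ (b j)) ,
      Abs-+ (Abs-* (Abs-weaken (≤-trans (x≤x+ (nat≥0 m)) (≤-reflexive (+-comm _ _))) q) (φ-bound (2 ℕ.+ i) j)) (proj₂ (b j))

  module Density (a b : ℕ → Carrier) where

    -- Truncation written as a combination of unit vectors, so that it can be approximated one
    -- vector at a time.
    cut : ℕ → (ℕ → Carrier) → ℕ → Carrier
    cut N x j = ∑ N (λ n → x n * δ n j)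

    cut-≥ : ∀ N x j → N ℕ.≤ j → cut N x j ≈ 0#
    cut-≥ N x j N≤j = ∑-0 N λ n n<N → trans (*-congˡ (δ-other λ e → ℕₚ.<⇒≢ (ℕₚ.<-≤-trans n<N N≤j) e)) (zeroʳ _)

    cut-< : ∀ N x j → j ℕ.< N → cut N x j ≈ x j
    cut-< (suc N) x j (ℕ.s≤s j≤N) = case (ℕₚ.m≤n⇒m<n∨m≡n j≤N)
      where
      case : j ℕ.< N ⊎ j ≡ N → _
      case (inj₁ j<N)    = trans (+-cong (cut-< N x j j<N) (trans (*-congˡ (δ-other λ e → ℕₚ.<⇒≢ j<N (≡.sym e))) (zeroʳ _))) (+-identityʳ _)
      case (inj₂ ≡.refl) = trans (+-cong (cut-≥ N x N ℕₚ.≤-refl) (trans (*-congˡ (δ-self N)) (*-identityʳ _))) (+-identityˡ _)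

    distance² : (ℕ → Carrier) × (ℕ → Carrier) → (ℕ → Carrier) × (ℕ → Carrier) → ℕ → Carrier
    distance² (x , y) (x′ , y′) j = (x j - x′ j) * (x j - x′ j) + (y j - y′ j) * (y j - y′ j)

    -- |u + v|² ≤ 2 |u|² + 2 |v|²
    parallelogram : ∀ x x′ x″ y y′ y″ → (x - x″) * (x - x″) + (y - y″) * (y - y″) ≤
      2# * ((x - x′) * (x - x′) + (y - y′) * (y - y′)) + 2# * ((x′ - x″) * (x′ - x″) + (y′ - y″) * (y′ - y″))
    parallelogram x x′ x″ y y′ y″ = ≥0⇒≤ _ (+-nonNeg (square-nonNeg (x - x′ - (x′ - x″))) (square-nonNeg (y - y′ - (y′ - y″))))
      (solve 6 (λ a b c d e f → (a :- b :- (b :- c)) :* (a :- b :- (b :- c)) :+ (d :- e :- (e :- f)) :* (d :- e :- (e :- f)) :=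
         con (+ 2) :* ((a :- b) :* (a :- b) :+ (d :- e) :* (d :- e)) :+ con (+ 2) :* ((b :- c) :* (b :- c) :+ (e :- f) :* (e :- f)) :- ((a :- c) :* (a :- c) :+ (d :- f) :* (d :- f))) refl x x′ x″ y y′ y″)

    energy-triangle : ∀ M V V′ V″ → ∑ M (λ j → distance² V V″ j * weight j) ≤ 2# * ∑ M (λ j → distance² V V′ j * weight j) + 2# * ∑ M (λ j → distance² V′ V″ j * weight j)
    energy-triangle M (x , y) (x′ , y′) (x″ , y″) = ≤-trans
      (∑-mono M λ j _ → ≤-trans (*-monoʳ _ (weight≥0 j) (parallelogram (x j) (x′ j) (x″ j) (y j) (y′ j) (y″ j)))
        (≤-reflexive (solve 3 (λ p q w → (con (+ 2) :* p :+ con (+ 2) :* q) :* w := con (+ 2) :* (p :* w) :+ con (+ 2) :* (q :* w)) refl _ _ _)))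
      (≤-reflexive (trans (∑-+ M _ _) (+-cong (∑-* M _ _) (∑-* M _ _))))

    extend : ℕ → List ((Carrier × Carrier) × ℕ) → List (Carrier × ℕ) → List ((Carrier × Carrier) × ℕ)
    extend N cs e = cs ++ map (λ (c , i) → (a N * c , b N * c) , i) (drop e)

    spanRe-extend : ∀ N cs e j → spanRe (extend N cs e) j ≈ spanRe cs j + a N * comb e j
    spanRe-extend N cs e j = trans (sum-++ cs _ _) (+-congˡ (trans (reflexive (sum-map _ (drop e) _)) (trans (sum-cong (drop e) λ _ → *-assoc _ _ _) (trans (sum-* (drop e) _ _) (*-congˡ (sym (comb-drop e j)))))))

    spanIm-extend : ∀ N cs e j → spanIm (extend N cs e) j ≈ spanIm cs j + b N * comb e j
    spanIm-extend N cs e j = trans (sum-++ cs _ _) (+-congˡ (trans (reflexive (sum-map _ (drop e) _)) (trans (sum-cong (drop e) λ _ → *-assoc _ _ _) (trans (sum-* (drop e) _ _) (*-congˡ (sym (comb-drop e j)))))))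

    2≥0 : 2# ≥0
    2≥0 = ι≥0 (0≤+/ 2 0)

    -- By induction on N, through an intermediate sequence that keeps the old approximation and adds
    -- the exact multiple of the new unit vector. The factor 2 of `energy-triangle` and the size of
    -- the new coefficient are absorbed by the tolerances `k₁` and `k₂`.
    approximate-cut : ∀ N k → ∃ λ cs → ∀ M → ∑ M (λ j → distance² (cut N a , cut N b) (spanRe cs , spanIm cs) j * weight j) ≤ inv k
    approximate-cut zero k = [] , λ M → ≤-trans (≤-reflexive (∑-0 M λ j _ →
      solve 1 (λ w → ((con (+ 0) :- con (+ 0)) :* (con (+ 0) :- con (+ 0)) :+ (con (+ 0) :- con (+ 0)) :* (con (+ 0) :- con (+ 0))) :* w := con (+ 0)) refl _)) (inv≥0 k)
    approximate-cut (suc N) k =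
      let k′ = suc (k ℕ.+ k)
          k₁ , f = finer 2# k′
          k₂ , g = finer (2# * (a N * a N + b N * b N)) k′
          cs , h = approximate-cut N k₁
          e , l = approximant N k₂
      in extend N cs e , λ M → ≤-trans (step M cs e) (≤-trans
        (+-mono (≤-trans (*-monoˡ 2# 2≥0 (h M)) (f k₁ ℕₚ.≤-refl))
                (≤-trans (*-monoˡ _ (*-nonNeg 2≥0 (+-nonNeg (square-nonNeg (a N)) (square-nonNeg (b N)))) (l M)) (g k₂ ℕₚ.≤-refl)))
        (≤-reflexive (inv-half k)))
      where
      step : ∀ M cs e → ∑ M (λ j → distance² (cut (suc N) a , cut (suc N) b) (spanRe (extend N cs e) , spanIm (extend N cs e)) j * weight j) ≤
        2# * ∑ M (λ j → distance² (cut N a , cut N b) (spanRe cs , spanIm cs) j * weight j) + 2# * (a N * a N + b N * b N) * ∑ M (λ j → (δ N j - comb e j) * (δ N j - comb e j) * weight j)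
      step M cs e = ≤-trans (energy-triangle M _ (mid a spanRe , mid b spanIm) _) (≤-reflexive (+-cong
          (*-congˡ (∑-cong′ M λ j → *-congʳ (+-cong (*-cong (down a spanRe j) (down a spanRe j)) (*-cong (down b spanIm j) (down b spanIm j)))))
          (trans (*-congˡ (trans (∑-cong′ M λ j → trans (*-congʳ (trans (+-cong (*-cong (up a spanRe j (spanRe-extend N cs e j)) (up a spanRe j (spanRe-extend N cs e j))) (*-cong (up b spanIm j (spanIm-extend N cs e j)) (up b spanIm j (spanIm-extend N cs e j))))
               (solve 3 (λ a b d → (a :* d) :* (a :* d) :+ (b :* d) :* (b :* d) := (a :* a :+ b :* b) :* (d :* d)) refl (a N) (b N) _))) (*-assoc _ _ _)) (∑-* M _ _))) (sym (*-assoc _ _ _)))))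
        where
        mid : (ℕ → Carrier) → (List ((Carrier × Carrier) × ℕ) → ℕ → Carrier) → ℕ → Carrier
        mid x span j = span cs j + x N * δ N j
        down : ∀ x span j → cut (suc N) x j - mid x span j ≈ cut N x j - span cs j
        down x span j = solve 3 (λ c t s → c :+ t :- (s :+ t) := c :- s) refl _ _ _
        up : ∀ x span j → span (extend N cs e) j ≈ span cs j + x N * comb e j → mid x span j - span (extend N cs e) j ≈ x N * (δ N j - comb e j)
        up x span j p = trans (+-congˡ (-‿cong p)) (solve 4 (λ s x d c → s :+ x :* d :- (s :+ x :* c) := x :* (d :- c)) refl _ _ _ _)

    module _ {s} (p : Lim (λ N → ∑ N (λ j → (a j * a j + b j * b j) * weight j)) s) where

      ∣a∣² : ℕ → Carrier
      ∣a∣² j = a j * a j + b j * b j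

      cut-tail : ∀ N M → ∑ M (λ j → distance² (a , b) (cut N a , cut N b) j * weight j) ≤ ∑ (N ℕ.+ M) (λ j → ∣a∣² j * weight j) - ∑ N (λ j → ∣a∣² j * weight j)
      cut-tail N M = ≤-trans (∑-≤ (ℕₚ.m≤n+m M N) λ j → *-nonNeg (+-nonNeg (square-nonNeg _) (square-nonNeg _)) (weight≥0 j)) (≤-reflexive (begin
        ∑ (N ℕ.+ M) (λ j → distance² (a , b) (cut N a , cut N b) j * weight j)
          ≈⟨ trans (∑-split N M _) (+-cong (∑-0 N λ j j<N → trans (*-congʳ (trans (+-cong (*-congʳ (below a j j<N)) (*-congʳ (below b j j<N)))
               (solve 2 (λ x y → con (+ 0) :* x :+ con (+ 0) :* y := con (+ 0)) refl _ _))) (zeroˡ _)) (∑-cong′ M λ i → *-congʳ (+-cong (*-cong (above a i) (above a i)) (*-cong (above b i) (above b i))))) ⟩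
        0# + ∑ M (λ i → ∣a∣² (N ℕ.+ i) * weight (N ℕ.+ i))
          ≈⟨ solve 2 (λ a b → con (+ 0) :+ b := a :+ b :- a) refl (∑ N (λ j → ∣a∣² j * weight j)) _ ⟩
        ∑ N (λ j → ∣a∣² j * weight j) + ∑ M (λ i → ∣a∣² (N ℕ.+ i) * weight (N ℕ.+ i)) - ∑ N (λ j → ∣a∣² j * weight j)
          ≈⟨ +-congʳ (sym (∑-split N M _)) ⟩
        ∑ (N ℕ.+ M) (λ j → ∣a∣² j * weight j) - ∑ N (λ j → ∣a∣² j * weight j) ∎))
        where
        open ≈-Reasoning
        below : ∀ x j → j ℕ.< N → x j - cut N x j ≈ 0#
        below x j h = trans (+-congˡ (-‿cong (cut-< N x j h))) (-‿inverseʳ _)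
        above : ∀ x i → x (N ℕ.+ i) - cut N x (N ℕ.+ i) ≈ x (N ℕ.+ i)
        above x i = trans (+-congˡ (-‿cong (cut-≥ N x (N ℕ.+ i) (ℕₚ.m≤m+n N i)))) (solve 1 (λ x → x :- con (+ 0) := x) refl _)

      -- The definition of distance demands the norm itself and not only a bound, so the series has
      -- to converge. Elements of the span have bounded coefficients, which enter `summable` through
      -- the constant `D`.
      span-distance : ∀ cs → ∃ (Lim (λ N → ∑ N (λ j → distance² (a , b) (spanRe cs , spanIm cs) j * weight j)))
      span-distance cs = bounded (span-bound cs)
        where
        bounded : (∃ λ B → ∀ j → Abs (spanRe cs j) B × Abs (spanIm cs j) B) → _
        bounded (B , β) = summable (distance² (a , b) (spanRe cs , spanIm cs)) ∣a∣² (2# * (B * B + B * B))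
          (λ j → +-nonNeg (square-nonNeg _) (square-nonNeg _))
          (*-nonNeg 2≥0 (+-nonNeg (square-nonNeg B) (square-nonNeg B)))
          (λ j → ≤-trans (parallelogram (a j) 0# (spanRe cs j) (b j) 0# (spanIm cs j)) (+-mono
            (≤-reflexive (*-congˡ (solve 2 (λ a b → (a :- con (+ 0)) :* (a :- con (+ 0)) :+ (b :- con (+ 0)) :* (b :- con (+ 0)) := a :* a :+ b :* b) refl (a j) (b j))))
            (*-monoˡ 2# 2≥0 (≤-resp (solve 2 (λ a b → a :* a :+ b :* b := (con (+ 0) :- a) :* (con (+ 0) :- a) :+ (con (+ 0) :- b) :* (con (+ 0) :- b)) refl (spanRe cs j) (spanIm cs j)) refl
              (+-mono (upper (Abs-* (proj₁ (β j)) (proj₁ (β j)))) (upper (Abs-* (proj₂ (β j)) (proj₂ (β j)))))))))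
          p

      -- Twice the tail beyond N plus twice the distance from the truncation to the span. The tail
      -- is a difference of two partial sums, both close to s, hence the constant 4 in the first
      -- tolerance and 2 in the second.
      approximate : ∀ k → ∃ λ cs → ∃ λ e → Lim (λ N → ∑ N (λ j → distance² (a , b) (spanRe cs , spanIm cs) j * weight j)) e × e ≤ inv k
      approximate k = choose (finer 4# k′) (finer 2# k′)
        where
        k′ : ℕ
        k′ = suc (k ℕ.+ k)
        close : ∀ {x y i} → Abs (x - s) i → Abs (y - s) i → x - y ≤ i + i
        close p q = ≤-resp (solve 3 (λ a b s → (a :- s) :+ :- (b :- s) := a :- b) refl _ _ s) refl (+-mono (upper p) (lower q))
        choose : (∃ λ j → ∀ i → j ℕ.≤ i → 4# * inv i ≤ inv k′) → (∃ λ j → ∀ i → j ℕ.≤ i → 2# * inv i ≤ inv k′) → _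
        choose (k₁ , f) (k₂ , g) = cutting (within p k₁)
          where
          cutting : (∃ λ N → ∀ n → N ℕ.≤ n → Abs (∑ n (λ j → ∣a∣² j * weight j) - s) (inv k₁)) → _
          cutting (N , h) = assemble (approximate-cut N k₂)
            where
            assemble : (∃ λ cs → ∀ M → ∑ M (λ j → distance² (cut N a , cut N b) (spanRe cs , spanIm cs) j * weight j) ≤ inv k₂) →
              ∃ λ cs → ∃ λ e → Lim (λ N → ∑ N (λ j → distance² (a , b) (spanRe cs , spanIm cs) j * weight j)) e × e ≤ inv k
            assemble (cs , l) = conclude (span-distance cs)
              where
              conclude : (∃ λ e → Lim (λ N → ∑ N (λ j → distance² (a , b) (spanRe cs , spanIm cs) j * weight j)) e) → _
              conclude (e , q) = cs , e , q , Lim-≤ q (Lim-const _) λ M → ≤-trans (energy-triangle M (a , b) (cut N a , cut N b) (spanRe cs , spanIm cs))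
                (≤-trans (+-mono
                  (≤-trans (*-monoˡ 2# 2≥0 (≤-trans (cut-tail N M) (close (h (N ℕ.+ M) (ℕₚ.m≤m+n N M)) (h N ℕₚ.≤-refl)))) (≤-trans (≤-reflexive (solve 1 (λ i → con (+ 2) :* (i :+ i) := con (+ 4) :* i) refl (inv k₁))) (f k₁ ℕₚ.≤-refl)))
                  (≤-trans (*-monoˡ 2# 2≥0 (l M)) (g k₂ ℕₚ.≤-refl)))
                  (≤-reflexive (inv-half k)))

  span-summable : ∀ cs → ∃ (Lim (λ N → ∑ N (λ j → (spanRe cs j * spanRe cs j + spanIm cs j * spanIm cs j) * weight j)))
  span-summable cs = let B , β = span-bound cs in summable _ (λ _ → 0#) (B * B + B * B)
    (λ j → +-nonNeg (square-nonNeg _) (square-nonNeg _)) (+-nonNeg (square-nonNeg B) (square-nonNeg B))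
    (λ j → ≤-resp refl (solve 1 (λ d → d := con (+ 2) :* con (+ 0) :+ d) refl _) (+-mono (upper (Abs-* (proj₁ (β j)) (proj₁ (β j)))) (upper (Abs-* (proj₂ (β j)) (proj₂ (β j))))))
    (Lim-cong (λ N → sym (∑-0 N λ j _ → zeroˡ _)) refl (Lim-const 0#))

  -- Complex numbers over 𝕂

  infix  4 _≈ᶜ_
  infixl 6 _+ᶜ_ _-ᶜ_
  infixl 7 _*ᶜ_
  infixr 8 _^ᶜ_

  record 𝒞 : Set where
    constructor _+i_
    field
      re im : Carrier
  open 𝒞 public

  record _≈ᶜ_ (z w : 𝒞) : Set where
    constructor _,ᶜ_
    field
      re≈ : re z ≈ re w
      im≈ : im z ≈ im w
  open _≈ᶜ_ public

  _+ᶜ_ _*ᶜ_ _-ᶜ_ : 𝒞 → 𝒞 → 𝒞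
  z +ᶜ w = (re z + re w) +i (im z + im w)
  z *ᶜ w = (re z * re w - im z * im w) +i (re z * im w + im z * re w)
  z -ᶜ w = (re z - re w) +i (im z - im w)

  -ᶜ_ : 𝒞 → 𝒞
  -ᶜ z = (- re z) +i (- im z)

  0ᶜ 1ᶜ : 𝒞
  0ᶜ = 0# +i 0#
  1ᶜ = 1# +i 0#

  complexRing : CommutativeRing _ _
  complexRing = record
    { Carrier = 𝒞 ; _≈_ = _≈ᶜ_ ; _+_ = _+ᶜ_ ; _*_ = _*ᶜ_ ; -_ = -ᶜ_ ; 0# = 0ᶜ ; 1# = 1ᶜ
    ; isCommutativeRing = record
      { isRing = record
        { +-isAbelianGroup = record
          { isGroup = record
            { isMonoid = record
              { isSemigroup = record
                { isMagma = record
                  { isEquivalence = record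
                    { refl = refl ,ᶜ refl ; sym = λ (p ,ᶜ q) → sym p ,ᶜ sym q ; trans = λ (p ,ᶜ q) (r ,ᶜ s) → trans p r ,ᶜ trans q s }
                  ; ∙-cong = λ (p ,ᶜ q) (r ,ᶜ s) → +-cong p r ,ᶜ +-cong q s }
                ; assoc = λ z w v → +-assoc _ _ _ ,ᶜ +-assoc _ _ _ }
              ; identity = (λ z → +-identityˡ _ ,ᶜ +-identityˡ _) , (λ z → +-identityʳ _ ,ᶜ +-identityʳ _) }
            ; inverse = (λ z → trans (+-comm _ _) (-‿inverseʳ _) ,ᶜ trans (+-comm _ _) (-‿inverseʳ _)) , (λ z → -‿inverseʳ _ ,ᶜ -‿inverseʳ _)
            ; ⁻¹-cong = λ (p ,ᶜ q) → -‿cong p ,ᶜ -‿cong q }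
          ; comm = λ z w → +-comm _ _ ,ᶜ +-comm _ _ }
        ; *-cong = λ (p ,ᶜ q) (r ,ᶜ s) → +-cong (*-cong p r) (-‿cong (*-cong q s)) ,ᶜ +-cong (*-cong p s) (*-cong q r)
        ; *-assoc = λ (a +i b) (c +i d) (e +i f) →
            solve 6 (λ a b c d e f → (a :* c :- b :* d) :* e :- (a :* d :+ b :* c) :* f := a :* (c :* e :- d :* f) :- b :* (c :* f :+ d :* e)) refl a b c d e f ,ᶜ
            solve 6 (λ a b c d e f → (a :* c :- b :* d) :* f :+ (a :* d :+ b :* c) :* e := a :* (c :* f :+ d :* e) :+ b :* (c :* e :- d :* f)) refl a b c d e f
        ; *-identity =
            (λ (a +i b) → solve 2 (λ a b → con (+ 1) :* a :- con (+ 0) :* b := a) refl a b ,ᶜ solve 2 (λ a b → con (+ 1) :* b :+ con (+ 0) :* a := b) refl a b) ,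
            (λ (a +i b) → solve 2 (λ a b → a :* con (+ 1) :- b :* con (+ 0) := a) refl a b ,ᶜ solve 2 (λ a b → a :* con (+ 0) :+ b :* con (+ 1) := b) refl a b)
        ; distrib =
            (λ (a +i b) (c +i d) (e +i f) →
              solve 6 (λ a b c d e f → a :* (c :+ e) :- b :* (d :+ f) := a :* c :- b :* d :+ (a :* e :- b :* f)) refl a b c d e f ,ᶜ
              solve 6 (λ a b c d e f → a :* (d :+ f) :+ b :* (c :+ e) := a :* d :+ b :* c :+ (a :* f :+ b :* e)) refl a b c d e f) ,
            (λ (a +i b) (c +i d) (e +i f) →
              solve 6 (λ a b c d e f → (c :+ e) :* a :- (d :+ f) :* b := c :* a :- d :* b :+ (e :* a :- f :* b)) refl a b c d e f ,ᶜ
              solve 6 (λ a b c d e f → (c :+ e) :* b :+ (d :+ f) :* a := c :* b :+ d :* a :+ (e :* b :+ f :* a)) refl a b c d e f)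
        }
      ; *-comm = λ (a +i b) (c +i d) →
          solve 4 (λ a b c d → a :* c :- b :* d := c :* a :- d :* b) refl a b c d ,ᶜ
          solve 4 (λ a b c d → a :* d :+ b :* c := c :* b :+ d :* a) refl a b c d
      }
    }

  module ℂ where
    open CommutativeRing complexRing public
      using (refl; sym; trans; reflexive; +-cong; *-cong; -‿cong; +-congˡ; +-congʳ; *-congˡ; *-congʳ; *-comm; *-assoc; +-identityˡ; +-identityʳ; zeroˡ; zeroʳ)
    module Reasoning = SetoidReasoning (CommutativeRing.setoid complexRing)

  embed : ℤ → 𝒞
  embed i = ι (i ℚ./ 1) +i 0#

  private
    almostᶜ : ACR.AlmostCommutativeRing _ _
    almostᶜ = ACR.fromCommutativeRing complexRing

    ℤ⟶𝒞 : ACR._-Raw-AlmostCommutative⟶_ (CommutativeRing.rawRing ℤₚ.+-*-commutativeRing) almostᶜ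
    ℤ⟶𝒞 = record
      { ⟦_⟧    = embed
      ; +-homo = λ i j → trans (reflexive (≡.cong ι (/1-homo-+ i j))) (ι-+ _ _) ,ᶜ solve 0 (con (+ 0) := con (+ 0) :+ con (+ 0)) refl
      ; *-homo = λ i j → trans (reflexive (≡.cong ι (/1-homo-* i j))) (trans (ι-* _ _) (solve 1 (λ x → x := x :- con (+ 0) :* con (+ 0)) refl _)) ,ᶜ
          solve 2 (λ x y → con (+ 0) := x :* con (+ 0) :+ con (+ 0) :* y) refl _ _
      ; -‿homo = λ i → trans (reflexive (≡.cong ι (-‿homo-/1 i))) (ι-neg _) ,ᶜ solve 0 (con (+ 0) := :- con (+ 0)) refl
      ; 0-homo = ℂ.refl
      ; 1-homo = ℂ.refl
      }

  open RingSolver (CommutativeRing.rawRing ℤₚ.+-*-commutativeRing) almostᶜ ℤ⟶𝒞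
    (λ i j → Maybe.map (λ e → ℂ.reflexive (≡.cong embed e)) (Dec.dec⇒maybe (i ℤₚ.≟ j)))
    public using () renaming (solve to solveᶜ; _:=_ to _:=ᶜ_; _:+_ to _:+ᶜ_; _:*_ to _:*ᶜ_; _:-_ to _:-ᶜ_; :-_ to :-ᶜ_; con to conᶜ)

  _^ᶜ_ : 𝒞 → ℕ → 𝒞
  z ^ᶜ zero  = 1ᶜ
  z ^ᶜ suc n = z *ᶜ z ^ᶜ n

  ∑ᶜ : ℕ → (ℕ → 𝒞) → 𝒞
  ∑ᶜ zero    g = 0ᶜ
  ∑ᶜ (suc n) g = ∑ᶜ n g +ᶜ g n

  ∣_∣² : 𝒞 → Carrier
  ∣ z ∣² = re z * re z + im z * im z

  real : Carrier → 𝒞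
  real x = x +i 0#

  series : (ℕ → 𝒞) → 𝒞 → ℕ → 𝒞
  series a z N = ∑ᶜ N (λ n → a n *ᶜ z ^ᶜ n)

  ∑ᶜ-cong : ∀ n {g h} → (∀ i → i ℕ.< n → g i ≈ᶜ h i) → ∑ᶜ n g ≈ᶜ ∑ᶜ n h
  ∑ᶜ-cong zero    e = ℂ.refl
  ∑ᶜ-cong (suc n) e = ℂ.+-cong (∑ᶜ-cong n λ i h → e i (ℕₚ.m<n⇒m<1+n h)) (e n ℕₚ.≤-refl)

  ∑ᶜ-* : ∀ n c g → ∑ᶜ n (λ i → c *ᶜ g i) ≈ᶜ c *ᶜ ∑ᶜ n g
  ∑ᶜ-* zero    c g = ℂ.sym (ℂ.zeroʳ c)
  ∑ᶜ-* (suc n) c g = ℂ.trans (ℂ.+-congʳ (∑ᶜ-* n c g)) (solveᶜ 3 (λ c s g → c :*ᶜ s :+ᶜ c :*ᶜ g :=ᶜ c :*ᶜ (s :+ᶜ g)) ℂ.refl c (∑ᶜ n g) (g n))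

  ∑ᶜ-+ : ∀ n g h → ∑ᶜ n (λ i → g i +ᶜ h i) ≈ᶜ ∑ᶜ n g +ᶜ ∑ᶜ n h
  ∑ᶜ-+ zero    g h = ℂ.sym (ℂ.+-identityˡ 0ᶜ)
  ∑ᶜ-+ (suc n) g h = ℂ.trans (ℂ.+-congʳ (∑ᶜ-+ n g h)) (solveᶜ 4 (λ a b c d → a :+ᶜ b :+ᶜ (c :+ᶜ d) :=ᶜ a :+ᶜ c :+ᶜ (b :+ᶜ d)) ℂ.refl (∑ᶜ n g) (∑ᶜ n h) (g n) (h n))

  ∑ᶜ-split : ∀ m n g → ∑ᶜ (m ℕ.+ n) g ≈ᶜ ∑ᶜ m g +ᶜ ∑ᶜ n (λ i → g (m ℕ.+ i))
  ∑ᶜ-split m zero    g = ℂ.trans (ℂ.reflexive (≡.cong (λ k → ∑ᶜ k g) (ℕₚ.+-identityʳ m))) (ℂ.sym (ℂ.+-identityʳ _))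
  ∑ᶜ-split m (suc n) g = ℂ.trans (ℂ.reflexive (≡.cong (λ k → ∑ᶜ k g) (ℕₚ.+-suc m n)))
    (ℂ.trans (ℂ.+-congʳ (∑ᶜ-split m n g)) (solveᶜ 3 (λ a b c → a :+ᶜ b :+ᶜ c :=ᶜ a :+ᶜ (b :+ᶜ c)) ℂ.refl (∑ᶜ m g) _ (g (m ℕ.+ n))))

  ^ᶜ-+ : ∀ z m n → z ^ᶜ (m ℕ.+ n) ≈ᶜ z ^ᶜ m *ᶜ z ^ᶜ n
  ^ᶜ-+ z zero    n = solveᶜ 1 (λ x → x :=ᶜ conᶜ (+ 1) :*ᶜ x) ℂ.refl (z ^ᶜ n)
  ^ᶜ-+ z (suc m) n = ℂ.trans (ℂ.*-congˡ (^ᶜ-+ z m n)) (ℂ.sym (ℂ.*-assoc z (z ^ᶜ m) (z ^ᶜ n)))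

  ∣∣²-* : ∀ z w → ∣ z *ᶜ w ∣² ≈ ∣ z ∣² * ∣ w ∣²
  ∣∣²-* (a +i b) (c +i d) = solve 4 (λ a b c d → (a :* c :- b :* d) :* (a :* c :- b :* d) :+ (a :* d :+ b :* c) :* (a :* d :+ b :* c) := (a :* a :+ b :* b) :* (c :* c :+ d :* d)) refl a b c d

  ∣∣²-^ : ∀ z n → ∣ z ^ᶜ n ∣² ≈ ∣ z ∣² ^ᴷ n
  ∣∣²-^ z zero    = solve 0 (con (+ 1) :* con (+ 1) :+ con (+ 0) :* con (+ 0) := con (+ 1)) refl
  ∣∣²-^ z (suc n) = trans (∣∣²-* z (z ^ᶜ n)) (*-congˡ (∣∣²-^ z n))

  ∣∣²-cong : ∀ {z w} → z ≈ᶜ w → ∣ z ∣² ≈ ∣ w ∣²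
  ∣∣²-cong (p ,ᶜ q) = +-cong (*-cong p p) (*-cong q q)

  ∣∣²≥0 : ∀ z → ∣ z ∣² ≥0
  ∣∣²≥0 z = +-nonNeg (square-nonNeg (re z)) (square-nonNeg (im z))

  record Limᶜ (x : ℕ → 𝒞) (l : 𝒞) : Set where
    constructor limᶜ
    field
      lim-re : Lim (λ n → re (x n)) (re l)
      lim-im : Lim (λ n → im (x n)) (im l)
  open Limᶜ public

  Limᶜ-+ : ∀ {x y l m} → Limᶜ x l → Limᶜ y m → Limᶜ (λ n → x n +ᶜ y n) (l +ᶜ m)
  Limᶜ-+ (limᶜ p q) (limᶜ r s) = limᶜ (Lim-+ p r) (Lim-+ q s)

  Limᶜ-* : ∀ {x l} c → Limᶜ x l → Limᶜ (λ n → c *ᶜ x n) (c *ᶜ l)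
  Limᶜ-* c (limᶜ p q) = limᶜ (Lim-- (Lim-* (re c) p) (Lim-* (im c) q)) (Lim-+ (Lim-* (re c) q) (Lim-* (im c) p))

  Limᶜ-cong : ∀ {x y l m} → (∀ n → x n ≈ᶜ y n) → l ≈ᶜ m → Limᶜ x l → Limᶜ y m
  Limᶜ-cong e (f ,ᶜ g) (limᶜ p q) = limᶜ (Lim-cong (λ n → re≈ (e n)) f p) (Lim-cong (λ n → im≈ (e n)) g q)

  Limᶜ-const : ∀ c → Limᶜ (λ _ → c) c
  Limᶜ-const c = limᶜ (Lim-const (re c)) (Lim-const (im c))

  -- The power series T of f k = Q′ / Q satisfies T = U + z^k T, and so does f k.
  module LogarithmicDerivative (K : ℕ) (z v : 𝒞) where

    k : ℕ
    k = suc K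

    Q Q′ : 𝒞
    Q  = ∑ᶜ k (z ^ᶜ_)
    Q′ = ∑ᶜ K (λ j → real (nat (suc j)) *ᶜ z ^ᶜ j)

    T : ℕ → 𝒞
    T = series (λ n → real (φ k n)) z

    Q[1-z] : ∀ k → ∑ᶜ k (z ^ᶜ_) *ᶜ (1ᶜ -ᶜ z) ≈ᶜ 1ᶜ -ᶜ z ^ᶜ k
    Q[1-z] zero    = solveᶜ 1 (λ z → conᶜ (+ 0) :*ᶜ (conᶜ (+ 1) :-ᶜ z) :=ᶜ conᶜ (+ 1) :-ᶜ conᶜ (+ 1)) ℂ.refl z
    Q[1-z] (suc k) = ℂ.trans (solveᶜ 3 (λ s p z → (s :+ᶜ p) :*ᶜ (conᶜ (+ 1) :-ᶜ z) :=ᶜ s :*ᶜ (conᶜ (+ 1) :-ᶜ z) :+ᶜ (p :-ᶜ z :*ᶜ p)) ℂ.refl (∑ᶜ k (z ^ᶜ_)) (z ^ᶜ k) z)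
      (ℂ.trans (ℂ.+-congʳ (Q[1-z] k)) (solveᶜ 2 (λ p q → conᶜ (+ 1) :-ᶜ p :+ᶜ (p :-ᶜ q) :=ᶜ conᶜ (+ 1) :-ᶜ q) ℂ.refl (z ^ᶜ k) (z ^ᶜ suc k)))

    Q′[1-z] : ∀ K → ∑ᶜ K (λ j → real (nat (suc j)) *ᶜ z ^ᶜ j) *ᶜ (1ᶜ -ᶜ z) ≈ᶜ ∑ᶜ K (z ^ᶜ_) -ᶜ real (nat K) *ᶜ z ^ᶜ K
    Q′[1-z] zero    = ℂ.trans (solveᶜ 1 (λ z → conᶜ (+ 0) :*ᶜ (conᶜ (+ 1) :-ᶜ z) :=ᶜ conᶜ (+ 0) :-ᶜ conᶜ (+ 0) :*ᶜ conᶜ (+ 1)) ℂ.refl z)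
      (ℂ.+-congˡ (ℂ.-‿cong (ℂ.*-congʳ (sym nat-0 ,ᶜ refl))))
    Q′[1-z] (suc K) = begin
      (s +ᶜ n *ᶜ p) *ᶜ (1ᶜ -ᶜ z)
        ≈⟨ solveᶜ 4 (λ s n p z → (s :+ᶜ n :*ᶜ p) :*ᶜ (conᶜ (+ 1) :-ᶜ z) :=ᶜ s :*ᶜ (conᶜ (+ 1) :-ᶜ z) :+ᶜ n :*ᶜ (p :-ᶜ z :*ᶜ p)) ℂ.refl s n p z ⟩
      s *ᶜ (1ᶜ -ᶜ z) +ᶜ n *ᶜ (p -ᶜ z *ᶜ p)
        ≈⟨ ℂ.+-congʳ (Q′[1-z] K) ⟩
      q -ᶜ real (nat K) *ᶜ p +ᶜ n *ᶜ (p -ᶜ z *ᶜ p)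
        ≈⟨ ℂ.+-congˡ (ℂ.*-congʳ n≈) ⟩
      q -ᶜ real (nat K) *ᶜ p +ᶜ (real (nat K) +ᶜ 1ᶜ) *ᶜ (p -ᶜ z *ᶜ p)
        ≈⟨ solveᶜ 4 (λ q m p z → q :-ᶜ m :*ᶜ p :+ᶜ (m :+ᶜ conᶜ (+ 1)) :*ᶜ (p :-ᶜ z :*ᶜ p) :=ᶜ q :+ᶜ p :-ᶜ (m :+ᶜ conᶜ (+ 1)) :*ᶜ (z :*ᶜ p)) ℂ.refl q (real (nat K)) p z ⟩
      q +ᶜ p -ᶜ (real (nat K) +ᶜ 1ᶜ) *ᶜ (z *ᶜ p)
        ≈⟨ ℂ.+-congˡ (ℂ.-‿cong (ℂ.*-congʳ (ℂ.sym n≈))) ⟩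
      q +ᶜ p -ᶜ n *ᶜ (z *ᶜ p) ∎
      where
      open ℂ.Reasoning
      s n p q : 𝒞
      s = ∑ᶜ K (λ j → real (nat (suc j)) *ᶜ z ^ᶜ j)
      n = real (nat (suc K))
      p = z ^ᶜ K
      q = ∑ᶜ K (z ^ᶜ_)
      n≈ : n ≈ᶜ real (nat K) +ᶜ 1ᶜ
      n≈ = nat-suc K ,ᶜ sym (+-identityʳ 0#)

    φ-small : ∀ n → n ℕ.< K → φ k n ≈ 1#
    φ-small n n<K = trans (+-congˡ (-‿cong (trans (*-congˡ (ind-no {k} {n} λ d → ℕₚ.<⇒≱ (ℕ.s≤s n<K) (∣⇒≤ d))) (zeroʳ _)))) (solve 0 (con (+ 1) :- con (+ 0) := con (+ 1)) refl)

    φ-K : φ k K ≈ - nat K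
    φ-K = trans (+-congˡ (-‿cong (trans (*-congˡ (ind-yes ∣-refl)) (*-identityʳ _)))) (trans (+-congˡ (-‿cong (nat-suc K)))
      (solve 1 (λ n → con (+ 1) :- (n :+ con (+ 1)) := :- n) refl (nat K)))

    φ-periodic : ∀ n → φ k (k ℕ.+ n) ≈ φ k n
    φ-periodic n with multiple? k n
    ... | multiple (divides c e) f  = +-congˡ (-‿cong (*-congˡ (trans (ind-yes (divides (suc c) (≡.trans (≡.sym (ℕₚ.+-suc k n)) (≡.cong (k ℕ.+_) e)))) (sym f))))
    ... | nonmultiple h f = +-congˡ (-‿cong (*-congˡ (trans (ind-no λ d → h (∣m+n∣m⇒∣n (≡.subst (k ∣_) (≡.sym (ℕₚ.+-suc k n)) d) ∣-refl)) (sym f))))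

    T-k : T k ≈ᶜ Q′ *ᶜ (1ᶜ -ᶜ z)
    T-k = ℂ.trans (ℂ.+-cong (∑ᶜ-cong K λ n n<K → ℂ.trans (ℂ.*-congʳ (φ-small n n<K ,ᶜ refl)) (solveᶜ 1 (λ x → conᶜ (+ 1) :*ᶜ x :=ᶜ x) ℂ.refl (z ^ᶜ n)))
        (ℂ.*-congʳ {z ^ᶜ K} (φ-K ,ᶜ solve 0 (con (+ 0) := :- con (+ 0)) refl)))
      (ℂ.trans (solveᶜ 3 (λ s m p → s :+ᶜ (:-ᶜ m) :*ᶜ p :=ᶜ s :-ᶜ m :*ᶜ p) ℂ.refl (∑ᶜ K (z ^ᶜ_)) (real (nat K)) (z ^ᶜ K)) (ℂ.sym (Q′[1-z] K)))

    T-periodic : ∀ N → T (k ℕ.+ N) ≈ᶜ T k +ᶜ z ^ᶜ k *ᶜ T N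
    T-periodic N = ℂ.trans (∑ᶜ-split k N _) (ℂ.+-congˡ (ℂ.trans
      (∑ᶜ-cong N λ n _ → ℂ.trans (ℂ.*-cong (φ-periodic n ,ᶜ refl) (^ᶜ-+ z k n)) (solveᶜ 3 (λ c p q → c :*ᶜ (p :*ᶜ q) :=ᶜ p :*ᶜ (c :*ᶜ q)) ℂ.refl (real (φ k n)) (z ^ᶜ k) (z ^ᶜ n)))
      (∑ᶜ-* N (z ^ᶜ k) _)))

    module _ (v*Q : v *ᶜ Q ≈ᶜ Q′) where

      -- Multiplied by 1 - z, the equation v Q = Q′ becomes v (1 - z^k) = T k: this factor reduces Q
      -- to 1 - z^k and Q′ to the first k terms of the series.
      v-fixed : v ≈ᶜ T k +ᶜ z ^ᶜ k *ᶜ v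
      v-fixed = begin
        v                                                  ≈⟨ solveᶜ 2 (λ v p → v :=ᶜ v :*ᶜ (conᶜ (+ 1) :-ᶜ p) :+ᶜ p :*ᶜ v) ℂ.refl v (z ^ᶜ k) ⟩
        v *ᶜ (1ᶜ -ᶜ z ^ᶜ k) +ᶜ z ^ᶜ k *ᶜ v                 ≈⟨ ℂ.+-congʳ (ℂ.*-congˡ (ℂ.sym (Q[1-z] k))) ⟩
        v *ᶜ (Q *ᶜ (1ᶜ -ᶜ z)) +ᶜ z ^ᶜ k *ᶜ v               ≈⟨ ℂ.+-congʳ (ℂ.trans (ℂ.sym (ℂ.*-assoc v Q (1ᶜ -ᶜ z))) (ℂ.*-congʳ v*Q)) ⟩
        Q′ *ᶜ (1ᶜ -ᶜ z) +ᶜ z ^ᶜ k *ᶜ v                     ≈⟨ ℂ.+-congʳ (ℂ.sym T-k) ⟩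
        T k +ᶜ z ^ᶜ k *ᶜ v ∎
        where
        open ℂ.Reasoning

      D : ℕ → 𝒞
      D N = T N -ᶜ v

      D-step : ∀ N → D (k ℕ.+ N) ≈ᶜ z ^ᶜ k *ᶜ D N
      D-step N = ℂ.trans (ℂ.+-cong (T-periodic N) (ℂ.-‿cong v-fixed))
        (solveᶜ 4 (λ t p s v → t :+ᶜ p :*ᶜ s :-ᶜ (t :+ᶜ p :*ᶜ v) :=ᶜ p :*ᶜ (s :-ᶜ v)) ℂ.refl (T k) (z ^ᶜ k) (T N) v)

      module _ (m : ℕ) (z<1 : ∣ z ∣² ≤ 1# - inv m) where

        ρ : Carrier
        ρ = 1# - inv m

        ρ≥0 : ρ ≥0
        ρ≥0 = ≤⇒≥0 (inv≤1 m)

        ρ≤1 : ρ ≤ 1#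
        ρ≤1 = ≥0⇒≤ _ (inv≥0 m) (solve 1 (λ i → i := con (+ 1) :- (con (+ 1) :- i)) refl (inv m))

        contraction : ∀ N → ∣ D (k ℕ.+ N) ∣² ≤ ρ * ∣ D N ∣²
        contraction N = ≤-trans (≤-reflexive (trans (∣∣²-cong (D-step N)) (∣∣²-* (z ^ᶜ k) (D N))))
          (*-monoʳ _ (∣∣²≥0 (D N)) (≤-trans (≤-reflexive (∣∣²-^ z k))
            (≤-resp refl (*-identityʳ ρ) (*-mono (^-≥0 K (∣∣²≥0 z)) ρ≥0 z<1 (^-≤1 K (∣∣²≥0 z) (≤-trans z<1 ρ≤1))))))

        B : Carrier
        B = ∑ k (λ s → ∣ D s ∣²)

        B≥0 : B ≥0
        B≥0 = ∑-≥0 k λ s _ → ∣∣²≥0 (D s)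

        -- Along each residue class modulo k the squared error contracts by a factor of at most ρ
        -- per step; `B` dominates the k starting values.
        decay : ∀ s M → s ℕ.< k → ∣ D (s ℕ.+ M ℕ.* k) ∣² ≤ B * ρ ^ᴷ M
        decay s zero h = ≤-trans (≤-reflexive (reflexive (≡.cong (λ n → ∣ D n ∣²) (ℕₚ.+-identityʳ s)))) (≤-trans
          (≤-trans (≥0⇒≤ _ (∑-≥0 s λ i _ → ∣∣²≥0 (D i)) (solve 2 (λ a b → a := a :+ b :- b) refl (∑ s (λ s → ∣ D s ∣²)) ∣ D s ∣²))
            (∑-≤ {suc s} {k} h λ i → ∣∣²≥0 (D i)))
          (≤-reflexive (sym (*-identityʳ B))))
        decay s (suc M) h = ≤-trans (≤-reflexive (reflexive (≡.cong (λ n → ∣ D n ∣²) (≡.trans (≡.sym (ℕₚ.+-assoc s k (M ℕ.* k))) (≡.trans (≡.cong (ℕ._+ M ℕ.* k) (ℕₚ.+-comm s k)) (ℕₚ.+-assoc k s (M ℕ.* k)))))))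
          (≤-trans (contraction (s ℕ.+ M ℕ.* k)) (≤-trans (*-monoˡ ρ ρ≥0 (decay s M h)) (≤-reflexive (solve 3 (λ r b p → r :* (b :* p) := b :* (r :* p)) refl ρ B _))))

        open Geometric ρ (nat (suc m)) ρ≥0 (nat≥0 _) (trans (solve 2 (λ i n → (con (+ 1) :- (con (+ 1) :- i)) :* n := n :* i) refl (inv m) _) (nat*inv m))

        small : ∀ j → ∃ λ N → ∀ n → N ℕ.≤ n → ∣ D n ∣² ≤ inv j * inv j
        small j = go (Lim-power ρ≤1 B B≥0 j′)
          where
          j′ : ℕ
          -- Chosen so that j′ + 1 = (j+1)², since it is the squared error that is estimated.
          j′ = j ℕ.+ j ℕ.* suc j
          go : (∃ λ M → ∀ n → M ℕ.≤ n → B * ρ ^ᴷ n ≤ inv j′) → ∃ λ N → ∀ n → N ℕ.≤ n → ∣ D n ∣² ≤ inv j * inv j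
          go (M , h) = M ℕ.* k , λ n M*k≤n → ≤-trans
            (≤-reflexive (reflexive (≡.cong (λ i → ∣ D i ∣²) (DM.m≡m%n+[m/n]*n n k))))
            (≤-trans (decay (n DM.% k) (n DM./ k) (DM.m%n<n n k)) (≤-trans
              (h (n DM./ k) (ℕₚ.≤-trans (ℕₚ.≤-reflexive (≡.sym (DM.m*n/n≡m M k))) (DM./-monoˡ-≤ k M*k≤n)))
              (≤-reflexive (inv-* j j ≡.refl))))

        T⟶v : Limᶜ T v
        T⟶v = limᶜ
          (lim λ j → let N , h = small j in N , λ n N≤n → Abs-square _ (inv j) (nat (suc j)) (nat≥0 _) (trans (*-comm _ _) (nat*inv j))
            (≤-trans (x≤x+ (square-nonNeg (im (D n)))) (h n N≤n)))
          (lim λ j → let N , h = small j in N , λ n N≤n → Abs-square _ (inv j) (nat (suc j)) (nat≥0 _) (trans (*-comm _ _) (nat*inv j))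
            (≤-trans (≤-trans (x≤x+ (square-nonNeg (re (D n)))) (≤-reflexive (+-comm _ _))) (h n N≤n)))

  -- Power series of linear combinations and of quotients.

  spanCoefficient : List ((Carrier × Carrier) × ℕ) → ℕ → 𝒞
  spanCoefficient cs n = spanRe cs n +i spanIm cs n

  combine : List ((Carrier × Carrier) × ℕ) → (ℕ → 𝒞) → 𝒞
  combine cs V = foldr (λ ((α , β) , i) s → (α +i β) *ᶜ V i +ᶜ s) 0ᶜ cs

  span-series : ∀ cs z V → (∀ i → Limᶜ (series (λ n → real (φ (2 ℕ.+ i) n)) z) (V i)) → Limᶜ (series (spanCoefficient cs) z) (combine cs V)
  span-series [] z V h = Limᶜ-cong (λ N → ℂ.sym (zero-series N)) ℂ.refl (Limᶜ-const 0ᶜ)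
    where
    zero-series : ∀ N → series (spanCoefficient []) z N ≈ᶜ 0ᶜ
    zero-series zero    = ℂ.refl
    zero-series (suc N) = ℂ.trans (ℂ.+-cong (zero-series N) (ℂ.zeroˡ _)) (ℂ.+-identityˡ 0ᶜ)
  span-series (((α , β) , i) ∷ cs) z V h = Limᶜ-cong
    (λ N → ℂ.trans (ℂ.+-congʳ (ℂ.sym (∑ᶜ-* N (α +i β) _))) (ℂ.trans (ℂ.sym (∑ᶜ-+ N _ _)) (∑ᶜ-cong N λ n _ →
      ℂ.trans (solveᶜ 4 (λ c p x d → c :*ᶜ (p :*ᶜ x) :+ᶜ d :*ᶜ x :=ᶜ (c :*ᶜ p :+ᶜ d) :*ᶜ x) ℂ.refl (α +i β) (real (φ (2 ℕ.+ i) n)) (z ^ᶜ n) (spanCoefficient cs n))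
        (ℂ.*-congʳ (solve 4 (λ a b p r → a :* p :- b :* con (+ 0) :+ r := a :* p :+ r) refl α β _ _ ,ᶜ
                    solve 4 (λ a b p r → a :* con (+ 0) :+ b :* p :+ r := b :* p :+ r) refl α β _ _)))))
    ℂ.refl (Limᶜ-+ (Limᶜ-* (α +i β) (h i)) (span-series cs z V h))

  series-sub : ∀ a b c z {v w} → (∀ n → c n ≈ᶜ a n -ᶜ b n) → Limᶜ (series a z) v → Limᶜ (series b z) w → Limᶜ (series c z) (v -ᶜ w)
  series-sub a b c z e p q = Limᶜ-cong difference ℂ.refl (limᶜ (Lim-- (lim-re p) (lim-re q)) (Lim-- (lim-im p) (lim-im q)))
    where
    difference : ∀ N → series a z N -ᶜ series b z N ≈ᶜ series c z N
    difference zero    = solveᶜ 0 (conᶜ (+ 0) :-ᶜ conᶜ (+ 0) :=ᶜ conᶜ (+ 0)) ℂ.refl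
    difference (suc N) = ℂ.trans
      (solveᶜ 5 (λ s t a b x → s :+ᶜ a :*ᶜ x :-ᶜ (t :+ᶜ b :*ᶜ x) :=ᶜ (s :-ᶜ t) :+ᶜ (a :-ᶜ b) :*ᶜ x) ℂ.refl (series a z N) (series b z N) (a N) (b N) (z ^ᶜ N))
      (ℂ.+-cong (difference N) (ℂ.*-congʳ (ℂ.sym (e N))))

  -- v = z w̄ / |w|² solves v w = z
  divide-inverse : ∀ z v c w r → v ≈ᶜ z *ᶜ c → c ≈ᶜ ((re w * r) +i (- im w * r)) → (re w * re w + im w * im w) * r ≈ 1# → v *ᶜ w ≈ᶜ z
  divide-inverse z v c w r e f g = ℂ.trans (ℂ.*-congʳ (ℂ.trans e (ℂ.*-congˡ f))) (ℂ.trans (ℂ.*-assoc z _ w) (ℂ.trans (ℂ.*-congˡ one)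
    (solveᶜ 1 (λ z → z :*ᶜ conᶜ (+ 1) :=ᶜ z) ℂ.refl z)))
    where
    one : ((re w * r) +i (- im w * r)) *ᶜ w ≈ᶜ 1ᶜ
    one = trans (solve 3 (λ a b r → a :* r :* a :- (:- b) :* r :* b := (a :* a :+ b :* b) :* r) refl (re w) (im w) r) g ,ᶜ
          solve 3 (λ a b r → a :* r :* b :+ (:- b) :* r :* a := con (+ 0)) refl (re w) (im w) r

  -- Parseval's formula for Riemann sums written with operations that agree with those of 𝕂.
  module RiemannSums (_⊞_ _⊠_ : Carrier → Carrier → Carrier) (κ′ : ℕ → Carrier) (z : Carrier)
    (+≡⊞ : ∀ x y → x + y ≡ x ⊞ y) (*≡⊠ : ∀ x y → x * y ≡ x ⊠ y) (κ≡κ′ : ∀ n → κ n ≡ κ′ n) (0≡z : 0# ≡ z) where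

    disc-parseval : ∀ a b (convergent : Parseval.Convergent a b) m φ →
      (∀ p → ¬ (∣ p ∣²ℚ ℚ.≤ exhaustion m) → φ p ≡ z) →
      (∀ p → ∣ p ∣²ℚ ℚ.≤ exhaustion m → ∃ λ v → ∃ λ w → Parseval.Sum a b p v w × φ p ≡ density p * (v * v + w * w)) →
      Lim (λ n → κ′ n ⊠ foldr (λ p s → φ p ⊞ s) z (grid n)) (Norm.I a b convergent m)
    disc-parseval a b convergent m φ out inn = Lim-cong same refl
      (Norm.parseval a b convergent m φ λ p i → let v , w , s , e = inn p i in v , w , s , reflexive e)
      where
      masked : ∀ p → Side (exhaustion m) p → χ (exhaustion m) p * φ p ≈ φ p
      masked p (inside c _)  = trans (*-congʳ c) (*-identityˡ _)
      masked p (outside _ k) = trans (*-congˡ 0≈) (trans (zeroʳ _) (sym 0≈))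
        where
        0≈ : φ p ≈ 0#
        0≈ = reflexive (≡.trans (out p k) (≡.sym 0≡z))
      abstract
       same : ∀ n → avg (exhaustion m) φ n ≈ κ′ n ⊠ foldr (λ p s → φ p ⊞ s) z (grid n)
       same n = trans (*-congˡ (sum-cong (grid n) λ p → masked p (side? (exhaustion m) p)))
        (reflexive (≡.trans (≡.cong₂ (λ k s → k * s) (κ≡κ′ n) (foldr-cong (λ p s → +≡⊞ (φ p) s) 0≡z (grid n))) (*≡⊠ (κ′ n) _)))

open import Defs

-- The Cauchy reals as a complete algebra.

module RealAlgebra where

  open RationalLemmas
  open RealLemmas
  open +-*-Solver

  infix 4 _≤_
  _≤_ : ℝ → ℝ → Set
  x ≤ y = ∀ ε → 0ℚ ℚ.< ε → ∃ λ N → ∀ n → N ℕ.≤ n → seq x n ℚ.≤ seq y n ℚ.+ ε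

  ≤⇒0≤ : ∀ {p q} → p ℚ.≤ q → 0ℚ ℚ.≤ q ℚ.- p
  ≤⇒0≤ {p} {q} h = ≡.subst (ℚ._≤ q ℚ.- p) (ℚₚ.+-inverseʳ p) (ℚₚ.+-monoˡ-≤ (ℚ.- p) h)

  0≤⇒≤ : ∀ {p q} e → 0ℚ ℚ.≤ e → e ≡ q ℚ.- p → p ℚ.≤ q
  0≤⇒≤ {p} {q} e h eq = ≡.subst₂ ℚ._≤_ (ℚₚ.+-identityˡ p) (Identity.p-q+q q p) (ℚₚ.+-monoˡ-≤ p (≡.subst (0ℚ ℚ.≤_) eq h))

  0≤+ : ∀ {p q} → 0ℚ ℚ.≤ p → 0ℚ ℚ.≤ q → 0ℚ ℚ.≤ p ℚ.+ q
  0≤+ = ℚₚ.+-mono-≤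

  upper : ∀ {p q ε} → ℚ.∣ p ℚ.- q ∣ ℚ.≤ ε → p ℚ.≤ q ℚ.+ ε
  upper {p} {q} {ε} h = 0≤⇒≤ _ (≤⇒0≤ (ℚₚ.≤-trans (p≤∣p∣ (p ℚ.- q)) h)) (solve 3 (λ p q e → e :- (p :- q) := q :+ e :- p) ≡.refl p q ε)
    where
    p≤∣p∣ : ∀ p → p ℚ.≤ ℚ.∣ p ∣
    p≤∣p∣ p with ℚₚ.≤-total 0ℚ p
    ... | inj₁ h = ℚₚ.≤-reflexive (≡.sym (ℚₚ.0≤p⇒∣p∣≡p h))
    ... | inj₂ h = ℚₚ.≤-trans h (ℚₚ.0≤∣p∣ p)

  flip : ∀ {p q ε} → ℚ.∣ p ℚ.- q ∣ ℚ.≤ ε → ℚ.∣ q ℚ.- p ∣ ℚ.≤ ε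
  flip {p} {q} {ε} h = ≡.subst (ℚ._≤ ε) (≡.trans (≡.sym (ℚₚ.∣-p∣≡∣p∣ (p ℚ.- q))) (≡.cong ℚ.∣_∣ (≡.sym (Identity.neg-sub p q)))) h

  within : ∀ {p q ε} → p ℚ.≤ q ℚ.+ ε → q ℚ.≤ p ℚ.+ ε → ℚ.∣ p ℚ.- q ∣ ℚ.≤ ε
  within {p} {q} {ε} h k with ℚₚ.∣p∣≡p∨∣p∣≡-p (p ℚ.- q)
  ... | inj₁ e = ≡.subst (ℚ._≤ ε) (≡.sym e) (0≤⇒≤ _ (≤⇒0≤ h) (solve 3 (λ p q e → q :+ e :- p := e :- (p :- q)) ≡.refl p q ε))
  ... | inj₂ e = ≡.subst (ℚ._≤ ε) (≡.sym e) (0≤⇒≤ _ (≤⇒0≤ k) (solve 3 (λ p q e → p :+ e :- q := e :- (:- (p :- q))) ≡.refl p q ε))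

  pointwise : ∀ {x y} → (∀ n → seq x n ≡ seq y n) → x ≈ y
  pointwise {x} {y} h ε 0<ε = 0 , λ n _ →
    ≡.subst (λ p → ℚ.∣ p ∣ ℚ.≤ ε) (≡.sym (≡.trans (≡.cong (ℚ._- seq y n) (h n)) (ℚₚ.+-inverseʳ (seq y n)))) (ℚₚ.<⇒≤ 0<ε)

  ≈-refl : ∀ {x} → x ≈ x
  ≈-refl {x} = pointwise {x} {x} λ _ → ≡.refl

  ≈-sym : ∀ {x y} → x ≈ y → y ≈ x
  ≈-sym {x} {y} h ε 0<ε = let N , b = h ε 0<ε in N , λ n p → flip {seq x n} {seq y n} (b n p)

  sum-close : ∀ {p q r s ε} → ℚ.∣ p ℚ.- q ∣ ℚ.≤ ½ ℚ.* ε → ℚ.∣ r ℚ.- s ∣ ℚ.≤ ½ ℚ.* ε → ℚ.∣ (p ℚ.+ r) ℚ.- (q ℚ.+ s) ∣ ℚ.≤ ε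
  sum-close {p} {q} {r} {s} {ε} h k = ≡.subst₂ ℚ._≤_ (≡.cong ℚ.∣_∣ (Identity.sub-interchange p q r s)) (Identity.half+half ε)
    (ℚₚ.≤-trans (ℚₚ.∣p+q∣≤∣p∣+∣q∣ (p ℚ.- q) (r ℚ.- s)) (ℚₚ.+-mono-≤ h k))

  ≈-trans : ∀ {x y z} → x ≈ y → y ≈ z → x ≈ z
  ≈-trans {x} {y} {z} h k ε 0<ε =
    let M , a = h (½ ℚ.* ε) (0<half 0<ε); N , b = k (½ ℚ.* ε) (0<half 0<ε) in M ℕ.⊔ N , λ n p →
      ≡.subst (λ d → ℚ.∣ d ∣ ℚ.≤ ε) (solve 3 (λ x y z → (x :+ y) :- (y :+ z) := x :- z) ≡.refl (seq x n) (seq y n) (seq z n))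
        (sum-close {seq x n} {seq y n} {seq y n} {seq z n} (a n (ℕₚ.m⊔n≤o⇒m≤o M N p)) (b n (ℕₚ.m⊔n≤o⇒n≤o M N p)))

  +-cong : ∀ {x y z w} → x ≈ y → z ≈ w → x + z ≈ y + w
  +-cong {x} {y} {z} {w} h k ε 0<ε =
    let M , a = h (½ ℚ.* ε) (0<half 0<ε); N , b = k (½ ℚ.* ε) (0<half 0<ε) in M ℕ.⊔ N , λ n p →
      sum-close {seq x n} {seq y n} {seq z n} {seq w n} (a n (ℕₚ.m⊔n≤o⇒m≤o M N p)) (b n (ℕₚ.m⊔n≤o⇒n≤o M N p))

  -‿cong : ∀ {x y} → x ≈ y → - x ≈ - y
  -‿cong {x} {y} h ε 0<ε = let N , b = h ε 0<ε in N , λ n p → ≡.subst (ℚ._≤ ε)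
    (≡.trans (≡.sym (ℚₚ.∣-p∣≡∣p∣ (seq x n ℚ.- seq y n))) (≡.cong ℚ.∣_∣ (Identity.neg-of-sub (seq x n) (seq y n)))) (b n p)

  *-congʳ : ∀ {x y} z → x ≈ y → x * z ≈ y * z
  *-congʳ {x} {y} z h ε 0<ε = go (eventually-bounded z)
    where
    go : EventuallyBounded z → ∃ λ N → ∀ n → N ℕ.≤ n → ℚ.∣ seq x n ℚ.* seq z n ℚ.- seq y n ℚ.* seq z n ∣ ℚ.≤ ε
    go (B , 0<B , L , bz) = L ℕ.⊔ M , λ n p → ≡.subst₂ ℚ._≤_
        (≡.trans (≡.sym (ℚₚ.∣p*q∣≡∣p∣*∣q∣ (seq x n ℚ.- seq y n) (seq z n))) (≡.cong ℚ.∣_∣ (solve 3 (λ x y z → (x :- y) :* z := x :* z :- y :* z) ≡.refl (seq x n) (seq y n) (seq z n))))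
        (≡.trans (solve 3 (λ e i b → (e :* i) :* b := e :* (b :* i)) ≡.refl ε i B) (≡.trans (≡.cong (ε ℚ.*_) (inv-inverse B 0<B)) (ℚₚ.*-identityʳ ε)))
        (*-mono-≤ (ℚₚ.0≤∣p∣ (seq z n)) (ℚₚ.<⇒≤ 0<δ) (proj₂ (h (ε ℚ.* i) 0<δ) n (ℕₚ.m⊔n≤o⇒n≤o L M p)) (bz n (ℕₚ.m⊔n≤o⇒m≤o L M p)))
      where
      i : ℚ
      i = inv B 0<B
      0<δ : 0ℚ ℚ.< ε ℚ.* i
      0<δ = 0<* 0<ε (0<inv B 0<B)
      M : ℕ
      M = proj₁ (h (ε ℚ.* i) 0<δ)

  *-comm : ∀ x y → x * y ≈ y * x
  *-comm x y = pointwise {x * y} {y * x} λ n → ℚₚ.*-comm (seq x n) (seq y n)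

  *-cong : ∀ {x y z w} → x ≈ y → z ≈ w → x * z ≈ y * w
  *-cong {x} {y} {z} {w} h k = ≈-trans {x * z} {y * z} {y * w} (*-congʳ {x} {y} z h)
    (≈-trans {y * z} {z * y} {y * w} (*-comm y z) (≈-trans {z * y} {w * y} {y * w} (*-congʳ {z} {w} y k) (*-comm w y)))

  ≤-reflexive : ∀ {x y} → x ≈ y → x ≤ y
  ≤-reflexive {x} {y} h ε 0<ε = let N , b = h ε 0<ε in N , λ n p → upper {seq x n} {seq y n} (b n p)

  ≤-trans : ∀ {x y z} → x ≤ y → y ≤ z → x ≤ z
  ≤-trans {x} {y} {z} h k ε 0<ε =
    let M , a = h (½ ℚ.* ε) (0<half 0<ε); N , b = k (½ ℚ.* ε) (0<half 0<ε) in M ℕ.⊔ N , λ n p →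
      0≤⇒≤ _ (0≤+ (≤⇒0≤ (a n (ℕₚ.m⊔n≤o⇒m≤o M N p))) (≤⇒0≤ (b n (ℕₚ.m⊔n≤o⇒n≤o M N p))))
        (solve 4 (λ x y z e → (y :+ con ½ :* e :- x) :+ (z :+ con ½ :* e :- y) := z :+ e :- x) ≡.refl (seq x n) (seq y n) (seq z n) ε)

  ≤-antisym : ∀ {x y} → x ≤ y → y ≤ x → x ≈ y
  ≤-antisym {x} {y} h k ε 0<ε = let M , a = h ε 0<ε; N , b = k ε 0<ε in
    M ℕ.⊔ N , λ n p → within {seq x n} {seq y n} (a n (ℕₚ.m⊔n≤o⇒m≤o M N p)) (b n (ℕₚ.m⊔n≤o⇒n≤o M N p))

  +-monoˡ : ∀ {x y} z → x ≤ y → x + z ≤ y + z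
  +-monoˡ {x} {y} z h ε 0<ε = let N , b = h ε 0<ε in N , λ n p →
    0≤⇒≤ _ (≤⇒0≤ (b n p)) (solve 4 (λ x y z e → y :+ e :- x := y :+ z :+ e :- (x :+ z)) ≡.refl (seq x n) (seq y n) (seq z n) ε)

  pointwise-≤ : ∀ {x y} → (∀ n → seq x n ℚ.≤ seq y n) → x ≤ y
  pointwise-≤ {x} {y} h ε 0<ε = 0 , λ n _ → ℚₚ.≤-trans (h n) (≡.subst (ℚ._≤ seq y n ℚ.+ ε) (ℚₚ.+-identityʳ _) (ℚₚ.+-monoʳ-≤ (seq y n) (ℚₚ.<⇒≤ 0<ε)))

  ι-cancel : ∀ {p q} → ι p ≤ ι q → p ℚ.≤ q
  ι-cancel {p} {q} h with p ℚₚ.≤? q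
  ... | yes p≤q = p≤q
  ... | no  p≰q = ⊥-elim (ℚₚ.<-irrefl ≡.refl (ℚₚ.<-≤-trans 0<δ (0≤⇒≤ _ (≤⇒0≤ (proj₂ (h δ 0<δ) _ ℕₚ.≤-refl)) (solve 2 (λ p q → q :+ con ½ :* (p :- q) :- p := con 0ℚ :- con ½ :* (p :- q)) ≡.refl p q))))
    where
    δ : ℚ
    δ = ½ ℚ.* (p ℚ.- q)
    0<δ : 0ℚ ℚ.< δ
    0<δ = 0<half (≡.subst (ℚ._< p ℚ.- q) (ℚₚ.+-inverseʳ q) (ℚₚ.+-monoˡ-< (ℚ.- q) (ℚₚ.≰⇒> p≰q)))

  -- (u + δ) (v + δ) ≥ 0 with u, v ≥ -δ gives u v ≥ - δ (u + v + δ).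
  *-nonNeg : ∀ {x y} → ι 0ℚ ≤ x → ι 0ℚ ≤ y → ι 0ℚ ≤ x * y
  *-nonNeg {x} {y} h k ε 0<ε = go (eventually-bounded x) (eventually-bounded y)
    where
    go : EventuallyBounded x → EventuallyBounded y → ∃ λ N → ∀ n → N ℕ.≤ n → 0ℚ ℚ.≤ seq x n ℚ.* seq y n ℚ.+ ε
    go (A , 0<A , L , bx) (B , 0<B , M , by) = (L ℕ.⊔ M) ℕ.⊔ (P ℕ.⊔ Q) , λ n p →
      let lm = ℕₚ.m⊔n≤o⇒m≤o (L ℕ.⊔ M) (P ℕ.⊔ Q) p
          pq = ℕₚ.m⊔n≤o⇒n≤o (L ℕ.⊔ M) (P ℕ.⊔ Q) p
      in bound (seq x n) (seq y n) (bx n (ℕₚ.m⊔n≤o⇒m≤o L M lm)) (by n (ℕₚ.m⊔n≤o⇒n≤o L M lm))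
           (proj₂ (h δ 0<δ) n (ℕₚ.m⊔n≤o⇒m≤o P Q pq)) (proj₂ (k δ 0<δ) n (ℕₚ.m⊔n≤o⇒n≤o P Q pq))
      where
      S i δ : ℚ
      -- The summand 1 pays for δ² ≤ δ, and the summand ε makes δ = ε / S at most 1.
      S = A ℚ.+ B ℚ.+ 1ℚ ℚ.+ ε
      0<S : 0ℚ ℚ.< S
      0<S = 0<+ (0<+ (0<+ 0<A 0<B) (ℚₚ.positive⁻¹ 1ℚ)) 0<ε
      i = inv S 0<S
      δ = ε ℚ.* i
      0<δ : 0ℚ ℚ.< δ
      0<δ = 0<* 0<ε (0<inv S 0<S)
      0≤δ : 0ℚ ℚ.≤ δ
      0≤δ = ℚₚ.<⇒≤ 0<δ
      P Q : ℕ
      P = proj₁ (h δ 0<δ)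
      Q = proj₁ (k δ 0<δ)
      Sδ : S ℚ.* δ ≡ ε
      Sδ = ≡.trans (solve 3 (λ s e i → s :* (e :* i) := e :* (s :* i)) ≡.refl S ε i) (≡.trans (≡.cong (ε ℚ.*_) (inv-inverse S 0<S)) (ℚₚ.*-identityʳ ε))
      ≤∣∣ : ∀ {u U} → ℚ.∣ u ∣ ℚ.≤ U → u ℚ.≤ U
      ≤∣∣ {u} {U} h = ≡.subst (u ℚ.≤_) (ℚₚ.+-identityˡ U) (upper {u} {0ℚ} (≡.subst (λ w → ℚ.∣ w ∣ ℚ.≤ U) (≡.sym (ℚₚ.+-identityʳ u)) h))
      δ≤1 : δ ℚ.≤ 1ℚ
      δ≤1 = 0≤⇒≤ ((A ℚ.+ B ℚ.+ 1ℚ) ℚ.* i) (0≤* (ℚₚ.<⇒≤ (0<+ (0<+ 0<A 0<B) (ℚₚ.positive⁻¹ 1ℚ))) (ℚₚ.<⇒≤ (0<inv S 0<S)))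
        (≡.trans (solve 3 (λ c e i → c :* i := (c :+ e) :* i :- e :* i) ≡.refl (A ℚ.+ B ℚ.+ 1ℚ) ε i) (≡.cong (ℚ._- δ) (inv-inverse S 0<S)))
      bound : ∀ u v → ℚ.∣ u ∣ ℚ.≤ A → ℚ.∣ v ∣ ℚ.≤ B → 0ℚ ℚ.≤ u ℚ.+ δ → 0ℚ ℚ.≤ v ℚ.+ δ → 0ℚ ℚ.≤ u ℚ.* v ℚ.+ ε
      bound u v hu hv pu pv = ≡.subst (0ℚ ℚ.≤_)
        (≡.trans (solve 6 (λ u v d A B e → (u :+ d) :* (v :+ d) :+ (d :* ((A :- u) :+ (B :- v)) :+ (d :* (con 1ℚ :- d) :+ d :* e)) := u :* v :+ (A :+ B :+ con 1ℚ :+ e) :* d) ≡.refl u v δ A B ε)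
          (≡.cong (u ℚ.* v ℚ.+_) Sδ))
        (0≤+ (0≤* pu pv) (0≤+ (0≤* 0≤δ (0≤+ (≤⇒0≤ (≤∣∣ hu)) (≤⇒0≤ (≤∣∣ hv)))) (0≤+ (0≤* 0≤δ (≤⇒0≤ δ≤1)) (0≤* 0≤δ (ℚₚ.<⇒≤ 0<ε)))))

  1/suc≤ : ∀ q → 0ℚ ℚ.< q → ∃ λ k → + 1 ℚ./ suc k ℚ.≤ q
  1/suc≤ q@(ℚ.mkℚ (+ suc a) d _) _ = d , ℚₚ.toℚᵘ-cancel-≤ (ℚᵘₚ.≤-trans (ℚᵘₚ.≤-reflexive (ℚₚ.toℚᵘ-fromℚᵘ (ℚᵘ.mkℚᵘ (+ 1) d)))
    (ℚᵘ.*≤* (ℤₚ.*-monoʳ-≤-nonNeg (+ suc d) {+ 1} {+ suc a} (ℤ.+≤+ (ℕ.s≤s ℕ.z≤n)))))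
  1/suc≤ (ℚ.mkℚ (+ 0) d _) (ℚ.*<* (ℤ.+<+ ()))
  1/suc≤ (ℚ.mkℚ ℤ.-[1+ a ] d _) (ℚ.*<* ())

  ≤-natural : ∀ q → ∃ λ n → q ℚ.≤ + n ℚ./ 1
  ≤-natural q@(ℚ.mkℚ (+ a) d _) = a , ℚₚ.toℚᵘ-cancel-≤ (ℚᵘₚ.≤-trans
    (ℚᵘ.*≤* (ℤₚ.≤-trans (ℤₚ.≤-reflexive {+ a ℤ.* + 1} {+ a} (ℤₚ.*-identityʳ (+ a))) (ℤₚ.≤-trans (ℤ.+≤+ {a} {a ℕ.* suc d} (ℕₚ.m≤m*n a (suc d))) (ℤₚ.≤-reflexive (ℤₚ.pos-* a (suc d))))))
    (ℚᵘₚ.≤-reflexive (ℚᵘₚ.≃-sym (ℚₚ.toℚᵘ-fromℚᵘ (ℚᵘ.mkℚᵘ (+ a) 0)))))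
  ≤-natural q@(ℚ.mkℚ ℤ.-[1+ a ] d _) = 0 , ℚₚ.toℚᵘ-cancel-≤ (ℚᵘ.*≤* ℤ.-≤+)

  e : ℕ → ℚ
  e k = + 1 ℚ./ suc k

  ≤-closed : ∀ {x y} → (∀ k → x ≤ y + ι (e k)) → x ≤ y
  ≤-closed {x} {y} h ε 0<ε =
    let k , e≤ = 1/suc≤ (½ ℚ.* ε) (0<half 0<ε); N , b = h k (½ ℚ.* ε) (0<half 0<ε) in N , λ n p →
      0≤⇒≤ _ (0≤+ (≤⇒0≤ (b n p)) (≤⇒0≤ e≤))
        (solve 4 (λ x y k e → (y :+ k :+ con ½ :* e :- x) :+ (con ½ :* e :- k) := y :+ e :- x) ≡.refl (seq x n) (seq y n) (e k) ε)

  archimedean : ∀ x → ∃ λ n → x ≤ ι (+ n ℚ./ 1)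
  archimedean x = go (eventually-bounded x)
    where
    go : EventuallyBounded x → ∃ λ n → x ≤ ι (+ n ℚ./ 1)
    go (B , _ , N , b) = let n , B≤n = ≤-natural B in n , λ ε 0<ε → N , λ i p →
      ℚₚ.≤-trans (0≤⇒≤ _ (≤⇒0≤ (upper {seq x i} {0ℚ} (≡.subst (λ w → ℚ.∣ w ∣ ℚ.≤ B) (≡.sym (ℚₚ.+-identityʳ (seq x i))) (b i p)))) (≡.cong (ℚ._- seq x i) (ℚₚ.+-identityˡ B)))
        (0≤⇒≤ _ (0≤+ (≤⇒0≤ B≤n) (ℚₚ.<⇒≤ 0<ε)) (solve 3 (λ b n e → n :- b :+ e := n :+ e :- b) ≡.refl B (+ n ℚ./ 1) ε))

  0<e : ∀ k → 0ℚ ℚ.< e k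
  0<e = 0<1/suc

  e-anti : ∀ {m n} → m ℕ.≤ n → e n ℚ.≤ e m
  e-anti {m} {n} h = ℚₚ.toℚᵘ-cancel-≤ (ℚᵘₚ.≤-trans (ℚᵘₚ.≤-reflexive (ℚₚ.toℚᵘ-fromℚᵘ (ℚᵘ.mkℚᵘ (+ 1) n)))
    (ℚᵘₚ.≤-trans (ℚᵘ.*≤* (ℤₚ.*-monoˡ-≤-nonNeg (+ 1) {+ suc m} {+ suc n} (ℤ.+≤+ (ℕ.s≤s h)))) (ℚᵘₚ.≤-reflexive (ℚᵘₚ.≃-sym (ℚₚ.toℚᵘ-fromℚᵘ (ℚᵘ.mkℚᵘ (+ 1) m))))))

  -- The limit of a Cauchy sequence x is built from rationals l j approximating
  -- the terms x (M j) up to 1/(j+1).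
  module Completeness (x : ℕ → ℝ) (c : ∀ k → ∃ λ N → ∀ m n → N ℕ.≤ m → N ℕ.≤ n → x m ≤ x n + ι (e k)) where

    M P : ℕ → ℕ
    M j = proj₁ (c j)
    P j = proj₁ (cauchy (x (M j)) (e j) (0<e j))

    l : ℕ → ℚ
    l j = seq (x (M j)) (P j)

    l-close : ∀ j n → P j ℕ.≤ n → ℚ.∣ seq (x (M j)) n ℚ.- l j ∣ ℚ.≤ e j
    l-close j n p = proj₂ (cauchy (x (M j)) (e j) (0<e j)) n (P j) p ℕₚ.≤-refl

    3ℚ : ℚ
    3ℚ = + 3 ℚ./ 1

    -- Three errors of size `e j`: the Cauchy condition on x, the tolerance contained in its
    -- inequality between reals, and the passage from `x (M j)` to the rational `l j`.
    term-l : ∀ j n → M j ℕ.≤ n → ∃ λ N → ∀ i → N ℕ.≤ i → seq (x n) i ℚ.≤ l j ℚ.+ 3ℚ ℚ.* e j × l j ℚ.≤ seq (x n) i ℚ.+ 3ℚ ℚ.* e j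
    term-l j n M≤n =
      let A , a = proj₂ (c j) n (M j) M≤n ℕₚ.≤-refl (e j) (0<e j)
          B , b = proj₂ (c j) (M j) n ℕₚ.≤-refl M≤n (e j) (0<e j)
      in (A ℕ.⊔ B) ℕ.⊔ P j , λ i p →
        let ab = ℕₚ.m⊔n≤o⇒m≤o (A ℕ.⊔ B) (P j) p; q = l-close j i (ℕₚ.m⊔n≤o⇒n≤o (A ℕ.⊔ B) (P j) p) in
        0≤⇒≤ _ (0≤+ (≤⇒0≤ (a i (ℕₚ.m⊔n≤o⇒m≤o A B ab))) (≤⇒0≤ (upper {seq (x (M j)) i} {l j} q)))
          (solve 4 (λ x y l e → (y :+ e :+ e :- x) :+ (l :+ e :- y) := l :+ con 3ℚ :* e :- x) ≡.refl (seq (x n) i) (seq (x (M j)) i) (l j) (e j)) ,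
        0≤⇒≤ _ (0≤+ (≤⇒0≤ (b i (ℕₚ.m⊔n≤o⇒n≤o A B ab))) (≤⇒0≤ (upper {l j} {seq (x (M j)) i} (flip {seq (x (M j)) i} {l j} q))))
          (solve 4 (λ x y l e → (x :+ e :+ e :- y) :+ (y :+ e :- l) := x :+ con 3ℚ :* e :- l) ≡.refl (seq (x n) i) (seq (x (M j)) i) (l j) (e j))

    6ℚ : ℚ
    6ℚ = + 6 ℚ./ 1

    l-l : ∀ k i j → k ℕ.≤ i → k ℕ.≤ j → l i ℚ.≤ l j ℚ.+ 6ℚ ℚ.* e k
    l-l k i j hi hj =
      let n = M i ℕ.⊔ M j
          A , a = term-l i n (ℕₚ.m≤m⊔n (M i) (M j)); B , b = term-l j n (ℕₚ.m≤n⊔m (M i) (M j))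
          t = seq (x n) (A ℕ.⊔ B) in
      0≤⇒≤ _ (0≤+ (0≤+ (≤⇒0≤ (proj₂ (a (A ℕ.⊔ B) (ℕₚ.m≤m⊔n A B)))) (≤⇒0≤ (proj₁ (b (A ℕ.⊔ B) (ℕₚ.m≤n⊔m A B)))))
                  (0≤+ (0≤* (0≤+/ 3 0) (≤⇒0≤ (e-anti hi))) (0≤* (0≤+/ 3 0) (≤⇒0≤ (e-anti hj)))))
        (solve 6 (λ t p q a b k → (t :+ con 3ℚ :* a :- p) :+ (q :+ con 3ℚ :* b :- t) :+ (con 3ℚ :* (k :- a) :+ con 3ℚ :* (k :- b)) := q :+ con 6ℚ :* k :- p) ≡.refl t (l i) (l j) (e i) (e j) (e k))

    -- The 12 leaves room for the 3 + 6 that accumulate in `converges`, where `term-l` and `l-l` are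
    -- added.
    scaled : ∀ ε → 0ℚ ℚ.< ε → ∃ λ k → (+ 12 ℚ./ 1) ℚ.* e k ℚ.≤ ε
    scaled ε 0<ε = let k , h = 1/suc≤ ((+ 1 ℚ./ 12) ℚ.* ε) (0<* (ℚₚ.positive⁻¹ (+ 1 ℚ./ 12)) 0<ε) in
      k , 0≤⇒≤ _ (0≤* (0≤+/ 12 0) (≤⇒0≤ h)) (solve 2 (λ e k → con (+ 12 ℚ./ 1) :* (con (+ 1 ℚ./ 12) :* e :- k) := e :- con (+ 12 ℚ./ 1) :* k) ≡.refl ε (e k))

    6≤12 : ∀ k ε → (+ 12 ℚ./ 1) ℚ.* e k ℚ.≤ ε → 6ℚ ℚ.* e k ℚ.≤ ε
    6≤12 k ε h = ℚₚ.≤-trans (0≤⇒≤ _ (0≤* (0≤+/ 6 0) (ℚₚ.<⇒≤ (0<e k))) (solve 1 (λ k → con 6ℚ :* k := con (+ 12 ℚ./ 1) :* k :- con 6ℚ :* k) ≡.refl (e k))) h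

    limit : ℝ
    limit = mkℝ l λ ε 0<ε → let k , h = scaled ε 0<ε in k , λ i j hi hj →
      ℚₚ.≤-trans (within {l i} {l j} (l-l k i j hi hj) (l-l k j i hj hi)) (6≤12 k ε h)

    converges : ∀ k → ∃ λ N → ∀ n → N ℕ.≤ n → x n ≤ limit + ι (e k) × limit ≤ x n + ι (e k)
    converges k = let j , h = scaled (e k) (0<e k) in M j , λ n M≤n → let N , b = term-l j n M≤n in
      (λ ε 0<ε → N ℕ.⊔ j , λ i p →
        0≤⇒≤ _ (0≤+ (0≤+ (≤⇒0≤ (proj₁ (b i (ℕₚ.m⊔n≤o⇒m≤o N j p)))) (≤⇒0≤ (l-l j j i ℕₚ.≤-refl (ℕₚ.m⊔n≤o⇒n≤o N j p)))) (0≤+ (0≤+ (≤⇒0≤ h) (0≤* (0≤+/ 3 0) (ℚₚ.<⇒≤ (0<e j)))) (ℚₚ.<⇒≤ 0<ε)))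
          (solve 6 (λ x a b j k ε → (a :+ con 3ℚ :* j :- x) :+ (b :+ con 6ℚ :* j :- a) :+ ((k :- con (+ 12 ℚ./ 1) :* j) :+ con 3ℚ :* j :+ ε) := b :+ k :+ ε :- x) ≡.refl (seq (x n) i) (l j) (l i) (e j) (e k) ε)) ,
      (λ ε 0<ε → N ℕ.⊔ j , λ i p →
        0≤⇒≤ _ (0≤+ (0≤+ (≤⇒0≤ (proj₂ (b i (ℕₚ.m⊔n≤o⇒m≤o N j p)))) (≤⇒0≤ (l-l j i j (ℕₚ.m⊔n≤o⇒n≤o N j p) ℕₚ.≤-refl))) (0≤+ (0≤+ (≤⇒0≤ h) (0≤* (0≤+/ 3 0) (ℚₚ.<⇒≤ (0<e j)))) (ℚₚ.<⇒≤ 0<ε)))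
          (solve 6 (λ x a b j k ε → (x :+ con 3ℚ :* j :- a) :+ (a :+ con 6ℚ :* j :- b) :+ ((k :- con (+ 12 ℚ./ 1) :* j) :+ con 3ℚ :* j :+ ε) := x :+ k :+ ε :- b) ≡.refl (seq (x n) i) (l j) (l i) (e j) (e k) ε))

  -- Abstract, so that conversion checking does not unfold real arithmetic.
  abstract
    realAlgebra : CompleteAlgebra ℝ
    realAlgebra = record
      { _≈_ = _≈_ ; _≤_ = _≤_ ; _+_ = _+_ ; _*_ = _*_ ; -_ = -_ ; ι = ι
      ; isCommutativeRing = record
        { isRing = record
          { +-isAbelianGroup = record
            { isGroup = record
              { isMonoid = record
                { isSemigroup = record
                  { isMagma = record
                    { isEquivalence = record { refl = λ {x} → ≈-refl {x} ; sym = λ {x} {y} → ≈-sym {x} {y} ; trans = λ {x} {y} {z} → ≈-trans {x} {y} {z} }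
                    ; ∙-cong = λ {x} {y} {z} {w} → +-cong {x} {y} {z} {w} }
                  ; assoc = λ x y z → pointwise {x + y + z} {x + (y + z)} λ n → ℚₚ.+-assoc (seq x n) (seq y n) (seq z n) }
                ; identity = (λ x → pointwise {ι 0ℚ + x} {x} λ n → ℚₚ.+-identityˡ (seq x n)) , (λ x → pointwise {x + ι 0ℚ} {x} λ n → ℚₚ.+-identityʳ (seq x n)) }
              ; inverse = (λ x → pointwise {(- x) + x} {ι 0ℚ} λ n → ℚₚ.+-inverseˡ (seq x n)) , (λ x → pointwise {x + - x} {ι 0ℚ} λ n → ℚₚ.+-inverseʳ (seq x n))
              ; ⁻¹-cong = λ {x} {y} → -‿cong {x} {y} }
            ; comm = λ x y → pointwise {x + y} {y + x} λ n → ℚₚ.+-comm (seq x n) (seq y n) }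
          ; *-cong = λ {x} {y} {z} {w} → *-cong {x} {y} {z} {w}
          ; *-assoc = λ x y z → pointwise {x * y * z} {x * (y * z)} λ n → ℚₚ.*-assoc (seq x n) (seq y n) (seq z n)
          ; *-identity = (λ x → pointwise {ι 1ℚ * x} {x} λ n → ℚₚ.*-identityˡ (seq x n)) , (λ x → pointwise {x * ι 1ℚ} {x} λ n → ℚₚ.*-identityʳ (seq x n))
          ; distrib = (λ x y z → pointwise {x * (y + z)} {x * y + x * z} λ n → ℚₚ.*-distribˡ-+ (seq x n) (seq y n) (seq z n)) ,
                      (λ x y z → pointwise {(y + z) * x} {y * x + z * x} λ n → ℚₚ.*-distribʳ-+ (seq x n) (seq y n) (seq z n)) }
        ; *-comm = *-comm }
      ; ι-+ = λ p q → pointwise {ι (p ℚ.+ q)} {ι p + ι q} λ _ → ≡.refl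
      ; ι-* = λ p q → pointwise {ι (p ℚ.* q)} {ι p * ι q} λ _ → ≡.refl
      ; ι-neg = λ p → pointwise {ι (ℚ.- p)} { - ι p} λ _ → ≡.refl
      ; ι-mono = λ {p} {q} h → pointwise-≤ {ι p} {ι q} λ _ → h
      ; ι-cancel = ι-cancel
      ; ≤-reflexive = λ {x} {y} → ≤-reflexive {x} {y}
      ; ≤-trans = λ {x} {y} {z} → ≤-trans {x} {y} {z}
      ; ≤-antisym = λ {x} {y} → ≤-antisym {x} {y}
      ; +-monoˡ = λ {x} {y} → +-monoˡ {x} {y}
      ; *-nonNeg = λ {x} {y} → *-nonNeg {x} {y}
      ; square-nonNeg = λ x → pointwise-≤ {ι 0ℚ} {x * x} λ n → 0≤p² (seq x n)
      ; ≤-closed = λ {x} {y} → ≤-closed {x} {y}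
      ; archimedean = archimedean
      ; complete = λ x c → Completeness.limit x c , Completeness.converges x c
      }

    algebra-+ : ∀ x y → CompleteAlgebra._+_ realAlgebra x y ≡ x + y
    algebra-+ x y = ≡.refl

    algebra-* : ∀ x y → CompleteAlgebra._*_ realAlgebra x y ≡ x * y
    algebra-* x y = ≡.refl

    algebra-neg : ∀ x → CompleteAlgebra.-_ realAlgebra x ≡ - x
    algebra-neg x = ≡.refl

    algebra-ι : ∀ p → CompleteAlgebra.ι realAlgebra p ≡ ι p
    algebra-ι p = ≡.refl

    from-≈ : ∀ x y → CompleteAlgebra._≈_ realAlgebra x y → x ≈ y
    from-≈ x y h = h

    to-≈ : ∀ x y → x ≈ y → CompleteAlgebra._≈_ realAlgebra x y
    to-≈ x y h = h

    from-≤ : ∀ x y → CompleteAlgebra._≤_ realAlgebra x y → x ≤ y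
    from-≤ x y h = h

    to-≤ : ∀ x y → x ≤ y → CompleteAlgebra._≤_ realAlgebra x y
    to-≤ x y h = h

module A = Analysis ℝ RealAlgebra.realAlgebra

-- Limits of real sequences and limits in the algebra.

module RealLimits where

  open RealAlgebra using (e; _≤_; 0≤⇒≤; ≤⇒0≤; 0≤+; upper; 1/suc≤; 0<e; algebra-ι; algebra-neg; algebra-+; algebra-*; from-≤; to-≤)
  open RationalLemmas
  open RealLemmas
  open +-*-Solver

  lift-+ : ∀ x x′ y y′ → x ≡ x′ → y ≡ y′ → x A.+ y ≡ x′ + y′
  lift-+ x _ y _ ≡.refl ≡.refl = algebra-+ x y

  lift-* : ∀ x x′ y y′ → x ≡ x′ → y ≡ y′ → x A.* y ≡ x′ * y′
  lift-* x _ y _ ≡.refl ≡.refl = algebra-* x y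

  lift-- : ∀ x x′ y y′ → x ≡ x′ → y ≡ y′ → x A.- y ≡ x′ - y′
  lift-- x _ y _ ≡.refl ≡.refl = lift-+ x x (A.- y) (- y) ≡.refl (algebra-neg y)

  inv-e : ∀ k → A.inv k ≡ ι (e k)
  inv-e k = ≡.trans (A.inv-ι k) (algebra-ι (e k))

  to-Abs : ∀ x k → x ≤ ι (e k) → (- x) ≤ ι (e k) → A.Abs x (A.inv k)
  to-Abs x k u l = A.abs
    (≡.subst (λ b → x A.≤ b) (≡.sym (inv-e k)) (to-≤ x (ι (e k)) u))
    (≡.subst₂ A._≤_ (≡.sym (algebra-neg x)) (≡.sym (inv-e k)) (to-≤ (- x) (ι (e k)) l))

  from-Abs : ∀ x k → A.Abs x (A.inv k) → x ≤ ι (e k) × (- x) ≤ ι (e k)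
  from-Abs x k (A.abs u l) =
    from-≤ x (ι (e k)) (≡.subst (λ b → x A.≤ b) (inv-e k) u) ,
    from-≤ (- x) (ι (e k)) (≡.subst₂ A._≤_ (algebra-neg x) (inv-e k) l)

  ∣∣-≤ : ∀ {p q} → ℚ.∣ p ∣ ℚ.≤ q → p ℚ.≤ q × ℚ.- p ℚ.≤ q
  ∣∣-≤ {p} {q} h =
    ≡.subst (p ℚ.≤_) (ℚₚ.+-identityˡ q) (upper {p} {0ℚ} (≡.subst (λ w → ℚ.∣ w ∣ ℚ.≤ q) (≡.sym (ℚₚ.+-identityʳ p)) h)) ,
    ≡.subst (ℚ.- p ℚ.≤_) (ℚₚ.+-identityˡ q) (upper {ℚ.- p} {0ℚ} (≡.subst (ℚ._≤ q) (≡.trans (≡.sym (ℚₚ.∣-p∣≡∣p∣ p)) (≡.cong ℚ.∣_∣ (≡.sym (ℚₚ.+-identityʳ (ℚ.- p))))) h))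

  ≤-∣∣ : ∀ {p q} → p ℚ.≤ q → ℚ.- p ℚ.≤ q → ℚ.∣ p ∣ ℚ.≤ q
  ≤-∣∣ {p} h k with ℚₚ.∣p∣≡p∨∣p∣≡-p p
  ... | inj₁ e = ≡.subst (ℚ._≤ _) (≡.sym e) h
  ... | inj₂ e = ≡.subst (ℚ._≤ _) (≡.sym e) k

  <⇒Abs : ∀ x k → ∣ x ∣ < ι (e k) → A.Abs x (A.inv k)
  <⇒Abs x k (δ , 0<δ , N , h) = to-Abs x k
    (λ ε 0<ε → N , λ n p → proj₁ (bound ε 0<ε n p))
    (λ ε 0<ε → N , λ n p → proj₂ (bound ε 0<ε n p))
    where
    bound : ∀ ε → 0ℚ ℚ.< ε → ∀ n → N ℕ.≤ n → seq x n ℚ.≤ e k ℚ.+ ε × ℚ.- seq x n ℚ.≤ e k ℚ.+ ε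
    bound ε 0<ε n p = ∣∣-≤ (0≤⇒≤ _ (0≤+ (≤⇒0≤ (h n p)) (ℚₚ.<⇒≤ (0<+ 0<δ 0<ε)))
      (solve 4 (λ x d k ε → k :- (x :+ d) :+ (d :+ ε) := k :+ ε :- x) ≡.refl ℚ.∣ seq x n ∣ δ (e k) ε))

  -- The strict order carries a rational gap. The bound e k ≤ ε/2 leaves ε/4 for the tolerance of
  -- the weak inequalities and ε/4 for the gap.
  Abs⇒< : ∀ x k ε → 0ℚ ℚ.< ε → e k ℚ.≤ ½ ℚ.* ε → A.Abs x (A.inv k) → ∣ x ∣ < ι ε
  Abs⇒< x k ε 0<ε e≤ b = let u , l = from-Abs x k b; M , a = u q 0<q; N , b = l q 0<q in q , 0<q , M ℕ.⊔ N , λ n p →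
    0≤⇒≤ _ (0≤+ (≤⇒0≤ (≤-∣∣ (a n (ℕₚ.m⊔n≤o⇒m≤o M N p)) (b n (ℕₚ.m⊔n≤o⇒n≤o M N p)))) (≤⇒0≤ e≤))
      (solve 3 (λ x k ε → (k :+ con ½ :* (con ½ :* ε) :- x) :+ (con ½ :* ε :- k) := ε :- (x :+ con ½ :* (con ½ :* ε))) ≡.refl ℚ.∣ seq x n ∣ (e k) ε)
    where
    q : ℚ
    q = ½ ℚ.* (½ ℚ.* ε)
    0<q : 0ℚ ℚ.< q
    0<q = 0<half (0<half 0<ε)

  ⟶⇒Lim : ∀ (x : ℕ → ℝ) l → x ⟶ l → A.Lim x l
  ⟶⇒Lim x l h = A.lim λ k → let N , b = h (e k) (0<e k) in N , λ n p →
    ≡.subst (λ d → A.Abs d (A.inv k)) (≡.sym (lift-- (x n) (x n) l l ≡.refl ≡.refl)) (<⇒Abs (x n - l) k (b n p))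

  Lim⇒⟶ : ∀ (x : ℕ → ℝ) l → A.Lim x l → x ⟶ l
  Lim⇒⟶ x l (A.lim h) ε 0<ε = let k , e≤ = 1/suc≤ (½ ℚ.* ε) (0<half 0<ε); N , b = h k in N , λ n p →
    Abs⇒< (x n - l) k ε 0<ε e≤ (≡.subst (λ d → A.Abs d (A.inv k)) (lift-- (x n) (x n) l l ≡.refl ≡.refl) (b n p))

  reciprocal-inverse : ∀ x (0<x : 0ℝ < x) → x * reciprocal x 0<x ≈ 1ℝ
  reciprocal-inverse x 0<x@(δ , 0<δ , L , lower) ε 0<ε = L , λ n p →
    ≡.subst (λ w → ℚ.∣ w ∣ ℚ.≤ ε) (≡.sym (one n p)) (ℚₚ.<⇒≤ 0<ε)
    where
    y : ℕ → ℚ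
    y n = seq x n ℚ.⊔ δ
    0<y : ∀ n → 0ℚ ℚ.< y n
    0<y n = ℚₚ.<-≤-trans 0<δ (ℚₚ.p≤q⊔p (seq x n) δ)
    y≡x : ∀ n → L ℕ.≤ n → y n ≡ seq x n
    y≡x n p = ℚₚ.p≥q⇒p⊔q≡p (≡.subst (ℚ._≤ seq x n) (ℚₚ.+-identityˡ δ) (lower n p))
    one : ∀ n → L ℕ.≤ n → seq x n ℚ.* seq (reciprocal x 0<x) n ℚ.- 1ℚ ≡ 0ℚ
    one n p = ≡.trans (≡.cong (λ w → w ℚ.* seq (reciprocal x 0<x) n ℚ.- 1ℚ) (≡.sym (y≡x n p)))
      (≡.trans (≡.cong (ℚ._- 1ℚ) (inv-inverse (y n) (0<y n))) (ℚₚ.+-inverseʳ 1ℚ))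

-- Analytic functions, Riemann sums and norms in terms of coefficients.

module Translation where

  open RealAlgebra using (e; algebra-ι; to-≈)
  open RealLimits
  open A using (𝒞; Lim; Limᶜ; limᶜ; lim-re; lim-im; zr; zi; module ℂ)

  to : ℂ → 𝒞
  to z = re z A.+i im z

  parts : ∀ (x x′ y y′ : ℝ) → x ≡ x′ → y ≡ y′ → (x′ A.+i y′) ≡ (x A.+i y)
  parts x _ y _ ≡.refl ≡.refl = ≡.refl

  product : ∀ x y → x A.* y ≡ x * y
  product x y = lift-* x x y y ≡.refl ≡.refl

  to-+ : ∀ z w → to (z +ᶜ w) ≡ to z A.+ᶜ to w
  to-+ z w = parts (re z A.+ re w) (re z + re w) (im z A.+ im w) (im z + im w)
    (lift-+ (re z) (re z) (re w) (re w) ≡.refl ≡.refl) (lift-+ (im z) (im z) (im w) (im w) ≡.refl ≡.refl)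

  to-- : ∀ z w → to (z -ᶜ w) ≡ to z A.-ᶜ to w
  to-- z w = parts (re z A.- re w) (re z - re w) (im z A.- im w) (im z - im w)
    (lift-- (re z) (re z) (re w) (re w) ≡.refl ≡.refl) (lift-- (im z) (im z) (im w) (im w) ≡.refl ≡.refl)

  to-* : ∀ z w → to (z *ᶜ w) ≡ to z A.*ᶜ to w
  to-* z w = parts (re z A.* re w A.- im z A.* im w) (re z * re w - im z * im w) (re z A.* im w A.+ im z A.* re w) (re z * im w + im z * re w)
    (lift-- (re z A.* re w) (re z * re w) (im z A.* im w) (im z * im w) (product (re z) (re w)) (product (im z) (im w)))
    (lift-+ (re z A.* im w) (re z * im w) (im z A.* re w) (im z * re w) (product (re z) (im w)) (product (im z) (re w)))

  to-0 : to 0ᶜ ≡ A.0ᶜ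
  to-0 = parts A.0# 0ℝ A.0# 0ℝ (algebra-ι 0ℚ) (algebra-ι 0ℚ)

  to-1 : to 1ᶜ ≡ A.1ᶜ
  to-1 = parts A.1# 1ℝ A.0# 0ℝ (algebra-ι 1ℚ) (algebra-ι 0ℚ)

  lift-square : ∀ x y → x A.* x A.+ y A.* y ≡ x * x + y * y
  lift-square x y = lift-+ (x A.* x) (x * x) (y A.* y) (y * y) (product x x) (product y y)

  to-^ : ∀ z n → to (z ^ n) ≡ to z A.^ᶜ n
  to-^ z zero    = to-1
  to-^ z (suc n) = ≡.trans (to-* z (z ^ n)) (≡.cong (λ w → to z A.*ᶜ w) (to-^ z n))

  to-∑ : ∀ N a → to (∑< N a) ≡ A.∑ᶜ N (λ n → to (a n))
  to-∑ zero    a = to-0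
  to-∑ (suc N) a = ≡.trans (to-+ (∑< N a) (a N)) (≡.cong (λ s → s A.+ᶜ to (a N)) (to-∑ N a))

  ∑ᶜ-≡ : ∀ N {g h : ℕ → 𝒞} → (∀ n → g n ≡ h n) → A.∑ᶜ N g ≡ A.∑ᶜ N h
  ∑ᶜ-≡ zero    e = ≡.refl
  ∑ᶜ-≡ (suc N) {g} {h} e = ≡.cong₂ (λ s t → s A.+ᶜ t) (∑ᶜ-≡ N {g} {h} e) (e N)

  to-term : ∀ c z n → to (c *ᶜ z ^ n) ≡ to c A.*ᶜ to z A.^ᶜ n
  to-term c z n = ≡.subst (λ w → to (c *ᶜ z ^ n) ≡ to c A.*ᶜ w) (to-^ z n) (to-* c (z ^ n))

  to-series : ∀ (a : ℕ → ℂ) z N → to (∑< N (λ n → a n *ᶜ z ^ n)) ≡ A.series (λ n → to (a n)) (to z) N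
  to-series a z zero    = to-0
  to-series a z (suc N) = ≡.trans (to-+ (∑< N (λ n → a n *ᶜ z ^ n)) (a N *ᶜ z ^ N))
    (≡.cong₂ A._+ᶜ_ {to (∑< N (λ n → a n *ᶜ z ^ n))} {A.series (λ n → to (a n)) (to z) N} {to (a N *ᶜ z ^ N)} {to (a N) A.*ᶜ to z A.^ᶜ N}
      (to-series a z N) (to-term (a N) z N))

  ⟶ᶜ⇒Lim : ∀ x l → x ⟶ᶜ l → Limᶜ (λ n → to (x n)) (to l)
  ⟶ᶜ⇒Lim x l (p , q) = limᶜ (⟶⇒Lim (λ n → re (x n)) (re l) p) (⟶⇒Lim (λ n → im (x n)) (im l) q)

  Lim⇒⟶ᶜ : ∀ x l → Limᶜ (λ n → to (x n)) (to l) → x ⟶ᶜ l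
  Lim⇒⟶ᶜ x l h = Lim⇒⟶ (λ n → re (x n)) (re l) (lim-re h) , Lim⇒⟶ (λ n → im (x n)) (im l) (lim-im h)

  -- Power series at real and at rational points

  ≡-Lim : ∀ {x y : ℕ → 𝒞} {l} → (∀ n → x n ≡ y n) → Limᶜ x l → Limᶜ y l
  ≡-Lim e h = A.Limᶜ-cong (λ n → ℂ.reflexive (e n)) ℂ.refl h

  SumsTo : (ℕ → ℂ) → (𝔻 → ℂ) → Set
  SumsTo a f = ∀ z → Limᶜ (A.series (λ n → to (a n)) (to (proj₁ z))) (to (f z))

  analytic⇒sums : ∀ {f} ((a , _) : Analytic f) → SumsTo a f
  analytic⇒sums {f} (a , h) z = ≡-Lim (λ N → to-series a (proj₁ z) N) (⟶ᶜ⇒Lim (λ N → ∑< N (λ n → a n *ᶜ proj₁ z ^ n)) (f z) (h z))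

  sums⇒analytic : ∀ {f} a → SumsTo a f → Analytic f
  sums⇒analytic {f} a h = a , λ z → Lim⇒⟶ᶜ (λ N → ∑< N (λ n → a n *ᶜ proj₁ z ^ n)) (f z) (≡-Lim (λ N → ≡.sym (to-series a (proj₁ z) N)) (h z))

  ^-parts : ∀ z n → z A.^ᶜ n ≡ (zr n (A.re z) (A.im z) A.+i zi n (A.re z) (A.im z))
  ^-parts z zero    = ≡.refl
  ^-parts z (suc n) = ≡.cong (z A.*ᶜ_) (^-parts z n)

  module _ (a : ℕ → ℂ) where

    open A.Parseval (λ n → re (a n)) (λ n → im (a n))

    series-parts : ∀ x y N → A.series (λ n → to (a n)) (A.ι x A.+i A.ι y) N ≡ (partialRe N (x , y) A.+i partialIm N (x , y))
    series-parts x y zero    = ≡.refl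
    series-parts x y (suc N) = ≡.cong₂ (λ s t → s A.+ᶜ t) (series-parts x y N) (≡.cong (λ w → to (a N) A.*ᶜ w) (^-parts (A.ι x A.+i A.ι y) N))

    grid-sum : ∀ {f r} → SumsTo a f → (r<1 : r ℚ.< 1ℚ) → ∀ p i → Sum p (re (f (gridPoint r<1 p i))) (im (f (gridPoint r<1 p i)))
    grid-sum {f} h r<1 p@(x , y) i = sums (lim-re l) (lim-im l)
      where
      z : 𝔻
      z = gridPoint r<1 p i
      point : to (proj₁ z) ≡ (A.ι x A.+i A.ι y)
      point = parts (A.ι x) (ι x) (A.ι y) (ι y) (algebra-ι x) (algebra-ι y)
      l : Limᶜ (λ N → partialRe N p A.+i partialIm N p) (to (f z))
      l = ≡-Lim (λ N → ≡.trans (≡.cong (λ w → A.series (λ n → to (a n)) w N) point) (series-parts x y N)) (h z)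

    convergent : ∀ {f} → SumsTo a f → Convergent
    convergent {f} h m p i = let z = gridPoint (exhaustion<1 m) p i in re (f z) , im (f z) , grid-sum {f} h (exhaustion<1 m) p i

  -- Riemann sums

  integrand : (𝔻 → ℂ) → 𝔻 → ℝ
  integrand f z = ι (+ 2 ℚ./ 1) * (1ℝ - ∣ proj₁ z ∣²) * ∣ f z ∣²

  sample-outside : ∀ {r} (r<1 : r ℚ.< 1ℚ) h p → ¬ (∣ p ∣²ℚ ℚ.≤ r) → sampleOn r<1 h p ≡ 0ℝ
  sample-outside {r} r<1 h p ¬i with inDisc? r p
  ... | yes i = ⊥-elim (¬i i)
  ... | no _  = ≡.refl

  -- The abstract copy of gridPoint keeps the with-abstraction below from normalising it.
  abstract
    gridPointᵃ : ∀ {r} → r ℚ.< 1ℚ → ∀ p → ∣ p ∣²ℚ ℚ.≤ r → 𝔻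
    gridPointᵃ = gridPoint

    gridPointᵃ≡ : ∀ {r} (r<1 : r ℚ.< 1ℚ) p i → gridPoint r<1 p i ≡ gridPointᵃ r<1 p i
    gridPointᵃ≡ r<1 p i = ≡.refl

  sample-insideᵃ : ∀ {r} (r<1 : r ℚ.< 1ℚ) (h : 𝔻 → ℝ) p → ∣ p ∣²ℚ ℚ.≤ r → ∃ λ i → sampleOn r<1 h p ≡ h (gridPointᵃ r<1 p i)
  sample-insideᵃ {r} r<1 h p i with inDisc? r p
  ... | yes i′ = i′ , ≡.cong h (gridPointᵃ≡ r<1 p i′)
  ... | no ¬i  = ⊥-elim (¬i i)

  -- The membership proof is the one found by `inDisc?`, which need not be the given one, and it
  -- enters the point of the disc; hence the existential.
  sample-inside : ∀ {r} (r<1 : r ℚ.< 1ℚ) (h : 𝔻 → ℝ) p → ∣ p ∣²ℚ ℚ.≤ r → ∃ λ i → sampleOn r<1 h p ≡ h (gridPoint r<1 p i)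
  sample-inside r<1 h p i = let i′ , e = sample-insideᵃ r<1 h p i in i′ , ≡.trans e (≡.cong h (≡.sym (gridPointᵃ≡ r<1 p i′)))

  module Sums = A.RiemannSums _+_ _*_ (λ n → ι ((+ 1 ℚ./ diskCount n) {{diskCount-nonZero n}})) 0ℝ
    RealAlgebra.algebra-+ RealAlgebra.algebra-* (λ n → algebra-ι _) (algebra-ι 0ℚ)

  norm≡ : ∀ x y → A.norm (x , y) ≡ ∣ ι x +i ι y ∣²
  norm≡ x y = lift-+ (A.ι x A.* A.ι x) (ι x * ι x) (A.ι y A.* A.ι y) (ι y * ι y)
    (lift-* (A.ι x) (ι x) (A.ι x) (ι x) (algebra-ι x) (algebra-ι x)) (lift-* (A.ι y) (ι y) (A.ι y) (ι y) (algebra-ι y) (algebra-ι y))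

  integrand≡ : ∀ f z x y → proj₁ z ≡ (ι x +i ι y) →
    A.density (x , y) A.* (re (f z) A.* re (f z) A.+ im (f z) A.* im (f z)) ≡ integrand f z
  integrand≡ f z@(_ , _) x y ≡.refl = lift-* (A.density (x , y)) (ι (+ 2 ℚ./ 1) * (1ℝ - ∣ ι x +i ι y ∣²)) (re (f z) A.* re (f z) A.+ im (f z) A.* im (f z)) ∣ f z ∣²
    (lift-* A.2# (ι (+ 2 ℚ./ 1)) (A.1# A.- A.norm (x , y)) (1ℝ - ∣ ι x +i ι y ∣²) (algebra-ι _)
      (lift-- A.1# 1ℝ (A.norm (x , y)) ∣ ι x +i ι y ∣² (algebra-ι 1ℚ) (norm≡ x y)))
    (lift-square (re (f z)) (im (f z)))

  Value : (ℕ → ℂ) → ℝ → ℚ × ℚ → Set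
  Value a s p = ∃ λ v → ∃ λ w → A.Parseval.Sum (λ n → re (a n)) (λ n → im (a n)) p v w × s ≡ A.density p A.* (v A.* v A.+ w A.* w)

  value-at : ∀ f a s z x y → proj₁ z ≡ (ι x +i ι y) → A.Parseval.Sum (λ n → re (a n)) (λ n → im (a n)) (x , y) (re (f z)) (im (f z)) →
    s ≡ integrand f z → Value a s (x , y)
  value-at f a s z x y q sum e = re (f z) , im (f z) , sum , ≡.trans e (≡.sym (integrand≡ f z x y q))

  value : ∀ f a (h : SumsTo a f) {r} (r<1 : r ℚ.< 1ℚ) x y → (∃ λ i → sampleOn r<1 (integrand f) (x , y) ≡ integrand f (gridPoint r<1 (x , y) i)) →
    Value a (sampleOn r<1 (integrand f) (x , y)) (x , y)
  value f a h r<1 x y (i , e) = value-at f a (sampleOn r<1 (integrand f) (x , y)) (gridPoint r<1 (x , y) i) x y ≡.refl (grid-sum a {f} h r<1 (x , y) i) e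

  disc : ∀ f a (h : SumsTo a f) m → Lim (riemannSum (exhaustion<1 m) (integrand f)) (A.Norm.I (λ n → re (a n)) (λ n → im (a n)) (convergent a {f} h) m)
  disc f a h m = Sums.disc-parseval (λ n → re (a n)) (λ n → im (a n)) (convergent a {f} h) m (sampleOn (exhaustion<1 m) (integrand f))
    (λ p k → sample-outside (exhaustion<1 m) (integrand f) p k) values
    where
    values : ∀ p → ∣ p ∣²ℚ ℚ.≤ exhaustion m → Value a (sampleOn (exhaustion<1 m) (integrand f) p) p
    values (x , y) i = value f a h (exhaustion<1 m) x y (sample-inside (exhaustion<1 m) (integrand f) (x , y) i)

  Energy : (ℕ → ℂ) → ℕ → ℝ
  Energy a N = A.∑ N (λ n → (re (a n) A.* re (a n) A.+ im (a n) A.* im (a n)) A.* A.weight n)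

  norm-intro : ∀ f s g → g ≡ (λ z → ι (+ 2 ℚ./ 1) * (1ℝ - ∣ proj₁ z ∣²) * ∣ f z ∣²) → (J : ℕ → ℝ) → (∀ m → riemannSum (exhaustion<1 m) g ⟶ J m) → J ⟶ s → ∥ f ∥₂²≈ s
  norm-intro f s _ ≡.refl J d p = J , d , p

  norm-elim : ∀ f s g → g ≡ (λ z → ι (+ 2 ℚ./ 1) * (1ℝ - ∣ proj₁ z ∣²) * ∣ f z ∣²) → ∥ f ∥₂²≈ s → Σ (ℕ → ℝ) λ J → (∀ m → riemannSum (exhaustion<1 m) g ⟶ J m) × J ⟶ s
  norm-elim f s _ ≡.refl h = h

  energy⇒norm : ∀ f a (h : SumsTo a f) s → Lim (Energy a) s → ∥ f ∥₂²≈ s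
  energy⇒norm f a h s p = go (A.Norm.I (λ n → re (a n)) (λ n → im (a n)) (convergent a {f} h)) (disc f a h)
    (A.Norm.energy⇒integral (λ n → re (a n)) (λ n → im (a n)) (convergent a {f} h) p)
    where
    go : ∀ J → (∀ m → Lim (riemannSum (exhaustion<1 m) (integrand f)) (J m)) → Lim J s → ∥ f ∥₂²≈ s
    go J d q = norm-intro f s (integrand f) ≡.refl J (λ m → Lim⇒⟶ (riemannSum (exhaustion<1 m) (integrand f)) (J m) (d m)) (Lim⇒⟶ J s q)

  -- The norm comes with its own sequence of integrals over discs; uniqueness of limits identifies
  -- it with the one computed from the coefficients.
  norm⇒energy : ∀ f a (h : SumsTo a f) s → ∥ f ∥₂²≈ s → Lim (Energy a) s
  norm⇒energy f a h s n = A.Norm.integral⇒energy (λ n → re (a n)) (λ n → im (a n)) (convergent a {f} h)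
    (go (A.Norm.I (λ n → re (a n)) (λ n → im (a n)) (convergent a {f} h)) (disc f a h) (norm-elim f s (integrand f) ≡.refl n))
    where
    go : ∀ J → (∀ m → Lim (riemannSum (exhaustion<1 m) (integrand f)) (J m)) →
      (Σ (ℕ → ℝ) λ J → (∀ m → riemannSum (exhaustion<1 m) (integrand f) ⟶ J m) × J ⟶ s) → Lim J s
    go J d (J′ , d′ , q) = A.Lim-cong (λ m → A.Lim-unique (⟶⇒Lim (riemannSum (exhaustion<1 m) (integrand f)) (J′ m) (d′ m)) (d m)) A.refl (⟶⇒Lim J′ s q)

-- The functions f k and their combinations as power series.

module Functions where

  open RealAlgebra using (e; _≤_; algebra-ι; algebra-neg; to-≈; to-≤; from-≤; pointwise; 0≤⇒≤; ≤⇒0≤; 0≤+; 1/suc≤)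
  open RealLimits
  open Translation
  open RationalLemmas
  open RealLemmas
  open A using (𝒞; Lim; Limᶜ; limᶜ; lim-re; lim-im; module ℂ)

  divide≈ : ∀ z w h → divide z w h ≈ᶜ z *ᶜ ((re w * reciprocal ∣ w ∣² h) +i (- im w * reciprocal ∣ w ∣² h))
  divide≈ z w h =
    pointwise {re (divide z w h)} {re (z *ᶜ ((re w * reciprocal ∣ w ∣² h) +i (- im w * reciprocal ∣ w ∣² h)))} (λ n → ≡.refl) ,
    pointwise {im (divide z w h)} {im (z *ᶜ ((re w * reciprocal ∣ w ∣² h) +i (- im w * reciprocal ∣ w ∣² h)))} (λ n → ≡.refl)

  to-≈ᶜ : ∀ z w → z ≈ᶜ w → to z A.≈ᶜ to w
  to-≈ᶜ z w (p , q) = to-≈ (re z) (re w) p A.,ᶜ to-≈ (im z) (im w) q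

  quotient : ∀ z w h → to (divide z w h) A.*ᶜ to w A.≈ᶜ to z
  quotient z w h = A.divide-inverse (to z) (to (divide z w h)) (to c) (to w) r
    (ℂ.trans (to-≈ᶜ (divide z w h) (z *ᶜ c) (divide≈ z w h)) (ℂ.reflexive (to-* z c)))
    (ℂ.reflexive (parts (re w A.* r) (re w * r) ((A.- im w) A.* r) (- im w * r) (product (re w) r)
      (lift-* (A.- im w) (- im w) r r (algebra-neg (im w)) ≡.refl)))
    (A.trans (A.reflexive (lift-* (re w A.* re w A.+ im w A.* im w) ∣ w ∣² r r (lift-square (re w) (im w)) ≡.refl))
      (A.trans (to-≈ (∣ w ∣² * r) 1ℝ (reciprocal-inverse ∣ w ∣² h)) (A.reflexive (≡.sym (algebra-ι 1ℚ)))))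
    where
    r : ℝ
    r = reciprocal ∣ w ∣² h
    c : ℂ
    c = (re w * r) +i (- im w * r)

  to-fromℕ : ∀ n → to (fromℕ n) ≡ A.real (A.nat n)
  to-fromℕ n = parts (A.nat n) (ι (+ n ℚ./ 1)) A.0# 0ℝ (≡.trans (A.nat-ι n) (algebra-ι (+ n ℚ./ 1))) (algebra-ι 0ℚ)

  to-geometric : ∀ k z → to (∑< k (λ j → z ^ j)) ≡ A.∑ᶜ k (λ j → to z A.^ᶜ j)
  to-geometric k z = ≡.trans (to-∑ k (λ j → z ^ j)) (∑ᶜ-≡ k {λ j → to (z ^ j)} {λ j → to z A.^ᶜ j} (to-^ z))

  to-coefficient : ∀ z j → to (fromℕ (suc j) *ᶜ z ^ j) ≡ A.real (A.nat (suc j)) A.*ᶜ to z A.^ᶜ j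
  to-coefficient z j = ≡.subst (λ c → to (fromℕ (suc j) *ᶜ z ^ j) ≡ c A.*ᶜ to z A.^ᶜ j) (to-fromℕ (suc j)) (to-term (fromℕ (suc j)) z j)

  to-derivative : ∀ K z → to (∑< K (λ j → fromℕ (suc j) *ᶜ z ^ j)) ≡ A.∑ᶜ K (λ j → A.real (A.nat (suc j)) A.*ᶜ to z A.^ᶜ j)
  to-derivative K z = ≡.trans (to-∑ K (λ j → fromℕ (suc j) *ᶜ z ^ j))
    (∑ᶜ-≡ K {λ j → to (fromℕ (suc j) *ᶜ z ^ j)} {λ j → A.real (A.nat (suc j)) A.*ᶜ to z A.^ᶜ j} (to-coefficient z))

  inside-disc : ∀ (z : 𝔻) → ∃ λ m → A.∣ to (proj₁ z) ∣² A.≤ A.1# A.- A.inv m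
  inside-disc (z , δ , 0<δ , N , h) = let m , m≤δ = 1/suc≤ δ 0<δ in m ,
    ≡.subst₂ A._≤_ (≡.sym (lift-square (re z) (im z))) (≡.sym (lift-- A.1# 1ℝ (A.inv m) (ι (e m)) (algebra-ι 1ℚ) (inv-e m)))
      (to-≤ ∣ z ∣² (1ℝ - ι (e m)) λ ε 0<ε → N , λ n p →
        0≤⇒≤ _ (0≤+ (0≤+ (≤⇒0≤ (h n p)) (≤⇒0≤ m≤δ)) (ℚₚ.<⇒≤ 0<ε))
          (solve 5 (λ x d o k ε → (o :- (x :+ d)) :+ (d :- k) :+ ε := o :- k :+ ε :- x) ≡.refl (seq ∣ z ∣² n) δ 1ℚ (e m) ε))
    where open +-*-Solver

  2≤2+ : ∀ i → 2 ℕ.≤ suc (suc i)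
  2≤2+ i = ℕ.s≤s (ℕ.s≤s ℕ.z≤n)

  abstract
    V : 𝔻 → ℕ → 𝒞
    V z i = to (f (suc (suc i)) (2≤2+ i) z)

    V-def : ∀ z i → to (f (suc (suc i)) (2≤2+ i) z) ≡ V z i
    V-def z i = ≡.refl

  to-geometric≡ : ∀ k z → to (geometric k z) ≡ A.∑ᶜ k (λ j → to z A.^ᶜ j)
  to-geometric≡ k z = to-geometric k z

  to-geometric′≡ : ∀ k z → to (geometric′ k z) ≡ A.∑ᶜ (k ℕ.∸ 1) (λ j → A.real (A.nat (suc j)) A.*ᶜ to z A.^ᶜ j)
  to-geometric′≡ k z = to-derivative (k ℕ.∸ 1) z

  f-quotient : ∀ k 2≤k z → to (f k 2≤k z) A.*ᶜ to (geometric k (proj₁ z)) A.≈ᶜ to (geometric′ k (proj₁ z))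
  f-quotient k 2≤k z = quotient (geometric′ k (proj₁ z)) (geometric k (proj₁ z)) (geometric-nonZero k 2≤k z)

  f-equation : ∀ k 2≤k z → to (f k 2≤k z) A.*ᶜ A.∑ᶜ k (λ j → to (proj₁ z) A.^ᶜ j) A.≈ᶜ A.∑ᶜ (k ℕ.∸ 1) (λ j → A.real (A.nat (suc j)) A.*ᶜ to (proj₁ z) A.^ᶜ j)
  f-equation k 2≤k z = ≡.subst₂ (λ q q′ → to (f k 2≤k z) A.*ᶜ q A.≈ᶜ q′) (to-geometric≡ k (proj₁ z)) (to-geometric′≡ k (proj₁ z)) (f-quotient k 2≤k z)

  f-series : ∀ (z : 𝔻) i → Limᶜ (A.series (λ n → A.real (A.φ (2 ℕ.+ i) n)) (to (proj₁ z))) (V z i)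
  f-series z i = let m , z<1 = inside-disc z in ≡.subst (Limᶜ (A.series (λ n → A.real (A.φ (2 ℕ.+ i) n)) (to (proj₁ z)))) (V-def z i)
    (A.LogarithmicDerivative.T⟶v (suc i) (to (proj₁ z)) (to (f (suc (suc i)) (2≤2+ i) z)) (f-equation (suc (suc i)) (2≤2+ i) z) m z<1)

  Index : Set
  Index = ∃ λ k → 2 ℕ.≤ k

  family : Index → 𝔻 → ℂ
  family (k , 2≤k) = f k 2≤k

  entry : ℂ × Index → (ℝ × ℝ) × ℕ
  entry (c , suc (suc i) , _) = (re c , im c) , i
  entry (c , suc zero , ℕ.s≤s ())

  index : Index → ℕ
  index (k , _) = k ℕ.∸ 2

  to-f : ∀ z i (p q : 2 ℕ.≤ suc (suc i)) → p ≡ q → to (f (suc (suc i)) p z) ≡ to (f (suc (suc i)) q z)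
  to-f z i p _ ≡.refl = ≡.refl

  -- Coefficient lists forget the proof of 2 ≤ k that `f` takes as an argument; the irrelevance of
  -- such proofs makes this harmless.
  to-family : ∀ z k → to (family k z) ≡ V z (index k)
  to-family z (suc (suc i) , p) = ≡.trans (to-f z i p (2≤2+ i) (ℕₚ.≤-irrelevant p (2≤2+ i))) (V-def z i)
  to-family z (suc zero , ℕ.s≤s ())

  combination-step : ∀ (c w s : ℂ) (v : 𝒞) → to w ≡ v → to (c *ᶜ w +ᶜ s) ≡ to c A.*ᶜ v A.+ᶜ to s
  combination-step c w s _ ≡.refl = ≡.trans (to-+ (c *ᶜ w) s) (≡.cong (λ u → u A.+ᶜ to s) (to-* c w))

  combine-entries : ∀ (cs : List (ℂ × Index)) z → foldr (λ x t → to (proj₁ x) A.*ᶜ V z (index (proj₂ x)) A.+ᶜ t) (to 0ᶜ) cs ≡ A.combine (map entry cs) (V z)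
  combine-entries [] z = to-0
  combine-entries ((c , suc (suc i) , p) ∷ cs) z = ≡.cong (λ t → to c A.*ᶜ V z i A.+ᶜ t) (combine-entries cs z)
  combine-entries ((c , suc zero , ℕ.s≤s ()) ∷ cs) z

  to-combination : ∀ cs z → to (combination family cs z) ≡ A.combine (map entry cs) (V z)
  to-combination cs z = ≡.trans
    (foldr-fusion to {f = λ (c , k) s → c *ᶜ family k z +ᶜ s} {g = λ x t → to (proj₁ x) A.*ᶜ V z (index (proj₂ x)) A.+ᶜ t} 0ᶜ
      (λ (c , k) s → combination-step c (family k z) s (V z (index k)) (to-family z k)) cs)
    (combine-entries cs z)

  coefficient : List ((ℝ × ℝ) × ℕ) → ℕ → ℂ
  coefficient cs n = A.spanRe cs n +i A.spanIm cs n

  combine-sums : ∀ cs (z : 𝔻) → Limᶜ (A.series (λ n → to (coefficient cs n)) (to (proj₁ z))) (A.combine cs (V z))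
  combine-sums cs z = A.span-series cs (to (proj₁ z)) (V z) (f-series z)

-- Membership of the span in the Bergman space, and its density.

module Approximation where

  open RealAlgebra using (e; _≤_; from-≤; pointwise; 0≤⇒≤; ≤⇒0≤; 0≤+; 1/suc≤)
  open RealLimits
  open Translation
  open Functions
  open RationalLemmas
  open RealLemmas
  open A using (Lim; Limᶜ; module ℂ)

  span-sums : ∀ h cs → (∀ z → h z ≈ᶜ combination family cs z) → SumsTo (coefficient (map entry cs)) h
  span-sums h cs eq z = A.Limᶜ-cong (λ N → ℂ.refl)
    (ℂ.sym (ℂ.trans (to-≈ᶜ (h z) (combination family cs z) (eq z)) (ℂ.reflexive (to-combination cs z)))) (combine-sums (map entry cs) z)

  span⊆A²₁ : ∀ {h} → Span family h → A²₁ h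
  span⊆A²₁ {h} (cs , eq) = let s , p = A.span-summable (map entry cs); S = span-sums h cs eq in
    sums⇒analytic {h} (coefficient (map entry cs)) S , s , energy⇒norm h (coefficient (map entry cs)) S s p

  unentry : (ℝ × ℝ) × ℕ → ℂ × Index
  unentry ((α , β) , i) = (α +i β) , (suc (suc i) , 2≤2+ i)

  entry-unentry : ∀ cs → map entry (map unentry cs) ≡ cs
  entry-unentry [] = ≡.refl
  entry-unentry (((α , β) , i) ∷ cs) = ≡.cong (((α , β) , i) ∷_) (entry-unentry cs)

  difference-sums : ∀ g h a b → SumsTo a g → SumsTo b h → SumsTo (λ n → a n -ᶜ b n) (λ z → g z -ᶜ h z)
  difference-sums g h a b p q z = ≡.subst (Limᶜ (A.series (λ n → to (a n -ᶜ b n)) (to (proj₁ z)))) (≡.sym (to-- (g z) (h z)))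
    (A.series-sub (λ n → to (a n)) (λ n → to (b n)) (λ n → to (a n -ᶜ b n)) (to (proj₁ z)) (λ n → ℂ.reflexive (to-- (a n) (b n))) (p z) (q z))

  -- x ≤ δ²/4 < δ² ≤ ε²
  <-square : ∀ ε (0<ε : 0ℝ < ε) → ∃ λ k → ∀ x → x ≤ ι (e k) → x < ε * ε
  <-square ε (δ , 0<δ , N , h) = let k , k≤ = 1/suc≤ q 0<q in k , λ x x≤ → let M , b = x≤ q 0<q in
    (½ ℚ.* (δ ℚ.* δ)) , 0<half (0<* 0<δ 0<δ) , M ℕ.⊔ N , λ n p →
      ℚₚ.≤-trans (0≤⇒≤ _ (0≤+ (≤⇒0≤ (b n (ℕₚ.m⊔n≤o⇒m≤o M N p))) (≤⇒0≤ k≤))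
        (solve 3 (λ x k d → (k :+ con ½ :* (con ½ :* (d :* d)) :- x) :+ (con ½ :* (con ½ :* (d :* d)) :- k) := d :* d :- (x :+ con ½ :* (d :* d))) ≡.refl (seq x n) (e k) δ))
      (*-mono-≤ (ℚₚ.<⇒≤ 0<δ) (ℚₚ.≤-trans (ℚₚ.<⇒≤ 0<δ) (δ≤ n (ℕₚ.m⊔n≤o⇒n≤o M N p))) (δ≤ n (ℕₚ.m⊔n≤o⇒n≤o M N p)) (δ≤ n (ℕₚ.m⊔n≤o⇒n≤o M N p)))
    where
    open +-*-Solver
    q : ℚ
    q = ½ ℚ.* (½ ℚ.* (δ ℚ.* δ))
    0<q : 0ℚ ℚ.< q
    0<q = 0<half (0<half (0<* 0<δ 0<δ))
    δ≤ : ∀ n → N ℕ.≤ n → δ ℚ.≤ seq ε n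
    δ≤ n p = ≡.subst (ℚ._≤ seq ε n) (ℚₚ.+-identityˡ δ) (h n p)

  difference-re : ∀ z w x → x ≡ re w → re z A.- x ≡ re (z -ᶜ w)
  difference-re z w _ ≡.refl = lift-- (re z) (re z) (re w) (re w) ≡.refl ≡.refl

  difference-im : ∀ z w x → x ≡ im w → im z A.- x ≡ im (z -ᶜ w)
  difference-im z w _ ≡.refl = lift-- (im z) (im z) (im w) (im w) ≡.refl ≡.refl

  energy-cong : ∀ (x y x′ y′ : ℕ → ℝ) s → (∀ j → x j ≡ x′ j) → (∀ j → y j ≡ y′ j) →
    Lim (λ N → A.∑ N (λ j → (x j A.* x j A.+ y j A.* y j) A.* A.weight j)) s → Lim (λ N → A.∑ N (λ j → (x′ j A.* x′ j A.+ y′ j A.* y′ j) A.* A.weight j)) s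
  energy-cong x y x′ y′ s p q = A.Lim-cong (λ N → A.∑-cong′ N λ j → A.reflexive (≡.cong₂ (λ u v → (u A.* u A.+ v A.* v) A.* A.weight j) (p j) (q j))) A.refl

  distance-energy : ∀ (a b : ℕ → ℂ) (x y : ℕ → ℝ) s → (∀ j → x j ≡ re (b j)) → (∀ j → y j ≡ im (b j)) →
    Lim (λ N → A.∑ N (λ j → ((re (a j) A.- x j) A.* (re (a j) A.- x j) A.+ (im (a j) A.- y j) A.* (im (a j) A.- y j)) A.* A.weight j)) s →
    Lim (Energy (λ n → a n -ᶜ b n)) s
  distance-energy a b x y s p q = energy-cong (λ j → re (a j) A.- x j) (λ j → im (a j) A.- y j) (λ j → re (a j -ᶜ b j)) (λ j → im (a j -ᶜ b j)) s
    (λ j → difference-re (a j) (b j) (x j) (p j)) (λ j → difference-im (a j) (b j) (y j) (q j))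

  Close : (ℕ → ℂ) → List ((ℝ × ℝ) × ℕ) → ℝ → Set
  Close a cs d = Lim (λ N → A.∑ N (λ j → ((re (a j) A.- A.spanRe cs j) A.* (re (a j) A.- A.spanRe cs j) A.+ (im (a j) A.- A.spanIm cs j) A.* (im (a j) A.- A.spanIm cs j)) A.* A.weight j)) d

  close-coefficients : ∀ a s → Lim (Energy a) s → ∀ k → ∃ λ cs → ∃ λ d → Close a cs d × d A.≤ A.inv k
  close-coefficients a s p k = A.Density.approximate (λ n → re (a n)) (λ n → im (a n)) p k

  approximant-norm : ∀ g a (S : SumsTo a g) h cs (T : SumsTo (coefficient cs) h) d → Close a cs d → ∥ (λ z → g z -ᶜ h z) ∥₂²≈ d
  approximant-norm g a S h cs T d p = energy⇒norm (λ z → g z -ᶜ h z) (λ n → a n -ᶜ coefficient cs n)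
    (difference-sums g h a (coefficient cs) S T) d
    (distance-energy a (coefficient cs) (A.spanRe cs) (A.spanIm cs) d (λ j → ≡.refl) (λ j → ≡.refl) p)

  span-element : List ((ℝ × ℝ) × ℕ) → 𝔻 → ℂ
  span-element cs = combination family (map unentry cs)

  span-element-sums : ∀ cs → SumsTo (coefficient cs) (span-element cs)
  span-element-sums cs = ≡.subst (λ cs′ → SumsTo (coefficient cs′) (span-element cs)) (entry-unentry cs)
    (span-sums (span-element cs) (map unentry cs) (λ z → reflexive (span-element cs z)))
    where
    reflexive : ∀ z → z ≈ᶜ z
    reflexive z = pointwise {re z} {re z} (λ _ → ≡.refl) , pointwise {im z} {im z} (λ _ → ≡.refl)

  approximate : ∀ g → A²₁ g → ∀ ε → 0ℝ < ε → Σ (𝔻 → ℂ) λ h → Span family h × ∥ (λ z → g z -ᶜ h z) ∥₂< ε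
  approximate g (analytic , s , norm) ε 0<ε = choose (<-square ε 0<ε)
    where
    S : SumsTo (proj₁ analytic) g
    S = analytic⇒sums {g} analytic
    choose : (∃ λ k → ∀ x → x ≤ ι (e k) → x < ε * ε) → Σ (𝔻 → ℂ) λ h → Span family h × ∥ (λ z → g z -ᶜ h z) ∥₂< ε
    choose (k , small) = assemble (close-coefficients (proj₁ analytic) s (norm⇒energy g (proj₁ analytic) S s norm) k)
      where
      assemble : (∃ λ cs → ∃ λ d → Close (proj₁ analytic) cs d × d A.≤ A.inv k) → Σ (𝔻 → ℂ) λ h → Span family h × ∥ (λ z → g z -ᶜ h z) ∥₂< ε
      assemble (cs , d , p , d≤) = span-element cs , (map unentry cs , λ z → reflexive (span-element cs z)) , 0<ε , d ,
          approximant-norm g (proj₁ analytic) S (span-element cs) cs (span-element-sums cs) d p ,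
          small d (from-≤ d (ι (e k)) (≡.subst (λ b → d A.≤ b) (inv-e k) d≤))
        where
        reflexive : ∀ z → z ≈ᶜ z
        reflexive z = pointwise {re z} {re z} (λ _ → ≡.refl) , pointwise {im z} {im z} (λ _ → ≡.refl)

open import Data.Nat.Base using (_≤_)

family-≡ : Functions.family ≡ λ (k , 2≤k) → f k 2≤k
family-≡ = ≡.refl

-- Comparing the two spans directly would unfold the functions f k, so the families are compared instead.
theorem1p1 : Dense (Span {∃ λ k → 2 ≤ k} (λ (k , 2≤k) → f k 2≤k))
theorem1p1 = ≡.subst (λ F → Dense (Span {∃ λ k → 2 ≤ k} F)) family-≡ ((λ {h} → Approximation.span⊆A²₁ {h}) , Approximation.approximate)
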